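{- Let $S_1,S_2\subset\mathbb{N}$ be infinite sets, let $t_1(m),t_2(m)\in\mathbb{Z}_{>0}$ for $m\in S_1$ and $t_3(m)\in\mathbb{Z}_{>0}$ for $m\in S_2$, and consider the power series $$f_1(X)=\sum_{m\in S_1}t_1(m)X^m,\quad f_2(X)=\sum_{m\in S_1}t_2(m)X^m,\quad f_3(X)=\sum_{m\in S_2}t_3(m)X^m$$ in $\mathbb{Z}[[X]]\setminus\mathbb{Z}[X]$. Put $t_1(m)=t_2(m)=0$ for $m\in\mathbb{N}\setminus S_1$ and $t_3(m)=0$ for $m\in\mathbb{N}\setminus S_2$. Assume the following conditions. (1) There exists a constant $C_1>1$ such that, for all sufficiently large $R$, $[R,C_1R)\cap S_2\neq\emptyset$. (2) For every positive real number $\varepsilon$ and $j=1,2$, $\lambda(S_j;R)=o(R^{\varepsilon})$ as $R\to\infty$. (3) For any nonnegative integers $a_1,a_2$, there exists a positive constant $C_2=C_2(a_1,a_2)$, depending only on $a_1,a_2$, such that for all $R\geq C_2$, $$R-\theta((1+a_1)S_1;R)<\frac{R}{\lambda(S_1;R)^{a_1}\lambda(S_2;R)^{a_2}}.$$ (4) There exists a constant $C_3$ with $0<C_3<1$ such that, for each $i=1,2,3$, $\log^{+}t_i(n)=o(n^{1-C_3})$ as $n\to\infty$. (5) $\displaystyle\lim_{n\to\infty,\ n\in S_1}\frac{t_1(n)}{t_2(n)}=\infty$. Then, for every Pisot or Salem number $\beta$, the three values $f_1(\beta^{ -1}),f_2(\beta^{ -1}),f_3(\beta^{ -1})$ are algebraically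 independent.
   Context: $\mathbb{N}$ is the set of nonnegative integers, $\mathbb{Z}_{>0}$ the set of positive integers, and $\log^{+}x=\log\max\{1,x\}$. For a nonempty $\mathcal{A}\subset\mathbb{N}$ and a nonnegative real number $R$, $\lambda(\mathcal{A};R)=\operatorname{Card}([0,R)\cap\mathcal{A})$; if $R>\min\mathcal{A}$, $\theta(\mathcal{A};R)=\max([0,R)\cap\mathcal{A})$. For nonempty $\mathcal{A},\mathcal{B}\subset\mathbb{N}$, $\mathcal{A}+\mathcal{B}=\{a+b\mid a\in\mathcal{A},b\in\mathcal{B}\}$; for a positive integer $k$, $k\mathcal{A}=\mathcal{A}+\cdots+\mathcal{A}$ ($k$ summands), and $0\mathcal{A}=\{0\}$. In condition (3), $R$ ranges over real numbers, and $C_2$ is understood to be such that the quantities appearing are defined for $R\ge C_2$. A Pisot number is an algebraic integer greater than $1$ whose conjugates other than itself all have absolute value less than $1$; a Salem number is an algebraic integer greater than $1$ whose conjugates other than itself all have absolute value at most $1$, with at least one of absolute value $1$. Algebraic independence is over $\mathbb{Q}$. -}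

module Defs where

open import Level using (0ℓ)
open import Algebra.Bundles using (CommutativeRing; Semiring)
open import Algebra.Bundles.Raw using (RawRing)
open import Axiom.ExcludedMiddle using (ExcludedMiddle)
open import Data.Fin.Base using (toℕ)
open import Data.Integer.Base as ℤ using (ℤ; +_; -[1+_]; 1ℤ)
open import Data.List.Base using (List; foldr; length; _∷ʳ_)
open import Data.List.Membership.Propositional using () renaming (_∈_ to _∈ˡ_)
open import Data.List.Relation.Unary.Any using (Any)
open import Data.List.Relation.Unary.Unique.Propositional using (Unique)
open import Data.Nat.Base as ℕ using (ℕ; zero; suc; _!)
open import Data.Product.Base using (Σ; ∃; _×_; _,_)
open import Data.Rational.Base using (ℚ; 0ℚ; 1ℚ; ↥_; ↧_)
open import Data.Vec.Base using (Vec; []; _∷_)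
open import Function.Bundles using (_⇔_)
open import Relation.Binary.Core using (Rel)
open import Relation.Binary.Structures using (IsStrictTotalOrder)
import Relation.Binary.Construct.StrictToNonStrict as ToNonStrict
open import Relation.Binary.PropositionalEquality.Core using (_≡_; _≢_)
open import Relation.Nullary using (¬_; yes; no)
open import Relation.Unary using (Pred; _∈_)

Infinite : Pred ℕ 0ℓ → Set
Infinite A = ∀ N → ∃ λ n → N ℕ.≤ n × n ∈ A

infixl 6 _⊕_
_⊕_ : Pred ℕ 0ℓ → Pred ℕ 0ℓ → Pred ℕ 0ℓ
(A ⊕ B) n = ∃ λ a → ∃ λ b → a ∈ A × b ∈ B × n ≡ a ℕ.+ b

infixr 8 _⊛_
-- k ⊛ A is the k-fold sumset kA, not the dilate.
_⊛_ : ℕ → Pred ℕ 0ℓ → Pred ℕ 0ℓ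
zero  ⊛ A = _≡ 0
suc k ⊛ A = A ⊕ (k ⊛ A)

HasCard : Pred ℕ 0ℓ → ℕ → Set
HasCard A k = Σ (List ℕ) λ xs →
  Unique xs × (∀ n → n ∈ˡ xs ⇔ n ∈ A) × length xs ≡ k

IsMax : Pred ℕ 0ℓ → ℕ → Set
IsMax A m = m ∈ A × (∀ n → n ∈ A → n ℕ.≤ m)

IsMin : Pred ℕ 0ℓ → ℕ → Set
IsMin A m = m ∈ A × (∀ n → n ∈ A → m ℕ.≤ n)

-- Poly A n is A[X₁,…,Xₙ], as lists of coefficients in A[X₂,…,Xₙ] with the
-- constant coefficient first; trailing zero coefficients are allowed.
Poly : Set → ℕ → Set
Poly A zero    = A
Poly A (suc n) = List (Poly A n)

NonZeroPoly : ∀ n → Poly ℚ n → Set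
NonZeroPoly zero    q  = q ≢ 0ℚ
NonZeroPoly (suc n) cs = Any (NonZeroPoly n) cs

-- For a monic polynomial, the length of the list is the degree plus one.
Monic : {A : Set} → A → Poly A 1 → Set
Monic one p = ∃ λ cs → p ≡ cs ∷ʳ one

module _ (K : RawRing 0ℓ 0ℓ) {A : Set} (ι : A → RawRing.Carrier K) where
  open RawRing K

  eval : ∀ {n} → Poly A n → Vec Carrier n → Carrier
  eval p  []       = ι p
  eval cs (x ∷ xs) = foldr (λ c acc → eval c xs + x * acc) 0# cs

-- Classically, this characterises the real numbers up to isomorphism.
record CompleteOrderedField : Set₁ where
  field
    commutativeRing : CommutativeRing 0ℓ 0ℓ

  open CommutativeRing commutativeRing public

  infix 4 _<_ _≤_
  field
    _<_                : Rel Carrier 0ℓ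
    isStrictTotalOrder : IsStrictTotalOrder _≈_ _<_

  _≤_ : Rel Carrier 0ℓ
  _≤_ = ToNonStrict._≤_ _≈_ _<_

  field
    0<1      : 0# < 1#
    +-mono-< : ∀ {x y} z → x < y → x + z < y + z
    *-pos    : ∀ {x y} → 0# < x → 0# < y → 0# < x * y
    inverse  : ∀ x → ¬ (x ≈ 0#) → ∃ λ y → x * y ≈ 1#
    supremum : (P : Carrier → Set) → ∃ P → (∃ λ b → ∀ x → P x → x ≤ b) →
               ∃ λ s → (∀ x → P x → x ≤ s) ×
                       (∀ b → (∀ x → P x → x ≤ b) → s ≤ b)

module Analysis (em : ExcludedMiddle 0ℓ) (ℛ : CompleteOrderedField) where

  open CompleteOrderedField ℛ public
    using (_≈_; _<_; _≤_; _+_; _*_; _-_; -_; 0#; 1#)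
    renaming (Carrier to ℝ; rawRing to ℝ-rawRing)
  open CompleteOrderedField ℛ using (semiring)
  open import Algebra.Definitions.RawSemiring (Semiring.rawSemiring semiring) public
    using (_^_; sum) renaming (_×_ to _·_)

  -- "The a such that P a", with value d when there is no such a.  Below, P
  -- always determines a (up to the relevant equality) if it is satisfiable.
  the : {A : Set} (d : A) → (A → Set) → A
  the d P with em {∃ P}
  ... | yes (a , _) = a
  ... | no  _       = d

  fromℕ : ℕ → ℝ
  fromℕ n = n · 1#

  fromℤ : ℤ → ℝ
  fromℤ (+ n)    = fromℕ n
  fromℤ -[1+ n ] = - fromℕ (suc n)

  infix 9 _⁻¹
  _⁻¹ : ℝ → ℝ
  x ⁻¹ = the 0# λ y → x * y ≈ 1#

  infixl 7 _/_
  _/_ : ℝ → ℝ → ℝ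
  x / y = x * y ⁻¹

  fromℚ : ℚ → ℝ
  fromℚ q = fromℤ (↥ q) / fromℤ (↧ q)

  max : ℝ → ℝ → ℝ
  max x y with em {x < y}
  ... | yes _ = y
  ... | no  _ = x

  ∣_∣ : ℝ → ℝ
  ∣ x ∣ = max x (- x)

  sqrt : ℝ → ℝ
  sqrt x = the 0# λ r → 0# ≤ r × r * r ≈ x

  infix 4 _⟶_
  _⟶_ : (ℕ → ℝ) → ℝ → Set
  s ⟶ l = ∀ ε → 0# < ε → ∃ λ N → ∀ n → N ℕ.≤ n → ∣ s n - l ∣ < ε

  ∑∞ : (ℕ → ℝ) → ℝ
  ∑∞ s = the 0# λ l → (λ n → sum {n} (λ i → s (toℕ i))) ⟶ l

  exp : ℝ → ℝ
  exp x = ∑∞ λ k → x ^ k / fromℕ (k !)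

  log : ℝ → ℝ
  log y = the 0# λ x → exp x ≈ y

  log⁺ : ℝ → ℝ
  log⁺ x = log (max 1# x)

  -- Meaningful for a positive base only
  infixr 8 _^ʳ_
  _^ʳ_ : ℝ → ℝ → ℝ
  x ^ʳ y = exp (y * log x)

  Eventually : (ℝ → Set) → Set
  Eventually P = ∃ λ R₀ → ∀ R → R₀ ≤ R → P R

  Eventuallyℕ : (ℕ → Set) → Set
  Eventuallyℕ P = ∃ λ N → ∀ n → N ℕ.≤ n → P n

  infix 4 _=o_ _=oℕ_
  _=o_ : (ℝ → ℝ) → (ℝ → ℝ) → Set
  f =o g = ∀ δ → 0# < δ → Eventually λ R → ∣ f R ∣ ≤ δ * ∣ g R ∣

  _=oℕ_ : (ℕ → ℝ) → (ℕ → ℝ) → Set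
  f =oℕ g = ∀ δ → 0# < δ → Eventuallyℕ λ n → ∣ f n ∣ ≤ δ * ∣ g n ∣

  TendsTo∞Along : Pred ℕ 0ℓ → (ℕ → ℝ) → Set
  TendsTo∞Along A f = ∀ M → Eventuallyℕ λ n → n ∈ A → M < f n

  [0,_⟩∩_ : ℝ → Pred ℕ 0ℓ → Pred ℕ 0ℓ
  ([0, R ⟩∩ A) n = fromℕ n < R × n ∈ A

  -- The counting function λ(A;R)
  Λ : Pred ℕ 0ℓ → ℝ → ℕ
  Λ A R = the 0 (HasCard ([0, R ⟩∩ A))

  θ : Pred ℕ 0ℓ → ℝ → ℕ
  θ A R = the 0 (IsMax ([0, R ⟩∩ A))

  -- R > min A, the condition for θ(A;R) to be defined
  θ-Defined : Pred ℕ 0ℓ → ℝ → Set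
  θ-Defined A R = ∃ λ m → IsMin A m × fromℕ m < R

  -- The value at x of the power series with coefficients t
  ⟦_⟧ : (ℕ → ℕ) → ℝ → ℝ
  ⟦ t ⟧ x = ∑∞ λ m → fromℕ (t m) * x ^ m

  record ℂ : Set where
    constructor _+i_
    field
      re : ℝ
      im : ℝ
  open ℂ public

  fromℝ : ℝ → ℂ
  fromℝ x = x +i 0#

  infix 4 _≈ᶜ_
  _≈ᶜ_ : Rel ℂ 0ℓ
  z ≈ᶜ w = re z ≈ re w × im z ≈ im w

  ℂ-rawRing : RawRing 0ℓ 0ℓ
  ℂ-rawRing = record
    { Carrier = ℂ
    ; _≈_     = _≈ᶜ_
    ; _+_     = λ z w → (re z + re w) +i (im z + im w)
    ; _*_     = λ z w → (re z * re w - im z * im w) +i (re z * im w + im z * re w)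
    ; -_      = λ z → (- re z) +i (- im z)
    ; 0#      = fromℝ 0#
    ; 1#      = fromℝ 1#
    }

  ∣_∣ᶜ : ℂ → ℝ
  ∣ z ∣ᶜ = sqrt (re z * re z + im z * im z)

  AlgebraicInteger : ℝ → Set
  AlgebraicInteger β =
    ∃ λ (p : Poly ℤ 1) → Monic 1ℤ p × eval ℝ-rawRing fromℤ p (β ∷ []) ≈ 0#

  MonicAnnihilator : ℝ → Poly ℚ 1 → Set
  MonicAnnihilator β p = Monic 1ℚ p × eval ℝ-rawRing fromℚ p (β ∷ []) ≈ 0#

  MinimalPolynomial : ℝ → Poly ℚ 1 → Set
  MinimalPolynomial β p =
    MonicAnnihilator β p × (∀ q → MonicAnnihilator β q → length p ℕ.≤ length q)

  Conjugate : ℝ → ℂ → Set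
  Conjugate β z = ∃ λ p → MinimalPolynomial β p ×
    eval ℂ-rawRing (λ q → fromℝ (fromℚ q)) p (z ∷ []) ≈ᶜ fromℝ 0#

  OtherConjugate : ℝ → ℂ → Set
  OtherConjugate β z = Conjugate β z × ¬ (z ≈ᶜ fromℝ β)

  Pisot : ℝ → Set
  Pisot β = AlgebraicInteger β × 1# < β ×
    (∀ z → OtherConjugate β z → ∣ z ∣ᶜ < 1#)

  Salem : ℝ → Set
  Salem β = AlgebraicInteger β × 1# < β ×
    (∀ z → OtherConjugate β z → ∣ z ∣ᶜ ≤ 1#) ×
    (∃ λ z → OtherConjugate β z × ∣ z ∣ᶜ ≈ 1#)

  AlgebraicallyIndependent : ∀ {n} → Vec ℝ n → Set
  AlgebraicallyIndependent {n} xs =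
    (P : Poly ℚ n) → NonZeroPoly n P → ¬ (eval ℝ-rawRing fromℚ P xs ≈ 0#)

{-# OPTIONS --safe #-}
-- An algebraic relation between the three values, multiplied by X₁ X₃, expands to Σ c(m) β⁻ᵐ = 0, where the
-- integers c(m) satisfy log⁺ ∣c(m)∣ = o(m^(1-C)) for some C > 0 by (4). Put Y(R) = Σ_{m≤R} c(m) β^(R-m), so that
-- Y(R+1) = β Y(R) + c(R+1) and Y(R) is -β^R times a tail of the series. Since the other conjugates of β have
-- absolute value at most 1, those of Y(R) are not large, and a Liouville argument bounds ∣Y(R)∣ from below unless
-- Y(R) = 0. The tail is tiny if c vanishes on a long interval after R, so a nonzero Y(R) forces a nonzero
-- coefficient in a short window after R.
--
-- Choose the leading monomial by maximal degree D + 1 in X₁, X₂, then in X₃, then in X₁, with a positive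
-- coefficient. By (2) there are few sums of at most D elements of S₁ and boundedly many of S₂, so some long block
-- is free of them, even after small shifts; by (3) it contains an element of (D+1)S₁, and walking on from
-- there one finds a sum u with the leading number of summands from S₁ and fewer than the leading number from S₂
-- that is followed by a long gap (u, u+ℓ) free of all such sums. In the gap only the monomials of leading
-- degree in both senses contribute, and by (5) the leading one dominates them: c ≥ 0. Adding copies of an element
-- of S₂, which exists by (1), to u gives m well inside the gap with c(m) > 0. Hence Y is negative on [u, m) or
-- positive on [m, u+ℓ). Such a stretch needs a nonzero c in each of its many windows, but by (2) there are too few
-- indices with c ≠ 0.

module Submission where

open import Defs
open import Level using (0ℓ)
open import Algebra.Bundles using (CommutativeRing; RawRing)
import Algebra.Solver.Ring
import Algebra.Solver.Ring.AlmostCommutativeRing as ACR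
import Algebra.Properties.Ring
import Algebra.Properties.Monoid.Mult
import Algebra.Properties.Semiring.Mult
import Algebra.Properties.CommutativeSemiring.Exp
open import Axiom.ExcludedMiddle using (ExcludedMiddle)
open import Data.Nat.Base as ℕ using (ℕ; zero; suc; z≤n; s≤s; _!)
import Data.Nat.Properties as ℕ
import Data.Nat.Combinatorics as ℕ
open import Data.Nat.Tactic.RingSolver using (solve-∀)
open import Data.Integer.Base as ℤ using (ℤ; +_; -[1+_])
import Data.Integer.Properties as ℤ
import Data.Integer.GCD as ℤ
open import Data.Rational.Base as ℚ using (ℚ; ↥_; ↧_)
import Data.Rational.Properties as ℚ
open import Data.Maybe.Base using (just; nothing)
open import Data.Product.Base using (∃; ∃₂; _×_; _,_; proj₁; proj₂)
open import Data.Sum.Base using (_⊎_; inj₁; inj₂)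
open import Data.Empty using (⊥; ⊥-elim)
open import Data.Fin.Base as Fin using (Fin; zero; suc; toℕ; fromℕ<; funToFin; finToFun)
import Data.Fin.Properties as Fin
open import Data.List.Base using (List; []; _∷_; _∷ʳ_; _++_; foldr; length; map; applyUpTo; upTo; replicate; filter; cartesianProductWith)
import Data.List.Properties as List
open import Data.List.Relation.Binary.Pointwise using (Pointwise; []; _∷_)
open import Data.List.Relation.Unary.All.Properties using (applyUpTo⁺₂; applyUpTo⁻)
import Data.List.Relation.Unary.All.Properties as All
open import Data.List.Relation.Unary.All as All using (All; []; _∷_)
open import Data.List.Relation.Unary.AllPairs as AllPairs using (AllPairs; []; _∷_)
import Data.List.Relation.Unary.AllPairs.Properties as AllPairs
open import Data.List.Relation.Unary.Any as Any using (Any; here; there)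
import Data.List.Relation.Unary.Any.Properties as Any
open import Data.List.Relation.Unary.Unique.Propositional using (Unique)
import Data.List.Relation.Unary.Unique.Propositional.Properties as Unique
open import Function.Bundles using (Equivalence; mk⇔)
open import Data.List.Membership.Propositional using (find; lose) renaming (_∈_ to _∈ˡ_)
open import Data.List.Membership.Propositional.Properties using (∈-cartesianProductWith⁺; ∈-map⁺; ∈-∃++; ∈-++⁺ˡ; ∈-++⁺ʳ; ∈-++⁻; ∈-filter⁺; ∈-filter⁻; ∈-upTo⁺; ∈-upTo⁻)
open import Data.Vec.Base using (Vec; []; _∷_)
open import Data.Unit.Base using (⊤; tt)
open import Relation.Binary.PropositionalEquality.Core as ≡ using (_≡_; _≢_)
open import Relation.Binary.Definitions using (tri<; tri≈; tri>)
import Relation.Binary.Construct.StrictToNonStrict as ToNonStrict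
import Relation.Binary.Reasoning.Setoid
import Relation.Binary.Reasoning.StrictPartialOrder
open import Relation.Binary.Bundles using (StrictPartialOrder)
open import Relation.Binary.Structures using (IsStrictTotalOrder)
open import Relation.Nullary using (¬_; Dec; yes; no; ¬?)
open import Relation.Unary using (Pred; _∈_; _∉_)

-- The argument compares powers of N. By (4) a window may be shorter than R by a factor v up to
-- R^(1/g), a fixed power, whereas by (2) a bound q for the number of relevant sums below 2N is
-- smaller than every power of N. So a constant times q³ is an admissible v: one factor q pays for
-- the blocks, one for the walk inside a block, one for the windows. The delicate point is to land
-- in the free block. Its length is about N / M(2N), where M bounds the number of sums to be
-- avoided, while (3) is applied at a point between N and 2N, where the counting functions might
-- have grown. As M is small, there are large N with M(2N) ≤ 4 M(N); the remaining constants are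
-- absorbed by one spare factor of the counting function of S₂ in (3). Multiplying by X₁ X₃ provides
-- a summand from S₁, as (3) requires, and one from S₂, so that the leading sums lie beyond u. The
-- Liouville bound comes from a pigeonhole argument on coordinates with respect to the powers of β.
-- The conjugates enter only through the growth of these coordinates, e β^k plus a polynomial
-- remainder; roots in the closed unit disc suffice, which covers Pisot and Salem numbers alike.

-- Ring solver with integer coefficients for an arbitrary commutative ring.

module IntegerSolver (R : CommutativeRing 0ℓ 0ℓ) where

  open CommutativeRing R
  open Algebra.Properties.Ring ring
    using (-‿+-comm; -‿distribˡ-*; -‿distribʳ-*; -‿involutive; -0#≈0#)
  open import Algebra.Properties.Semiring.Mult.TCOptimised semiring
    using (×-homo-+; ×1-homo-*; 1+×) renaming (_×_ to _×ₙ_)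
  open Relation.Binary.Reasoning.Setoid setoid

  -- With the optimised multiple, `num 0`, `num 1` and `num 2` reduce to `0#`, `1#` and `1# + 1#`,
  -- so the solver's constants match these terms definitionally.
  num : ℕ → Carrier
  num n = n ×ₙ 1#

  num-suc : ∀ n → num (suc n) ≈ 1# + num n
  num-suc n = 1+× n 1#

  int : ℤ → Carrier
  int (+ n)    = num n
  int -[1+ n ] = - num (suc n)

  private
    cancel : ∀ x y z → (x + y) - (x + z) ≈ y - z
    cancel x y z = begin
      (x + y) - (x + z)       ≈⟨ +-congˡ (sym (-‿+-comm x z)) ⟩
      (x + y) + (- x - z)     ≈⟨ +-congʳ (+-comm x y) ⟩
      (y + x) + (- x - z)     ≈⟨ +-assoc y x _ ⟩
      y + (x + (- x - z))     ≈⟨ +-congˡ (sym (+-assoc x (- x) _)) ⟩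
      y + ((x - x) - z)       ≈⟨ +-congˡ (+-congʳ (-‿inverseʳ x)) ⟩
      y + (0# - z)            ≈⟨ +-congˡ (+-identityˡ _) ⟩
      y - z                   ∎

  int-⊖ : ∀ m n → int (m ℤ.⊖ n) ≈ num m - num n
  int-⊖ zero    zero    = sym (-‿inverseʳ 0#)
  int-⊖ zero    (suc n) = sym (+-identityˡ _)
  int-⊖ (suc m) zero    = sym (trans (+-congˡ -0#≈0#) (+-identityʳ _))
  int-⊖ (suc m) (suc n) = begin
    int (suc m ℤ.⊖ suc n)         ≡⟨ ≡.cong int (ℤ.[1+m]⊖[1+n]≡m⊖n m n) ⟩
    int (m ℤ.⊖ n)                 ≈⟨ int-⊖ m n ⟩
    num m - num n                 ≈⟨ sym (cancel 1# _ _) ⟩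
    (1# + num m) - (1# + num n)   ≈⟨ sym (+-cong (1+× m 1#) (-‿cong (1+× n 1#))) ⟩
    num (suc m) - num (suc n)     ∎

  int-neg : ∀ i → int (ℤ.- i) ≈ - int i
  int-neg (+ zero)   = sym -0#≈0#
  int-neg (+ suc n)  = refl
  int-neg (-[1+ n ]) = sym (-‿involutive _)

  int-+ : ∀ i j → int (i ℤ.+ j) ≈ int i + int j
  int-+ (+ m)    (+ n)    = ×-homo-+ 1# m n
  int-+ (+ m)    -[1+ n ] = int-⊖ m (suc n)
  int-+ -[1+ m ] (+ n)    = trans (int-⊖ n (suc m)) (+-comm _ _)
  int-+ -[1+ m ] -[1+ n ] = begin
    - num (suc (suc (m ℕ.+ n)))   ≡⟨ ≡.cong (λ k → - num k) (≡.sym (≡.cong suc (ℕ.+-suc m n))) ⟩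
    - num (suc m ℕ.+ suc n)       ≈⟨ -‿cong (×-homo-+ 1# (suc m) (suc n)) ⟩
    - (num (suc m) + num (suc n)) ≈⟨ sym (-‿+-comm _ _) ⟩
    - num (suc m) - num (suc n)   ∎

  int-pos-* : ∀ m j → int (+ m ℤ.* j) ≈ num m * int j
  int-pos-* m (+ n) = begin
    int (+ m ℤ.* + n) ≡⟨ ≡.cong int (≡.sym (ℤ.pos-* m n)) ⟩
    num (m ℕ.* n)     ≈⟨ ×1-homo-* m n ⟩
    num m * num n     ∎
  int-pos-* m -[1+ n ] = begin
    int (+ m ℤ.* -[1+ n ])        ≡⟨ ≡.cong int (≡.sym (ℤ.neg-distribʳ-* (+ m) (+ suc n))) ⟩
    int (ℤ.- (+ m ℤ.* + suc n))   ≈⟨ int-neg (+ m ℤ.* + suc n) ⟩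
    - int (+ m ℤ.* + suc n)       ≈⟨ -‿cong (int-pos-* m (+ suc n)) ⟩
    - (num m * num (suc n))       ≈⟨ -‿distribʳ-* _ _ ⟩
    num m * - num (suc n)         ∎

  int-* : ∀ i j → int (i ℤ.* j) ≈ int i * int j
  int-* (+ m) j    = int-pos-* m j
  int-* -[1+ m ] j = begin
    int (-[1+ m ] ℤ.* j)          ≡⟨ ≡.cong int (≡.sym (ℤ.neg-distribˡ-* (+ suc m) j)) ⟩
    int (ℤ.- (+ suc m ℤ.* j))     ≈⟨ int-neg (+ suc m ℤ.* j) ⟩
    - int (+ suc m ℤ.* j)         ≈⟨ -‿cong (int-pos-* (suc m) j) ⟩
    - (num (suc m) * int j)       ≈⟨ -‿distribˡ-* _ _ ⟩
    - num (suc m) * int j         ∎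

  private
    -- Normalisation compares coefficients, so they are taken from ℤ, where equality is decidable,
    -- and are interpreted in the ring by `int`.
    morphism : ACR._-Raw-AlmostCommutative⟶_ (CommutativeRing.rawRing ℤ.+-*-commutativeRing)
                                              (ACR.fromCommutativeRing R)
    morphism = record
      { ⟦_⟧    = int
      ; +-homo = int-+
      ; *-homo = int-*
      ; -‿homo = int-neg
      ; 0-homo = refl
      ; 1-homo = refl
      }

    coeff≟ : ∀ i j → _
    coeff≟ i j with i ℤ.≟ j
    ... | yes i≡j = just (reflexive (≡.cong int i≡j))
    ... | no _    = nothing

  open Algebra.Solver.Ring (CommutativeRing.rawRing ℤ.+-*-commutativeRing)
    (ACR.fromCommutativeRing R) morphism coeff≟ public
    using (Polynomial; solve; con; _:+_; _:*_; _:-_; :-_; _:=_; _:^_)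

  𝟘 𝟙 𝟚 : ∀ {n} → Polynomial n
  𝟘 = con (+ 0)
  𝟙 = con (+ 1)
  𝟚 = con (+ 2)

-- Coefficient lists: synthetic division and polynomials in the shift operator.

module Polynomials (R : CommutativeRing 0ℓ 0ℓ) where

  open CommutativeRing R
  open IntegerSolver R
  open Algebra.Properties.CommutativeSemiring.Exp commutativeSemiring using (_^_)
  open Relation.Binary.Reasoning.Setoid setoid

  infixl 9 _⟨_⟩
  _⟨_⟩ : List Carrier → Carrier → Carrier
  []       ⟨ x ⟩ = 0#
  (c ∷ cs) ⟨ x ⟩ = c + x * cs ⟨ x ⟩

  -- The list has exactly n + 1 entries, so the degree drops structurally under `quot`; the last
  -- entry need only be equal to `1#` in the sense of the ring.
  data MonicOfDegree : ℕ → List Carrier → Set where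
    [_] : ∀ {c} → c ≈ 1# → MonicOfDegree 0 (c ∷ [])
    _∷_ : ∀ {n cs} c → MonicOfDegree n cs → MonicOfDegree (suc n) (c ∷ cs)

  ⟨⟩-cong : ∀ cs {x y} → x ≈ y → cs ⟨ x ⟩ ≈ cs ⟨ y ⟩
  ⟨⟩-cong []       p = refl
  ⟨⟩-cong (c ∷ cs) p = +-congˡ (*-cong p (⟨⟩-cong cs p))

  -- Synthetic division by X - x.
  quot : Carrier → List Carrier → List Carrier
  quot x []            = []
  quot x (c ∷ [])      = []
  quot x (c ∷ d ∷ cs)  = (d ∷ cs) ⟨ x ⟩ ∷ quot x (d ∷ cs)

  quot-monic : ∀ {n cs} x → MonicOfDegree (suc n) cs → MonicOfDegree n (quot x cs)
  quot-monic x (c ∷ [ p ])         = [ trans (+-cong p (zeroʳ x)) (+-identityʳ 1#) ]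
  quot-monic x (c ∷ p@(d ∷ [ _ ])) = _ ∷ quot-monic x p
  quot-monic x (c ∷ p@(d ∷ _ ∷ _)) = _ ∷ quot-monic x p

  ⟨⟩-quot : ∀ cs x y → cs ⟨ y ⟩ ≈ cs ⟨ x ⟩ + (y - x) * quot x cs ⟨ y ⟩
  ⟨⟩-quot []           x y = solve 2 (λ x y → 𝟘 := 𝟘 :+ (y :- x) :* 𝟘) refl x y
  ⟨⟩-quot (c ∷ [])     x y = solve 3 (λ c x y → c :+ y :* 𝟘 := (c :+ x :* 𝟘) :+ (y :- x) :* 𝟘) refl c x y
  ⟨⟩-quot (c ∷ d ∷ cs) x y = begin
    c + y * P y                            ≈⟨ +-congˡ (*-congˡ (⟨⟩-quot (d ∷ cs) x y)) ⟩
    c + y * (P x + (y - x) * Q)            ≈⟨ solve 5 (λ c x y p q → c :+ y :* (p :+ (y :- x) :* q)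
                                                 := (c :+ x :* p) :+ (y :- x) :* (p :+ y :* q)) refl c x y (P x) Q ⟩
    (c + x * P x) + (y - x) * (P x + y * Q) ∎
    where
    P = (d ∷ cs) ⟨_⟩
    Q = quot x (d ∷ cs) ⟨ y ⟩

  quot-root : ∀ {cs x y} → cs ⟨ x ⟩ ≈ 0# → quot x cs ⟨ y ⟩ ≈ 0# → cs ⟨ y ⟩ ≈ 0#
  quot-root {cs} {x} {y} p q = trans (⟨⟩-quot cs x y)
    (trans (+-cong p (trans (*-congˡ q) (zeroʳ _))) (+-identityˡ 0#))

  -- The derivative of c + X (c₁ + c₂ X + ⋯) has coefficients weighted 1 (c₁ ∷ c₂ ∷ ⋯).
  weighted : ℕ → List Carrier → List Carrier
  weighted n []       = []
  weighted n (c ∷ cs) = num n * c ∷ weighted (suc n) cs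

  weighted-suc : ∀ n cs x → weighted (suc n) cs ⟨ x ⟩ ≈ weighted n cs ⟨ x ⟩ + cs ⟨ x ⟩
  weighted-suc n []       x = sym (+-identityˡ 0#)
  weighted-suc n (c ∷ cs) x = trans (+-cong (*-congʳ (num-suc n)) (*-congˡ (weighted-suc (suc n) cs x)))
    (solve 5 (λ n c x w p → (𝟙 :+ n) :* c :+ x :* (w :+ p) := (n :* c :+ x :* w) :+ (c :+ x :* p)) refl (num n) c x _ _)

  -- Both sides are the derivative at x: by `⟨⟩-quot` the quotient is the difference quotient. This
  -- is how the simplicity of the root β will be tested.
  quot-self : ∀ c cs x → quot x (c ∷ cs) ⟨ x ⟩ ≈ weighted 1 cs ⟨ x ⟩
  quot-self c []       x = refl
  quot-self c (d ∷ ds) x = begin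
    (d + x * ds ⟨ x ⟩) + x * quot x (d ∷ ds) ⟨ x ⟩
      ≈⟨ +-congˡ (*-congˡ (quot-self d ds x)) ⟩
    (d + x * ds ⟨ x ⟩) + x * weighted 1 ds ⟨ x ⟩
      ≈⟨ solve 4 (λ d x p w → (d :+ x :* p) :+ x :* w := 𝟙 :* d :+ x :* (w :+ p)) refl d x _ _ ⟩
    1# * d + x * (weighted 1 ds ⟨ x ⟩ + ds ⟨ x ⟩)
      ≈⟨ +-congˡ (*-congˡ (weighted-suc 1 ds x)) ⟨
    1# * d + x * weighted 2 ds ⟨ x ⟩ ∎

  -- The polynomial with coefficients cs, evaluated at the shift operator.
  infixl 4 _⟦_⟧ˢ
  _⟦_⟧ˢ : List Carrier → (ℕ → Carrier) → ℕ → Carrier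
  ([]     ⟦ s ⟧ˢ) k = 0#
  (c ∷ cs ⟦ s ⟧ˢ) k = c * s k + (cs ⟦ s ⟧ˢ) (suc k)

  ⟦⟧ˢ-cong : ∀ cs {s t} → (∀ k → s k ≈ t k) → ∀ k → (cs ⟦ s ⟧ˢ) k ≈ (cs ⟦ t ⟧ˢ) k
  ⟦⟧ˢ-cong []       p k = refl
  ⟦⟧ˢ-cong (c ∷ cs) p k = +-cong (*-congˡ (p k)) (⟦⟧ˢ-cong cs p (suc k))

  ⟦⟧ˢ-linear : ∀ cs s t a b k → (cs ⟦ (λ j → a * s j + b * t j) ⟧ˢ) k ≈ a * (cs ⟦ s ⟧ˢ) k + b * (cs ⟦ t ⟧ˢ) k
  ⟦⟧ˢ-linear []       s t a b k = solve 2 (λ a b → 𝟘 := a :* 𝟘 :+ b :* 𝟘) refl a b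
  ⟦⟧ˢ-linear (c ∷ cs) s t a b k = trans (+-congˡ (⟦⟧ˢ-linear cs s t a b (suc k)))
    (solve 7 (λ c x y a b z w → c :* (a :* x :+ b :* y) :+ (a :* z :+ b :* w) := a :* (c :* x :+ z) :+ b :* (c :* y :+ w))
      refl c (s k) (t k) a b _ _)

  ⟦⟧ˢ-shift : ∀ cs s k → (cs ⟦ (λ j → s (suc j)) ⟧ˢ) k ≈ (cs ⟦ s ⟧ˢ) (suc k)
  ⟦⟧ˢ-shift []       s k = refl
  ⟦⟧ˢ-shift (c ∷ cs) s k = +-congˡ (⟦⟧ˢ-shift cs s (suc k))

  ⟦⟧ˢ-geometric : ∀ cs x k → (cs ⟦ (x ^_) ⟧ˢ) k ≈ cs ⟨ x ⟩ * x ^ k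
  ⟦⟧ˢ-geometric []       x k = sym (zeroˡ _)
  ⟦⟧ˢ-geometric (c ∷ cs) x k = trans (+-congˡ (⟦⟧ˢ-geometric cs x (suc k)))
    (solve 4 (λ c x p y → c :* y :+ p :* (x :* y) := (c :+ x :* p) :* y) refl c x _ (x ^ k))

  shift-minus : Carrier → (ℕ → Carrier) → ℕ → Carrier
  shift-minus x s k = s (suc k) - x * s k

  -- With E for the shift, this is p(E) = p(x) + q(E) (E - x), the analogue of `⟨⟩-quot`;
  -- `shift-minus x` is E - x. At a root x the first term disappears.
  ⟦⟧ˢ-quot : ∀ cs x s k → (cs ⟦ s ⟧ˢ) k ≈ cs ⟨ x ⟩ * s k + (quot x cs ⟦ shift-minus x s ⟧ˢ) k
  ⟦⟧ˢ-quot []           x s k = solve 1 (λ a → 𝟘 := 𝟘 :* a :+ 𝟘) refl (s k)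
  ⟦⟧ˢ-quot (c ∷ [])     x s k = solve 3 (λ c x a → c :* a :+ 𝟘 := (c :+ x :* 𝟘) :* a :+ 𝟘) refl c x (s k)
  ⟦⟧ˢ-quot (c ∷ d ∷ cs) x s k = trans (+-congˡ (⟦⟧ˢ-quot (d ∷ cs) x s (suc k)))
    (solve 6 (λ c x p a b q → c :* a :+ (p :* b :+ q) := (c :+ x :* p) :* a :+ (p :* (b :- x :* a) :+ q))
      refl c x ((d ∷ cs) ⟨ x ⟩) (s k) (s (suc k)) _)

  ⟦⟧ˢ-shift-minus : ∀ cs x s k → (cs ⟦ shift-minus x s ⟧ˢ) k ≈ shift-minus x (cs ⟦ s ⟧ˢ) k
  ⟦⟧ˢ-shift-minus cs x s k = begin
    (cs ⟦ shift-minus x s ⟧ˢ) k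
      ≈⟨ ⟦⟧ˢ-cong cs (λ j → solve 3 (λ x a b → b :- x :* a := 𝟙 :* b :+ (:- x) :* a) refl x (s j) (s (suc j))) k ⟩
    (cs ⟦ (λ j → 1# * s (suc j) + (- x) * s j) ⟧ˢ) k
      ≈⟨ ⟦⟧ˢ-linear cs (λ j → s (suc j)) s 1# (- x) k ⟩
    1# * (cs ⟦ (λ j → s (suc j)) ⟧ˢ) k + (- x) * (cs ⟦ s ⟧ˢ) k
      ≈⟨ +-congʳ (*-congˡ (⟦⟧ˢ-shift cs s k)) ⟩
    1# * (cs ⟦ s ⟧ˢ) (suc k) + (- x) * (cs ⟦ s ⟧ˢ) k
      ≈⟨ solve 3 (λ x a b → 𝟙 :* b :+ (:- x) :* a := b :- x :* a) refl x _ _ ⟩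
    shift-minus x (cs ⟦ s ⟧ˢ) k ∎

-- Closure properties of subexponential growth.

module SubexponentialFunctions where

  -- F grows like exp(R^(1 - 1/g)).
  record Subexponential (g : ℕ) (F : ℕ → ℕ) : Set where
    constructor subexponential
    field
      base   : ℕ
      1≤base : 1 ℕ.≤ base
      bound  : ∀ R v → 1 ℕ.≤ v → v ℕ.^ g ℕ.≤ R → suc (F R) ℕ.^ v ℕ.≤ base ℕ.^ R
  open Subexponential public

  ^-distrib : ∀ a b n → (a ℕ.* b) ℕ.^ n ≡ a ℕ.^ n ℕ.* b ℕ.^ n
  ^-distrib a b zero    = ≡.refl
  ^-distrib a b (suc n) = ≡.trans (≡.cong (a ℕ.* b ℕ.*_) (^-distrib a b n)) (swap a b (a ℕ.^ n) (b ℕ.^ n))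
    where
    swap : ∀ a b c d → a ℕ.* b ℕ.* (c ℕ.* d) ≡ a ℕ.* c ℕ.* (b ℕ.* d)
    swap = solve-∀

  v≤R : ∀ {v g R} → 1 ℕ.≤ g → 1 ℕ.≤ v → v ℕ.^ g ℕ.≤ R → v ℕ.≤ R
  v≤R {v} {suc g} _ 1≤v p = ℕ.≤-trans (ℕ.m≤m*n v (v ℕ.^ g) ⦃ ℕ.>-nonZero (ℕ.m^n>0 v ⦃ ℕ.>-nonZero 1≤v ⦄ g) ⦄) p

  private
    -- Bounding `suc (F R)` rather than `F R` lets a single product of successors dominate sums and
    -- products alike; the bases are multiplied.
    combine-bounds : ∀ {g F F′ F″} → (∀ R → suc (F″ R) ℕ.≤ suc (F R) ℕ.* suc (F′ R)) →
                     Subexponential g F → Subexponential g F′ → Subexponential g F″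
    combine-bounds {F = F} {F′} p (subexponential E 1≤E q) (subexponential E′ 1≤E′ q′) = subexponential (E ℕ.* E′) (ℕ.*-mono-≤ 1≤E 1≤E′) λ R v 1≤v r →
      ℕ.≤-trans (ℕ.^-monoˡ-≤ v (p R)) (ℕ.≤-trans (ℕ.≤-reflexive (^-distrib (suc (F R)) (suc (F′ R)) v))
        (ℕ.≤-trans (ℕ.*-mono-≤ (q R v 1≤v r) (q′ R v 1≤v r)) (ℕ.≤-reflexive (≡.sym (^-distrib E E′ R)))))

  Subexponential-+ : ∀ {g F F′} → Subexponential g F → Subexponential g F′ → Subexponential g (λ R → F R ℕ.+ F′ R)
  Subexponential-+ {F = F} {F′} = combine-bounds λ R → ℕ.≤-trans (ℕ.m≤m+n (suc (F R ℕ.+ F′ R)) (F R ℕ.* F′ R)) (ℕ.≤-reflexive (expand (F R) (F′ R)))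
    where
    expand : ∀ a b → 1 ℕ.+ (a ℕ.+ b) ℕ.+ a ℕ.* b ≡ (1 ℕ.+ a) ℕ.* (1 ℕ.+ b)
    expand = solve-∀

  Subexponential-* : ∀ {g F F′} → Subexponential g F → Subexponential g F′ → Subexponential g (λ R → F R ℕ.* F′ R)
  Subexponential-* {F = F} {F′} = combine-bounds λ R → ℕ.≤-trans (ℕ.m≤m+n (suc (F R ℕ.* F′ R)) (F R ℕ.+ F′ R)) (ℕ.≤-reflexive (expand (F R) (F′ R)))
    where
    expand : ∀ a b → 1 ℕ.+ a ℕ.* b ℕ.+ (a ℕ.+ b) ≡ (1 ℕ.+ a) ℕ.* (1 ℕ.+ b)
    expand = solve-∀

  Subexponential-const : ∀ {g} → 1 ℕ.≤ g → ∀ c → Subexponential g (λ _ → c)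
  Subexponential-const 1≤g c = subexponential (suc c) (s≤s z≤n) λ R v 1≤v r → ℕ.^-monoʳ-≤ (suc c) (v≤R 1≤g 1≤v r)

  Subexponential-^ : ∀ {g F} → 1 ℕ.≤ g → Subexponential g F → ∀ n → Subexponential g (λ R → F R ℕ.^ n)
  Subexponential-^ 1≤g p zero    = Subexponential-const 1≤g 1
  Subexponential-^ 1≤g p (suc n) = Subexponential-* p (Subexponential-^ 1≤g p n)

  private
    sqrt-exists : ∀ R → ∃ λ r → r ℕ.* r ℕ.≤ R × R ℕ.< suc r ℕ.* suc r
    sqrt-exists zero = 0 , z≤n , s≤s z≤n
    sqrt-exists (suc R) with sqrt-exists R
    ... | r , p , q with suc R ℕ.<? suc r ℕ.* suc r
    ... | yes s = r , ℕ.m≤n⇒m≤1+n p , s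
    ... | no s  = suc r , ℕ.≮⇒≥ s , ℕ.≤-<-trans q (ℕ.*-mono-< (ℕ.n<1+n (suc r)) (ℕ.n<1+n (suc r)))

    n<2^n : ∀ n → suc n ℕ.≤ 2 ℕ.^ n
    n<2^n zero    = s≤s z≤n
    n<2^n (suc n) = ℕ.≤-trans (ℕ.+-mono-≤ (ℕ.m^n>0 2 n) (n<2^n n)) (ℕ.≤-reflexive (≡.cong (2 ℕ.^ n ℕ.+_) (≡.sym (ℕ.+-identityʳ (2 ℕ.^ n)))))

  -- With r = ⌊√R⌋ ≥ v: (R + 1)^v ≤ (r + 1)^2r ≤ 2^(2r²).
  Subexponential-id : ∀ {g} → 2 ℕ.≤ g → Subexponential g (λ R → R)
  Subexponential-id {g} 2≤g = subexponential 4 (s≤s z≤n) bounded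
    where
    bounded : ∀ R v → 1 ℕ.≤ v → v ℕ.^ g ℕ.≤ R → suc R ℕ.^ v ℕ.≤ 4 ℕ.^ R
    bounded R v 1≤v p with sqrt-exists R
    ... | r , r²≤R , R<[1+r]² = begin
      suc R ℕ.^ v                ≤⟨ ℕ.^-monoʳ-≤ (suc R) v≤r ⟩
      suc R ℕ.^ r                ≤⟨ ℕ.^-monoˡ-≤ r R<[1+r]² ⟩
      (suc r ℕ.* suc r) ℕ.^ r    ≤⟨ ℕ.^-monoˡ-≤ r (ℕ.*-mono-≤ (n<2^n r) (n<2^n r)) ⟩
      (2 ℕ.^ r ℕ.* 2 ℕ.^ r) ℕ.^ r  ≡⟨ ≡.cong (ℕ._^ r) (≡.sym (^-distrib 2 2 r)) ⟩
      (4 ℕ.^ r) ℕ.^ r            ≡⟨ ℕ.^-*-assoc 4 r r ⟩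
      4 ℕ.^ (r ℕ.* r)            ≤⟨ ℕ.^-monoʳ-≤ 4 r²≤R ⟩
      4 ℕ.^ R                    ∎
      where
      open ℕ.≤-Reasoning
      v²≤R : v ℕ.* v ℕ.≤ R
      v²≤R = ℕ.≤-trans (ℕ.≤-trans (ℕ.≤-reflexive (≡.cong (v ℕ.*_) (≡.sym (ℕ.*-identityʳ v)))) (ℕ.^-monoʳ-≤ v ⦃ ℕ.>-nonZero 1≤v ⦄ 2≤g)) p
      v≤r : v ℕ.≤ r
      v≤r = ℕ.≮⇒≥ λ r<v → ℕ.<⇒≱ R<[1+r]² (ℕ.≤-trans (ℕ.*-mono-≤ r<v r<v) v²≤R)

-- Numerical inequalities for the choice of blocks, gaps and windows.

module GapArithmetic where

  open import Data.Nat.Base using (_+_; _*_; _∸_; _^_; _≤_; _<_)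
  open SubexponentialFunctions using (^-distrib)

  floor : ∀ d N → 1 ≤ d → ∃ λ L → d * L ≤ N × N < d * suc L
  floor d zero    1≤d = 0 , ℕ.≤-reflexive (ℕ.*-zeroʳ d) , ℕ.≤-trans 1≤d (ℕ.≤-reflexive (≡.sym (ℕ.*-identityʳ d)))
  floor d (suc N) 1≤d with floor d N 1≤d
  ... | L , p , q with suc N ℕ.<? d * suc L
  ... | yes r = L , ℕ.m≤n⇒m≤1+n p , r
  ... | no r  = suc L , ℕ.≮⇒≥ r , ℕ.≤-<-trans q (ℕ.*-monoʳ-< d ⦃ ℕ.>-nonZero 1≤d ⦄ (ℕ.n<1+n (suc L)))

  ^*^≤ : ∀ a b m n → suc a ^ m * suc b ^ n ≤ (suc a * suc b) ^ (m + n)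
  ^*^≤ a b m n = ℕ.≤-trans (ℕ.*-mono-≤ (ℕ.^-monoˡ-≤ m (ℕ.m≤m*n (suc a) (suc b))) (ℕ.^-monoˡ-≤ n (ℕ.m≤n*m (suc b) (suc a))))
    (ℕ.≤-reflexive (≡.sym (ℕ.^-distribˡ-+-* (suc a * suc b) m n)))

  suc^≤ : ∀ {a} n → 1 ≤ a → suc a ^ n ≤ 2 ^ n * a ^ n
  suc^≤ {a} n 1≤a = ℕ.≤-trans (ℕ.^-monoˡ-≤ n (ℕ.≤-trans (ℕ.+-monoˡ-≤ a 1≤a) (ℕ.≤-reflexive (≡.cong (ℕ._+_ a) (≡.sym (ℕ.+-identityʳ a))))))
    (ℕ.≤-reflexive (^-distrib 2 a n))

  -- The constant is 20 = 5 · 4: since `suc n ≤ 5 M`, the block length L is at least 4 δ, and so its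
  -- half h is at least 2 δ.
  half-block : ∀ {δ M n L h N} → 1 ≤ M → 20 * (δ * M) < N → N < suc n * suc L → n ≤ 4 * M → L < 2 * suc h → δ ≤ h
  half-block {δ} {M} {n} {L} {h} {N} 1≤M p q r s = ℕ.≤-trans (ℕ.m≤m+n δ (δ + 0)) (ℕ.≤-pred (ℕ.*-cancelˡ-< 2 (2 * δ) (suc h)
      (ℕ.≤-<-trans (ℕ.≤-pred (ℕ.*-cancelˡ-< (5 * M) (2 * (2 * δ)) (suc L) (ℕ.≤-<-trans (ℕ.≤-reflexive (e M δ)) (ℕ.<-≤-trans (ℕ.<-trans p q)
        (ℕ.*-monoˡ-≤ (suc L) (ℕ.≤-trans (ℕ.+-mono-≤ 1≤M r) (ℕ.≤-reflexive (e′ M)))))))) s)))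
    where
    e : ∀ M δ → 5 * M * (2 * (2 * δ)) ≡ 20 * (δ * M)
    e = solve-∀
    e′ : ∀ M → M + 4 * M ≡ 5 * M
    e′ = solve-∀

  -- The spare factor `l₂`, a value of the counting function of S₂, absorbs the constant b; 40 = 2 ·
  -- 20 makes up for `R ≤ 2 N`.
  twenty : ∀ {δ M P b l₂ N R} → 1 ≤ b → δ * (P * l₂) < R → R ≤ 2 * N → M ≤ b * P → 40 * b ≤ l₂ → 20 * (δ * M) < N
  twenty {δ} {M} {P} {b} {l₂} {N} {R} 1≤b p q r s = ℕ.*-cancelˡ-< 2 (20 * (δ * M)) N (ℕ.<-≤-trans (ℕ.≤-<-trans
      (ℕ.≤-trans (ℕ.≤-trans (ℕ.*-monoʳ-≤ 2 (ℕ.*-monoʳ-≤ 20 (ℕ.*-monoʳ-≤ δ r))) (ℕ.≤-reflexive (e δ b P)))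
        (ℕ.*-monoʳ-≤ δ (ℕ.*-monoʳ-≤ P s))) p) q)
    where
    e : ∀ δ b P → 2 * (20 * (δ * (b * P))) ≡ δ * (P * (40 * b))
    e = solve-∀

  -- Put w = 2 c₀ q³. Rounding down ρ and H costs at most w ≤ N in the estimate 2 N < w (H + 1),
  -- which leaves N < w H. The factor `suc (2 C)` then turns this into the claim.
  window-large : ∀ {c₀ q ρ H N} C v₀ → 1 ≤ q → 1 ≤ c₀ → 2 * (c₀ * q ^ 3) ≤ N → N < c₀ * q ^ 2 * suc ρ → ρ < q * suc H →
                 C * (2 * N) < H * (suc (2 * C) * (2 * (c₀ * q ^ 3)) * suc v₀)
  window-large {c₀} {q} {ρ} {H} {N} C v₀ 1≤q 1≤c₀ w≤N N< ρ< = ℕ.<-≤-trans (ℕ.≤-<-trans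
      (ℕ.≤-trans (ℕ.≤-reflexive (e₁ C N)) (ℕ.*-monoʳ-≤ (2 * C) (ℕ.<⇒≤ N<wH)))
      (ℕ.m<n+m (2 * C * (w * H)) (ℕ.≤-<-trans z≤n N<wH)))
      (ℕ.≤-trans (ℕ.m≤m*n (suc (2 * C) * (w * H)) (suc v₀)) (ℕ.≤-reflexive (e₂ C w H v₀)))
    where
    w = 2 * (c₀ * q ^ 3)
    e₁ : ∀ C N → C * (2 * N) ≡ 2 * C * N
    e₁ = solve-∀
    e₂ : ∀ C w H v → (1 + 2 * C) * (w * H) * (1 + v) ≡ H * ((1 + 2 * C) * w * (1 + v))
    e₂ = solve-∀
    e₃ : ∀ c q H → 2 * (c * (q * (q * 1)) * (q * (1 + H))) ≡ 2 * (c * (q * (q * (q * 1)))) * H + 2 * (c * (q * (q * (q * 1))))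
    e₃ = solve-∀
    N<wH : N < w * H
    N<wH = ℕ.+-cancelʳ-< N N (w * H) (ℕ.<-≤-trans (ℕ.≤-<-trans (ℕ.≤-reflexive (≡.cong (ℕ._+_ N) (≡.sym (ℕ.+-identityʳ N))))
        (ℕ.*-monoʳ-< 2 (ℕ.<-≤-trans N< (ℕ.*-monoʳ-≤ (c₀ * q ^ 2) ρ<))))
      (ℕ.≤-trans (ℕ.≤-reflexive (e₃ c₀ q H)) (ℕ.+-monoʳ-≤ (w * H) w≤N)))

  floor-≤ : ∀ {d x L N} → d * x ≤ N → N < d * suc L → x ≤ L
  floor-≤ {d} {x} {L} p q = ℕ.≤-pred (ℕ.*-cancelˡ-< d x (suc L) (ℕ.≤-<-trans p q))

module Independence (em : ExcludedMiddle 0ℓ) (ℛ : CompleteOrderedField) where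

  -- Order and powers in the ordered field.

  module OrderedField where

    open CompleteOrderedField ℛ public hiding (zero)
    open IsStrictTotalOrder isStrictTotalOrder public
      using (compare; <-respˡ-≈; <-respʳ-≈)
      renaming (trans to <-trans; irrefl to <-irrefl; isStrictPartialOrder to <-isStrictPartialOrder)
    open IntegerSolver commutativeRing public

    <-strictPartialOrder : StrictPartialOrder 0ℓ 0ℓ 0ℓ
    <-strictPartialOrder = record { isStrictPartialOrder = <-isStrictPartialOrder }

    module ≤-Reasoning = Relation.Binary.Reasoning.StrictPartialOrder <-strictPartialOrder

    private
      module S = ToNonStrict _≈_ _<_

    ≤-refl : ∀ {x} → x ≤ x
    ≤-refl = inj₂ refl

    ≤-reflexive : ∀ {x y} → x ≈ y → x ≤ y
    ≤-reflexive = inj₂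

    <⇒≤ : ∀ {x y} → x < y → x ≤ y
    <⇒≤ = inj₁

    <-≤-trans : ∀ {x y z} → x < y → y ≤ z → x < z
    <-≤-trans = S.<-≤-trans <-trans <-respʳ-≈

    ≤-<-trans : ∀ {x y z} → x ≤ y → y < z → x < z
    ≤-<-trans = S.≤-<-trans sym <-trans <-respˡ-≈

    ≤-trans : ∀ {x y z} → x ≤ y → y ≤ z → x ≤ z
    ≤-trans (inj₁ p) q = inj₁ (<-≤-trans p q)
    ≤-trans (inj₂ p) (inj₁ q) = inj₁ (<-respˡ-≈ (sym p) q)
    ≤-trans (inj₂ p) (inj₂ q) = inj₂ (trans p q)

    ≤-respˡ : ∀ {x y z} → x ≈ y → x ≤ z → y ≤ z
    ≤-respˡ p q = ≤-trans (inj₂ (sym p)) q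

    ≤-respʳ : ∀ {x y z} → y ≈ z → x ≤ y → x ≤ z
    ≤-respʳ p q = ≤-trans q (inj₂ p)

    <⇒≱ : ∀ {x y} → x < y → ¬ (y ≤ x)
    <⇒≱ p q = <-irrefl refl (<-≤-trans p q)

    <⇒≉ : ∀ {x y} → x < y → ¬ (x ≈ y)
    <⇒≉ p q = <-irrefl q p

    ≤-antisym : ∀ {x y} → x ≤ y → y ≤ x → x ≈ y
    ≤-antisym (inj₂ p) _ = p
    ≤-antisym (inj₁ p) q = ⊥-elim (<⇒≱ p q)

    ≤∨> : ∀ x y → (x ≤ y) ⊎ (y < x)
    ≤∨> x y with compare x y
    ... | tri< p _ _ = inj₁ (inj₁ p)
    ... | tri≈ _ p _ = inj₁ (inj₂ p)
    ... | tri> _ _ p = inj₂ p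

    ≮⇒≥ : ∀ {x y} → ¬ (x < y) → y ≤ x
    ≮⇒≥ {x} {y} p with ≤∨> y x
    ... | inj₁ q = q
    ... | inj₂ q = ⊥-elim (p q)

    ≰⇒> : ∀ {x y} → ¬ (x ≤ y) → y < x
    ≰⇒> {x} {y} p with ≤∨> x y
    ... | inj₁ q = ⊥-elim (p q)
    ... | inj₂ q = q

    x<y⇒0<y-x : ∀ {x y} → x < y → 0# < y - x
    x<y⇒0<y-x {x} p = <-respˡ-≈ (-‿inverseʳ x) (+-mono-< (- x) p)

    x≤y⇒0≤y-x : ∀ {x y} → x ≤ y → 0# ≤ y - x
    x≤y⇒0≤y-x (inj₁ p) = inj₁ (x<y⇒0<y-x p)
    x≤y⇒0≤y-x {x} (inj₂ p) = inj₂ (trans (sym (-‿inverseʳ x)) (+-congʳ p))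

    -- Most inequalities are proved by exhibiting the difference as a visibly positive expression;
    -- what remains is a ring identity for the solver.
    <-by : ∀ {x y e} → 0# < e → y - x ≈ e → x < y
    <-by {x} {y} p q = <-respˡ-≈ (+-identityˡ x)
      (<-respʳ-≈ (solve 2 (λ x y → (y :- x) :+ x := y) refl x y)
        (+-mono-< x (<-respʳ-≈ (sym q) p)))

    ≤-by : ∀ {x y e} → 0# ≤ e → y - x ≈ e → x ≤ y
    ≤-by (inj₁ p) q = inj₁ (<-by p q)
    ≤-by {x} {y} (inj₂ p) q = inj₂ (sym (trans (solve 2 (λ x y → y := (y :- x) :+ x) refl x y)
      (trans (+-congʳ (trans q (sym p))) (+-identityˡ x))))

    0<x+y : ∀ {x y} → 0# < x → 0# < y → 0# < x + y
    0<x+y {x} {y} p q = <-trans q (<-respˡ-≈ (+-identityˡ y) (+-mono-< y p))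

    0≤x+y : ∀ {x y} → 0# ≤ x → 0# ≤ y → 0# ≤ x + y
    0≤x+y (inj₁ p) (inj₁ q) = inj₁ (0<x+y p q)
    0≤x+y (inj₁ p) (inj₂ q) = inj₁ (<-respʳ-≈ (trans (sym (+-identityʳ _)) (+-congˡ q)) p)
    0≤x+y (inj₂ p) q = ≤-respʳ (trans (sym (+-identityˡ _)) (+-congʳ p)) q

    0<x+y′ : ∀ {x y} → 0# < x → 0# ≤ y → 0# < x + y
    0<x+y′ p (inj₁ q) = 0<x+y p q
    0<x+y′ p (inj₂ q) = <-respʳ-≈ (trans (sym (+-identityʳ _)) (+-congˡ q)) p

    0≤x*y : ∀ {x y} → 0# ≤ x → 0# ≤ y → 0# ≤ x * y
    0≤x*y (inj₁ p) (inj₁ q) = inj₁ (*-pos p q)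
    0≤x*y {x} (inj₁ p) (inj₂ q) = inj₂ (trans (sym (zeroʳ x)) (*-congˡ q))
    0≤x*y {y = y} (inj₂ p) q = inj₂ (trans (sym (zeroˡ y)) (*-congʳ p))

    0≤1 : 0# ≤ 1#
    0≤1 = inj₁ 0<1

    neg-mono-< : ∀ {x y} → x < y → - y < - x
    neg-mono-< {x} {y} p = <-by (x<y⇒0<y-x p) (solve 2 (λ x y → :- x :- :- y := y :- x) refl x y)

    neg-mono-≤ : ∀ {x y} → x ≤ y → - y ≤ - x
    neg-mono-≤ {x} {y} p = ≤-by (x≤y⇒0≤y-x p) (solve 2 (λ x y → :- x :- :- y := y :- x) refl x y)

    0<-x : ∀ {x} → x < 0# → 0# < - x
    0<-x {x} p = <-by (x<y⇒0<y-x p) (solve 1 (λ x → :- x :- 𝟘 := 𝟘 :- x) refl x)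

    x<x+y : ∀ {x y} → 0# < y → x < x + y
    x<x+y {x} {y} p = <-by p (solve 2 (λ x y → (x :+ y) :- x := y) refl x y)

    x≤x+y : ∀ {x y} → 0# ≤ y → x ≤ x + y
    x≤x+y {x} {y} p = ≤-by p (solve 2 (λ x y → (x :+ y) :- x := y) refl x y)

    y≤x+y : ∀ {x y} → 0# ≤ x → y ≤ x + y
    y≤x+y {x} {y} p = ≤-by p (solve 2 (λ x y → (x :+ y) :- y := x) refl x y)

    +-mono-≤ : ∀ {a b c d} → a ≤ b → c ≤ d → a + c ≤ b + d
    +-mono-≤ {a} {b} {c} {d} p q = ≤-by (0≤x+y (x≤y⇒0≤y-x p) (x≤y⇒0≤y-x q))
      (solve 4 (λ a b c d → (b :+ d) :- (a :+ c) := (b :- a) :+ (d :- c)) refl a b c d)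

    +-mono-<-≤ : ∀ {a b c d} → a < b → c ≤ d → a + c < b + d
    +-mono-<-≤ {a} {b} {c} {d} p q = <-by (0<x+y′ (x<y⇒0<y-x p) (x≤y⇒0≤y-x q))
      (solve 4 (λ a b c d → (b :+ d) :- (a :+ c) := (b :- a) :+ (d :- c)) refl a b c d)

    +-monoʳ-≤ : ∀ x {a b} → a ≤ b → x + a ≤ x + b
    +-monoʳ-≤ x = +-mono-≤ (≤-refl {x})

    +-monoˡ-≤ : ∀ x {a b} → a ≤ b → a + x ≤ b + x
    +-monoˡ-≤ x p = +-mono-≤ p (≤-refl {x})

    *-monoˡ-≤ : ∀ {x a b} → 0# ≤ x → a ≤ b → x * a ≤ x * b
    *-monoˡ-≤ {x} {a} {b} p q = ≤-by (0≤x*y p (x≤y⇒0≤y-x q))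
      (solve 3 (λ x a b → x :* b :- x :* a := x :* (b :- a)) refl x a b)

    *-monoʳ-≤ : ∀ {x a b} → 0# ≤ x → a ≤ b → a * x ≤ b * x
    *-monoʳ-≤ {x} {a} {b} p q = ≤-by (0≤x*y p (x≤y⇒0≤y-x q))
      (solve 3 (λ x a b → b :* x :- a :* x := x :* (b :- a)) refl x a b)

    *-monoˡ-< : ∀ {x a b} → 0# < x → a < b → x * a < x * b
    *-monoˡ-< {x} {a} {b} p q = <-by (*-pos p (x<y⇒0<y-x q))
      (solve 3 (λ x a b → x :* b :- x :* a := x :* (b :- a)) refl x a b)

    *-mono-≤ : ∀ {a b c d} → 0# ≤ a → 0# ≤ c → a ≤ b → c ≤ d → a * c ≤ b * d
    *-mono-≤ p q r s = ≤-trans (*-monoʳ-≤ q r) (*-monoˡ-≤ (≤-trans p r) s)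

    *-cancelˡ-≤ : ∀ {x a b} → 0# < x → x * a ≤ x * b → a ≤ b
    *-cancelˡ-≤ {x} {a} {b} p q with ≤∨> a b
    ... | inj₁ r = r
    ... | inj₂ r = ⊥-elim (<⇒≱ (*-monoˡ-< p r) q)

    *-cancelˡ-< : ∀ {x a b} → 0# ≤ x → x * a < x * b → a < b
    *-cancelˡ-< {x} {a} {b} p q with ≤∨> b a
    ... | inj₂ r = r
    ... | inj₁ r = ⊥-elim (<⇒≱ q (*-monoˡ-≤ p r))

    0≤x² : ∀ x → 0# ≤ x * x
    0≤x² x with ≤∨> 0# x
    ... | inj₁ p = 0≤x*y p p
    ... | inj₂ p = ≤-respʳ (solve 1 (λ x → :- x :* :- x := x :* x) refl x)
                     (0≤x*y (inj₁ (0<-x p)) (inj₁ (0<-x p)))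

    x-y≈0⇒x≈y : ∀ {x y} → x - y ≈ 0# → x ≈ y
    x-y≈0⇒x≈y {x} {y} p = trans (solve 2 (λ x y → x := (x :- y) :+ y) refl x y)
      (trans (+-congʳ p) (+-identityˡ y))

    x≈y⇒x-y≈0 : ∀ {x y} → x ≈ y → x - y ≈ 0#
    x≈y⇒x-y≈0 {x} {y} p = trans (+-congʳ p) (-‿inverseʳ y)

    -- The counterpart of `<-by` for equations: the difference is a multiple of one known to vanish.
    ≈-by : ∀ {x y a b} c → a ≈ b → x - y ≈ c * (a - b) → x ≈ y
    ≈-by c p q = x-y≈0⇒x≈y (trans q (trans (*-congˡ (x≈y⇒x-y≈0 p)) (zeroʳ c)))

    0≉1 : ¬ (1# ≈ 0#)
    0≉1 p = <⇒≉ 0<1 (sym p)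

    ≉0⇒0<x² : ∀ {x} → ¬ (x ≈ 0#) → 0# < x * x
    ≉0⇒0<x² {x} p with compare x 0#
    ... | tri< q _ _ = <-respʳ-≈ (solve 1 (λ x → :- x :* :- x := x :* x) refl x) (*-pos (0<-x q) (0<-x q))
    ... | tri≈ _ q _ = ⊥-elim (p q)
    ... | tri> _ _ q = *-pos q q

    *-≉0 : ∀ {x y} → ¬ (x ≈ 0#) → ¬ (y ≈ 0#) → ¬ (x * y ≈ 0#)
    *-≉0 {x} {y} p q r = p (trans (sym (trans (*-congˡ (proj₂ (inverse y q))) (*-identityʳ x)))
       (trans (sym (*-assoc x y _)) (trans (*-congʳ r) (zeroˡ _))))

    0<2 : 0# < 1# + 1#
    0<2 = 0<x+y 0<1 0<1

    x²≤y²⇒x≤y : ∀ {x y} → 0# ≤ y → x * x ≤ y * y → x ≤ y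
    x²≤y²⇒x≤y {x} {y} p q with ≤∨> x y
    ... | inj₁ r = r
    ... | inj₂ r = ⊥-elim (<⇒≱ (<-by (*-pos (x<y⇒0<y-x r) (0<x+y′ (≤-<-trans p r) p))
        (solve 2 (λ x y → x :* x :- y :* y := (x :- y) :* (x :+ y)) refl x y)) q)

    open Algebra.Properties.CommutativeSemiring.Exp commutativeSemiring public
      using (_^_; ^-congˡ; ^-homo-*; ^-assocʳ; ^-distrib-*)

    0≤x^n : ∀ {x} n → 0# ≤ x → 0# ≤ x ^ n
    0≤x^n zero    p = 0≤1
    0≤x^n (suc n) p = 0≤x*y p (0≤x^n n p)

    0<x^n : ∀ {x} n → 0# < x → 0# < x ^ n
    0<x^n zero    p = 0<1
    0<x^n (suc n) p = *-pos p (0<x^n n p)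

    1^n≈1 : ∀ n → 1# ^ n ≈ 1#
    1^n≈1 zero    = refl
    1^n≈1 (suc n) = trans (*-identityˡ _) (1^n≈1 n)

    ^-monoˡ-≤ : ∀ {x y} n → 0# ≤ x → x ≤ y → x ^ n ≤ y ^ n
    ^-monoˡ-≤ zero    p q = ≤-refl
    ^-monoˡ-≤ (suc n) p q = *-mono-≤ p (0≤x^n n p) q (^-monoˡ-≤ n p q)

    1≤x^n : ∀ {x} n → 1# ≤ x → 1# ≤ x ^ n
    1≤x^n n p = ≤-respˡ (1^n≈1 n) (^-monoˡ-≤ n 0≤1 p)

    x^n≤1 : ∀ {x} n → 0# ≤ x → x ≤ 1# → x ^ n ≤ 1#
    x^n≤1 n p q = ≤-respʳ (1^n≈1 n) (^-monoˡ-≤ n p q)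

    ^-monoʳ-≤ : ∀ {x m n} → 1# ≤ x → m ℕ.≤ n → x ^ m ≤ x ^ n
    ^-monoʳ-≤ {x} {m} {n} p q = ≤-respʳ (reflexive (≡.cong (x ^_) (ℕ.m+[n∸m]≡n q)))
      (≤-respʳ (sym (^-homo-* x m (n ℕ.∸ m)))
        (≤-respˡ (*-identityʳ _) (*-monoˡ-≤ (0≤x^n m (≤-trans 0≤1 p)) (1≤x^n (n ℕ.∸ m) p))))

    ^-monoˡ-< : ∀ {x y} n → 0# ≤ x → x < y → x ^ suc n < y ^ suc n
    ^-monoˡ-< {x} {y} n p q = ≤-<-trans (*-monoˡ-≤ p (^-monoˡ-≤ n p (inj₁ q)))
      (<-respˡ-≈ (*-comm _ _) (<-respʳ-≈ (*-comm _ _) (*-monoˡ-< (0<x^n n (≤-<-trans p q)) q)))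

    ^-cancelˡ-≤ : ∀ {x y} n → 0# ≤ y → x ^ suc n ≤ y ^ suc n → x ≤ y
    ^-cancelˡ-≤ {x} {y} n p q with ≤∨> x y
    ... | inj₁ r = r
    ... | inj₂ r = ⊥-elim (<⇒≱ (^-monoˡ-< n p r) q)

  -- Division, absolute values and integers among the reals.

  module RealField where

    open OrderedField public
    open Analysis em ℛ public
      hiding (_≈_; _<_; _≤_; _+_; _*_; _-_; -_; 0#; 1#; _^_)

    by-contradiction : {P : Set} → ¬ ¬ P → P
    by-contradiction {P} p with em {P}
    ... | yes q = q
    ... | no q  = ⊥-elim (p q)

    the-satisfies : ∀ {A : Set} (d : A) (P : A → Set) → ∃ P → P (the d P)
    the-satisfies d P p with em {∃ P}
    ... | yes (_ , q) = q
    ... | no q        = ⊥-elim (q p)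

    *-inverseʳ : ∀ {x} → ¬ (x ≈ 0#) → x * x ⁻¹ ≈ 1#
    *-inverseʳ {x} p = the-satisfies 0# (λ y → x * y ≈ 1#) (inverse x p)

    0<x⇒x≉0 : ∀ {x} → 0# < x → ¬ (x ≈ 0#)
    0<x⇒x≉0 p q = <⇒≉ p (sym q)

    x/x≈1 : ∀ {x} → 0# < x → x * x ⁻¹ ≈ 1#
    x/x≈1 p = *-inverseʳ (0<x⇒x≉0 p)

    *-cancelˡ : ∀ {x y z} → ¬ (x ≈ 0#) → x * y ≈ x * z → y ≈ z
    *-cancelˡ {x} {y} {z} p q = begin
      y                ≈⟨ lem y ⟨
      x ⁻¹ * (x * y)   ≈⟨ *-congˡ q ⟩
      x ⁻¹ * (x * z)   ≈⟨ lem z ⟩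
      z                ∎
      where
      open Relation.Binary.Reasoning.Setoid setoid
      lem : ∀ y → x ⁻¹ * (x * y) ≈ y
      lem y = trans (sym (*-assoc _ _ _)) (trans (*-congʳ (trans (*-comm _ _) (*-inverseʳ p))) (*-identityˡ y))

    ⁻¹-unique : ∀ {x y} → ¬ (x ≈ 0#) → x * y ≈ 1# → y ≈ x ⁻¹
    ⁻¹-unique p q = *-cancelˡ p (trans q (sym (*-inverseʳ p)))

    ⁻¹-cong : ∀ {x y} → ¬ (x ≈ 0#) → x ≈ y → x ⁻¹ ≈ y ⁻¹
    ⁻¹-cong p q = ⁻¹-unique (λ r → p (trans q r)) (trans (*-congʳ (sym q)) (*-inverseʳ p))

    0<x⁻¹ : ∀ {x} → 0# < x → 0# < x ⁻¹
    0<x⁻¹ {x} p = *-cancelˡ-< (inj₁ p) (<-respˡ-≈ (sym (zeroʳ x)) (<-respʳ-≈ (sym (x/x≈1 p)) 0<1))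

    *-/-cancel : ∀ {x} y → 0# < x → x * (y / x) ≈ y
    *-/-cancel {x} y p = trans (solve 3 (λ x y z → x :* (y :* z) := y :* (x :* z)) refl x y (x ⁻¹))
      (trans (*-congˡ (x/x≈1 p)) (*-identityʳ y))

    0<x/y : ∀ {x y} → 0# < x → 0# < y → 0# < x / y
    0<x/y p q = *-pos p (0<x⁻¹ q)

    x≤y*z⇒x/y≤z : ∀ {x y z} → 0# < y → x ≤ y * z → x / y ≤ z
    x≤y*z⇒x/y≤z {x} {y} {z} p q = *-cancelˡ-≤ p (≤-respˡ (sym (*-/-cancel x p)) q)

    half : ℝ → ℝ
    half x = x / (1# + 1#)

    half+half : ∀ x → half x + half x ≈ x
    half+half x = trans (solve 2 (λ x h → x :* h :+ x :* h := x :* (𝟚 :* h)) refl x ((1# + 1#) ⁻¹))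
      (trans (*-congˡ (x/x≈1 0<2)) (*-identityʳ x))

    0<half : ∀ {x} → 0# < x → 0# < half x
    0<half p = 0<x/y p 0<2

    between : ∀ {x y} → x < y → ∃ λ z → x < z × z < y
    between {x} {y} p = half (x + y) ,
      *-cancelˡ-< (inj₁ 0<2) (<-by (x<y⇒0<y-x p) (trans (solve 2 (λ h x → 𝟚 :* h :- 𝟚 :* x := (h :+ h) :- (x :+ x)) refl (half (x + y)) x)
        (trans (+-congʳ (half+half (x + y))) (solve 2 (λ x y → (x :+ y) :- (x :+ x) := y :- x) refl x y)))) ,
      *-cancelˡ-< (inj₁ 0<2) (<-by (x<y⇒0<y-x p) (trans (solve 2 (λ h y → 𝟚 :* y :- 𝟚 :* h := (y :+ y) :- (h :+ h)) refl (half (x + y)) y)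
        (trans (+-congˡ (-‿cong (half+half (x + y)))) (solve 2 (λ x y → (y :+ y) :- (x :+ y) := y :- x) refl x y))))

    max-≤ : ∀ {x y z} → x ≤ z → y ≤ z → max x y ≤ z
    max-≤ {x} {y} p q with em {x < y}
    ... | yes _ = q
    ... | no  _ = p

    x≤max : ∀ x y → x ≤ max x y
    x≤max x y with em {x < y}
    ... | yes p = inj₁ p
    ... | no  _ = ≤-refl

    y≤max : ∀ x y → y ≤ max x y
    y≤max x y with em {x < y}
    ... | yes _ = ≤-refl
    ... | no  p = ≮⇒≥ p

    ∣x∣≤ : ∀ {x y} → x ≤ y → - x ≤ y → ∣ x ∣ ≤ y
    ∣x∣≤ = max-≤

    x≤∣x∣ : ∀ x → x ≤ ∣ x ∣
    x≤∣x∣ x = x≤max x (- x)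

    -x≤∣x∣ : ∀ x → - x ≤ ∣ x ∣
    -x≤∣x∣ x = y≤max x (- x)

    ∣x∣< : ∀ {x y} → x < y → - x < y → ∣ x ∣ < y
    ∣x∣< {x} {y} p q with em {x < - x}
    ... | yes _ = q
    ... | no  _ = p

    0≤∣x∣ : ∀ x → 0# ≤ ∣ x ∣
    0≤∣x∣ x with ≤∨> 0# x
    ... | inj₁ p = ≤-trans p (x≤∣x∣ x)
    ... | inj₂ p = ≤-trans (inj₁ (0<-x p)) (-x≤∣x∣ x)

    0≤x⇒∣x∣≈x : ∀ {x} → 0# ≤ x → ∣ x ∣ ≈ x
    0≤x⇒∣x∣≈x {x} p = ≤-antisym (∣x∣≤ ≤-refl (≤-by (0≤x+y p p) (solve 1 (λ x → x :- :- x := x :+ x) refl x))) (x≤∣x∣ x)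

    ∣∣-cong : ∀ {x y} → x ≈ y → ∣ x ∣ ≈ ∣ y ∣
    ∣∣-cong p = ≤-antisym (h p) (h (sym p))
      where
      h : ∀ {x y} → x ≈ y → ∣ x ∣ ≤ ∣ y ∣
      h {x} {y} p = ∣x∣≤ (≤-respˡ (sym p) (x≤∣x∣ y)) (≤-respˡ (-‿cong (sym p)) (-x≤∣x∣ y))

    ∣-x∣≈∣x∣ : ∀ x → ∣ - x ∣ ≈ ∣ x ∣
    ∣-x∣≈∣x∣ x = ≤-antisym (h x) (≤-respˡ (∣∣-cong (solve 1 (λ x → :- :- x := x) refl x)) (h (- x)))
      where
      h : ∀ x → ∣ - x ∣ ≤ ∣ x ∣
      h x = ∣x∣≤ (-x≤∣x∣ x) (≤-respˡ (solve 1 (λ x → x := :- :- x) refl x) (x≤∣x∣ x))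

    ∣x-y∣≈∣y-x∣ : ∀ x y → ∣ x - y ∣ ≈ ∣ y - x ∣
    ∣x-y∣≈∣y-x∣ x y = trans (∣∣-cong (solve 2 (λ x y → x :- y := :- (y :- x)) refl x y)) (∣-x∣≈∣x∣ _)

    ∣x+y∣≤∣x∣+∣y∣ : ∀ x y → ∣ x + y ∣ ≤ ∣ x ∣ + ∣ y ∣
    ∣x+y∣≤∣x∣+∣y∣ x y = ∣x∣≤ (+-mono-≤ (x≤∣x∣ x) (x≤∣x∣ y))
      (≤-respˡ (solve 2 (λ x y → :- x :+ :- y := :- (x :+ y)) refl x y) (+-mono-≤ (-x≤∣x∣ x) (-x≤∣x∣ y)))

    ∣x-z∣≤ : ∀ x y z → ∣ x - z ∣ ≤ ∣ x - y ∣ + ∣ y - z ∣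
    ∣x-z∣≤ x y z = ≤-respˡ (∣∣-cong (solve 3 (λ x y z → (x :- y) :+ (y :- z) := x :- z) refl x y z))
      (∣x+y∣≤∣x∣+∣y∣ (x - y) (y - z))

    ∣x∣-cases : ∀ x → (0# ≤ x × ∣ x ∣ ≈ x) ⊎ (0# ≤ - x × ∣ x ∣ ≈ - x)
    ∣x∣-cases x with ≤∨> 0# x
    ... | inj₁ p = inj₁ (p , 0≤x⇒∣x∣≈x p)
    ... | inj₂ p = inj₂ (inj₁ (0<-x p) , trans (sym (∣-x∣≈∣x∣ x)) (0≤x⇒∣x∣≈x (inj₁ (0<-x p))))

    ∣x*y∣≈∣x∣*∣y∣ : ∀ x y → ∣ x * y ∣ ≈ ∣ x ∣ * ∣ y ∣
    ∣x*y∣≈∣x∣*∣y∣ x y with ∣x∣-cases x | ∣x∣-cases y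
    ... | inj₁ (p , p′) | inj₁ (q , q′) = trans (0≤x⇒∣x∣≈x (0≤x*y p q)) (sym (*-cong p′ q′))
    ... | inj₁ (p , p′) | inj₂ (q , q′) = trans (trans (sym (∣-x∣≈∣x∣ _)) (trans (∣∣-cong (solve 2 (λ x y → :- (x :* y) := x :* :- y) refl x y)) (0≤x⇒∣x∣≈x (0≤x*y p q)))) (sym (*-cong p′ q′))
    ... | inj₂ (p , p′) | inj₁ (q , q′) = trans (trans (sym (∣-x∣≈∣x∣ _)) (trans (∣∣-cong (solve 2 (λ x y → :- (x :* y) := :- x :* y) refl x y)) (0≤x⇒∣x∣≈x (0≤x*y p q)))) (sym (*-cong p′ q′))
    ... | inj₂ (p , p′) | inj₂ (q , q′) = trans (trans (∣∣-cong (solve 2 (λ x y → x :* y := :- x :* :- y) refl x y)) (0≤x⇒∣x∣≈x (0≤x*y p q))) (sym (*-cong p′ q′))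

    ∣x∣≈0⇒x≈0 : ∀ {x} → ∣ x ∣ ≤ 0# → x ≈ 0#
    ∣x∣≈0⇒x≈0 {x} p = ≤-antisym (≤-trans (x≤∣x∣ x) p)
      (≤-by (x≤y⇒0≤y-x (≤-trans (-x≤∣x∣ x) p)) (solve 1 (λ x → x :- 𝟘 := 𝟘 :- :- x) refl x))

    ∣0∣≈0 : ∣ 0# ∣ ≈ 0#
    ∣0∣≈0 = 0≤x⇒∣x∣≈x ≤-refl

    ≈0⇒∣x∣≈0 : ∀ {x} → x ≈ 0# → ∣ x ∣ ≈ 0#
    ≈0⇒∣x∣≈0 p = trans (∣∣-cong p) ∣0∣≈0

    ∣x^n∣≈∣x∣^n : ∀ x n → ∣ x ^ n ∣ ≈ ∣ x ∣ ^ n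
    ∣x^n∣≈∣x∣^n x zero    = 0≤x⇒∣x∣≈x 0≤1
    ∣x^n∣≈∣x∣^n x (suc n) = trans (∣x*y∣≈∣x∣*∣y∣ x (x ^ n)) (*-congˡ (∣x^n∣≈∣x∣^n x n))

    open Algebra.Properties.Semiring.Mult semiring using (×1-homo-*; ×-homo-+)

    fromℕ-+ : ∀ m n → fromℕ (m ℕ.+ n) ≈ fromℕ m + fromℕ n
    fromℕ-+ = ×-homo-+ 1#

    fromℕ-* : ∀ m n → fromℕ (m ℕ.* n) ≈ fromℕ m * fromℕ n
    fromℕ-* = ×1-homo-*

    fromℕ-1 : fromℕ 1 ≈ 1#
    fromℕ-1 = +-identityʳ 1#

    fromℕ-^ : ∀ m n → fromℕ (m ℕ.^ n) ≈ fromℕ m ^ n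
    fromℕ-^ m zero    = fromℕ-1
    fromℕ-^ m (suc n) = trans (fromℕ-* m (m ℕ.^ n)) (*-congˡ (fromℕ-^ m n))

    0≤fromℕ : ∀ n → 0# ≤ fromℕ n
    0≤fromℕ zero    = ≤-refl
    0≤fromℕ (suc n) = 0≤x+y 0≤1 (0≤fromℕ n)

    0<fromℕ-suc : ∀ n → 0# < fromℕ (suc n)
    0<fromℕ-suc n = 0<x+y′ 0<1 (0≤fromℕ n)

    0<fromℕ : ∀ {n} → 0 ℕ.< n → 0# < fromℕ n
    0<fromℕ {suc n} _ = 0<fromℕ-suc n

    fromℕ-mono-≤ : ∀ {m n} → m ℕ.≤ n → fromℕ m ≤ fromℕ n
    fromℕ-mono-≤ {n = n} z≤n = 0≤fromℕ n
    fromℕ-mono-≤ (s≤s p)     = +-monoʳ-≤ 1# (fromℕ-mono-≤ p)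

    fromℕ-mono-< : ∀ {m n} → m ℕ.< n → fromℕ m < fromℕ n
    fromℕ-mono-< {m} p = <-≤-trans (<-respʳ-≈ (+-comm _ _) (x<x+y 0<1)) (fromℕ-mono-≤ p)

    fromℕ-cancel-≤ : ∀ {m n} → fromℕ m ≤ fromℕ n → m ℕ.≤ n
    fromℕ-cancel-≤ {m} {n} p with m ℕ.≤? n
    ... | yes q = q
    ... | no q  = ⊥-elim (<⇒≱ (fromℕ-mono-< (ℕ.≰⇒> q)) p)

    fromℕ-cancel-< : ∀ {m n} → fromℕ m < fromℕ n → m ℕ.< n
    fromℕ-cancel-< {m} {n} p with m ℕ.<? n
    ... | yes q = q
    ... | no q  = ⊥-elim (<⇒≱ p (fromℕ-mono-≤ (ℕ.≮⇒≥ q)))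

    1≤fromℕ : ∀ {n} → 1 ℕ.≤ n → 1# ≤ fromℕ n
    1≤fromℕ p = ≤-respˡ fromℕ-1 (fromℕ-mono-≤ p)

    private
      ×≈num : ∀ n → fromℕ n ≈ num n
      ×≈num n = TCO.×ᵤ≈× n 1#
        where import Algebra.Properties.Monoid.Mult.TCOptimised +-monoid as TCO

    fromℤ≈int : ∀ i → fromℤ i ≈ int i
    fromℤ≈int (+ n)    = ×≈num n
    fromℤ≈int -[1+ n ] = -‿cong (×≈num (suc n))

    fromℤ-+ : ∀ i j → fromℤ (i ℤ.+ j) ≈ fromℤ i + fromℤ j
    fromℤ-+ i j = trans (fromℤ≈int (i ℤ.+ j)) (trans (int-+ i j) (sym (+-cong (fromℤ≈int i) (fromℤ≈int j))))

    fromℤ-* : ∀ i j → fromℤ (i ℤ.* j) ≈ fromℤ i * fromℤ j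
    fromℤ-* i j = trans (fromℤ≈int (i ℤ.* j)) (trans (int-* i j) (sym (*-cong (fromℤ≈int i) (fromℤ≈int j))))

    fromℤ-neg : ∀ i → fromℤ (ℤ.- i) ≈ - fromℤ i
    fromℤ-neg i = trans (fromℤ≈int (ℤ.- i)) (trans (int-neg i) (-‿cong (sym (fromℤ≈int i))))

    ∣fromℤ∣ : ∀ i → ∣ fromℤ i ∣ ≈ fromℕ ℤ.∣ i ∣
    ∣fromℤ∣ (+ n)    = 0≤x⇒∣x∣≈x (0≤fromℕ n)
    ∣fromℤ∣ -[1+ n ] = trans (∣-x∣≈∣x∣ _) (0≤x⇒∣x∣≈x (0≤fromℕ (suc n)))

    ∣fromℤ∣<1⇒≡0 : ∀ i → ∣ fromℤ i ∣ < 1# → i ≡ + 0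
    ∣fromℤ∣<1⇒≡0 i p = ℤ.∣i∣≡0⇒i≡0 (ℕ.n<1⇒n≡0 (fromℕ-cancel-< (<-respˡ-≈ (∣fromℤ∣ i) (<-respʳ-≈ (sym fromℕ-1) p))))

    fromℤ≈0⇒≡0 : ∀ i → fromℤ i ≈ 0# → i ≡ + 0
    fromℤ≈0⇒≡0 i p = ∣fromℤ∣<1⇒≡0 i (<-respˡ-≈ (sym (≈0⇒∣x∣≈0 p)) 0<1)

    abstract
      -- If x bounded all natural numbers, their supremum s would satisfy s ≤ s - 1, because n + 1 ≤
      -- s for every n.
      archimedean : ∀ x → ∃ λ n → x < fromℕ n
      archimedean x = by-contradiction λ p →
        let bound : ∀ y → (∃ λ n → y ≈ fromℕ n) → y ≤ x
            bound y (n , q) = ≤-respˡ (sym q) (≮⇒≥ λ r → p (n , r))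
            s , ub , lub = supremum (λ y → ∃ λ n → y ≈ fromℕ n) (0# , 0 , refl) (x , bound)
            s≤s-1 : s ≤ s - 1#
            s≤s-1 = lub (s - 1#) λ { y (n , q) → ≤-by (x≤y⇒0≤y-x (ub (fromℕ (suc n)) (suc n , refl)))
                      (trans (+-congˡ (-‿cong q))
                        (solve 2 (λ s n → (s :- 𝟙) :- n := s :- (𝟙 :+ n)) refl s (fromℕ n))) }
        in <⇒≱ (<-by 0<1 (solve 1 (λ s → s :- (s :- 𝟙) := 𝟙) refl s)) s≤s-1

      0≤x⇒x≤fromℕ : ∀ x → ∃ λ n → x ≤ fromℕ n × 1 ℕ.≤ n
      0≤x⇒x≤fromℕ x = let n , p = archimedean x in
        suc n , ≤-trans (inj₁ p) (fromℕ-mono-≤ (ℕ.n≤1+n n)) , s≤s z≤n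

    bernoulli : ∀ {x} n → 0# ≤ x → 1# + fromℕ n * x ≤ (1# + x) ^ n
    bernoulli {x} zero p = ≤-reflexive (solve 1 (λ x → 𝟙 :+ 𝟘 :* x := 𝟙) refl x)
    bernoulli {x} (suc n) p = ≤-trans
      (≤-by (0≤x*y (0≤fromℕ n) (0≤x*y p p))
         (solve 2 (λ x n → (𝟙 :+ x) :* (𝟙 :+ n :* x) :- (𝟙 :+ (𝟙 :+ n) :* x) := n :* (x :* x)) refl x (fromℕ n)))
      (*-monoˡ-≤ (0≤x+y 0≤1 p) (bernoulli n p))

    ^-unbounded : ∀ {x} → 1# < x → ∀ M → ∃ λ n → M < x ^ n
    ^-unbounded {x} p M =
      let d = x - 1#
          0<d = x<y⇒0<y-x p
          n , q = archimedean (M / d)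
      in n , <-≤-trans
          (<-≤-trans (<-respˡ-≈ (*-/-cancel M 0<d) (*-monoˡ-< 0<d q))
            (≤-by 0≤1 (solve 2 (λ d n → (𝟙 :+ n :* d) :- d :* n := 𝟙) refl d (fromℕ n))))
          (≤-respʳ (^-congˡ n (solve 1 (λ x → 𝟙 :+ (x :- 𝟙) := x) refl x)) (bernoulli n (inj₁ 0<d)))

  -- Limits, absolutely convergent series and Cauchy products.

  module Series where

    open RealField

    ∑ : (ℕ → ℝ) → ℕ → ℝ
    ∑ f zero    = 0#
    ∑ f (suc n) = ∑ f n + f n

    ∑-cong : ∀ {f g} n → (∀ i → i ℕ.< n → f i ≈ g i) → ∑ f n ≈ ∑ g n
    ∑-cong zero    p = refl
    ∑-cong (suc n) p = +-cong (∑-cong n λ i q → p i (ℕ.m≤n⇒m≤1+n q)) (p n ℕ.≤-refl)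

    ∑-mono : ∀ {f g} n → (∀ i → i ℕ.< n → f i ≤ g i) → ∑ f n ≤ ∑ g n
    ∑-mono zero    p = ≤-refl
    ∑-mono (suc n) p = +-mono-≤ (∑-mono n λ i q → p i (ℕ.m≤n⇒m≤1+n q)) (p n ℕ.≤-refl)

    ∑-+ : ∀ f g n → ∑ (λ i → f i + g i) n ≈ ∑ f n + ∑ g n
    ∑-+ f g zero    = sym (+-identityˡ 0#)
    ∑-+ f g (suc n) = trans (+-congʳ (∑-+ f g n))
      (solve 4 (λ a b c d → (a :+ b) :+ (c :+ d) := (a :+ c) :+ (b :+ d)) refl (∑ f n) (∑ g n) (f n) (g n))

    ∑-*ˡ : ∀ c f n → ∑ (λ i → c * f i) n ≈ c * ∑ f n
    ∑-*ˡ c f zero    = sym (zeroʳ c)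
    ∑-*ˡ c f (suc n) = trans (+-congʳ (∑-*ˡ c f n)) (sym (distribˡ c _ _))

    ∑-*ʳ : ∀ c f n → ∑ (λ i → f i * c) n ≈ ∑ f n * c
    ∑-*ʳ c f zero    = sym (zeroˡ c)
    ∑-*ʳ c f (suc n) = trans (+-congʳ (∑-*ʳ c f n)) (sym (distribʳ c _ _))

    ∑-0 : ∀ n → ∑ (λ _ → 0#) n ≈ 0#
    ∑-0 zero    = refl
    ∑-0 (suc n) = trans (+-identityʳ _) (∑-0 n)

    ∑-const : ∀ c n → ∑ (λ _ → c) n ≈ fromℕ n * c
    ∑-const c zero    = sym (zeroˡ c)
    ∑-const c (suc n) = trans (+-congʳ (∑-const c n)) (solve 2 (λ c n → n :* c :+ c := (𝟙 :+ n) :* c) refl c (fromℕ n))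

    ∑-head : ∀ f n → ∑ f (suc n) ≈ f 0 + ∑ (λ i → f (suc i)) n
    ∑-head f zero    = +-comm _ _
    ∑-head f (suc n) = trans (+-congʳ (∑-head f n)) (+-assoc _ _ _)

    ∑-nonneg : ∀ {f} n → (∀ i → 0# ≤ f i) → 0# ≤ ∑ f n
    ∑-nonneg zero    p = ≤-refl
    ∑-nonneg (suc n) p = 0≤x+y (∑-nonneg n p) (p n)

    ∑-monoʳ : ∀ {f m n} → (∀ i → 0# ≤ f i) → m ℕ.≤ n → ∑ f m ≤ ∑ f n
    ∑-monoʳ {f} {m} {n} p q = ≡.subst (λ k → ∑ f m ≤ ∑ f k) (ℕ.m∸n+n≡m q) (h (n ℕ.∸ m))
      where
      h : ∀ k → ∑ f m ≤ ∑ f (k ℕ.+ m)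
      h zero    = ≤-refl
      h (suc k) = ≤-trans (h k) (x≤x+y (p (k ℕ.+ m)))

    ∣∑∣≤∑∣∣ : ∀ f n → ∣ ∑ f n ∣ ≤ ∑ (λ i → ∣ f i ∣) n
    ∣∑∣≤∑∣∣ f zero    = ≤-reflexive ∣0∣≈0
    ∣∑∣≤∑∣∣ f (suc n) = ≤-trans (∣x+y∣≤∣x∣+∣y∣ _ _) (+-monoˡ-≤ _ (∣∑∣≤∑∣∣ f n))

    sum≈∑ : ∀ f n → sum {n} (λ i → f (toℕ i)) ≈ ∑ f n
    sum≈∑ f zero    = refl
    sum≈∑ f (suc n) = trans (+-congˡ (sum≈∑ (λ i → f (suc i)) n)) (sym (∑-head f n))

    ⟶-cong : ∀ {s t l m} → (∀ n → s n ≈ t n) → l ≈ m → s ⟶ l → t ⟶ m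
    ⟶-cong p q r ε 0<ε = let N , h = r ε 0<ε in
      N , λ n N≤n → <-respˡ-≈ (∣∣-cong (+-cong (p n) (-‿cong q))) (h n N≤n)

    ⟶-unique : ∀ {s l m} → s ⟶ l → s ⟶ m → l ≈ m
    ⟶-unique {s} {l} {m} p q with ≤∨> ∣ l - m ∣ 0#
    ... | inj₁ r = x-y≈0⇒x≈y (∣x∣≈0⇒x≈0 r)
    ... | inj₂ r =
      let ε = half ∣ l - m ∣
          N , h = p ε (0<half r)
          N′ , h′ = q ε (0<half r)
          n = N ℕ.⊔ N′
      in ⊥-elim (<⇒≱ (+-mono-<-≤ (<-respˡ-≈ (∣x-y∣≈∣y-x∣ _ _) (h n (ℕ.m≤m⊔n N N′))) (inj₁ (h′ n (ℕ.m≤n⊔m N N′))))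
           (≤-respˡ (sym (half+half _)) (∣x-z∣≤ l (s n) m)))

    ⟶-const : ∀ c → (λ _ → c) ⟶ c
    ⟶-const c ε 0<ε = 0 , λ n _ → <-respˡ-≈ (sym (≈0⇒∣x∣≈0 (-‿inverseʳ c))) 0<ε

    ⟶-+ : ∀ {s t l m} → s ⟶ l → t ⟶ m → (λ n → s n + t n) ⟶ (l + m)
    ⟶-+ {s} {t} {l} {m} p q ε 0<ε =
      let N , h = p (half ε) (0<half 0<ε)
          N′ , h′ = q (half ε) (0<half 0<ε)
      in N ℕ.⊔ N′ , λ n r → ≤-<-trans
        (≤-respˡ (∣∣-cong (solve 4 (λ s t l m → (s :- l) :+ (t :- m) := (s :+ t) :- (l :+ m)) refl (s n) (t n) l m))
          (∣x+y∣≤∣x∣+∣y∣ (s n - l) (t n - m)))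
        (<-respʳ-≈ (half+half ε) (+-mono-<-≤ (h n (ℕ.m⊔n≤o⇒m≤o N N′ r)) (inj₁ (h′ n (ℕ.m⊔n≤o⇒n≤o N N′ r)))))

    ⟶-*ˡ : ∀ {s l} c → s ⟶ l → (λ n → c * s n) ⟶ (c * l)
    ⟶-*ˡ {s} {l} c p ε 0<ε =
      let d = 1# + ∣ c ∣
          0<d = 0<x+y′ 0<1 (0≤∣x∣ c)
          N , h = p (ε / d) (0<x/y 0<ε 0<d)
      in N , λ n q → ≤-<-trans
        (≤-respˡ (sym (trans (∣∣-cong (solve 3 (λ c s l → c :* s :- c :* l := c :* (s :- l)) refl c (s n) l)) (∣x*y∣≈∣x∣*∣y∣ _ _)))
          (*-monoʳ-≤ (0≤∣x∣ _) (y≤x+y 0≤1)))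
        (<-respʳ-≈ (*-/-cancel ε 0<d) (*-monoˡ-< 0<d (h n q)))

    ⟶-∣∣≤ : ∀ {s t} → (∀ n → ∣ s n ∣ ≤ t n) → t ⟶ 0# → s ⟶ 0#
    ⟶-∣∣≤ {s} {t} p q ε 0<ε = let N , h = q ε 0<ε in N , λ n r → ≤-<-trans
      (≤-trans (≤-respˡ (∣∣-cong (solve 1 (λ s → s := s :- 𝟘) refl (s n))) (p n))
        (≤-respˡ (solve 1 (λ s → s :- 𝟘 := s) refl (t n)) (x≤∣x∣ _))) (h n r)

    -- Expanding (s - l)(t - m) reduces the claim to a product of null sequences; there it is enough
    -- to keep the second factor below 1.
    ⟶-* : ∀ {s t l m} → s ⟶ l → t ⟶ m → (λ n → s n * t n) ⟶ (l * m)
    ⟶-* {s} {t} {l} {m} p q = ⟶-cong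
        (λ n → solve 4 (λ s t l m → (s :- l) :* (t :- m) :+ (l :* t :+ m :* s :- l :* m) := s :* t) refl (s n) (t n) l m)
        (solve 2 (λ l m → 𝟘 :+ (l :* m :+ m :* l :- l :* m) := l :* m) refl l m)
        (⟶-+ prod (⟶-+ (⟶-+ (⟶-*ˡ l q) (⟶-*ˡ m p)) (⟶-const (- (l * m)))))
      where
      prod : (λ n → (s n - l) * (t n - m)) ⟶ 0#
      prod ε 0<ε =
        let N , h = p ε 0<ε
            N′ , h′ = q 1# 0<1
        in N ℕ.⊔ N′ , λ n r → <-respˡ-≈ (sym (trans (∣∣-cong (solve 1 (λ x → x :- 𝟘 := x) refl _)) (∣x*y∣≈∣x∣*∣y∣ _ _)))
             (≤-<-trans (*-monoˡ-≤ (0≤∣x∣ _) (inj₁ (h′ n (ℕ.m⊔n≤o⇒n≤o N N′ r))))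
               (<-respˡ-≈ (sym (*-identityʳ _)) (h n (ℕ.m⊔n≤o⇒m≤o N N′ r))))

    ⟶-≤ : ∀ {s l b} N → s ⟶ l → (∀ n → N ℕ.≤ n → s n ≤ b) → l ≤ b
    ⟶-≤ {s} {l} {b} N p q with ≤∨> l b
    ... | inj₁ r = r
    ... | inj₂ r =
      let N′ , h = p (l - b) (x<y⇒0<y-x r)
          n = N ℕ.⊔ N′
      in ⊥-elim (<⇒≱ (≤-<-trans (-x≤∣x∣ _) (h n (ℕ.m≤n⊔m N N′)))
            (≤-by (x≤y⇒0≤y-x (q n (ℕ.m≤m⊔n N N′))) (solve 3 (λ s l b → :- (s :- l) :- (l :- b) := b :- s) refl (s n) l b)))

    ⟶-≥ : ∀ {s l b} N → s ⟶ l → (∀ n → N ℕ.≤ n → b ≤ s n) → b ≤ l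
    ⟶-≥ {s} {l} {b} N p q = ≤-by (x≤y⇒0≤y-x
       (⟶-≤ {b = - b} N (⟶-cong (λ n → solve 1 (λ x → :- 𝟙 :* x := :- x) refl (s n)) refl (⟶-*ˡ (- 1#) p)) λ n r → neg-mono-≤ (q n r)))
       (solve 2 (λ l b → l :- b := :- b :- :- 𝟙 :* l) refl l b)

    ⟶-shift : ∀ {s l} (f : ℕ → ℕ) → (∀ n → n ℕ.≤ f n) → s ⟶ l → (λ n → s (f n)) ⟶ l
    ⟶-shift f p q ε 0<ε = let N , h = q ε 0<ε in N , λ n r → h (f n) (ℕ.≤-trans r (p n))

    monotone-converges : ∀ {s B} → (∀ {m n} → m ℕ.≤ n → s m ≤ s n) → (∀ n → s n ≤ B) → ∃ λ l → s ⟶ l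
    monotone-converges {s} {B} mono bd =
      let l , ub , lub = supremum (λ x → ∃ λ n → x ≈ s n) (s 0 , 0 , refl) (B , λ { x (n , p) → ≤-respˡ (sym p) (bd n) })
      in l , λ ε 0<ε → by-contradiction λ p →
        let far : ∀ x → (∃ λ n → x ≈ s n) → x ≤ l - ε
            far x (n , q) = ≮⇒≥ λ r → p (n , λ k n≤k → ∣x∣<
              (≤-<-trans (≤-respʳ (-‿inverseʳ l) (+-monoˡ-≤ (- l) (ub (s k) (k , refl)))) 0<ε)
              (<-by (x<y⇒0<y-x (<-≤-trans r (≤-respˡ (sym q) (mono n≤k))))
                 (solve 3 (λ ε s l → ε :- :- (s :- l) := s :- (l :- ε)) refl ε (s k) l)))
        in <⇒≱ 0<ε (≤-by (x≤y⇒0≤y-x (lub (l - ε) far)) (solve 2 (λ ε l → 𝟘 :- ε := (l :- ε) :- l) refl ε l))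

    HasSum : (ℕ → ℝ) → ℝ → Set
    HasSum f l = ∑ f ⟶ l

    ∑∞-unique : ∀ {f l} → HasSum f l → ∑∞ f ≈ l
    ∑∞-unique {f} {l} p = ⟶-unique
      (⟶-cong (sum≈∑ f) refl (the-satisfies 0# _ (l , ⟶-cong (λ n → sym (sum≈∑ f n)) refl p))) p

    HasSum-cong : ∀ {f g l m} → (∀ n → f n ≈ g n) → l ≈ m → HasSum f l → HasSum g m
    HasSum-cong p = ⟶-cong λ n → ∑-cong n λ i _ → p i

    HasSum-+ : ∀ {f g l m} → HasSum f l → HasSum g m → HasSum (λ n → f n + g n) (l + m)
    HasSum-+ {f} {g} p q = ⟶-cong (λ n → sym (∑-+ f g n)) refl (⟶-+ p q)

    HasSum-*ˡ : ∀ {f l} c → HasSum f l → HasSum (λ n → c * f n) (c * l)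
    HasSum-*ˡ {f} c p = ⟶-cong (λ n → sym (∑-*ˡ c f n)) refl (⟶-*ˡ c p)

    HasSum-0 : HasSum (λ _ → 0#) 0#
    HasSum-0 = ⟶-cong (λ n → sym (∑-0 n)) refl (⟶-const 0#)

    AbsSummable : (ℕ → ℝ) → Set
    AbsSummable f = ∃ λ B → ∀ n → ∑ (λ i → ∣ f i ∣) n ≤ B

    -- f is the difference of |f| + f and |f|, both nonnegative with bounded partial sums.
    AbsSummable⇒HasSum : ∀ {f} → AbsSummable f → ∃ (HasSum f)
    AbsSummable⇒HasSum {f} (B , p) =
      let l , h = monotone-converges {∑ (λ i → ∣ f i ∣)} (∑-monoʳ λ i → 0≤∣x∣ (f i)) p
          nonneg : ∀ i → 0# ≤ ∣ f i ∣ + f i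
          nonneg i = ≤-by (x≤y⇒0≤y-x (-x≤∣x∣ (f i))) (solve 2 (λ a x → (a :+ x) :- 𝟘 := a :- :- x) refl ∣ f i ∣ (f i))
          m , k = monotone-converges {∑ (λ i → ∣ f i ∣ + f i)} (∑-monoʳ nonneg) λ n →
                    ≤-trans (∑-mono n λ i _ → +-monoʳ-≤ _ (x≤∣x∣ (f i))) (≤-respˡ (sym (∑-+ _ _ n)) (+-mono-≤ (p n) (p n)))
      in m + - 1# * l , HasSum-cong (λ n → solve 2 (λ a x → (a :+ x) :+ :- 𝟙 :* a := x) refl ∣ f n ∣ (f n)) refl
           (HasSum-+ k (HasSum-*ˡ (- 1#) h))

    AbsSummable-≤ : ∀ {f g} → (∀ i → ∣ f i ∣ ≤ g i) → AbsSummable g → AbsSummable f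
    AbsSummable-≤ p (B , q) = B , λ n → ≤-trans (∑-mono n λ i _ → ≤-trans (p i) (x≤∣x∣ _)) (q n)

    infixl 7 _✶_
    _✶_ : (ℕ → ℝ) → (ℕ → ℝ) → ℕ → ℝ
    (a ✶ b) k = ∑ (λ i → a i * b (k ℕ.∸ i)) (suc k)

    -- Both sides add up `a i * b j` over the triangle i + j < n, by diagonals and by rows.
    ∑-✶ : ∀ a b n → ∑ (a ✶ b) n ≈ ∑ (λ i → a i * ∑ b (n ℕ.∸ i)) n
    ∑-✶ a b zero    = refl
    ∑-✶ a b (suc n) = begin
      ∑ (a ✶ b) n + (a ✶ b) n
        ≈⟨ +-congʳ (∑-✶ a b n) ⟩
      ∑ f n + (∑ g n + g n)
        ≈⟨ sym (+-assoc _ _ _) ⟩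
      (∑ f n + ∑ g n) + g n
        ≈⟨ +-cong (sym (∑-+ f g n)) last ⟩
      ∑ (λ i → f i + g i) n + h n
        ≈⟨ +-congʳ (∑-cong n step) ⟩
      ∑ h n + h n ∎
      where
      open Relation.Binary.Reasoning.Setoid setoid
      f g h : ℕ → ℝ
      f i = a i * ∑ b (n ℕ.∸ i)
      g i = a i * b (n ℕ.∸ i)
      h i = a i * ∑ b (suc n ℕ.∸ i)
      step : ∀ i → i ℕ.< n → f i + g i ≈ h i
      step i i<n rewrite ℕ.+-∸-assoc 1 (ℕ.<⇒≤ i<n) = sym (distribˡ _ _ _)
      last : g n ≈ h n
      last rewrite ℕ.+-∸-assoc 1 (ℕ.≤-refl {n}) | ℕ.n∸n≡0 n = *-congˡ (sym (+-identityˡ _))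

    private
      module Product {a b} (sa : AbsSummable a) (sb : AbsSummable b) where

        ā b̄ : ℕ → ℝ
        ā i = ∣ a i ∣
        b̄ i = ∣ b i ∣

        0≤ā✶b̄ : ∀ k → 0# ≤ (ā ✶ b̄) k
        0≤ā✶b̄ k = ∑-nonneg (suc k) λ i → 0≤x*y (0≤∣x∣ _) (0≤∣x∣ _)

        ≤-product : ∀ n → ∑ (ā ✶ b̄) n ≤ ∑ ā n * ∑ b̄ n
        ≤-product n = ≤-respˡ (sym (∑-✶ ā b̄ n)) (≤-respʳ (∑-*ʳ _ ā n)
          (∑-mono n λ i _ → *-monoˡ-≤ (0≤∣x∣ _) (∑-monoʳ (λ j → 0≤∣x∣ (b j)) (ℕ.m∸n≤m n i))))

        -- The square i, j < n lies inside the triangle i + j < 2n, and all terms are nonnegative.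
        product-≤ : ∀ n → ∑ ā n * ∑ b̄ n ≤ ∑ (ā ✶ b̄) (n ℕ.+ n)
        product-≤ n = ≤-respʳ (sym (∑-✶ ā b̄ (n ℕ.+ n))) (≤-respˡ (∑-*ʳ _ ā n)
          (≤-trans
            (∑-mono n λ i i<n → *-monoˡ-≤ (0≤∣x∣ _) (∑-monoʳ (λ j → 0≤∣x∣ (b j))
               (≡.subst (ℕ._≤ n ℕ.+ n ℕ.∸ i) (ℕ.m+n∸n≡m n n) (ℕ.∸-monoʳ-≤ (n ℕ.+ n) (ℕ.<⇒≤ i<n)))))
            (∑-monoʳ (λ i → 0≤x*y (0≤∣x∣ _) (∑-nonneg (n ℕ.+ n ℕ.∸ i) λ j → 0≤∣x∣ (b j))) (ℕ.m≤m+n n n))))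

        0≤B : 0# ≤ proj₁ sb
        0≤B = proj₂ sb 0

        ā✶b̄-bounded : ∀ n → ∑ (ā ✶ b̄) n ≤ proj₁ sa * proj₁ sb
        ā✶b̄-bounded n = ≤-trans (≤-product n)
          (*-mono-≤ (∑-nonneg n λ i → 0≤∣x∣ _) (∑-nonneg n λ i → 0≤∣x∣ _) (proj₂ sa n) (proj₂ sb n))

        gap : ℕ → ℝ
        gap n = ∑ (ā ✶ b̄) (n ℕ.+ n) - ∑ (ā ✶ b̄) n

        gap⟶0 : gap ⟶ 0#
        gap⟶0 = let l , h = monotone-converges (∑-monoʳ 0≤ā✶b̄) ā✶b̄-bounded in
          ⟶-cong (λ n → solve 2 (λ x y → x :+ :- 𝟙 :* y := x :- y) refl _ _) (solve 1 (λ l → l :+ :- 𝟙 :* l := 𝟘) refl l)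
            (⟶-+ (⟶-shift (λ n → n ℕ.+ n) (λ n → ℕ.m≤m+n n n) h) (⟶-*ˡ (- 1#) h))

        diff : (a b : ℕ → ℝ) → ℕ → ℝ
        diff a b n = ∑ (λ i → a i * (∑ b n - ∑ b (n ℕ.∸ i))) n

        diff≈ : ∀ a b n → diff a b n ≈ ∑ a n * ∑ b n - ∑ (a ✶ b) n
        diff≈ a b n = trans (∑-cong n λ i _ → solve 3 (λ a x y → a :* (x :- y) := a :* x :+ :- 𝟙 :* (a :* y)) refl (a i) _ _)
          (trans (∑-+ _ _ n) (+-cong (∑-*ʳ _ a n)
            (trans (∑-*ˡ (- 1#) _ n) (trans (*-congˡ (sym (∑-✶ a b n))) (solve 1 (λ x → :- 𝟙 :* x := :- x) refl _)))))

        tail-≤ : ∀ {m n} → m ℕ.≤ n → ∣ ∑ b n - ∑ b m ∣ ≤ ∑ b̄ n - ∑ b̄ m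
        tail-≤ {m} {n} p = ≡.subst (λ k → ∣ ∑ b k - ∑ b m ∣ ≤ ∑ b̄ k - ∑ b̄ m) (ℕ.m∸n+n≡m p) (h (n ℕ.∸ m))
          where
          h : ∀ k → ∣ ∑ b (k ℕ.+ m) - ∑ b m ∣ ≤ ∑ b̄ (k ℕ.+ m) - ∑ b̄ m
          h zero    = ≤-trans (≤-reflexive (≈0⇒∣x∣≈0 (-‿inverseʳ _))) (≤-reflexive (sym (-‿inverseʳ _)))
          h (suc k) = ≤-trans
            (≤-respˡ (∣∣-cong (solve 3 (λ x y z → (x :- y) :+ z := (x :+ z) :- y) refl _ _ _)) (∣x+y∣≤∣x∣+∣y∣ _ _))
            (≤-respʳ (solve 3 (λ x y z → (x :- y) :+ z := (x :+ z) :- y) refl _ _ _) (+-monoˡ-≤ _ (h k)))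

        -- `diff a b n` is the sum over the part of the square i, j < n outside the triangle i + j <
        -- n. With absolute values it is bounded by the terms of a convergent series with indices
        -- from n to 2n.
        ∣diff∣≤gap : ∀ n → ∣ diff a b n ∣ ≤ gap n
        ∣diff∣≤gap n = ≤-trans
          (≤-trans (∣∑∣≤∑∣∣ _ n) (∑-mono n λ i _ → ≤-respˡ (sym (∣x*y∣≈∣x∣*∣y∣ _ _)) (*-monoˡ-≤ (0≤∣x∣ _) (tail-≤ (ℕ.m∸n≤m n i)))))
          (≤-respˡ (sym (diff≈ ā b̄ n)) (+-monoˡ-≤ _ (product-≤ n)))

        hasSum : ∀ {A B} → HasSum a A → HasSum b B → HasSum (a ✶ b) (A * B)
        hasSum p q = ⟶-cong
          (λ n → trans (+-congˡ (*-congˡ (diff≈ a b n))) (solve 2 (λ x y → x :+ :- 𝟙 :* (x :- y) := y) refl _ _))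
          (solve 1 (λ x → x :+ :- 𝟙 :* 𝟘 := x) refl _)
          (⟶-+ (⟶-* p q) (⟶-*ˡ (- 1#) (⟶-∣∣≤ ∣diff∣≤gap gap⟶0)))

        absSummable : AbsSummable (a ✶ b)
        absSummable = proj₁ sa * proj₁ sb , λ n → ≤-trans
          (∑-mono n λ k _ → ≤-trans (∣∑∣≤∑∣∣ _ (suc k)) (≤-reflexive (∑-cong (suc k) λ i _ → ∣x*y∣≈∣x∣*∣y∣ _ _)))
          (ā✶b̄-bounded n)

    HasSum-✶ : ∀ {a b A B} → AbsSummable a → AbsSummable b → HasSum a A → HasSum b B → HasSum (a ✶ b) (A * B)
    HasSum-✶ sa sb = Product.hasSum sa sb

    AbsSummable-✶ : ∀ {a b} → AbsSummable a → AbsSummable b → AbsSummable (a ✶ b)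
    AbsSummable-✶ = Product.absSummable

    geometric-≤ : ∀ {x} n → 0# ≤ x → ∑ (x ^_) n * (1# - x) ≤ 1#
    geometric-≤ {x} n p = ≤-by (0≤x^n n p) (trans (+-congˡ (-‿cong (eq n)))
        (solve 1 (λ y → 𝟙 :- (𝟙 :- y) := y) refl (x ^ n)))
      where
      eq : ∀ n → ∑ (x ^_) n * (1# - x) ≈ 1# - x ^ n
      eq zero    = solve 1 (λ x → 𝟘 :* (𝟙 :- x) := 𝟙 :- 𝟙) refl x
      eq (suc n) = trans (distribʳ _ _ _) (trans (+-congʳ (eq n))
        (solve 2 (λ x y → (𝟙 :- y) :+ y :* (𝟙 :- x) := 𝟙 :- x :* y) refl x (x ^ n)))

    ∑-geometric-≤ : ∀ {x} n → 0# ≤ x → x < 1# → ∑ (x ^_) n ≤ (1# - x) ⁻¹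
    ∑-geometric-≤ {x} n p q = *-cancelˡ-≤ (x<y⇒0<y-x q)
      (≤-respˡ (*-comm _ _) (≤-respʳ (sym (x/x≈1 (x<y⇒0<y-x q))) (geometric-≤ n p)))

  -- Exponential function and logarithm.

  module Exponential where

    open RealField
    open Series

    private
      term : ℝ → ℕ → ℝ
      term x k = x ^ k / fromℕ (k !)

      0<k! : ∀ k → 0# < fromℕ (k !)
      0<k! k = 0<fromℕ (ℕ.>-nonZero⁻¹ (k !) ⦃ k ℕ.!≢0 ⦄)

      -- Once k exceeds M, each further factor M on the left is met by a larger factor of k!.
      M^k≤M^M*k! : ∀ M k → 1 ℕ.≤ M → M ℕ.^ k ℕ.≤ M ℕ.^ M ℕ.* k !
      M^k≤M^M*k! M k 1≤M with k ℕ.≤? M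
      ... | yes k≤M = ℕ.≤-trans (ℕ.^-monoʳ-≤ M ⦃ ℕ.>-nonZero 1≤M ⦄ k≤M) (ℕ.m≤m*n _ (k !) ⦃ k ℕ.!≢0 ⦄)
      M^k≤M^M*k! M zero    1≤M | no k≰M = ⊥-elim (k≰M z≤n)
      M^k≤M^M*k! M (suc k) 1≤M | no k≰M = ℕ.≤-trans
        (ℕ.*-mono-≤ (ℕ.<⇒≤ (ℕ.≰⇒> k≰M)) (M^k≤M^M*k! M k 1≤M))
        (ℕ.≤-reflexive (swap (suc k) (M ℕ.^ M) (k !)))
        where
        swap : ∀ a b c → a ℕ.* (b ℕ.* c) ≡ b ℕ.* (a ℕ.* c)
        swap = solve-∀

      ½ : ℝ
      ½ = half 1#

      0≤½ : 0# ≤ ½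
      0≤½ = inj₁ (0<half 0<1)

      ½<1 : ½ < 1#
      ½<1 = <-respʳ-≈ (half+half 1#) (x<x+y (0<half 0<1))

      -- (2|x|)^k / k! is bounded, by comparison with M^k / k! for a natural number M ≥ 2|x|.
      term-summable : ∀ x → AbsSummable (term x)
      term-summable x = AbsSummable-≤ {g = λ k → fromℕ (M ℕ.^ M) * ½ ^ k} bound
          (fromℕ (M ℕ.^ M) * (1# - ½) ⁻¹ , λ n → ≤-trans
            (≤-reflexive (trans (∑-cong n λ i _ → 0≤x⇒∣x∣≈x (0≤x*y (0≤fromℕ (M ℕ.^ M)) (0≤x^n i 0≤½))) (∑-*ˡ _ (½ ^_) n)))
            (*-monoˡ-≤ (0≤fromℕ (M ℕ.^ M)) (∑-geometric-≤ n 0≤½ ½<1)))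
        where
        2∣x∣ = (1# + 1#) * ∣ x ∣
        M = proj₁ (0≤x⇒x≤fromℕ 2∣x∣)
        2∣x∣≤M = proj₁ (proj₂ (0≤x⇒x≤fromℕ 2∣x∣))
        1≤M = proj₂ (proj₂ (0≤x⇒x≤fromℕ 2∣x∣))

        bound : ∀ k → ∣ term x k ∣ ≤ fromℕ (M ℕ.^ M) * ½ ^ k
        bound k = begin
          ∣ term x k ∣
            ≈⟨ trans (∣x*y∣≈∣x∣*∣y∣ _ _) (*-cong (∣x^n∣≈∣x∣^n x k) (0≤x⇒∣x∣≈x (inj₁ (0<x⁻¹ (0<k! k))))) ⟩
          ∣ x ∣ ^ k * fromℕ (k !) ⁻¹
            ≤⟨ x≤y*z⇒x/y≤z (0<k! k) power-bound ⟩
          fromℕ (M ℕ.^ M) * ½ ^ k ∎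
          where
          open ≤-Reasoning
          power-bound : ∣ x ∣ ^ k ≤ fromℕ (k !) * (fromℕ (M ℕ.^ M) * ½ ^ k)
          power-bound = begin
            ∣ x ∣ ^ k
              ≈⟨ ^-congˡ k (trans (sym (half+half _)) (solve 2 (λ x h → x :* h :+ x :* h := (𝟚 :* x) :* (𝟙 :* h)) refl ∣ x ∣ _)) ⟩
            (2∣x∣ * ½) ^ k
              ≈⟨ ^-distrib-* _ _ k ⟩
            2∣x∣ ^ k * ½ ^ k
              ≤⟨ *-monoʳ-≤ (0≤x^n k 0≤½) (^-monoˡ-≤ k (0≤x*y (inj₁ 0<2) (0≤∣x∣ x)) 2∣x∣≤M) ⟩
            fromℕ M ^ k * ½ ^ k
              ≈⟨ *-congʳ (fromℕ-^ M k) ⟨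
            fromℕ (M ℕ.^ k) * ½ ^ k
              ≤⟨ *-monoʳ-≤ (0≤x^n k 0≤½) (fromℕ-mono-≤ (M^k≤M^M*k! M k 1≤M)) ⟩
            fromℕ (M ℕ.^ M ℕ.* k !) * ½ ^ k
              ≈⟨ *-congʳ (fromℕ-* (M ℕ.^ M) (k !)) ⟩
            (fromℕ (M ℕ.^ M) * fromℕ (k !)) * ½ ^ k
              ≈⟨ solve 3 (λ a b c → (a :* b) :* c := b :* (a :* c)) refl _ _ _ ⟩
            fromℕ (k !) * (fromℕ (M ℕ.^ M) * ½ ^ k) ∎

      term-suc : ∀ x k → fromℕ (suc k) * term x (suc k) ≈ x * term x k
      term-suc x k = *-cancelˡ (0<x⇒x≉0 (0<k! k)) (begin
        K! * (K * (x ^ suc k / fromℕ (suc k !)))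
          ≈⟨ solve 3 (λ a b c → a :* (b :* c) := (b :* a) :* c) refl K! K _ ⟩
        (K * K!) * (x ^ suc k / fromℕ (suc k !))
          ≈⟨ *-congʳ (fromℕ-* (suc k) (k !)) ⟨
        fromℕ (suc k !) * (x ^ suc k / fromℕ (suc k !))
          ≈⟨ *-/-cancel _ (0<k! (suc k)) ⟩
        x * x ^ k
          ≈⟨ *-congˡ (*-/-cancel _ (0<k! k)) ⟨
        x * (K! * term x k)
          ≈⟨ solve 3 (λ a b c → a :* (b :* c) := b :* (a :* c)) refl x K! _ ⟩
        K! * (x * term x k) ∎)
        where
        open Relation.Binary.Reasoning.Setoid setoid
        K! = fromℕ (k !)
        K = fromℕ (suc k)

      -- Writing k + 1 = i + (k + 1 - i) in each summand and lowering one factor by `term-suc` gives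
      -- (x + y) times the previous coefficient, the product rule in disguise. Thus no binomial
      -- coefficients occur.
      term-✶ : ∀ x y k → (term x ✶ term y) k ≈ term (x + y) k
      term-✶ x y zero = begin
        0# + 1# / fromℕ 1 * (1# / fromℕ 1)  ≈⟨ +-identityˡ _ ⟩
        1# / fromℕ 1 * (1# / fromℕ 1)       ≈⟨ *-congʳ (trans (*-identityˡ _) (sym (⁻¹-unique (0<x⇒x≉0 (0<fromℕ-suc 0)) (trans (*-identityʳ _) fromℕ-1)))) ⟩
        1# * (1# / fromℕ 1)                 ≈⟨ *-identityˡ _ ⟩
        1# / fromℕ 1                        ∎
        where open Relation.Binary.Reasoning.Setoid setoid
      term-✶ x y (suc k) = *-cancelˡ (0<x⇒x≉0 (0<fromℕ-suc k)) (begin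
        K * ∑ (λ i → a i * b (suc k ℕ.∸ i)) (suc (suc k))
          ≈⟨ ∑-*ˡ K _ (suc (suc k)) ⟨
        ∑ (λ i → K * (a i * b (suc k ℕ.∸ i))) (suc (suc k))
          ≈⟨ ∑-cong (suc (suc k)) split ⟩
        ∑ (λ i → f i + g i) (suc (suc k))
          ≈⟨ ∑-+ f g (suc (suc k)) ⟩
        ∑ f (suc (suc k)) + ∑ g (suc (suc k))
          ≈⟨ +-cong part₁ part₂ ⟩
        x * (a ✶ b) k + y * (a ✶ b) k
          ≈⟨ distribʳ _ x y ⟨
        (x + y) * (a ✶ b) k
          ≈⟨ *-congˡ (term-✶ x y k) ⟩
        (x + y) * term (x + y) k
          ≈⟨ term-suc (x + y) k ⟨
        K * term (x + y) (suc k) ∎)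
        where
        open Relation.Binary.Reasoning.Setoid setoid
        K = fromℕ (suc k)
        a = term x
        b = term y
        f g : ℕ → ℝ
        f i = fromℕ i * a i * b (suc k ℕ.∸ i)
        g i = a i * (fromℕ (suc k ℕ.∸ i) * b (suc k ℕ.∸ i))
        split : ∀ i → i ℕ.< suc (suc k) → K * (a i * b (suc k ℕ.∸ i)) ≈ f i + g i
        split i (s≤s i≤) = begin
          K * (a i * b (suc k ℕ.∸ i))
            ≡⟨ ≡.cong (λ n → fromℕ n * (a i * b (suc k ℕ.∸ i))) (≡.sym (ℕ.m+[n∸m]≡n i≤)) ⟩
          fromℕ (i ℕ.+ (suc k ℕ.∸ i)) * (a i * b (suc k ℕ.∸ i))
            ≈⟨ *-congʳ (fromℕ-+ i _) ⟩
          (fromℕ i + fromℕ (suc k ℕ.∸ i)) * (a i * b (suc k ℕ.∸ i))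
            ≈⟨ solve 4 (λ i j a b → (i :+ j) :* (a :* b) := i :* a :* b :+ a :* (j :* b)) refl _ _ _ _ ⟩
          f i + g i ∎
        part₁ : ∑ f (suc (suc k)) ≈ x * (a ✶ b) k
        part₁ = begin
          ∑ f (suc (suc k))
            ≈⟨ ∑-head f (suc k) ⟩
          f 0 + ∑ (λ i → f (suc i)) (suc k)
            ≈⟨ +-cong (solve 2 (λ a b → 𝟘 :* a :* b := 𝟘) refl _ _)
                 (∑-cong (suc k) λ i _ → trans (*-congʳ (term-suc x i)) (*-assoc _ _ _)) ⟩
          0# + ∑ (λ i → x * (a i * b (k ℕ.∸ i))) (suc k)
            ≈⟨ trans (+-identityˡ _) (∑-*ˡ x _ (suc k)) ⟩
          x * (a ✶ b) k ∎
        part₂ : ∑ g (suc (suc k)) ≈ y * (a ✶ b) k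
        part₂ = begin
          ∑ g (suc k) + g (suc k)
            ≈⟨ +-cong (∑-cong (suc k) λ { i (s≤s i≤k) → step i i≤k }) last ⟩
          ∑ (λ i → y * (a i * b (k ℕ.∸ i))) (suc k) + 0#
            ≈⟨ trans (+-identityʳ _) (∑-*ˡ y _ (suc k)) ⟩
          y * (a ✶ b) k ∎
          where
          step : ∀ i → i ℕ.≤ k → g i ≈ y * (a i * b (k ℕ.∸ i))
          step i i≤k rewrite ℕ.+-∸-assoc 1 i≤k = trans (*-congˡ (term-suc y (k ℕ.∸ i)))
            (solve 3 (λ a b c → a :* (b :* c) := b :* (a :* c)) refl _ _ _)
          last : g (suc k) ≈ 0#
          last rewrite ℕ.n∸n≡0 k = solve 2 (λ a b → a :* (𝟘 :* b) := 𝟘) refl _ _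

      exp-HasSum : ∀ x → HasSum (term x) (exp x)
      exp-HasSum x = let l , h = AbsSummable⇒HasSum (term-summable x) in
        ⟶-cong (λ _ → refl) (sym (∑∞-unique h)) h

    exp-+ : ∀ x y → exp (x + y) ≈ exp x * exp y
    exp-+ x y = ⟶-unique (exp-HasSum (x + y))
      (HasSum-cong (term-✶ x y) refl
        (HasSum-✶ (term-summable x) (term-summable y) (exp-HasSum x) (exp-HasSum y)))

    exp-cong : ∀ {x y} → x ≈ y → exp x ≈ exp y
    exp-cong {x} {y} p = ⟶-unique (exp-HasSum x) (HasSum-cong (λ k → *-congʳ (^-congˡ k (sym p))) refl (exp-HasSum y))

    1+x≤exp : ∀ {x} → 0# ≤ x → 1# + x ≤ exp x
    1+x≤exp {x} p = ⟶-≥ 2 (exp-HasSum x) λ n 2≤n → ≤-respˡ two (∑-monoʳ nonneg 2≤n)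
      where
      nonneg : ∀ i → 0# ≤ term x i
      nonneg i = 0≤x*y (0≤x^n i p) (inj₁ (0<x⁻¹ (0<k! i)))
      two : ∑ (term x) 2 ≈ 1# + x
      two = trans (+-congʳ (+-identityˡ _)) (trans
        (+-cong (*-congˡ inv1) (*-congˡ inv1)) (solve 1 (λ x → 𝟙 :* 𝟙 :+ (x :* 𝟙) :* 𝟙 := 𝟙 :+ x) refl x))
        where
        inv1 : fromℕ 1 ⁻¹ ≈ 1#
        inv1 = sym (⁻¹-unique (0<x⇒x≉0 (0<fromℕ-suc 0)) (trans (*-identityʳ _) fromℕ-1))

    exp-0 : exp 0# ≈ 1#
    exp-0 = *-cancelˡ (0<x⇒x≉0 (<-≤-trans 0<1 (≤-respˡ (+-identityʳ 1#) (1+x≤exp ≤-refl))))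
      (trans (sym (exp-+ 0# 0#)) (trans (exp-cong (+-identityʳ 0#)) (sym (*-identityʳ _))))

    exp-neg : ∀ x → exp x * exp (- x) ≈ 1#
    exp-neg x = trans (sym (exp-+ x (- x))) (trans (exp-cong (-‿inverseʳ x)) exp-0)

    -- exp x is the square of exp (x/2), and it is nonzero since it has the inverse exp (-x).
    0<exp : ∀ x → 0# < exp x
    0<exp x with ≤∨> (exp x) 0#
    ... | inj₂ p = p
    ... | inj₁ p = ⊥-elim (0≉1 (trans (sym (exp-neg x)) (trans (*-congʳ exp≈0) (zeroˡ _))))
      where
      exp≈0 : exp x ≈ 0#
      exp≈0 = ≤-antisym p (≤-respʳ (trans (sym (exp-+ (half x) (half x))) (exp-cong (half+half x))) (0≤x² (exp (half x))))

    exp-mono-< : ∀ {x y} → x < y → exp x < exp y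
    exp-mono-< {x} {y} p = <-≤-trans
      (<-by (*-pos (0<exp x) (x<y⇒0<y-x p)) (solve 2 (λ e d → e :* (𝟙 :+ d) :- e := e :* d) refl (exp x) (y - x)))
      (≤-respʳ (trans (sym (exp-+ x (y - x))) (exp-cong (solve 2 (λ x y → x :+ (y :- x) := y) refl x y)))
        (*-monoˡ-≤ (inj₁ (0<exp x)) (1+x≤exp (inj₁ (x<y⇒0<y-x p)))))

    exp-mono-≤ : ∀ {x y} → x ≤ y → exp x ≤ exp y
    exp-mono-≤ (inj₁ p) = inj₁ (exp-mono-< p)
    exp-mono-≤ (inj₂ p) = inj₂ (exp-cong p)

    exp-cancel-≤ : ∀ {x y} → exp x ≤ exp y → x ≤ y
    exp-cancel-≤ {x} {y} p with ≤∨> x y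
    ... | inj₁ q = q
    ... | inj₂ q = ⊥-elim (<⇒≱ (exp-mono-< q) p)

    exp-^ : ∀ n x → exp x ^ n ≈ exp (fromℕ n * x)
    exp-^ zero    x = trans (sym exp-0) (exp-cong (sym (zeroˡ x)))
    exp-^ (suc n) x = trans (*-congˡ (exp-^ n x)) (trans (sym (exp-+ x _))
      (exp-cong (solve 2 (λ x n → x :+ n :* x := (𝟙 :+ n) :* x) refl x (fromℕ n))))

    private
      -- As i! ≥ 1, the exponential series is dominated termwise by the geometric series.
      exp*[1-h]≤1 : ∀ {h} → 0# ≤ h → h < 1# → exp h * (1# - h) ≤ 1#
      exp*[1-h]≤1 {h} p q = ≤-respˡ (*-comm _ _) (≤-respʳ (x/x≈1 (x<y⇒0<y-x q))
        (*-monoˡ-≤ (inj₁ (x<y⇒0<y-x q)) (⟶-≤ 0 (exp-HasSum h) λ n _ →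
          ≤-trans (∑-mono n λ i _ → x≤y*z⇒x/y≤z (0<k! i)
              (≤-respˡ (*-identityˡ _) (*-monoʳ-≤ (0≤x^n i p) (1≤fromℕ (ℕ.>-nonZero⁻¹ (i !) ⦃ i ℕ.!≢0 ⦄)))))
            (∑-geometric-≤ n p q))))

    -- The supremum of {x | exp x ≤ y} is the logarithm of y.
    exp-surjective : ∀ {y} → 1# ≤ y → ∃ λ x → exp x ≈ y
    exp-surjective {y} 1≤y = s , ≤-antisym (≮⇒≥ too-big) (≮⇒≥ too-small)
      where
      0<y = <-≤-trans 0<1 1≤y
      sup = supremum (λ x → exp x ≤ y) (0# , ≤-respˡ (sym exp-0) 1≤y)
              (y , λ x p → ≮⇒≥ λ q → <⇒≱ (<-≤-trans q (≤-trans (y≤x+y 0≤1) (1+x≤exp (inj₁ (<-trans 0<y q))))) p)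
      s = proj₁ sup

      too-small : ¬ (exp s < y)
      too-small q = <⇒≱ (x<x+y 0<h) (proj₁ (proj₂ sup) (s + h) bound)
        where
        d = (y - exp s) / y
        0<d = 0<x/y (x<y⇒0<y-x q) 0<y
        h = d
        0<h = 0<d
        yd = *-/-cancel (y - exp s) 0<y
        h<1 : h < 1#
        h<1 = *-cancelˡ-< (inj₁ 0<y) (<-respˡ-≈ (sym yd) (<-by (0<exp s) (solve 2 (λ y e → y :* 𝟙 :- (y :- e) := e) refl y (exp s))))
        -- exp s = y (1 - h) and exp h (1 - h) ≤ 1.
        bound : exp (s + h) ≤ y
        bound = ≤-respˡ (sym (exp-+ s h)) (≤-respˡ
          (trans (solve 3 (λ y e h → y :* (e :* (𝟙 :- h)) := (y :- y :* h) :* e) refl y (exp h) h)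
             (*-congʳ (trans (+-congˡ (-‿cong yd)) (solve 2 (λ y e → y :- (y :- e) := e) refl y (exp s)))))
          (≤-respʳ (*-identityʳ y) (*-monoˡ-≤ (inj₁ 0<y) (exp*[1-h]≤1 (inj₁ 0<h) h<1))))

      too-big : ¬ (y < exp s)
      too-big q = <⇒≱ (<-by 0<h (solve 2 (λ s h → s :- (s :- h) := h) refl s h))
          (proj₂ (proj₂ sup) (s - h) λ x p → ≮⇒≥ λ r → <⇒≱ (≤-<-trans bound (exp-mono-< r)) p)
        where
        -- Now y = exp s · (1 - h), so exp h · (1 - h) ≤ 1 yields y ≤ exp (s - h), and s - h is
        -- already an upper bound.
        h = (exp s - y) / exp s
        0<h = 0<x/y (x<y⇒0<y-x q) (0<exp s)
        eh = *-/-cancel (exp s - y) (0<exp s)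
        h<1 : h < 1#
        h<1 = *-cancelˡ-< (inj₁ (0<exp s)) (<-respˡ-≈ (sym eh) (<-by 0<y (solve 2 (λ y e → e :* 𝟙 :- (e :- y) := y) refl y (exp s))))
        bound : y ≤ exp (s - h)
        bound = *-cancelˡ-≤ (0<exp h) (≤-respʳ
          (trans (exp-cong (solve 2 (λ s h → s := h :+ (s :- h)) refl s h)) (exp-+ h (s - h)))
          (≤-respˡ
            (trans (solve 3 (λ e s h → s :* (e :* (𝟙 :- h)) := e :* (s :- s :* h)) refl (exp h) (exp s) h)
              (*-congˡ (trans (+-congˡ (-‿cong eh)) (solve 2 (λ y e → e :- (e :- y) := y) refl y (exp s)))))
            (≤-respʳ (*-identityʳ _) (*-monoˡ-≤ (inj₁ (0<exp s)) (exp*[1-h]≤1 (inj₁ 0<h) h<1)))))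

    log-exp : ∀ {y} → 1# ≤ y → exp (log y) ≈ y
    log-exp p = the-satisfies 0# _ (exp-surjective p)

    0≤log : ∀ {y} → 1# ≤ y → 0# ≤ log y
    0≤log p = exp-cancel-≤ (≤-respˡ (sym exp-0) (≤-respʳ (sym (log-exp p)) p))

  -- The growth conditions (2) and (4) as inequalities between natural numbers.

  module Growth where

    open RealField
    open Exponential

    abstract
      nat-bound : (t : ℕ → ℕ) → ∀ n → ∃ λ B → ∀ i → i ℕ.< n → t i ℕ.≤ B
      nat-bound t zero    = 0 , λ i ()
      nat-bound t (suc n) = let B , p = nat-bound t n in B ℕ.⊔ t n , λ i q → h i (ℕ.m≤n⇒m<n∨m≡n (ℕ.≤-pred q)) B p
        where
        h : ∀ i → i ℕ.< n ⊎ i ≡ n → ∀ B → (∀ i → i ℕ.< n → t i ℕ.≤ B) → t i ℕ.≤ B ℕ.⊔ t n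
        h i (inj₁ q)      B p = ℕ.≤-trans (p i q) (ℕ.m≤m⊔n B (t n))
        h i (inj₂ ≡.refl) B p = ℕ.m≤n⊔m B (t n)

    -- The hypothesis is used with ε = 1/s and δ = 1; raising to the power s then removes the real
    -- exponent.
    =o-^ʳ⇒^≤ : ∀ {f : ℝ → ℕ} → (∀ ε → 0# < ε → (λ R → fromℕ (f R)) =o (λ R → R ^ʳ ε)) →
               ∀ s → Eventuallyℕ λ N → f (fromℕ N) ℕ.^ s ℕ.≤ N
    =o-^ʳ⇒^≤ p zero = 1 , λ N 1≤N → 1≤N
    =o-^ʳ⇒^≤ {f} p (suc s) =
      let R₀ , h = p ε 0<ε 1# 0<1
          n₀ , R₀<n₀ = archimedean R₀
      in n₀ ℕ.⊔ 1 , λ N q → fromℕ-cancel-≤ (bound N (ℕ.m⊔n≤o⇒n≤o n₀ 1 q)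
           (h (fromℕ N) (≤-trans (inj₁ R₀<n₀) (fromℕ-mono-≤ (ℕ.m⊔n≤o⇒m≤o n₀ 1 q)))))
      where
      ε = 1# / fromℕ (suc s)
      0<ε = 0<x/y 0<1 (0<fromℕ-suc s)
      bound : ∀ N → 1 ℕ.≤ N → ∣ fromℕ (f (fromℕ N)) ∣ ≤ 1# * ∣ fromℕ N ^ʳ ε ∣ → fromℕ (f (fromℕ N) ℕ.^ suc s) ≤ fromℕ N
      bound N 1≤N q = begin
        fromℕ (f (fromℕ N) ℕ.^ suc s)
          ≈⟨ fromℕ-^ (f (fromℕ N)) (suc s) ⟩
        fromℕ (f (fromℕ N)) ^ suc s
          ≤⟨ ^-monoˡ-≤ (suc s) (0≤fromℕ (f (fromℕ N))) (≤-trans (x≤∣x∣ _) (≤-respʳ (trans (*-identityˡ _) (0≤x⇒∣x∣≈x (inj₁ (0<exp _)))) q)) ⟩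
        exp (ε * log (fromℕ N)) ^ suc s
          ≈⟨ exp-^ (suc s) _ ⟩
        exp (fromℕ (suc s) * (ε * log (fromℕ N)))
          ≈⟨ exp-cong (trans (sym (*-assoc _ _ _)) (trans (*-congʳ (*-/-cancel 1# (0<fromℕ-suc s))) (*-identityˡ _))) ⟩
        exp (log (fromℕ N))
          ≈⟨ log-exp (1≤fromℕ 1≤N) ⟩
        fromℕ N ∎
        where open ≤-Reasoning

    m≤m^n : ∀ m {n} → 1 ℕ.≤ m → 1 ℕ.≤ n → m ℕ.≤ m ℕ.^ n
    m≤m^n m {suc n} p (s≤s _) = ℕ.m≤m*n m (m ℕ.^ n) ⦃ ℕ.>-nonZero (ℕ.m^n>0 m ⦃ ℕ.>-nonZero p ⦄ n) ⦄

    -- A bound of the shape exp(R^(1 - 1/g)) with the logarithm cleared: v plays the part of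
    -- R^(1/g), and the maximum with 1 mirrors `log⁺`.
    SubexponentialBound : ℕ → ℕ → (ℕ → ℕ) → Set
    SubexponentialBound g E t = ∀ R v n → n ℕ.≤ R → 1 ℕ.≤ v → v ℕ.^ g ℕ.≤ R → (1 ℕ.⊔ t n) ℕ.^ v ℕ.≤ E ℕ.^ R

    -- With 1 ≤ g C₃ and v^g ≤ R we have v ≤ R^C₃, so t(n)^v ≤ exp(v R^(1-C₃)) ≤ exp R.
    log⁺-=o⇒^≤ : ∀ {t C₃} → C₃ < 1# → (λ n → log⁺ (fromℕ (t n))) =oℕ (λ n → fromℕ n ^ʳ (1# - C₃)) →
                 ∀ g → 1# ≤ fromℕ g * C₃ → ∃ λ E → SubexponentialBound g E t
    log⁺-=o⇒^≤ {t} {C₃} C₃<1 p g 1≤gC₃ = E , bound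
      where
      n₀ = suc (proj₁ (p 1# 0<1))
      B = proj₁ (nat-bound t n₀)
      t≤B = proj₂ (nat-bound t n₀)
      E₀ = proj₁ (0≤x⇒x≤fromℕ (exp 1#))
      exp1≤E₀ = proj₁ (proj₂ (0≤x⇒x≤fromℕ (exp 1#)))
      1≤E₀ = proj₂ (proj₂ (0≤x⇒x≤fromℕ (exp 1#)))
      E = suc B ℕ.* E₀

      1≤g : 1 ℕ.≤ g
      1≤g = ℕ.n≢0⇒n>0 λ { ≡.refl → <⇒≱ 0<1 (≤-respʳ (zeroˡ C₃) 1≤gC₃) }

      module Large {R v n} (n₀≤n : n₀ ℕ.≤ n) (n≤R : n ℕ.≤ R) (1≤v : 1 ℕ.≤ v) (v^g≤R : v ℕ.^ g ℕ.≤ R) where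
        open ≤-Reasoning
        1≤n : 1 ℕ.≤ n
        1≤n = ℕ.≤-trans (s≤s z≤n) n₀≤n
        1≤R = ℕ.≤-trans 1≤n n≤R
        L = log (max 1# (fromℕ (t n)))
        ℓn = log (fromℕ n)
        ℓR = log (fromℕ R)
        ℓv = log (fromℕ v)
        expℓR = log-exp (1≤fromℕ 1≤R)
        expℓv = log-exp (1≤fromℕ 1≤v)

        ℓv≤ : ℓv ≤ C₃ * ℓR
        ℓv≤ = *-cancelˡ-≤ (0<fromℕ 1≤g) (≤-trans
          (exp-cancel-≤ (begin
            exp (fromℕ g * ℓv)  ≈⟨ exp-^ g ℓv ⟨
            exp ℓv ^ g          ≈⟨ ^-congˡ g expℓv ⟩
            fromℕ v ^ g         ≈⟨ fromℕ-^ v g ⟨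
            fromℕ (v ℕ.^ g)     ≤⟨ fromℕ-mono-≤ v^g≤R ⟩
            fromℕ R             ≈⟨ expℓR ⟨
            exp ℓR              ∎))
          (≤-respˡ (*-identityˡ ℓR) (≤-respʳ (*-assoc _ _ _) (*-monoʳ-≤ (0≤log (1≤fromℕ 1≤R)) 1≤gC₃))))

        vL≤R : fromℕ v * L ≤ fromℕ R
        vL≤R = begin
          fromℕ v * L
            ≤⟨ *-monoˡ-≤ (0≤fromℕ v) (≤-trans (x≤∣x∣ L) (≤-respʳ (trans (*-identityˡ _) (0≤x⇒∣x∣≈x (inj₁ (0<exp _))))
                 (proj₂ (p 1# 0<1) n (ℕ.≤-trans (ℕ.n≤1+n _) n₀≤n)))) ⟩
          fromℕ v * exp ((1# - C₃) * ℓn)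
            ≤⟨ *-monoˡ-≤ (0≤fromℕ v) (exp-mono-≤ (*-monoˡ-≤ (inj₁ (x<y⇒0<y-x C₃<1))
                 (exp-cancel-≤ (≤-respˡ (sym (log-exp (1≤fromℕ 1≤n))) (≤-respʳ (sym expℓR) (fromℕ-mono-≤ n≤R)))))) ⟩
          fromℕ v * exp ((1# - C₃) * ℓR)
            ≈⟨ *-congʳ expℓv ⟨
          exp ℓv * exp ((1# - C₃) * ℓR)
            ≈⟨ exp-+ _ _ ⟨
          exp (ℓv + (1# - C₃) * ℓR)
            ≤⟨ exp-mono-≤ (≤-by (x≤y⇒0≤y-x ℓv≤) (solve 3 (λ v c r → r :- (v :+ (𝟙 :- c) :* r) := c :* r :- v) refl ℓv C₃ ℓR)) ⟩
          exp ℓR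
            ≈⟨ expℓR ⟩
          fromℕ R ∎

        1⊔t≤ : fromℕ (1 ℕ.⊔ t n) ≤ max 1# (fromℕ (t n))
        1⊔t≤ with ℕ.⊔-sel 1 (t n)
        ... | inj₁ q = ≡.subst (λ k → fromℕ k ≤ max 1# (fromℕ (t n))) (≡.sym q) (≤-respˡ (sym fromℕ-1) (x≤max 1# (fromℕ (t n))))
        ... | inj₂ q = ≡.subst (λ k → fromℕ k ≤ max 1# (fromℕ (t n))) (≡.sym q) (y≤max 1# (fromℕ (t n)))

        conclusion : (1 ℕ.⊔ t n) ℕ.^ v ℕ.≤ E₀ ℕ.^ R
        conclusion = fromℕ-cancel-≤ (begin
          fromℕ ((1 ℕ.⊔ t n) ℕ.^ v)     ≈⟨ fromℕ-^ (1 ℕ.⊔ t n) v ⟩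
          fromℕ (1 ℕ.⊔ t n) ^ v         ≤⟨ ^-monoˡ-≤ v (0≤fromℕ (1 ℕ.⊔ t n)) 1⊔t≤ ⟩
          max 1# (fromℕ (t n)) ^ v      ≈⟨ ^-congˡ v (log-exp (x≤max 1# (fromℕ (t n)))) ⟨
          exp L ^ v                     ≈⟨ exp-^ v L ⟩
          exp (fromℕ v * L)             ≤⟨ exp-mono-≤ vL≤R ⟩
          exp (fromℕ R)                 ≈⟨ exp-cong (*-identityʳ _) ⟨
          exp (fromℕ R * 1#)            ≈⟨ exp-^ R 1# ⟨
          exp 1# ^ R                    ≤⟨ ^-monoˡ-≤ R (inj₁ (0<exp 1#)) exp1≤E₀ ⟩
          fromℕ E₀ ^ R                  ≈⟨ fromℕ-^ E₀ R ⟨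
          fromℕ (E₀ ℕ.^ R)              ∎)

      bound : SubexponentialBound g E t
      bound R v n n≤R 1≤v v^g≤R with n₀ ℕ.≤? n
      ... | yes n₀≤n = ℕ.≤-trans (Large.conclusion n₀≤n n≤R 1≤v v^g≤R)
                         (ℕ.^-monoˡ-≤ R (ℕ.m≤n*m E₀ (suc B)))
      -- For the finitely many small n the constant base `suc B` suffices, since v ≤ v^g ≤ R.
      ... | no n₀≰n = ℕ.≤-trans (ℕ.^-monoˡ-≤ v (ℕ.⊔-lub (s≤s z≤n) (ℕ.m≤n⇒m≤1+n (t≤B n (ℕ.≰⇒> n₀≰n)))))
                        (ℕ.≤-trans (ℕ.^-monoʳ-≤ (suc B) (ℕ.≤-trans (m≤m^n v 1≤v 1≤g) v^g≤R))
                          (ℕ.^-monoˡ-≤ R (ℕ.m≤m*n (suc B) E₀ ⦃ ℕ.>-nonZero 1≤E₀ ⦄)))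

  -- The complex numbers: ring structure, two measures of size, square roots.

  module Complex where

    open RealField
    open Exponential

    private
      module C = RawRing ℂ-rawRing

    ℂ-commutativeRing : CommutativeRing 0ℓ 0ℓ
    ℂ-commutativeRing = record
      { Carrier = ℂ
      ; _≈_ = _≈ᶜ_
      ; _+_ = C._+_
      ; _*_ = C._*_
      ; -_ = C.-_
      ; 0# = C.0#
      ; 1# = C.1#
      ; isCommutativeRing = record
        { isRing = record
          { +-isAbelianGroup = record
            { isGroup = record
              { isMonoid = record
                { isSemigroup = record
                  { isMagma = record
                    { isEquivalence = record
                      { refl = refl , refl
                      ; sym = λ (p , q) → sym p , sym q
                      ; trans = λ (p , q) (p′ , q′) → trans p p′ , trans q q′
                      }
                    ; ∙-cong = λ (p , q) (p′ , q′) → +-cong p p′ , +-cong q q′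
                    }
                  ; assoc = λ x y z → +-assoc _ _ _ , +-assoc _ _ _
                  }
                ; identity = (λ x → +-identityˡ _ , +-identityˡ _) , (λ x → +-identityʳ _ , +-identityʳ _)
                }
              ; inverse = (λ x → -‿inverseˡ _ , -‿inverseˡ _) , (λ x → -‿inverseʳ _ , -‿inverseʳ _)
              ; ⁻¹-cong = λ (p , q) → -‿cong p , -‿cong q
              }
            ; comm = λ x y → +-comm _ _ , +-comm _ _
            }
          ; *-cong = λ (p , q) (p′ , q′) →
              +-cong (*-cong p p′) (-‿cong (*-cong q q′)) , +-cong (*-cong p q′) (*-cong q p′)
          ; *-assoc = λ x y z → assoc-re (re x) (im x) (re y) (im y) (re z) (im z) , assoc-im (re x) (im x) (re y) (im y) (re z) (im z)
          ; *-identity = (λ x → id-re (re x) (im x) , id-im (re x) (im x)) , (λ x → id-re′ (re x) (im x) , id-im′ (re x) (im x))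
          ; distrib = (λ x y z → dist-re (re x) (im x) (re y) (im y) (re z) (im z) , dist-im (re x) (im x) (re y) (im y) (re z) (im z))
                    , (λ x y z → dist-re′ (re x) (im x) (re y) (im y) (re z) (im z) , dist-im′ (re x) (im x) (re y) (im y) (re z) (im z))
          }
        ; *-comm = λ x y → comm-re (re x) (im x) (re y) (im y) , comm-im (re x) (im x) (re y) (im y)
        }
      }
      where
      assoc-re = solve 6 (λ a b c d e f → (a :* c :- b :* d) :* e :- (a :* d :+ b :* c) :* f := a :* (c :* e :- d :* f) :- b :* (c :* f :+ d :* e)) refl
      assoc-im = solve 6 (λ a b c d e f → (a :* c :- b :* d) :* f :+ (a :* d :+ b :* c) :* e := a :* (c :* f :+ d :* e) :+ b :* (c :* e :- d :* f)) refl
      id-re = solve 2 (λ a b → 𝟙 :* a :- 𝟘 :* b := a) refl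
      id-im = solve 2 (λ a b → 𝟙 :* b :+ 𝟘 :* a := b) refl
      id-re′ = solve 2 (λ a b → a :* 𝟙 :- b :* 𝟘 := a) refl
      id-im′ = solve 2 (λ a b → a :* 𝟘 :+ b :* 𝟙 := b) refl
      dist-re = solve 6 (λ a b c d e f → a :* (c :+ e) :- b :* (d :+ f) := (a :* c :- b :* d) :+ (a :* e :- b :* f)) refl
      dist-im = solve 6 (λ a b c d e f → a :* (d :+ f) :+ b :* (c :+ e) := (a :* d :+ b :* c) :+ (a :* f :+ b :* e)) refl
      dist-re′ = solve 6 (λ a b c d e f → (c :+ e) :* a :- (d :+ f) :* b := (c :* a :- d :* b) :+ (e :* a :- f :* b)) refl
      dist-im′ = solve 6 (λ a b c d e f → (c :+ e) :* b :+ (d :+ f) :* a := (c :* b :+ d :* a) :+ (e :* b :+ f :* a)) refl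
      comm-re = solve 4 (λ a b c d → a :* c :- b :* d := c :* a :- d :* b) refl
      comm-im = solve 4 (λ a b c d → a :* d :+ b :* c := c :* b :+ d :* a) refl

    module ℂᶠ = CommutativeRing ℂ-commutativeRing
    open ℂᶠ public using () renaming (_+_ to _+ᶜ_; _*_ to _*ᶜ_; -_ to -ᶜ_; _-_ to _-ᶜ_; 0# to 0ᶜ; 1# to 1ᶜ)
    open Algebra.Properties.CommutativeSemiring.Exp ℂᶠ.commutativeSemiring public
      using () renaming (_^_ to _^ᶜ_)

    -- The squared modulus: multiplicative, and free of square roots.
    N : ℂ → ℝ
    N z = re z * re z + im z * im z

    N-cong : ∀ {z w} → z ≈ᶜ w → N z ≈ N w
    N-cong (p , q) = +-cong (*-cong p p) (*-cong q q)

    N-* : ∀ z w → N (z *ᶜ w) ≈ N z * N w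
    N-* z w = solve 4 (λ a b c d → (a :* c :- b :* d) :* (a :* c :- b :* d) :+ (a :* d :+ b :* c) :* (a :* d :+ b :* c)
      := (a :* a :+ b :* b) :* (c :* c :+ d :* d)) refl (re z) (im z) (re w) (im w)

    0≤N : ∀ z → 0# ≤ N z
    0≤N z = 0≤x+y (0≤x² (re z)) (0≤x² (im z))

    ≉0⇒0<N : ∀ {z} → ¬ (z ≈ᶜ 0ᶜ) → 0# < N z
    ≉0⇒0<N {z} p with em {re z ≈ 0#} | em {im z ≈ 0#}
    ... | no q  | _     = 0<x+y′ (≉0⇒0<x² q) (0≤x² (im z))
    ... | yes q | no r  = <-respʳ-≈ (+-comm _ _) (0<x+y′ (≉0⇒0<x² r) (0≤x² (re z)))
    ... | yes q | yes r = ⊥-elim (p (q , r))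

    N≉0⇒≉0 : ∀ {z} → 0# < N z → ¬ (z ≈ᶜ 0ᶜ)
    N≉0⇒≉0 {z} p q = <⇒≉ p (sym (trans (N-cong {z} {0ᶜ} q) (solve 0 (𝟘 :* 𝟘 :+ 𝟘 :* 𝟘 := 𝟘) refl)))

    *ᶜ-≉0 : ∀ {z w} → ¬ (z ≈ᶜ 0ᶜ) → ¬ (w ≈ᶜ 0ᶜ) → ¬ (z *ᶜ w ≈ᶜ 0ᶜ)
    *ᶜ-≉0 {z} {w} p q = N≉0⇒≉0 {z *ᶜ w} (<-respʳ-≈ (sym (N-* z w)) (*-pos (≉0⇒0<N {z} p) (≉0⇒0<N {w} q)))

    N-^ : ∀ z n → N (z ^ᶜ n) ≈ N z ^ n
    N-^ z zero    = solve 0 (𝟙 :* 𝟙 :+ 𝟘 :* 𝟘 := 𝟙) refl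
    N-^ z (suc n) = trans (N-* z (z ^ᶜ n)) (*-congˡ (N-^ z n))

    -- The ℓ¹ norm obeys the triangle inequality without square roots. It is multiplicative only up
    -- to a factor 2, by comparison with `N`; estimates below carry that factor along.
    ‖_‖ : ℂ → ℝ
    ‖ z ‖ = ∣ re z ∣ + ∣ im z ∣

    ‖‖-cong : ∀ {z w} → z ≈ᶜ w → ‖ z ‖ ≈ ‖ w ‖
    ‖‖-cong (p , q) = +-cong (∣∣-cong p) (∣∣-cong q)

    0≤‖‖ : ∀ z → 0# ≤ ‖ z ‖
    0≤‖‖ z = 0≤x+y (0≤∣x∣ _) (0≤∣x∣ _)

    ‖0‖≈0 : ‖ 0ᶜ ‖ ≈ 0#
    ‖0‖≈0 = trans (+-cong ∣0∣≈0 ∣0∣≈0) (+-identityˡ 0#)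

    ‖+‖≤ : ∀ z w → ‖ z +ᶜ w ‖ ≤ ‖ z ‖ + ‖ w ‖
    ‖+‖≤ z w = ≤-respʳ (solve 4 (λ a b c d → (a :+ b) :+ (c :+ d) := (a :+ c) :+ (b :+ d)) refl _ _ _ _)
      (+-mono-≤ (∣x+y∣≤∣x∣+∣y∣ (re z) (re w)) (∣x+y∣≤∣x∣+∣y∣ (im z) (im w)))

    ‖-‖ : ∀ z → ‖ -ᶜ z ‖ ≈ ‖ z ‖
    ‖-‖ z = +-cong (∣-x∣≈∣x∣ (re z)) (∣-x∣≈∣x∣ (im z))

    ‖*‖≤ : ∀ z w → ‖ z *ᶜ w ‖ ≤ ‖ z ‖ * ‖ w ‖
    ‖*‖≤ z w = ≤-respʳ
      (solve 4 (λ a b c d → (a :* c :+ b :* d) :+ (a :* d :+ b :* c) := (a :+ b) :* (c :+ d)) refl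
        (∣ re z ∣) (∣ im z ∣) (∣ re w ∣) ∣ im w ∣)
      (+-mono-≤
        (≤-trans (∣x+y∣≤∣x∣+∣y∣ _ _) (≤-reflexive (+-cong (∣x*y∣≈∣x∣*∣y∣ (re z) (re w))
          (trans (∣-x∣≈∣x∣ _) (∣x*y∣≈∣x∣*∣y∣ (im z) (im w))))))
        (≤-trans (∣x+y∣≤∣x∣+∣y∣ _ _) (≤-reflexive (+-cong (∣x*y∣≈∣x∣*∣y∣ (re z) (im w)) (∣x*y∣≈∣x∣*∣y∣ (im z) (re w))))))

    ∣x∣²≈x² : ∀ x → ∣ x ∣ * ∣ x ∣ ≈ x * x
    ∣x∣²≈x² x = trans (sym (∣x*y∣≈∣x∣*∣y∣ x x)) (0≤x⇒∣x∣≈x (0≤x² x))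

    N≈∣∣ : ∀ z → N z ≈ ∣ re z ∣ * ∣ re z ∣ + ∣ im z ∣ * ∣ im z ∣
    N≈∣∣ z = sym (+-cong (∣x∣²≈x² (re z)) (∣x∣²≈x² (im z)))

    N≤‖‖² : ∀ z → N z ≤ ‖ z ‖ * ‖ z ‖
    N≤‖‖² z = ≤-respˡ (sym (N≈∣∣ z)) (≤-by (0≤x*y (inj₁ 0<2) (0≤x*y (0≤∣x∣ (re z)) (0≤∣x∣ (im z))))
      (solve 2 (λ a b → (a :+ b) :* (a :+ b) :- (a :* a :+ b :* b) := 𝟚 :* (a :* b)) refl (∣ re z ∣) ∣ im z ∣))

    ‖‖²≤2N : ∀ z → ‖ z ‖ * ‖ z ‖ ≤ (1# + 1#) * N z
    ‖‖²≤2N z = ≤-respʳ (*-congˡ (sym (N≈∣∣ z))) (≤-by (0≤x² (∣ re z ∣ - ∣ im z ∣))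
      (solve 2 (λ a b → 𝟚 :* (a :* a :+ b :* b) :- (a :+ b) :* (a :+ b) := (a :- b) :* (a :- b)) refl (∣ re z ∣) ∣ im z ∣))

    ‖‖*‖‖≤2‖*‖ : ∀ z w → ‖ z ‖ * ‖ w ‖ ≤ (1# + 1#) * ‖ z *ᶜ w ‖
    ‖‖*‖‖≤2‖*‖ z w = x²≤y²⇒x≤y (0≤x*y (inj₁ 0<2) (0≤‖‖ (z *ᶜ w))) (begin
      (‖ z ‖ * ‖ w ‖) * (‖ z ‖ * ‖ w ‖)
        ≈⟨ solve 2 (λ a b → (a :* b) :* (a :* b) := (a :* a) :* (b :* b)) refl (‖ z ‖) (‖ w ‖) ⟩
      (‖ z ‖ * ‖ z ‖) * (‖ w ‖ * ‖ w ‖)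
        ≤⟨ *-mono-≤ (0≤x² ‖ z ‖) (0≤x² ‖ w ‖) (‖‖²≤2N z) (‖‖²≤2N w) ⟩
      ((1# + 1#) * N z) * ((1# + 1#) * N w)
        ≈⟨ solve 2 (λ a b → (𝟚 :* a) :* (𝟚 :* b) := con (+ 4) :* (a :* b)) refl (N z) (N w) ⟩
      num 4 * (N z * N w)
        ≈⟨ *-congˡ (N-* z w) ⟨
      num 4 * N (z *ᶜ w)
        ≤⟨ *-monoˡ-≤ (0≤x+y (0≤x+y (0≤x+y 0≤1 0≤1) 0≤1) 0≤1) (N≤‖‖² (z *ᶜ w)) ⟩
      num 4 * (‖ z *ᶜ w ‖ * ‖ z *ᶜ w ‖)
        ≈⟨ solve 1 (λ a → con (+ 4) :* (a :* a) := (𝟚 :* a) :* (𝟚 :* a)) refl (‖ z *ᶜ w ‖) ⟩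
      ((1# + 1#) * ‖ z *ᶜ w ‖) * ((1# + 1#) * ‖ z *ᶜ w ‖) ∎)
      where open ≤-Reasoning

    abstract
      -- For x ≥ 1 take exp (log x / 2). For 0 < x < 1, where only the logarithm of 1/x is at hand,
      -- use √x = x · √(1/x).
      √-exists : ∀ {x} → 0# ≤ x → ∃ λ r → 0# ≤ r × r * r ≈ x
      √-exists {x} p with compare x 0# | ≤∨> 1# x
      ... | tri< q _ _ | _      = ⊥-elim (<⇒≱ q p)
      ... | tri≈ _ q _ | _      = 0# , ≤-refl , trans (zeroˡ 0#) (sym q)
      ... | tri> _ _ _ | inj₁ q = large q
        where
        large : ∀ {x} → 1# ≤ x → ∃ λ r → 0# ≤ r × r * r ≈ x
        large {x} q = exp (half (log x)) , inj₁ (0<exp _) ,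
          trans (sym (exp-+ _ _)) (trans (exp-cong (half+half (log x))) (log-exp q))
      ... | tri> _ _ q | inj₂ r =
        let y = x ⁻¹
            s = exp (half (log y))
            1≤y = *-cancelˡ-≤ q (≤-respˡ (sym (*-identityʳ x)) (≤-respʳ (sym (x/x≈1 q)) (inj₁ r)))
            s²≈y = trans (sym (exp-+ _ _)) (trans (exp-cong (half+half (log y))) (log-exp 1≤y))
        in x * s , 0≤x*y p (inj₁ (0<exp _)) ,
           trans (solve 2 (λ x s → (x :* s) :* (x :* s) := x :* (x :* (s :* s))) refl x s)
             (trans (*-congˡ (trans (*-congˡ s²≈y) (x/x≈1 q))) (*-identityʳ x))

    ∣z∣ᶜ≤1⇒N≤1 : ∀ z → ∣ z ∣ᶜ ≤ 1# → N z ≤ 1#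
    ∣z∣ᶜ≤1⇒N≤1 z p = let 0≤r , r²≈N = the-satisfies 0# (λ r → 0# ≤ r × r * r ≈ N z) (√-exists (0≤N z)) in
      ≤-respˡ r²≈N (≤-respʳ (*-identityˡ 1#) (*-mono-≤ 0≤r 0≤r p p))

    private
      module Root (a b r x y : ℝ) (0≤r : 0# ≤ r) (0≤x : 0# ≤ x) (0≤y : 0# ≤ y) (r²≈N : r * r ≈ a * a + b * b)
                  (x² : x * x ≈ half (r + a)) (y² : y * y ≈ half (r - a)) where
        h : ℝ
        h = (1# + 1#) ⁻¹
        2h≈1 : (1# + 1#) * h ≈ 1#
        2h≈1 = x/x≈1 0<2
        real : x * x - y * y ≈ a
        real = trans (+-cong x² (-‿cong y²)) (trans (solve 3 (λ r a h → (r :+ a) :* h :- (r :- a) :* h := a :* (𝟚 :* h)) refl r a h)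
          (trans (*-congˡ 2h≈1) (*-identityʳ a)))
        0≤2xy : 0# ≤ x * y + x * y
        0≤2xy = let p = 0≤x*y 0≤x 0≤y in 0≤x+y p p
        [2xy]²≈b² : (x * y + x * y) * (x * y + x * y) ≈ ∣ b ∣ * ∣ b ∣
        [2xy]²≈b² = trans (solve 2 (λ x y → (x :* y :+ x :* y) :* (x :* y :+ x :* y) := con (+ 4) :* ((x :* x) :* (y :* y))) refl x y)
          (trans (*-congˡ (*-cong x² y²)) (trans (solve 3 (λ r a h → con (+ 4) :* (((r :+ a) :* h) :* ((r :- a) :* h))
              := ((𝟚 :* h) :* (𝟚 :* h)) :* (r :* r :- a :* a)) refl r a h)
            (trans (*-cong (trans (*-cong 2h≈1 2h≈1) (*-identityˡ 1#)) (+-congʳ r²≈N))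
              (trans (solve 2 (λ a b → 𝟙 :* ((a :* a :+ b :* b) :- a :* a) := b :* b) refl a b) (sym (∣x∣²≈x² b))))))
        2xy≈∣b∣ : x * y + x * y ≈ ∣ b ∣
        2xy≈∣b∣ = ≤-antisym (x²≤y²⇒x≤y (0≤∣x∣ b) (≤-reflexive [2xy]²≈b²)) (x²≤y²⇒x≤y 0≤2xy (≤-reflexive (sym [2xy]²≈b²)))
        root : (0# ≤ b) ⊎ (b < 0#) → ∃ λ w → w *ᶜ w ≈ᶜ (a +i b)
        root (inj₁ p) = (x +i y) , real , trans (solve 2 (λ x y → x :* y :+ y :* x := x :* y :+ x :* y) refl x y) (trans 2xy≈∣b∣ (0≤x⇒∣x∣≈x p))
        root (inj₂ p) = (x +i (- y)) , trans (solve 2 (λ x y → x :* x :- :- y :* :- y := x :* x :- y :* y) refl x y) real ,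
          trans (solve 2 (λ x y → x :* :- y :+ :- y :* x := :- (x :* y :+ x :* y)) refl x y)
            (trans (-‿cong (trans 2xy≈∣b∣ (trans (sym (∣-x∣≈∣x∣ b)) (0≤x⇒∣x∣≈x (inj₁ (0<-x p))))))
              (solve 1 (λ b → :- :- b := b) refl b))

    -- With r = |z| the parts of the root are √((r + re z)/2) and ±√((r - re z)/2), the sign being
    -- that of im z.
    √ᶜ-exists : ∀ z → ∃ λ w → w *ᶜ w ≈ᶜ z
    √ᶜ-exists z with √-exists (0≤N z)
    ... | r , 0≤r , r²≈N = combine (√-exists 0≤half₁) (√-exists 0≤half₂)
      where
      ∣a∣≤r : ∣ re z ∣ ≤ r
      ∣a∣≤r = x²≤y²⇒x≤y 0≤r (≤-respˡ (sym (∣x∣²≈x² (re z))) (≤-respʳ (sym r²≈N) (x≤x+y (0≤x² (im z)))))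
      0≤half₁ : 0# ≤ half (r + re z)
      0≤half₁ = 0≤x*y (≤-by (x≤y⇒0≤y-x (≤-trans (-x≤∣x∣ (re z)) ∣a∣≤r)) (solve 2 (λ r a → (r :+ a) :- 𝟘 := r :- :- a) refl r (re z)))
                      (inj₁ (0<x⁻¹ 0<2))
      0≤half₂ : 0# ≤ half (r - re z)
      0≤half₂ = 0≤x*y (x≤y⇒0≤y-x (≤-trans (x≤∣x∣ (re z)) ∣a∣≤r)) (inj₁ (0<x⁻¹ 0<2))
      combine : (∃ λ x → 0# ≤ x × x * x ≈ half (r + re z)) → (∃ λ y → 0# ≤ y × y * y ≈ half (r - re z)) →
                ∃ λ w → w *ᶜ w ≈ᶜ z
      combine (x , 0≤x , x²) (y , 0≤y , y²) = Root.root (re z) (im z) r x y 0≤r 0≤x 0≤y r²≈N x² y² (≤∨> 0# (im z))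

  -- Minima of Lipschitz functions and growth of complex polynomials.

  module FundamentalTheoremOfAlgebra where

    open RealField
    open Complex
    open Polynomials ℂ-commutativeRing public
    open IntegerSolver ℂ-commutativeRing using () renaming
      (solve to solveᶜ; _:+_ to _:+ᶜ_; _:*_ to _:*ᶜ_; _:-_ to _:-ᶜ_; _:=_ to _:=ᶜ_; 𝟘 to 𝟘ᶜ; 𝟙 to 𝟙ᶜ)

    -x≤y⇒-y≤x : ∀ {x y} → - x ≤ y → - y ≤ x
    -x≤y⇒-y≤x {x} {y} p = ≤-by (x≤y⇒0≤y-x p) (solve 2 (λ x y → x :- :- y := y :- :- x) refl x y)

    private
      infimum : (P : ℝ → Set) → ∃ P → (∃ λ b → ∀ x → P x → b ≤ x) →
                ∃ λ m → (∀ x → P x → m ≤ x) × (∀ b → (∀ x → P x → b ≤ x) → b ≤ m)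
      infimum P (x₀ , p₀) (b₀ , q₀)
        with supremum (λ y → ∃ λ x → P x × y ≈ - x) (- x₀ , x₀ , p₀ , refl)
               (- b₀ , λ { y (x , p , r) → ≤-respˡ (sym r) (neg-mono-≤ (q₀ x p)) })
      ... | s , ub , lub = - s , (λ x p → -x≤y⇒-y≤x (ub (- x) (x , p , refl))) ,
            λ b q → ≤-by (x≤y⇒0≤y-x (lub (- b) λ { y (x , p , r) → ≤-respˡ (sym r) (neg-mono-≤ (q x p)) }))
              (solve 2 (λ s b → :- s :- b := :- b :- s) refl s b)

      ∣x-y∣≤ : ∀ {x y d} → x - y ≤ d → y - x ≤ d → ∣ x - y ∣ ≤ d
      ∣x-y∣≤ {x} {y} p q = ∣x∣≤ p (≤-respˡ (solve 2 (λ x y → y :- x := :- (x :- y)) refl x y) q)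

    -- An explicit constant takes the place of continuity: polynomials provide one on every bounded
    -- set, and it survives minimisation over one variable.
    Lipschitz : ℝ → ℝ → ℝ → (ℝ → ℝ) → Set
    Lipschitz K a b h = ∀ x y → a ≤ x → x ≤ b → a ≤ y → y ≤ b → ∣ h x - h y ∣ ≤ K * ∣ x - y ∣

    private
      module ExtremeValue {a b : ℝ} (a≤b : a ≤ b) (h : ℝ → ℝ) (K : ℝ) (0≤K : 0# ≤ K) (lip : Lipschitz K a b h)
        (m : ℝ) (lower : ∀ u → a ≤ u → u ≤ b → m ≤ h u)
        (near : ∀ ε → 0# < ε → ∃ λ u → a ≤ u × u ≤ b × h u < m + ε) where

        -- The minimum is attained at the supremum of T.
        T : ℝ → Set
        T t = a ≤ t × t ≤ b × (∀ ε → 0# < ε → ∃ λ u → t ≤ u × u ≤ b × h u < m + ε)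

        T-a : T a
        T-a = ≤-refl , a≤b , near

        module AtSup (s : ℝ) (ub : ∀ t → T t → t ≤ s) (lub : ∀ c → (∀ t → T t → t ≤ c) → s ≤ c) where

          a≤s : a ≤ s
          a≤s = ub a T-a

          s≤b : s ≤ b
          s≤b = lub b λ t p → proj₁ (proj₂ p)

          module Gap (η δ : ℝ) (0<η : 0# < η) (0<δ : 0# < δ) (m+η+η≤hs : m + η + η ≤ h s) (Kδ≤η : K * δ ≤ η) where

            high : ∀ u → a ≤ u → u ≤ b → s - δ ≤ u → u ≤ s + δ → m + η ≤ h u
            high u a≤u u≤b p q = ≤-by
              (0≤x+y (x≤y⇒0≤y-x m+η+η≤hs) (x≤y⇒0≤y-x (≤-trans (≤-trans (x≤∣x∣ (h s - h u)) (lip s u a≤s s≤b a≤u u≤b))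
                (≤-trans (*-monoˡ-≤ 0≤K (∣x-y∣≤
                  (≤-by (x≤y⇒0≤y-x p) (solve 3 (λ s d u → d :- (s :- u) := u :- (s :- d)) refl s δ u))
                  (≤-by (x≤y⇒0≤y-x q) (solve 3 (λ s d u → d :- (u :- s) := (s :+ d) :- u) refl s δ u)))) Kδ≤η))))
              (solve 4 (λ m e hs hu → hu :- (m :+ e) := (hs :- (m :+ e :+ e)) :+ (e :- (hs :- hu))) refl m η (h s) (h u))

            beyond : ∀ t → T t → s - δ < t → ∀ ε → 0# < ε → ε ≤ η → ∃ λ u → s + δ ≤ u × u ≤ b × h u < m + ε
            beyond t (a≤t , _ , p) q ε 0<ε ε≤η with p ε 0<ε
            ... | u , t≤u , u≤b , hu< with ≤∨> (s + δ) u
            ... | inj₁ r = u , r , u≤b , hu<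
            ... | inj₂ r = ⊥-elim (<⇒≱ hu< (≤-trans (+-monoʳ-≤ m ε≤η)
                    (high u (≤-trans a≤t t≤u) u≤b (inj₁ (<-≤-trans q t≤u)) (inj₁ r))))

            beyond′ : ∀ t → T t → s - δ < t → ∀ ε → 0# < ε → ∃ λ u → s + δ ≤ u × u ≤ b × h u < m + ε
            beyond′ t p q ε 0<ε with ≤∨> ε η
            ... | inj₁ r = beyond t p q ε 0<ε r
            ... | inj₂ r with beyond t p q η 0<η ≤-refl
            ... | u , r₁ , r₂ , r₃ = u , r₁ , r₂ , <-≤-trans r₃ (+-monoʳ-≤ m (inj₁ r))

            -- Near s the function stays at least η above m. So near-minimal points to the right of
            -- some t in T with t > s - δ lie beyond s + δ, which puts s + δ into T; if there is no
            -- such t, then s - δ already bounds T.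
            impossible : ⊥
            impossible = <⇒≱ (<-by 0<δ (solve 2 (λ s d → s :- (s :- d) := d) refl s δ))
              (lub (s - δ) λ t p → ≮⇒≥ λ q →
                let u , r₁ , r₂ , _ = beyond′ t p q η 0<η
                in <⇒≱ (x<x+y 0<δ) (ub (s + δ) (≤-trans a≤s (x≤x+y (inj₁ 0<δ)) , ≤-trans r₁ r₂ , beyond′ t p q)))

          hs≤m : h s ≤ m
          hs≤m = ≮⇒≥ λ m<hs →
            let d = h s - m
                0<η = 0<half (x<y⇒0<y-x m<hs)
                0<K′ = 0<x+y′ 0<1 0≤K
                0<δ = 0<x/y 0<η 0<K′
            in Gap.impossible (half d) (half d / (1# + K)) 0<η 0<δ
                 (≤-reflexive (trans (+-assoc _ _ _) (trans (+-congˡ (half+half d)) (solve 2 (λ m h → m :+ (h :- m) := h) refl m (h s)))))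
                 (≤-respʳ (*-/-cancel (half d) 0<K′) (*-monoʳ-≤ (inj₁ 0<δ) (y≤x+y 0≤1)))

    abstract
      extreme-value : ∀ {a b} → a ≤ b → (h : ℝ → ℝ) (K : ℝ) → 0# ≤ K → Lipschitz K a b h →
                      ∃ λ s → a ≤ s × s ≤ b × (∀ y → a ≤ y → y ≤ b → h s ≤ h y)
      extreme-value {a} {b} a≤b h K 0≤K lip
        with infimum (λ v → ∃ λ u → a ≤ u × u ≤ b × v ≈ h u) (h a , a , ≤-refl , a≤b , refl)
               (h a - K * (b - a) , λ { v (u , p , q , r) → ≤-respʳ (sym r)
                  (≤-by (x≤y⇒0≤y-x (≤-trans (≤-trans (x≤∣x∣ (h a - h u)) (lip a u ≤-refl a≤b p q))
                      (*-monoˡ-≤ 0≤K (∣x-y∣≤ (≤-trans (≤-respʳ (-‿inverseʳ a) (+-monoʳ-≤ a (neg-mono-≤ p))) (x≤y⇒0≤y-x a≤b))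
                                            (+-monoˡ-≤ (- a) q)))))
                    (solve 3 (λ k ha hu → hu :- (ha :- k) := k :- (ha :- hu)) refl (K * (b - a)) (h a) (h u))) })
      ... | m , lower , greatest = attain lower′ near
        where
        lower′ : ∀ u → a ≤ u → u ≤ b → m ≤ h u
        lower′ u p q = lower (h u) (u , p , q , refl)
        near : ∀ ε → 0# < ε → ∃ λ u → a ≤ u × u ≤ b × h u < m + ε
        near ε 0<ε = by-contradiction λ ¬p → <⇒≱ (x<x+y 0<ε)
          (greatest (m + ε) λ { v (u , p , q , r) → ≤-respʳ (sym r) (≮⇒≥ λ r′ → ¬p (u , p , q , r′)) })
        attain : (∀ u → a ≤ u → u ≤ b → m ≤ h u) → (∀ ε → 0# < ε → ∃ λ u → a ≤ u × u ≤ b × h u < m + ε) →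
                 ∃ λ s → a ≤ s × s ≤ b × (∀ y → a ≤ y → y ≤ b → h s ≤ h y)
        attain lower near with supremum (ExtremeValue.T a≤b h K 0≤K lip m lower near)
          (a , ExtremeValue.T-a a≤b h K 0≤K lip m lower near) (b , λ t p → proj₁ (proj₂ p))
        ... | s , ub , lub = s , A.a≤s , A.s≤b , λ y p q → ≤-trans A.hs≤m (lower y p q)
          where module A = ExtremeValue.AtSup a≤b h K 0≤K lip m lower near s ub lub

    ∣x∣≤⇒ : ∀ {x y} → ∣ x ∣ ≤ y → - y ≤ x × x ≤ y
    ∣x∣≤⇒ {x} p = -x≤y⇒-y≤x (≤-trans (-x≤∣x∣ x) p) , ≤-trans (x≤∣x∣ x) p

    ⇒∣x∣≤ : ∀ {x y} → - y ≤ x → x ≤ y → ∣ x ∣ ≤ y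
    ⇒∣x∣≤ p q = ∣x∣≤ q (-x≤y⇒-y≤x p)

    LocallyLipschitz : (ℝ → ℝ → ℝ) → Set
    LocallyLipschitz f = ∀ C → 0# ≤ C → ∃ λ K → 0# ≤ K × (∀ x y x′ y′ →
      ∣ x ∣ ≤ C → ∣ y ∣ ≤ C → ∣ x′ ∣ ≤ C → ∣ y′ ∣ ≤ C → ∣ f x y - f x′ y′ ∣ ≤ K * (∣ x - x′ ∣ + ∣ y - y′ ∣))

    module _ (f : ℝ → ℝ → ℝ) (lip : LocallyLipschitz f) (B : ℝ) (0≤B : 0# ≤ B) where

      private
        -B≤B : - B ≤ B
        -B≤B = ≤-trans (neg-mono-≤ 0≤B) (≤-respˡ (solve 0 (𝟘 := :- 𝟘) refl) 0≤B)

        x-x≈0 : ∀ x → ∣ x - x ∣ ≈ 0#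
        x-x≈0 x = ≈0⇒∣x∣≈0 (-‿inverseʳ x)

        column : ∀ x → ∃ λ y → - B ≤ y × y ≤ B × (∀ y′ → - B ≤ y′ → y′ ≤ B → f x y ≤ f x y′)
        column x with lip (∣ x ∣ + B) (0≤x+y (0≤∣x∣ x) 0≤B)
        ... | K , 0≤K , p = extreme-value -B≤B (f x) K 0≤K λ y y′ q₁ q₂ q₃ q₄ →
          ≤-respʳ (*-congˡ (trans (+-congʳ (x-x≈0 x)) (+-identityˡ _)))
            (p x y x y′ (x≤x+y 0≤B) (wide (⇒∣x∣≤ q₁ q₂)) (x≤x+y 0≤B) (wide (⇒∣x∣≤ q₃ q₄)))
          where
          wide : ∀ {y} → ∣ y ∣ ≤ B → ∣ y ∣ ≤ ∣ x ∣ + B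
          wide q = ≤-trans q (y≤x+y (0≤∣x∣ x))

        g : ℝ → ℝ
        g x = f x (proj₁ (column x))

        g-≤ : ∀ x y → ∣ y ∣ ≤ B → g x ≤ f x y
        g-≤ x y p = proj₂ (proj₂ (proj₂ (column x))) y (proj₁ (∣x∣≤⇒ p)) (proj₂ (∣x∣≤⇒ p))

        arg-≤ : ∀ x → ∣ proj₁ (column x) ∣ ≤ B
        arg-≤ x = ⇒∣x∣≤ (proj₁ (proj₂ (column x))) (proj₁ (proj₂ (proj₂ (column x))))

        -- Evaluating `f x` at the minimiser belonging to x′ bounds g x - g x′ by a difference of f
        -- in the first variable alone; exchanging x and x′ gives the other sign.
        g-lip : ∀ K → (∀ x y x′ y′ → ∣ x ∣ ≤ B → ∣ y ∣ ≤ B → ∣ x′ ∣ ≤ B → ∣ y′ ∣ ≤ B →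
                  ∣ f x y - f x′ y′ ∣ ≤ K * (∣ x - x′ ∣ + ∣ y - y′ ∣)) → Lipschitz K (- B) B g
        g-lip K p x x′ q₁ q₂ q₃ q₄ = ∣x-y∣≤ (half-lip x x′ (⇒∣x∣≤ q₁ q₂) (⇒∣x∣≤ q₃ q₄))
            (≤-respʳ (*-congˡ (∣x-y∣≈∣y-x∣ x′ x)) (half-lip x′ x (⇒∣x∣≤ q₃ q₄) (⇒∣x∣≤ q₁ q₂)))
          where
          half-lip : ∀ x x′ → ∣ x ∣ ≤ B → ∣ x′ ∣ ≤ B → g x - g x′ ≤ K * ∣ x - x′ ∣
          half-lip x x′ r r′ = let y = proj₁ (column x′) in
            ≤-trans (+-monoˡ-≤ (- g x′) (g-≤ x y (arg-≤ x′))) (≤-trans (x≤∣x∣ _)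
              (≤-respʳ (*-congˡ (trans (+-congˡ (x-x≈0 y)) (+-identityʳ _))) (p x y x′ y r (arg-≤ x′) r′ (arg-≤ x′))))

      -- Minimising over y for each x and then over x uses only the one-dimensional theorem, so
      -- compactness in the plane is avoided.
      box-minimum : ∃ λ x → ∃ λ y → ∣ x ∣ ≤ B × ∣ y ∣ ≤ B × (∀ x′ y′ → ∣ x′ ∣ ≤ B → ∣ y′ ∣ ≤ B → f x y ≤ f x′ y′)
      box-minimum =
        let K , 0≤K , p = lip B 0≤B
        in finish (extreme-value -B≤B g K 0≤K (g-lip K p))
        where
        finish : (∃ λ x → - B ≤ x × x ≤ B × (∀ x′ → - B ≤ x′ → x′ ≤ B → g x ≤ g x′)) →
                 ∃ λ x → ∃ λ y → ∣ x ∣ ≤ B × ∣ y ∣ ≤ B × (∀ x′ y′ → ∣ x′ ∣ ≤ B → ∣ y′ ∣ ≤ B → f x y ≤ f x′ y′)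
        finish (x , q₁ , q₂ , q) = x , proj₁ (column x) , ⇒∣x∣≤ q₁ q₂ , arg-≤ x ,
          λ x′ y′ r r′ → ≤-trans (q x′ (proj₁ (∣x∣≤⇒ r)) (proj₂ (∣x∣≤⇒ r))) (g-≤ x′ y′ r′)

    ⟨⟩-bounded : ∀ cs B → 0# ≤ B → ∃ λ M → 0# ≤ M × (∀ z → ‖ z ‖ ≤ B → ‖ cs ⟨ z ⟩ ‖ ≤ M)
    ⟨⟩-bounded []       B 0≤B = 0# , ≤-refl , λ z _ → ≤-reflexive ‖0‖≈0
    ⟨⟩-bounded (c ∷ cs) B 0≤B with ⟨⟩-bounded cs B 0≤B
    ... | M , 0≤M , p = ‖ c ‖ + B * M , 0≤x+y (0≤‖‖ c) (0≤x*y 0≤B 0≤M) , λ z q →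
      ≤-trans (‖+‖≤ c (z *ᶜ cs ⟨ z ⟩)) (+-monoʳ-≤ ‖ c ‖ (≤-trans (‖*‖≤ z (cs ⟨ z ⟩)) (*-mono-≤ (0≤‖‖ z) (0≤‖‖ (cs ⟨ z ⟩)) q (p z q))))

    ⟨⟩-lipschitz : ∀ cs B → 0# ≤ B → ∃ λ K → 0# ≤ K ×
      (∀ z w → ‖ z ‖ ≤ B → ‖ w ‖ ≤ B → ‖ cs ⟨ z ⟩ -ᶜ cs ⟨ w ⟩ ‖ ≤ K * ‖ z -ᶜ w ‖)
    ⟨⟩-lipschitz [] B 0≤B = 0# , ≤-refl , λ z w _ _ →
      ≤-reflexive (trans (‖‖-cong {0ᶜ -ᶜ 0ᶜ} {0ᶜ} (ℂᶠ.-‿inverseʳ 0ᶜ)) (trans ‖0‖≈0 (sym (zeroˡ _))))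
    ⟨⟩-lipschitz (c ∷ cs) B 0≤B with ⟨⟩-bounded cs B 0≤B | ⟨⟩-lipschitz cs B 0≤B
    ... | M , 0≤M , p | K , 0≤K , q = M + B * K , 0≤x+y 0≤M (0≤x*y 0≤B 0≤K) , λ z w z≤B w≤B → step z w (cs ⟨ z ⟩) (cs ⟨ w ⟩) (p z z≤B) (q z w z≤B w≤B) w≤B
      where
      open ≤-Reasoning
      step : ∀ z w P Q → ‖ P ‖ ≤ M → ‖ P -ᶜ Q ‖ ≤ K * ‖ z -ᶜ w ‖ → ‖ w ‖ ≤ B →
             ‖ (c +ᶜ z *ᶜ P) -ᶜ (c +ᶜ w *ᶜ Q) ‖ ≤ (M + B * K) * ‖ z -ᶜ w ‖
      step z w P Q P≤M PQ≤ w≤B = begin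
        ‖ (c +ᶜ z *ᶜ P) -ᶜ (c +ᶜ w *ᶜ Q) ‖
          ≈⟨ ‖‖-cong (solveᶜ 5 (λ c z w p q → (c :+ᶜ z :*ᶜ p) :-ᶜ (c :+ᶜ w :*ᶜ q) :=ᶜ (z :-ᶜ w) :*ᶜ p :+ᶜ w :*ᶜ (p :-ᶜ q)) ℂᶠ.refl c z w P Q) ⟩
        ‖ (z -ᶜ w) *ᶜ P +ᶜ w *ᶜ (P -ᶜ Q) ‖
          ≤⟨ ‖+‖≤ ((z -ᶜ w) *ᶜ P) (w *ᶜ (P -ᶜ Q)) ⟩
        ‖ (z -ᶜ w) *ᶜ P ‖ + ‖ w *ᶜ (P -ᶜ Q) ‖
          ≤⟨ +-mono-≤ (≤-trans (‖*‖≤ (z -ᶜ w) P) (*-monoˡ-≤ (0≤‖‖ (z -ᶜ w)) P≤M))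
                      (≤-trans (‖*‖≤ w (P -ᶜ Q)) (*-mono-≤ (0≤‖‖ w) (0≤‖‖ (P -ᶜ Q)) w≤B PQ≤)) ⟩
        ‖ z -ᶜ w ‖ * M + B * (K * ‖ z -ᶜ w ‖)
          ≈⟨ solve 4 (λ d m b k → d :* m :+ b :* (k :* d) := (m :+ b :* k) :* d) refl (‖ z -ᶜ w ‖) M B K ⟩
        (M + B * K) * ‖ z -ᶜ w ‖ ∎

    ∣N-N∣≤ : ∀ u v → ∣ N u - N v ∣ ≤ (‖ u ‖ + ‖ v ‖) * ‖ u -ᶜ v ‖
    ∣N-N∣≤ u v = begin
      ∣ N u - N v ∣
        ≈⟨ ∣∣-cong (solve 4 (λ a b c d → (a :* a :+ b :* b) :- (c :* c :+ d :* d) := (a :+ c) :* (a :- c) :+ (b :+ d) :* (b :- d)) refl (re u) (im u) (re v) (im v)) ⟩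
      ∣ (re u + re v) * (re u - re v) + (im u + im v) * (im u - im v) ∣
        ≤⟨ ≤-trans (∣x+y∣≤∣x∣+∣y∣ _ _) (≤-reflexive (+-cong (∣x*y∣≈∣x∣*∣y∣ (re u + re v) (re u - re v)) (∣x*y∣≈∣x∣*∣y∣ (im u + im v) (im u - im v)))) ⟩
      ∣ re u + re v ∣ * ∣ re u - re v ∣ + ∣ im u + im v ∣ * ∣ im u - im v ∣
        ≤⟨ +-mono-≤ (*-monoʳ-≤ (0≤∣x∣ (re u - re v)) (≤-trans (x≤x+y (0≤∣x∣ (im u + im v))) (‖+‖≤ u v)))
                    (*-monoʳ-≤ (0≤∣x∣ (im u - im v)) (≤-trans (y≤x+y (0≤∣x∣ (re u + re v))) (‖+‖≤ u v))) ⟩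
      (‖ u ‖ + ‖ v ‖) * ∣ re u - re v ∣ + (‖ u ‖ + ‖ v ‖) * ∣ im u - im v ∣
        ≈⟨ sym (distribˡ _ _ _) ⟩
      (‖ u ‖ + ‖ v ‖) * ‖ u -ᶜ v ‖ ∎
      where open ≤-Reasoning

    N⟨⟩-lipschitz : ∀ cs → LocallyLipschitz (λ x y → N (cs ⟨ x +i y ⟩))
    N⟨⟩-lipschitz cs C 0≤C with ⟨⟩-bounded cs (C + C) (0≤x+y 0≤C 0≤C) | ⟨⟩-lipschitz cs (C + C) (0≤x+y 0≤C 0≤C)
    ... | M , 0≤M , p | K , 0≤K , q = (M + M) * K , 0≤x*y (0≤x+y 0≤M 0≤M) 0≤K , λ x y x′ y′ x≤ y≤ x′≤ y′≤ →
      let z = x +i y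
          w = x′ +i y′
          z≤ = +-mono-≤ x≤ y≤
          w≤ = +-mono-≤ x′≤ y′≤
      in ≤-trans (∣N-N∣≤ (cs ⟨ z ⟩) (cs ⟨ w ⟩)) (≤-respʳ (sym (*-assoc _ _ _))
           (*-mono-≤ (0≤x+y (0≤‖‖ (cs ⟨ z ⟩)) (0≤‖‖ (cs ⟨ w ⟩))) (0≤‖‖ (cs ⟨ z ⟩ -ᶜ cs ⟨ w ⟩))
             (+-mono-≤ (p z z≤) (p w w≤)) (q z w z≤ w≤)))

    ‖w‖-‖v‖≤‖v+w‖ : ∀ v w → ‖ w ‖ - ‖ v ‖ ≤ ‖ v +ᶜ w ‖
    ‖w‖-‖v‖≤‖v+w‖ v w = ≤-by (x≤y⇒0≤y-x (≤-respˡ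
        (‖‖-cong (solveᶜ 2 (λ v w → (v :+ᶜ w) :+ᶜ (𝟘ᶜ :-ᶜ v) :=ᶜ w) ℂᶠ.refl v w))
        (≤-respʳ (+-congˡ (trans (‖‖-cong (ℂᶠ.+-identityˡ (-ᶜ v))) (‖-‖ v))) (‖+‖≤ (v +ᶜ w) (0ᶜ -ᶜ v)))))
      (solve 3 (λ a b c → c :- (b :- a) := (c :+ a) :- b) refl (‖ v ‖) (‖ w ‖) (‖ v +ᶜ w ‖))

    -- ‖ c + z w ‖ ≥ ½ ‖ z ‖ ‖ w ‖ - ‖ c ‖, so a monic polynomial of positive degree grows without bound.
    monic-grows : ∀ {n cs} → MonicOfDegree n cs → ∀ M → ∃ λ B → 0# ≤ B × (∀ z → B ≤ ‖ z ‖ → 1# ≤ ‖ cs ⟨ z ⟩ ‖) ×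
                  (1 ℕ.≤ n → ∀ z → B ≤ ‖ z ‖ → M ≤ ‖ cs ⟨ z ⟩ ‖)
    monic-grows ([_] {c} c≈1) M = 0# , ≤-refl , (λ z _ → ≤-reflexive (sym (trans
        (‖‖-cong {(c ∷ []) ⟨ z ⟩} {1ᶜ} (ℂᶠ.trans (ℂᶠ.+-congˡ {c} (ℂᶠ.zeroʳ z)) (ℂᶠ.trans (ℂᶠ.+-identityʳ c) c≈1)))
        (trans (+-cong (0≤x⇒∣x∣≈x 0≤1) ∣0∣≈0) (+-identityʳ 1#))))) , λ ()
    monic-grows (_∷_ {cs = cs} c m) M with monic-grows m 0#
    ... | B , 0≤B , p , _ = B + num 2 * (A + ‖ c ‖) , 0≤x+y 0≤B (0≤x*y (inj₁ 0<2) (0≤x+y 0≤A (0≤‖‖ c))) ,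
      (λ z q → ≤-trans (x≤x+y (0≤∣x∣ M)) (grow z q)) ,
      λ _ z q → ≤-trans (≤-trans (x≤∣x∣ M) (y≤x+y 0≤1)) (grow z q)
      where
      A = 1# + ∣ M ∣
      0≤A = 0≤x+y 0≤1 (0≤∣x∣ M)
      grow : ∀ z → B + num 2 * (A + ‖ c ‖) ≤ ‖ z ‖ → A ≤ ‖ c +ᶜ z *ᶜ cs ⟨ z ⟩ ‖
      grow z q = *-cancelˡ-≤ 0<2 (begin
        num 2 * A
          ≤⟨ ≤-by (0≤x+y 0≤B (x≤y⇒0≤y-x q)) (solve 4 (λ b a c z → (z :- 𝟚 :* c) :- 𝟚 :* a := b :+ (z :- (b :+ 𝟚 :* (a :+ c)))) refl B A (‖ c ‖) (‖ z ‖)) ⟩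
        ‖ z ‖ - num 2 * ‖ c ‖
          ≤⟨ +-monoˡ-≤ _ (≤-respˡ (*-identityʳ ‖ z ‖) (*-monoˡ-≤ (0≤‖‖ z) (p z (≤-trans (x≤x+y (0≤x*y (inj₁ 0<2) (0≤x+y 0≤A (0≤‖‖ c)))) q)))) ⟩
        ‖ z ‖ * ‖ cs ⟨ z ⟩ ‖ - num 2 * ‖ c ‖
          ≤⟨ +-monoˡ-≤ _ (‖‖*‖‖≤2‖*‖ z (cs ⟨ z ⟩)) ⟩
        num 2 * ‖ z *ᶜ cs ⟨ z ⟩ ‖ - num 2 * ‖ c ‖
          ≈⟨ solve 2 (λ a b → 𝟚 :* a :- 𝟚 :* b := 𝟚 :* (a :- b)) refl (‖ z *ᶜ cs ⟨ z ⟩ ‖) (‖ c ‖) ⟩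
        num 2 * (‖ z *ᶜ cs ⟨ z ⟩ ‖ - ‖ c ‖)
          ≤⟨ *-monoˡ-≤ (inj₁ 0<2) (‖w‖-‖v‖≤‖v+w‖ c (z *ᶜ cs ⟨ z ⟩)) ⟩
        num 2 * ‖ c +ᶜ z *ᶜ cs ⟨ z ⟩ ‖ ∎)
        where open ≤-Reasoning

  -- Existence of a root of a monic complex polynomial.

  module Roots where

    open RealField
    open Complex
    open FundamentalTheoremOfAlgebra
    open IntegerSolver ℂ-commutativeRing using () renaming
      (solve to solveᶜ; _:+_ to _:+ᶜ_; _:*_ to _:*ᶜ_; _:-_ to _:-ᶜ_; :-_ to :-ᶜ_; _:=_ to _:=ᶜ_; 𝟘 to 𝟘ᶜ; 𝟙 to 𝟙ᶜ)
    open Algebra.Properties.CommutativeSemiring.Exp ℂᶠ.commutativeSemiring using ()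
      renaming (^-distrib-* to ^ᶜ-distrib-*; ^-homo-* to ^ᶜ-homo-*; ^-congˡ to ^ᶜ-congˡ)

    1ᶜ≉0 : ¬ (1ᶜ ≈ᶜ 0ᶜ)
    1ᶜ≉0 (p , _) = 0≉1 p

    -- Divide by X - x as long as x is a root. This ends with a nonvanishing cofactor because the
    -- degree drops and a monic constant is 1.
    vanishing-order : ∀ {n cs} → MonicOfDegree n cs → ∀ x → ∃₂ λ k g → ¬ (g ⟨ x ⟩ ≈ᶜ 0ᶜ) ×
                      (∀ z → cs ⟨ z ⟩ ≈ᶜ (z -ᶜ x) ^ᶜ k *ᶜ g ⟨ z ⟩)
    vanishing-order {cs = c ∷ []} [ c≈1 ] x = 0 , c ∷ [] ,
      (λ p → 1ᶜ≉0 (ℂᶠ.trans (ℂᶠ.sym c≈1) (ℂᶠ.trans (solveᶜ 2 (λ c x → c :=ᶜ c :+ᶜ x :*ᶜ 𝟘ᶜ) ℂᶠ.refl c x) p))) ,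
      λ z → ℂᶠ.sym (ℂᶠ.*-identityˡ ((c ∷ []) ⟨ z ⟩))
    vanishing-order {cs = cs} m@(_ ∷ _) x with em {cs ⟨ x ⟩ ≈ᶜ 0ᶜ}
    ... | no p  = 0 , cs , p , λ z → ℂᶠ.sym (ℂᶠ.*-identityˡ (cs ⟨ z ⟩))
    ... | yes p = let k , g , g≉0 , q = vanishing-order (quot-monic x m) x in suc k , g , g≉0 , λ z →
      ℂᶠ.trans (⟨⟩-quot cs x z) (ℂᶠ.trans (ℂᶠ.+-cong p (ℂᶠ.*-congˡ {z -ᶜ x} (q z)))
        (solveᶜ 3 (λ a b c → 𝟘ᶜ :+ᶜ a :*ᶜ (b :*ᶜ c) :=ᶜ (a :*ᶜ b) :*ᶜ c) ℂᶠ.refl (z -ᶜ x) ((z -ᶜ x) ^ᶜ k) (g ⟨ z ⟩)))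

    half-or-odd : ∀ m → (∃ λ j → m ≡ j ℕ.+ j) ⊎ (∃ λ j → m ≡ suc (j ℕ.+ j))
    half-or-odd zero = inj₁ (0 , ≡.refl)
    half-or-odd (suc m) with half-or-odd m
    ... | inj₁ (j , p) = inj₂ (j , ≡.cong suc p)
    ... | inj₂ (j , p) = inj₁ (suc j , ≡.cong suc (≡.trans p (≡.sym (ℕ.+-suc j j))))

    iᶜ : ℂ
    iᶜ = 0# +i 1#

    i^2j : ∀ j → im (iᶜ ^ᶜ (j ℕ.+ j)) ≈ 0# × ¬ (re (iᶜ ^ᶜ (j ℕ.+ j)) ≈ 0#)
    i^2j zero = refl , 0≉1
    i^2j (suc j) rewrite ℕ.+-suc j j = let p , q = i^2j j in step (iᶜ ^ᶜ (j ℕ.+ j)) p q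
      where
      step : ∀ z → im z ≈ 0# → ¬ (re z ≈ 0#) → im (iᶜ *ᶜ (iᶜ *ᶜ z)) ≈ 0# × ¬ (re (iᶜ *ᶜ (iᶜ *ᶜ z)) ≈ 0#)
      step z p q =
        trans (solve 2 (λ a b → 𝟘 :* (𝟘 :* b :+ 𝟙 :* a) :+ 𝟙 :* (𝟘 :* a :- 𝟙 :* b) := :- b) refl (re z) (im z))
          (trans (-‿cong p) (solve 0 (:- 𝟘 := 𝟘) refl)) ,
        λ r → q (trans (solve 2 (λ a b → a := :- (𝟘 :* (𝟘 :* a :- 𝟙 :* b) :- 𝟙 :* (𝟘 :* b :+ 𝟙 :* a))) refl (re z) (im z))
          (trans (-‿cong r) (solve 0 (:- 𝟘 := 𝟘) refl)))

    [-w]^2j : ∀ w j → (-ᶜ w) ^ᶜ (j ℕ.+ j) ≈ᶜ w ^ᶜ (j ℕ.+ j)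
    [-w]^2j w zero = ℂᶠ.refl
    [-w]^2j w (suc j) rewrite ℕ.+-suc j j = ℂᶠ.trans (ℂᶠ.*-congˡ { -ᶜ w} (ℂᶠ.*-congˡ { -ᶜ w} ([-w]^2j w j)))
      (solveᶜ 2 (λ w p → (:-ᶜ w) :*ᶜ ((:-ᶜ w) :*ᶜ p) :=ᶜ w :*ᶜ (w :*ᶜ p)) ℂᶠ.refl w (w ^ᶜ (j ℕ.+ j)))

    1ᶜ^n : ∀ n → 1ᶜ ^ᶜ n ≈ᶜ 1ᶜ
    1ᶜ^n zero    = ℂᶠ.refl
    1ᶜ^n (suc n) = ℂᶠ.trans (ℂᶠ.*-identityˡ (1ᶜ ^ᶜ n)) (1ᶜ^n n)

    -- For odd m, one of w = ±1, ±i works; for even m, take a square root.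
    descent-direction : ∀ b m → m ℕ.≤ b → 1 ℕ.≤ m → ∀ u → ¬ (u ≈ᶜ 0ᶜ) → ∃ λ w → re (u *ᶜ w ^ᶜ m) < 0#
    descent-direction zero    zero    _ () u u≉0
    descent-direction (suc b) m m≤b 1≤m u u≉0 with half-or-odd m
    ... | inj₁ (zero , ≡.refl) = ⊥-elim (ℕ.n≮0 1≤m)
    ... | inj₁ (suc j , ≡.refl) =
      let v , p = descent-direction b (suc j) (ℕ.≤-trans (ℕ.m≤n+m (suc j) j) (ℕ.≤-pred m≤b)) (s≤s z≤n) u u≉0
          w , w²≈v = √ᶜ-exists v
      in w , <-respˡ-≈ (proj₁ (ℂᶠ.*-congˡ {u} (ℂᶠ.trans (ℂᶠ.sym (^ᶜ-congˡ (suc j) w²≈v))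
               (ℂᶠ.trans (^ᶜ-distrib-* w w (suc j)) (ℂᶠ.sym (^ᶜ-homo-* w (suc j) (suc j))))))) p
    ... | inj₂ (j , ≡.refl) = choose (em {re u ≈ 0#})
      where
      odd : ∀ w → (-ᶜ w) ^ᶜ suc (j ℕ.+ j) ≈ᶜ -ᶜ (w ^ᶜ suc (j ℕ.+ j))
      odd w = ℂᶠ.trans (ℂᶠ.*-congˡ { -ᶜ w} ([-w]^2j w j))
        (solveᶜ 2 (λ w p → (:-ᶜ w) :*ᶜ p :=ᶜ :-ᶜ (w :*ᶜ p)) ℂᶠ.refl w (w ^ᶜ (j ℕ.+ j)))
      flip-sign : ∀ w → ¬ (re (u *ᶜ w ^ᶜ m) ≈ 0#) → ∃ λ w → re (u *ᶜ w ^ᶜ m) < 0#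
      flip-sign w p with compare (re (u *ᶜ w ^ᶜ m)) 0#
      ... | tri< q _ _ = w , q
      ... | tri≈ _ q _ = ⊥-elim (p q)
      ... | tri> _ _ q = -ᶜ w , <-respˡ-≈ (sym (proj₁ (ℂᶠ.trans (ℂᶠ.*-congˡ {u} (odd w))
          (solveᶜ 2 (λ u p → u :*ᶜ (:-ᶜ p) :=ᶜ :-ᶜ (u :*ᶜ p)) ℂᶠ.refl u (w ^ᶜ m)))))
          (<-respʳ-≈ (solve 0 (:- 𝟘 := 𝟘) refl) (neg-mono-< q))
      choose : Dec (re u ≈ 0#) → ∃ λ w → re (u *ᶜ w ^ᶜ m) < 0#
      choose (no p) = flip-sign 1ᶜ λ q → p (trans (sym (proj₁ (ℂᶠ.trans (ℂᶠ.*-congˡ {u} (1ᶜ^n m)) (ℂᶠ.*-identityʳ u)))) q)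
      choose (yes p) = flip-sign iᶜ λ q → *-≉0 (λ r → u≉0 (p , r)) (proj₂ (i^2j j)) (trans (calc (iᶜ ^ᶜ (j ℕ.+ j)) (proj₁ (i^2j j)))
          (trans (-‿cong q) (solve 0 (:- 𝟘 := 𝟘) refl)))
        where
        calc : ∀ z → im z ≈ 0# → im u * re z ≈ - re (u *ᶜ (iᶜ *ᶜ z))
        calc z q = trans (sym (trans (+-cong (*-congʳ {im z} (trans (*-identityʳ (re u)) p)) refl) (trans (+-congʳ (zeroˡ (im z))) (+-identityˡ _))))
          (solve 4 (λ a b c d → a :* 𝟙 :* d :+ b :* c := :- (a :* (𝟘 :* c :- 𝟙 :* d) :- b :* (𝟘 :* d :+ 𝟙 :* c))) refl (re u) (im u) (re z) (im z))

    fromℝ-^ : ∀ x n → fromℝ x ^ᶜ n ≈ᶜ fromℝ (x ^ n)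
    fromℝ-^ x zero    = ℂᶠ.refl
    fromℝ-^ x (suc n) = ℂᶠ.trans (ℂᶠ.*-congˡ {fromℝ x} (fromℝ-^ x n))
      (solve 2 (λ a b → a :* b :- 𝟘 :* 𝟘 := a :* b) refl x (x ^ n) , solve 2 (λ a b → a :* 𝟘 :+ 𝟘 :* b := 𝟘) refl x (x ^ n))

    conj : ℂ → ℂ
    conj z = re z +i (- im z)

    -- Near a point x where the polynomial does not vanish, it is p + (z - x)^m g(z) with g(x) ≠ 0.
    private
      module Descent (p w wᵐ : ℂ) (m : ℕ) (wᵐ≈ : wᵐ ≈ᶜ w ^ᶜ suc m) (x : ℂ) (g : List ℂ)
                     (neg : re (conj p *ᶜ g ⟨ x ⟩ *ᶜ wᵐ) < 0#) where

        E : ℂ → ℂ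
        E z = wᵐ *ᶜ g ⟨ z ⟩

        D : ℂ → ℝ
        D z = re p * re (E z) + im p * im (E z)

        η : ℝ
        η = half (- D x)

        0<η : 0# < η
        0<η = 0<half (0<-x (<-respˡ-≈ (solve 6 (λ a b c d e f →
            (a :* c :- :- b :* d) :* e :- (a :* d :+ :- b :* c) :* f := a :* (e :* c :- f :* d) :+ b :* (e :* d :+ f :* c))
            refl (re p) (im p) (re (g ⟨ x ⟩)) (im (g ⟨ x ⟩)) (re wᵐ) (im wᵐ)) neg))

        point : ℝ → ℂ
        point t = x +ᶜ fromℝ t *ᶜ w

        0≤B : 0# ≤ ‖ x ‖ + ‖ w ‖
        0≤B = 0≤x+y (0≤‖‖ x) (0≤‖‖ w)

        ‖tw‖ : ∀ t → 0# ≤ t → ‖ fromℝ t *ᶜ w ‖ ≤ t * ‖ w ‖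
        ‖tw‖ t 0≤t = ≤-respʳ (*-congʳ (trans (+-cong (0≤x⇒∣x∣≈x 0≤t) ∣0∣≈0) (+-identityʳ t))) (‖*‖≤ (fromℝ t) w)

        ‖point‖≤ : ∀ t → 0# ≤ t → t ≤ 1# → ‖ point t ‖ ≤ ‖ x ‖ + ‖ w ‖
        ‖point‖≤ t 0≤t t≤1 = ≤-trans (‖+‖≤ x (fromℝ t *ᶜ w)) (+-monoʳ-≤ ‖ x ‖ (≤-trans (‖tw‖ t 0≤t)
          (≤-respʳ (*-identityˡ ‖ w ‖) (*-monoʳ-≤ (0≤‖‖ w) t≤1))))

        module _ (M K : ℝ) (0≤M : 0# ≤ M) (0≤K : 0# ≤ K) (bounded : ∀ z → ‖ z ‖ ≤ ‖ x ‖ + ‖ w ‖ → ‖ g ⟨ z ⟩ ‖ ≤ M)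
                 (lip : ∀ z z′ → ‖ z ‖ ≤ ‖ x ‖ + ‖ w ‖ → ‖ z′ ‖ ≤ ‖ x ‖ + ‖ w ‖ → ‖ g ⟨ z ⟩ -ᶜ g ⟨ z′ ⟩ ‖ ≤ K * ‖ z -ᶜ z′ ‖) where

          C′ K₂ t τ : ℝ
          C′ = ‖ p ‖ * (‖ wᵐ ‖ * (K * ‖ w ‖))
          K₂ = (‖ wᵐ ‖ * M) * (‖ wᵐ ‖ * M)

          0≤C′ : 0# ≤ C′
          0≤C′ = 0≤x*y (0≤‖‖ p) (0≤x*y (0≤‖‖ wᵐ) (0≤x*y 0≤K (0≤‖‖ w)))

          0≤K₂ : 0# ≤ K₂
          0≤K₂ = 0≤x² (‖ wᵐ ‖ * M)

          0<den : 0# < η + (C′ + K₂)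
          0<den = 0<x+y′ 0<η (0≤x+y 0≤C′ 0≤K₂)

          -- One step length serves three ends: t ≤ 1, t C′ ≤ η, which controls the change of D, and
          -- t K₂ ≤ η, which controls the quadratic term.
          t = η / (η + (C′ + K₂))
          τ = t ^ suc m

          0<t : 0# < t
          0<t = 0<x/y 0<η 0<den

          t*den : (η + (C′ + K₂)) * t ≈ η
          t*den = *-/-cancel η 0<den

          t*≤ : ∀ {y} → 0# ≤ y → y ≤ η + (C′ + K₂) → t * y ≤ η
          t*≤ p q = ≤-respʳ (trans (*-comm _ _) t*den) (*-monoˡ-≤ (inj₁ 0<t) q)

          tC′≤η : t * C′ ≤ η
          tC′≤η = t*≤ 0≤C′ (≤-trans (x≤x+y 0≤K₂) (y≤x+y (inj₁ 0<η)))

          tK₂≤η : t * K₂ ≤ η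
          tK₂≤η = t*≤ 0≤K₂ (≤-trans (y≤x+y 0≤C′) (y≤x+y (inj₁ 0<η)))

          t≤1 : t ≤ 1#
          t≤1 = *-cancelˡ-≤ 0<den (≤-respˡ (sym t*den) (≤-respʳ (sym (*-identityʳ _)) (x≤x+y (0≤x+y 0≤C′ 0≤K₂))))

          τ≤t : τ ≤ t
          τ≤t = ≤-respʳ (*-identityʳ t) (*-monoˡ-≤ (inj₁ 0<t) (x^n≤1 m (inj₁ 0<t) t≤1))

          y : ℂ
          y = point t

          y≤ : ‖ y ‖ ≤ ‖ x ‖ + ‖ w ‖
          y≤ = ‖point‖≤ t (inj₁ 0<t) t≤1

          D-close : D y - D x ≤ η
          D-close = begin
            D y - D x
              ≈⟨ solve 6 (λ a b c d e f → (a :* c :+ b :* d) :- (a :* e :+ b :* f) := a :* (c :- e) :+ b :* (d :- f)) refl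
                   (re p) (im p) (re (E y)) (im (E y)) (re (E x)) (im (E x)) ⟩
            re p * re d + im p * im d
              ≤⟨ +-mono-≤ (≤-trans (x≤∣x∣ _) (≤-reflexive (∣x*y∣≈∣x∣*∣y∣ (re p) (re d)))) (≤-trans (x≤∣x∣ _) (≤-reflexive (∣x*y∣≈∣x∣*∣y∣ (im p) (im d)))) ⟩
            ∣ re p ∣ * ∣ re d ∣ + ∣ im p ∣ * ∣ im d ∣
              ≤⟨ +-mono-≤ (*-monoʳ-≤ (0≤∣x∣ (re d)) (x≤x+y (0≤∣x∣ (im p)))) (*-monoʳ-≤ (0≤∣x∣ (im d)) (y≤x+y (0≤∣x∣ (re p)))) ⟩
            ‖ p ‖ * ∣ re d ∣ + ‖ p ‖ * ∣ im d ∣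
              ≈⟨ sym (distribˡ ‖ p ‖ ∣ re d ∣ ∣ im d ∣) ⟩
            ‖ p ‖ * ‖ d ‖
              ≤⟨ *-monoˡ-≤ (0≤‖‖ p) d≤ ⟩
            ‖ p ‖ * (‖ wᵐ ‖ * (K * (t * ‖ w ‖)))
              ≈⟨ solve 5 (λ p w k t v → p :* (w :* (k :* (t :* v))) := t :* (p :* (w :* (k :* v)))) refl (‖ p ‖) (‖ wᵐ ‖) K t (‖ w ‖) ⟩
            t * C′
              ≤⟨ tC′≤η ⟩
            η ∎
            where
            open ≤-Reasoning
            d : ℂ
            d = E y -ᶜ E x
            d≤ : ‖ d ‖ ≤ ‖ wᵐ ‖ * (K * (t * ‖ w ‖))
            d≤ = ≤-respˡ (‖‖-cong {wᵐ *ᶜ (g ⟨ y ⟩ -ᶜ g ⟨ x ⟩)} {d} (solveᶜ 3 (λ w a b → w :*ᶜ (a :-ᶜ b) :=ᶜ w :*ᶜ a :-ᶜ w :*ᶜ b) ℂᶠ.refl wᵐ (g ⟨ y ⟩) (g ⟨ x ⟩)))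
              (≤-trans (‖*‖≤ wᵐ (g ⟨ y ⟩ -ᶜ g ⟨ x ⟩)) (*-monoˡ-≤ (0≤‖‖ wᵐ) (≤-trans (lip y x y≤ (x≤x+y (0≤‖‖ w)))
                (*-monoˡ-≤ 0≤K (≤-respˡ (‖‖-cong {fromℝ t *ᶜ w} {y -ᶜ x} (solveᶜ 2 (λ x v → v :=ᶜ (x :+ᶜ v) :-ᶜ x) ℂᶠ.refl x (fromℝ t *ᶜ w)))
                   (‖tw‖ t (inj₁ 0<t)))))))

          NE≤ : N (E y) ≤ K₂
          NE≤ = ≤-trans (N≤‖‖² (E y)) (*-mono-≤ (0≤‖‖ (E y)) (0≤‖‖ (E y)) e≤ e≤)
            where e≤ = ≤-trans (‖*‖≤ wᵐ (g ⟨ y ⟩)) (*-monoˡ-≤ (0≤‖‖ wᵐ) (bounded y y≤))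

          -- Expanding, N p - N (p + τ E) = τ (-2 D y - τ N E). Here D x = -2η and D changes by at
          -- most η, so -2 D y ≥ 2η, while τ N E ≤ η.
          decreases : N (p +ᶜ (y -ᶜ x) ^ᶜ suc m *ᶜ g ⟨ y ⟩) < N p
          decreases = <-by (*-pos (0<x^n (suc m) 0<t) positive) (trans (+-congˡ (-‿cong (N-cong {p +ᶜ (y -ᶜ x) ^ᶜ suc m *ᶜ g ⟨ y ⟩} {p +ᶜ fromℝ τ *ᶜ E y} (ℂᶠ.+-congˡ {p} rewrite-power))))
              (solve 5 (λ a b t e f → (a :* a :+ b :* b) :- ((a :+ (t :* e :- 𝟘 :* f)) :* (a :+ (t :* e :- 𝟘 :* f)) :+ (b :+ (t :* f :+ 𝟘 :* e)) :* (b :+ (t :* f :+ 𝟘 :* e)))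
                  := t :* (:- (𝟚 :* (a :* e :+ b :* f)) :- t :* (e :* e :+ f :* f))) refl (re p) (im p) τ (re (E y)) (im (E y))))
            where
            rewrite-power : (y -ᶜ x) ^ᶜ suc m *ᶜ g ⟨ y ⟩ ≈ᶜ fromℝ τ *ᶜ E y
            rewrite-power = ℂᶠ.trans (ℂᶠ.*-congʳ {g ⟨ y ⟩} (ℂᶠ.trans
                (^ᶜ-congˡ (suc m) (solveᶜ 2 (λ x v → (x :+ᶜ v) :-ᶜ x :=ᶜ v) ℂᶠ.refl x (fromℝ t *ᶜ w)))
                (ℂᶠ.trans (^ᶜ-distrib-* (fromℝ t) w (suc m)) (ℂᶠ.*-cong (fromℝ-^ t (suc m)) (ℂᶠ.sym wᵐ≈)))))
              (ℂᶠ.*-assoc (fromℝ τ) wᵐ (g ⟨ y ⟩))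
            positive : 0# < - (num 2 * D y) - τ * N (E y)
            positive = <-by (0<x+y′ 0<η (0≤x+y (0≤x*y (inj₁ 0<2) (x≤y⇒0≤y-x D-close))
                (x≤y⇒0≤y-x (≤-trans (≤-trans (*-monoˡ-≤ (inj₁ (0<x^n (suc m) 0<t)) NE≤) (*-monoʳ-≤ 0≤K₂ τ≤t)) tK₂≤η))))
              (trans (solve 4 (λ e d tn h → (:- (𝟚 :* d) :- tn) :- 𝟘 := h :+ (𝟚 :* (h :- (d :- (:- (h :+ h)))) :+ (h :- tn))) refl η (D y) (τ * N (E y)) η)
                (+-congˡ (+-congʳ (*-congˡ (+-congˡ (-‿cong (+-congˡ (-‿cong (trans (-‿cong (half+half (- D x))) (solve 1 (λ d → :- :- d := d) refl (D x)))))))))))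

    monic-root : ∀ {n cs} → MonicOfDegree (suc n) cs → ∃ λ z → cs ⟨ z ⟩ ≈ᶜ 0ᶜ
    monic-root {cs = cs} monic = root minimum
      where
      M : ℝ
      -- Large enough that, despite the factor 2 between `N` and the square of the ℓ¹ norm, values
      -- outside the box are no smaller than the one at 0. The minimum over the box is then global.
      M = num 2 * ‖ cs ⟨ 0ᶜ ⟩ ‖ + 1#
      grows : ∃ λ B → 0# ≤ B × (∀ z → B ≤ ‖ z ‖ → M ≤ ‖ cs ⟨ z ⟩ ‖)
      grows = let B , 0≤B , _ , p = monic-grows monic M in B , 0≤B , p (s≤s z≤n)

      minimum : ∃ λ x → ∀ z → N (cs ⟨ x ⟩) ≤ N (cs ⟨ z ⟩)
      minimum = global grows
        where
        global : (∃ λ B → 0# ≤ B × (∀ z → B ≤ ‖ z ‖ → M ≤ ‖ cs ⟨ z ⟩ ‖)) → ∃ λ x → ∀ z → N (cs ⟨ x ⟩) ≤ N (cs ⟨ z ⟩)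
        global (B , 0≤B , p) = finish (box-minimum (λ x y → N (cs ⟨ x +i y ⟩)) (N⟨⟩-lipschitz cs) B 0≤B)
          where
          N0≤ : ∀ z → B ≤ ‖ z ‖ → N (cs ⟨ 0ᶜ ⟩) ≤ N (cs ⟨ z ⟩)
          N0≤ z q = *-cancelˡ-≤ 0<2 (≤-trans (≤-trans (*-monoˡ-≤ (inj₁ 0<2) (N≤‖‖² (cs ⟨ 0ᶜ ⟩)))
            (≤-by (0≤x+y (0≤x*y (0≤x+y 0≤1 0≤1) (0≤x² a)) (0≤x+y (0≤x*y (0≤x+y (0≤x+y (0≤x+y 0≤1 0≤1) 0≤1) 0≤1) (0≤‖‖ (cs ⟨ 0ᶜ ⟩))) 0≤1))
              (solve 1 (λ a → (𝟚 :* a :+ 𝟙) :* (𝟚 :* a :+ 𝟙) :- 𝟚 :* (a :* a) := 𝟚 :* (a :* a) :+ (con (+ 4) :* a :+ 𝟙)) refl a)))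
            (≤-trans (*-mono-≤ 0≤M 0≤M (p z q) (p z q)) (‖‖²≤2N (cs ⟨ z ⟩))))
            where
            a = ‖ cs ⟨ 0ᶜ ⟩ ‖
            0≤M = 0≤x+y (0≤x*y (inj₁ 0<2) (0≤‖‖ (cs ⟨ 0ᶜ ⟩))) 0≤1
          finish : (∃ λ x → ∃ λ y → ∣ x ∣ ≤ B × ∣ y ∣ ≤ B × (∀ x′ y′ → ∣ x′ ∣ ≤ B → ∣ y′ ∣ ≤ B → N (cs ⟨ x +i y ⟩) ≤ N (cs ⟨ x′ +i y′ ⟩))) →
                   ∃ λ x → ∀ z → N (cs ⟨ x ⟩) ≤ N (cs ⟨ z ⟩)
          finish (x , y , _ , _ , q) = (x +i y) , λ z → inside-or-outside z (≤∨> ‖ z ‖ B)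
            where
            0≤B′ : ∣ 0# ∣ ≤ B
            0≤B′ = ≤-respˡ (sym ∣0∣≈0) 0≤B
            inside-or-outside : ∀ z → (‖ z ‖ ≤ B) ⊎ (B < ‖ z ‖) → N (cs ⟨ x +i y ⟩) ≤ N (cs ⟨ z ⟩)
            inside-or-outside z (inj₁ r) = q (re z) (im z) (≤-trans (x≤x+y (0≤∣x∣ (im z))) r) (≤-trans (y≤x+y (0≤∣x∣ (re z))) r)
            inside-or-outside z (inj₂ r) = ≤-trans (q 0# 0# 0≤B′ 0≤B′) (N0≤ z (inj₁ r))

      root : (∃ λ x → ∀ z → N (cs ⟨ x ⟩) ≤ N (cs ⟨ z ⟩)) → ∃ λ z → cs ⟨ z ⟩ ≈ᶜ 0ᶜ
      -- Applying `vanishing-order` to the quotient by X - x writes p(z) = p(x) + (z - x)^(k+1) g(z)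
      -- with g(x) ≠ 0. The exponent is positive, so a descent direction exists.
      root (x , least) = x , by-contradiction λ p≉0 → contradict p≉0 (vanishing-order (quot-monic x monic) x)
        where
        p = cs ⟨ x ⟩
        contradict : ¬ (p ≈ᶜ 0ᶜ) → (∃₂ λ k g → ¬ (g ⟨ x ⟩ ≈ᶜ 0ᶜ) × (∀ z → quot x cs ⟨ z ⟩ ≈ᶜ (z -ᶜ x) ^ᶜ k *ᶜ g ⟨ z ⟩)) → ⊥
        contradict p≉0 (k , g , g≉0 , factor) =
          let w , neg = descent-direction (suc k) (suc k) ℕ.≤-refl (s≤s z≤n) (conj p *ᶜ g ⟨ x ⟩)
                          (*ᶜ-≉0 {conj p} {g ⟨ x ⟩} conj≉0 g≉0)
          in go w neg (⟨⟩-bounded g (‖ x ‖ + ‖ w ‖) (0≤x+y (0≤‖‖ x) (0≤‖‖ w))) (⟨⟩-lipschitz g (‖ x ‖ + ‖ w ‖) (0≤x+y (0≤‖‖ x) (0≤‖‖ w)))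
          where
          conj≉0 : ¬ (conj p ≈ᶜ 0ᶜ)
          conj≉0 (q , r) = p≉0 (q , trans (solve 1 (λ x → x := :- :- x) refl (im p)) (trans (-‿cong r) (solve 0 (:- 𝟘 := 𝟘) refl)))
          go : ∀ w → re (conj p *ᶜ g ⟨ x ⟩ *ᶜ w ^ᶜ suc k) < 0# →
               (∃ λ M → 0# ≤ M × (∀ z → ‖ z ‖ ≤ ‖ x ‖ + ‖ w ‖ → ‖ g ⟨ z ⟩ ‖ ≤ M)) →
               (∃ λ K → 0# ≤ K × (∀ z z′ → ‖ z ‖ ≤ ‖ x ‖ + ‖ w ‖ → ‖ z′ ‖ ≤ ‖ x ‖ + ‖ w ‖ → ‖ g ⟨ z ⟩ -ᶜ g ⟨ z′ ⟩ ‖ ≤ K * ‖ z -ᶜ z′ ‖)) → ⊥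
          go w neg (M , 0≤M , b) (K , 0≤K , l) = <⇒≱ (D.decreases M K 0≤M 0≤K b l)
            (≤-respʳ (N-cong {cs ⟨ y ⟩} {p +ᶜ (y -ᶜ x) ^ᶜ suc k *ᶜ g ⟨ y ⟩}
              (ℂᶠ.trans (⟨⟩-quot cs x y) (ℂᶠ.+-congˡ {p} (ℂᶠ.trans (ℂᶠ.*-congˡ {y -ᶜ x} (factor y))
                 (ℂᶠ.sym (ℂᶠ.*-assoc (y -ᶜ x) ((y -ᶜ x) ^ᶜ k) (g ⟨ y ⟩))))))) (least y))
            where
            module D = Descent p w (w ^ᶜ suc k) k ℂᶠ.refl x g neg
            y = D.y M K 0≤M 0≤K b l

  -- Integers and rationals among the reals; minimal polynomials.

  module Integrality where

    open RealField
    open Series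
    open Polynomials commutativeRing

    IsInteger : ℝ → Set
    IsInteger x = ∃ λ i → x ≈ fromℤ i

    IsInteger-resp : ∀ {x y} → x ≈ y → IsInteger x → IsInteger y
    IsInteger-resp p (i , q) = i , trans (sym p) q

    IsInteger-+ : ∀ {x y} → IsInteger x → IsInteger y → IsInteger (x + y)
    IsInteger-+ (i , p) (j , q) = i ℤ.+ j , trans (+-cong p q) (sym (fromℤ-+ i j))

    IsInteger-* : ∀ {x y} → IsInteger x → IsInteger y → IsInteger (x * y)
    IsInteger-* (i , p) (j , q) = i ℤ.* j , trans (*-cong p q) (sym (fromℤ-* i j))

    IsInteger-neg : ∀ {x} → IsInteger x → IsInteger (- x)
    IsInteger-neg (i , p) = ℤ.- i , trans (-‿cong p) (sym (fromℤ-neg i))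

    IsInteger-fromℕ : ∀ n → IsInteger (fromℕ n)
    IsInteger-fromℕ n = + n , refl

    IsInteger-0 : IsInteger 0#
    IsInteger-0 = + 0 , refl

    IsInteger-1 : IsInteger 1#
    IsInteger-1 = + 1 , sym fromℕ-1

    IsInteger-∑ : ∀ {f} n → (∀ i → i ℕ.< n → IsInteger (f i)) → IsInteger (∑ f n)
    IsInteger-∑ zero    p = IsInteger-0
    IsInteger-∑ (suc n) p = IsInteger-+ (IsInteger-∑ n λ i q → p i (ℕ.m≤n⇒m≤1+n q)) (p n ℕ.≤-refl)

    -- A positive denominator inside the field reduces the closure properties to integer arithmetic;
    -- ℚ itself enters only where minimal polynomials are compared.
    IsRational : ℝ → Set
    IsRational x = ∃ λ n → IsInteger (fromℕ (suc n) * x)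

    IsInteger⇒IsRational : ∀ {x} → IsInteger x → IsRational x
    IsInteger⇒IsRational p = 0 , IsInteger-* (IsInteger-fromℕ 1) p

    private
      suc*suc : ∀ m n → ∃ λ k → suc m ℕ.* suc n ≡ suc k × fromℕ (suc k) ≈ fromℕ (suc m) * fromℕ (suc n)
      suc*suc m n = n ℕ.+ m ℕ.* suc n , ≡.refl , fromℕ-* (suc m) (suc n)

    IsRational-+ : ∀ {x y} → IsRational x → IsRational y → IsRational (x + y)
    IsRational-+ {x} {y} (m , p) (n , q) = let k , _ , r = suc*suc m n in k ,
      IsInteger-resp (trans (solve 4 (λ m n x y → n :* (m :* x) :+ m :* (n :* y) := (m :* n) :* (x :+ y)) refl (fromℕ (suc m)) (fromℕ (suc n)) x y) (*-congʳ (sym r)))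
        (IsInteger-+ (IsInteger-* (IsInteger-fromℕ (suc n)) p) (IsInteger-* (IsInteger-fromℕ (suc m)) q))

    IsRational-* : ∀ {x y} → IsRational x → IsRational y → IsRational (x * y)
    IsRational-* {x} {y} (m , p) (n , q) = let k , _ , r = suc*suc m n in k ,
      IsInteger-resp (trans (solve 4 (λ m n x y → (m :* x) :* (n :* y) := (m :* n) :* (x :* y)) refl (fromℕ (suc m)) (fromℕ (suc n)) x y) (*-congʳ (sym r)))
        (IsInteger-* p q)

    IsRational-neg : ∀ {x} → IsRational x → IsRational (- x)
    IsRational-neg {x} (m , p) = m , IsInteger-resp (solve 2 (λ m x → :- (m :* x) := m :* :- x) refl (fromℕ (suc m)) x) (IsInteger-neg p)

    IsRational-⁻¹ : ∀ {x} → ¬ (x ≈ 0#) → IsRational x → IsRational (x ⁻¹)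
    IsRational-⁻¹ {x} x≉0 (m , + zero , p) = ⊥-elim (*-≉0 (0<x⇒x≉0 (0<fromℕ-suc m)) x≉0 p)
    IsRational-⁻¹ {x} x≉0 (m , + suc n , p) = n , IsInteger-resp (trans (sym (*-identityʳ _)) (trans (*-congˡ (sym (*-inverseʳ x≉0)))
      (trans (sym (*-assoc _ _ _)) (*-congʳ p)))) (IsInteger-fromℕ (suc m))
    IsRational-⁻¹ {x} x≉0 (m , -[1+ n ] , p) = n , IsInteger-resp (trans (sym (*-identityʳ _)) (trans (*-congˡ (sym (*-inverseʳ x≉0)))
      (trans (solve 3 (λ m x y → :- m :* (x :* y) := :- (m :* x) :* y) refl (fromℕ (suc m)) x (x ⁻¹))
        (*-congʳ (trans (-‿cong p) (solve 1 (λ a → :- :- a := a) refl (fromℕ (suc n)))))))) (IsInteger-neg (IsInteger-fromℕ (suc m)))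

    IsRational-fromℚ : ∀ q → IsRational (fromℚ q)
    IsRational-fromℚ q = ℚ.denominator-1 q , ↥ q , *-/-cancel (fromℤ (↥ q)) (0<fromℕ-suc (ℚ.denominator-1 q))

    IsRational⇒fromℚ : ∀ {x} → IsRational x → ∃ λ q → fromℚ q ≈ x
    IsRational⇒fromℚ {x} (n , i , p) = q , *-cancelˡ (0<x⇒x≉0 (0<fromℕ-suc n)) (trans lem (sym p))
      where
      q = i ℚ./ suc n
      g = ℤ.gcd i (+ suc n)
      lem : fromℕ (suc n) * fromℚ q ≈ fromℤ i
      lem = trans (*-congʳ (trans (reflexive (≡.cong fromℤ (≡.sym (ℚ.↧-/ i (suc n))))) (fromℤ-* (↧ q) g)))
        (trans (solve 3 (λ d g x → (d :* g) :* x := (d :* x) :* g) refl (fromℤ (↧ q)) (fromℤ g) (fromℚ q))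
          (trans (*-congʳ (*-/-cancel (fromℤ (↥ q)) (0<fromℕ-suc (ℚ.denominator-1 q))))
            (trans (sym (fromℤ-* (↥ q) g)) (reflexive (≡.cong fromℤ (ℚ.↥-/ i (suc n)))))))

    fromℚ-≉0 : ∀ {q} → q ≢ ℚ.0ℚ → ¬ (fromℚ q ≈ 0#)
    fromℚ-≉0 {q} q≢0 p = q≢0 (ℚ.↥p≡0⇒p≡0 q (fromℤ≈0⇒≡0 (↥ q)
      (trans (sym (*-/-cancel (fromℤ (↥ q)) (0<fromℕ-suc (ℚ.denominator-1 q)))) (trans (*-congˡ p) (zeroʳ _)))))

    fromℚ-1 : fromℚ ℚ.1ℚ ≈ 1#
    fromℚ-1 = x/x≈1 (0<fromℕ-suc 0)

    eval≈ : ∀ {A : Set} (ι : A → ℝ) cs x → eval ℝ-rawRing ι {1} cs (x ∷ []) ≡ map ι cs ⟨ x ⟩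
    eval≈ ι []       x = ≡.refl
    eval≈ ι (c ∷ cs) x = ≡.cong (λ y → ι c + x * y) (eval≈ ι cs x)

    monic-map : ∀ {A : Set} {ι : A → ℝ} {one : A} → ι one ≈ 1# → ∀ cs → MonicOfDegree (length cs) (map ι (cs ∷ʳ one))
    monic-map p []       = [ p ]
    monic-map p (c ∷ cs) = _ ∷ monic-map p cs

    Monic⇒MonicOfDegree : ∀ {A : Set} {ι : A → ℝ} {one : A} → ι one ≈ 1# → ∀ cs → Monic one cs →
                          ∃ λ n → MonicOfDegree n (map ι cs) × length cs ≡ suc n
    Monic⇒MonicOfDegree p cs (ds , ≡.refl) = length ds , monic-map p ds , ≡.trans (List.length-++ ds) (ℕ.+-comm (length ds) 1)

    -- Over the rationals the leading coefficient 1 is represented exactly.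
    rational-monic : ∀ {n cs} → MonicOfDegree n cs → All IsRational cs →
                     ∃ λ qs → Monic ℚ.1ℚ qs × length qs ≡ suc n × (∀ x → map fromℚ qs ⟨ x ⟩ ≈ cs ⟨ x ⟩)
    rational-monic [ c≈1 ] (r ∷ []) = ℚ.1ℚ ∷ [] , ([] , ≡.refl) , ≡.refl , λ x → +-congʳ (trans fromℚ-1 (sym c≈1))
    rational-monic (c ∷ m) (r ∷ rs) =
      let q , p = IsRational⇒fromℚ r
          qs , (ds , e) , l , f = rational-monic m rs
      in q ∷ qs , (q ∷ ds , ≡.cong (q ∷_) e) , ≡.cong suc l , λ x → +-cong p (*-congˡ (f x))

    -- Trailing zeros may be present, so the leading coefficient is found from the far end, each
    -- vanishing being decided by excluded middle.
    monicize : ∀ cs → All IsRational cs → All (_≈ 0#) cs ⊎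
      (∃ λ c → ∃₂ λ n ds → ¬ (c ≈ 0#) × suc n ℕ.≤ length cs × MonicOfDegree n ds × All IsRational ds × IsRational c × (∀ x → cs ⟨ x ⟩ ≈ c * ds ⟨ x ⟩))
    monicize [] [] = inj₁ []
    monicize (c ∷ cs) (r ∷ rs) with monicize cs rs
    ... | inj₂ (d , n , ds , d≉0 , n< , m , ss , s , f) = inj₂ (d , suc n , c * d ⁻¹ ∷ ds , d≉0 , s≤s n< , _ ∷ m ,
      IsRational-* r (IsRational-⁻¹ d≉0 s) ∷ ss , s , λ x → trans (+-congˡ (*-congˡ (f x)))
        (trans (+-congʳ (trans (sym (*-identityʳ c)) (*-congˡ (sym (*-inverseʳ d≉0)))))
          (solve 5 (λ c d e x p → c :* (d :* e) :+ x :* (d :* p) := d :* (c :* e :+ x :* p)) refl c d (d ⁻¹) x (ds ⟨ x ⟩))))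
    ... | inj₁ zs with em {c ≈ 0#}
    ... | yes c≈0 = inj₁ (c≈0 ∷ zs)
    ... | no c≉0  = inj₂ (c , 0 , 1# ∷ [] , c≉0 , s≤s z≤n , [ refl ] , IsInteger⇒IsRational IsInteger-1 ∷ [] , r ,
      λ x → trans (+-congˡ (*-congˡ (zeros cs zs x))) (solve 2 (λ c x → c :+ x :* 𝟘 := c :* (𝟙 :+ x :* 𝟘)) refl c x))
      where
      zeros : ∀ cs → All (_≈ 0#) cs → ∀ x → cs ⟨ x ⟩ ≈ 0#
      zeros []       []       x = refl
      zeros (c ∷ cs) (z ∷ zs) x = trans (+-cong z (*-congˡ (zeros cs zs x))) (solve 1 (λ x → 𝟘 :+ x :* 𝟘 := 𝟘) refl x)

    abstract
      least : (P : ℕ → Set) → ∃ P → ∃ λ n → P n × (∀ m → P m → n ℕ.≤ m)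
      least P (n , p) = go n n ℕ.≤-refl p
        where
        go : ∀ b n → n ℕ.≤ b → P n → ∃ λ n → P n × (∀ m → P m → n ℕ.≤ m)
        go zero    n n≤b p = n , p , λ m _ → ℕ.≤-trans n≤b z≤n
        go (suc b) n n≤b p with em {∃ λ m → P m × m ℕ.< n}
        ... | yes (m , q , m<n) = go b m (ℕ.≤-pred (ℕ.≤-trans m<n n≤b)) q
        ... | no ¬q = n , p , λ m q → ℕ.≮⇒≥ λ m<n → ¬q (m , q , m<n)

    minimal-polynomial : ∀ {β} → AlgebraicInteger β → ∃ (MinimalPolynomial β)
    minimal-polynomial {β} (p , monic , root) =
      let n , m , _ = Monic⇒MonicOfDegree fromℕ-1 p monic
          qs , mq , _ , f = rational-monic m (rationals p)
          _ , (rs , a , len) , lo = least (λ k → ∃ λ rs → MonicAnnihilator β rs × length rs ≡ k)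
             (length qs , qs , (mq , trans (reflexive (eval≈ fromℚ qs β)) (trans (f β) (trans (sym (reflexive (eval≈ fromℤ p β))) root))) , ≡.refl)
      in rs , a , λ q b → ≡.subst (ℕ._≤ length q) (≡.sym len) (lo (length q) (q , b , ≡.refl))
      where
      rationals : ∀ p → All IsRational (map fromℤ p)
      rationals []      = []
      rationals (i ∷ p) = IsInteger⇒IsRational (i , refl) ∷ rationals p

    -- A nontrivial relation, divided by its leading coefficient, would be a monic annihilator
    -- shorter than the minimal polynomial.
    linearly-independent : ∀ {β p} → MinimalPolynomial β p → ∀ cs → All IsRational cs → suc (length cs) ℕ.≤ length p →
                           cs ⟨ β ⟩ ≈ 0# → All (_≈ 0#) cs
    linearly-independent {β} (_ , lo) cs rs cs<p z with monicize cs rs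
    ... | inj₁ zs = zs
    ... | inj₂ (c , n , ds , c≉0 , n< , m , ss , _ , f) =
      let qs , mq , l , g = rational-monic m ss
          ds⟨β⟩≈0 = *-cancelˡ c≉0 (trans (sym (f β)) (trans z (sym (zeroʳ c))))
      in ⊥-elim (ℕ.<⇒≱ cs<p (ℕ.≤-trans (lo qs (mq , trans (reflexive (eval≈ fromℚ qs β)) (trans (g β) ds⟨β⟩≈0)))
           (ℕ.≤-trans (ℕ.≤-reflexive l) n<)))

  -- Growth of linear recurrences with one simple dominant root.

  module Recurrences where

    open RealField
    open Complex
    open FundamentalTheoremOfAlgebra
    open Roots using (monic-root; fromℝ-^)
    open IntegerSolver ℂ-commutativeRing using () renaming
      (solve to solveᶜ; _:+_ to _:+ᶜ_; _:*_ to _:*ᶜ_; _:-_ to _:-ᶜ_; :-_ to :-ᶜ_; _:=_ to _:=ᶜ_; 𝟘 to 𝟘ᶜ; 𝟙 to 𝟙ᶜ)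
    private
      module Pℝ = Polynomials commutativeRing

    N≤1⇒‖z^j*w‖≤ : ∀ {z} → N z ≤ 1# → ∀ j w → ‖ z ^ᶜ j *ᶜ w ‖ ≤ num 2 * ‖ w ‖
    N≤1⇒‖z^j*w‖≤ {z} p j w = ≤-trans (‖*‖≤ (z ^ᶜ j) w) (*-monoʳ-≤ (0≤‖‖ w) (x²≤y²⇒x≤y (inj₁ 0<2) (begin
      ‖ z ^ᶜ j ‖ * ‖ z ^ᶜ j ‖  ≤⟨ ‖‖²≤2N (z ^ᶜ j) ⟩
      num 2 * N (z ^ᶜ j)       ≤⟨ *-monoˡ-≤ (inj₁ 0<2) (≤-respˡ (sym (N-^ z j)) (x^n≤1 j (0≤N z) p)) ⟩
      num 2 * 1#               ≤⟨ *-monoˡ-≤ (inj₁ 0<2) (x≤x+y 0≤1) ⟩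
      num 2 * num 2            ∎)))
      where open ≤-Reasoning

    -- s k = z^k s 0 + Σ_{i<k} z^(k-1-i) w i, where w = shift-minus z s.
    shift-minus-bounded : ∀ {z} → N z ≤ 1# → ∀ s K W → (∀ i → i ℕ.< K → ‖ shift-minus z s i ‖ ≤ W) →
      ∀ k → k ℕ.≤ K → ∀ j → ‖ z ^ᶜ j *ᶜ s k ‖ ≤ num 2 * ‖ s 0 ‖ + fromℕ k * (num 2 * W)
    shift-minus-bounded p s K W q zero _ j = ≤-trans (N≤1⇒‖z^j*w‖≤ p j (s 0)) (≤-reflexive (solve 2 (λ a w → a := a :+ 𝟘 :* w) refl (num 2 * ‖ s 0 ‖) (num 2 * W)))
    shift-minus-bounded {z} p s K W q (suc k) k<K j = begin
      ‖ z ^ᶜ j *ᶜ s (suc k) ‖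
        ≈⟨ ‖‖-cong (solveᶜ 4 (λ p z a b → p :*ᶜ b :=ᶜ (z :*ᶜ p) :*ᶜ a :+ᶜ p :*ᶜ (b :-ᶜ z :*ᶜ a)) ℂᶠ.refl (z ^ᶜ j) z (s k) (s (suc k))) ⟩
      ‖ z ^ᶜ suc j *ᶜ s k +ᶜ z ^ᶜ j *ᶜ shift-minus z s k ‖
        ≤⟨ ‖+‖≤ (z ^ᶜ suc j *ᶜ s k) (z ^ᶜ j *ᶜ shift-minus z s k) ⟩
      ‖ z ^ᶜ suc j *ᶜ s k ‖ + ‖ z ^ᶜ j *ᶜ shift-minus z s k ‖
        ≤⟨ +-mono-≤ (shift-minus-bounded p s K W q k (ℕ.<⇒≤ k<K) (suc j))
             (≤-trans (N≤1⇒‖z^j*w‖≤ p j (shift-minus z s k)) (*-monoˡ-≤ (inj₁ 0<2) (q k k<K))) ⟩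
      (num 2 * ‖ s 0 ‖ + fromℕ k * (num 2 * W)) + num 2 * W
        ≈⟨ solve 3 (λ a k w → (a :+ k :* w) :+ w := a :+ (𝟙 :+ k) :* w) refl (num 2 * ‖ s 0 ‖) (fromℕ k) (num 2 * W) ⟩
      num 2 * ‖ s 0 ‖ + fromℕ (suc k) * (num 2 * W) ∎
      where open ≤-Reasoning

    -- Roots are removed one at a time: for a root z the sequence `shift-minus z s` satisfies the
    -- recurrence of the quotient. Summing it back with |z| ≤ 1 costs one more power of k.
    recurrence-bounded : ∀ n cs → MonicOfDegree n cs → (∀ z → cs ⟨ z ⟩ ≈ᶜ 0ᶜ → N z ≤ 1#) →
      ∀ s → (∀ k → (cs ⟦ s ⟧ˢ) k ≈ᶜ 0ᶜ) → ∃ λ C → ∀ k → ‖ s k ‖ ≤ fromℕ C * fromℕ (suc k) ^ n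
    recurrence-bounded zero (c ∷ []) [ c≈1 ] roots s rec = 0 , λ k → ≤-reflexive (trans (‖‖-cong (ℂᶠ.trans
        (solveᶜ 1 (λ a → a :=ᶜ 𝟙ᶜ :*ᶜ a :+ᶜ 𝟘ᶜ) ℂᶠ.refl (s k)) (ℂᶠ.trans (ℂᶠ.+-congʳ (ℂᶠ.*-congʳ {s k} (ℂᶠ.sym c≈1))) (rec k))))
        (trans ‖0‖≈0 (sym (zeroˡ _))))
    recurrence-bounded (suc n) cs monic roots s rec =
      let z , z-root = monic-root monic
          C , p = recurrence-bounded n (quot z cs) (quot-monic z monic) (λ y r → roots y (quot-root {cs} z-root r)) (shift-minus z s)
                    λ k → ℂᶠ.trans (solveᶜ 2 (λ a b → b :=ᶜ 𝟘ᶜ :*ᶜ a :+ᶜ b) ℂᶠ.refl (s k) ((quot z cs ⟦ shift-minus z s ⟧ˢ) k))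
                      (ℂᶠ.trans (ℂᶠ.+-congʳ (ℂᶠ.*-congʳ {s k} (ℂᶠ.sym z-root))) (ℂᶠ.trans (ℂᶠ.sym (⟦⟧ˢ-quot cs z s k)) (rec k)))
          S , s0≤S , _ = 0≤x⇒x≤fromℕ ‖ s 0 ‖
      in 2 ℕ.* S ℕ.+ 2 ℕ.* C , λ k → bound z (roots z z-root) C p S s0≤S k
      where
      bound : ∀ z → N z ≤ 1# → ∀ C → (∀ k → ‖ shift-minus z s k ‖ ≤ fromℕ C * fromℕ (suc k) ^ n) →
              ∀ S → ‖ s 0 ‖ ≤ fromℕ S → ∀ k → ‖ s k ‖ ≤ fromℕ (2 ℕ.* S ℕ.+ 2 ℕ.* C) * fromℕ (suc k) ^ suc n
      bound z N≤1 C p S s0≤S k = begin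
        ‖ s k ‖
          ≈⟨ ‖‖-cong (ℂᶠ.sym (ℂᶠ.*-identityˡ (s k))) ⟩
        ‖ z ^ᶜ 0 *ᶜ s k ‖
          ≤⟨ shift-minus-bounded N≤1 s k (fromℕ C * P) (λ i i<k → ≤-trans (p i)
               (*-monoˡ-≤ (0≤fromℕ C) (^-monoˡ-≤ n (0≤fromℕ (suc i)) (fromℕ-mono-≤ (s≤s (ℕ.<⇒≤ i<k)))))) k ℕ.≤-refl 0 ⟩
        num 2 * ‖ s 0 ‖ + fromℕ k * (num 2 * (fromℕ C * P))
          ≤⟨ +-mono-≤ (*-monoˡ-≤ (inj₁ 0<2) s0≤S) (≤-reflexive (solve 3 (λ k c p → k :* (𝟚 :* (c :* p)) := (𝟚 :* c) :* (k :* p)) refl (fromℕ k) (fromℕ C) P)) ⟩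
        num 2 * fromℕ S + (num 2 * fromℕ C) * (fromℕ k * P)
          ≤⟨ +-mono-≤ (≤-respˡ (*-identityʳ _) (*-monoˡ-≤ (0≤x*y (inj₁ 0<2) (0≤fromℕ S)) (1≤x^n (suc n) (1≤fromℕ {suc k} (s≤s z≤n)))))
               (*-monoˡ-≤ (0≤x*y (inj₁ 0<2) (0≤fromℕ C)) (*-monoʳ-≤ (0≤x^n n (0≤fromℕ (suc k))) (fromℕ-mono-≤ (ℕ.n≤1+n k)))) ⟩
        num 2 * fromℕ S * (fromℕ (suc k) * P) + (num 2 * fromℕ C) * (fromℕ (suc k) * P)
          ≈⟨ sym (distribʳ _ _ _) ⟩
        (num 2 * fromℕ S + num 2 * fromℕ C) * (fromℕ (suc k) * P)
          ≈⟨ *-congʳ (sym (trans (fromℕ-+ (2 ℕ.* S) (2 ℕ.* C)) (+-cong (double S) (double C)))) ⟩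
        fromℕ (2 ℕ.* S ℕ.+ 2 ℕ.* C) * fromℕ (suc k) ^ suc n ∎
        where
        open ≤-Reasoning
        P = fromℕ (suc k) ^ n
        double : ∀ m → fromℕ (2 ℕ.* m) ≈ num 2 * fromℕ m
        double m = trans (fromℕ-* 2 m) (*-congʳ (+-congˡ (+-identityʳ 1#)))

    -- A pointwise relation rather than an equation between lists, because `fromℝ` commutes with the
    -- operations only up to `_≈ᶜ_`, and quotients have to be lifted as well.
    Lift : List ℝ → List ℂ → Set
    Lift = Pointwise λ x z → fromℝ x ≈ᶜ z

    lift : ∀ cs → Lift cs (map fromℝ cs)
    lift []       = []
    lift (c ∷ cs) = ℂᶠ.refl ∷ lift cs

    fromℝ-*+ : ∀ a b c → fromℝ (a + b * c) ≈ᶜ fromℝ a +ᶜ fromℝ b *ᶜ fromℝ c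
    fromℝ-*+ a b c = solve 3 (λ a b c → a :+ b :* c := a :+ (b :* c :- 𝟘 :* 𝟘)) refl a b c ,
      solve 2 (λ b c → 𝟘 := 𝟘 :+ (b :* 𝟘 :+ 𝟘 :* c)) refl b c

    lift-⟨⟩ : ∀ {cs ds} → Lift cs ds → ∀ x → fromℝ (cs Pℝ.⟨ x ⟩) ≈ᶜ ds ⟨ fromℝ x ⟩
    lift-⟨⟩ []           x = ℂᶠ.refl
    lift-⟨⟩ {c ∷ cs} (p ∷ ps) x = ℂᶠ.trans (fromℝ-*+ c x (cs Pℝ.⟨ x ⟩)) (ℂᶠ.+-cong p (ℂᶠ.*-congˡ {fromℝ x} (lift-⟨⟩ ps x)))

    lift-quot : ∀ {cs ds} → Lift cs ds → ∀ x → Lift (Pℝ.quot x cs) (quot (fromℝ x) ds)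
    lift-quot []             x = []
    lift-quot (p ∷ [])       x = []
    lift-quot (p ∷ ps@(_ ∷ _)) x = lift-⟨⟩ ps x ∷ lift-quot ps x

    lift-monic : ∀ {n cs ds} → Lift cs ds → Pℝ.MonicOfDegree n cs → MonicOfDegree n ds
    lift-monic (p ∷ []) Pℝ.[ q ] = [ ℂᶠ.trans (ℂᶠ.sym p) (q , refl) ]
    lift-monic (p ∷ ps) (c Pℝ.∷ m) = _ ∷ lift-monic ps m

    lift-⟦⟧ˢ : ∀ {cs ds} → Lift cs ds → ∀ s k → fromℝ ((cs Pℝ.⟦ s ⟧ˢ) k) ≈ᶜ (ds ⟦ (λ j → fromℝ (s j)) ⟧ˢ) k
    lift-⟦⟧ˢ [] s k = ℂᶠ.refl
    lift-⟦⟧ˢ {c ∷ cs} (p ∷ ps) s k = ℂᶠ.trans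
      (trans (+-comm (c * s k) _) (trans (proj₁ (fromℝ-*+ ((cs Pℝ.⟦ s ⟧ˢ) (suc k)) c (s k))) (+-comm _ _)) ,
       trans (proj₂ (fromℝ-*+ ((cs Pℝ.⟦ s ⟧ˢ) (suc k)) c (s k))) (+-comm _ _))
      (ℂᶠ.+-cong (ℂᶠ.*-congʳ {fromℝ (s k)} p) (lift-⟦⟧ˢ ps s (suc k)))

    -- With q = μ / (X - β), the sequence q(E)s is geometric with ratio β. As q(β) ≠ 0, subtracting
    -- e β^k with e = (q(E)s)(0) / q(β) leaves a sequence annihilated by q, all of whose roots lie
    -- in the closed unit disc.
    dominant-root : ∀ {n μ β} → Pℝ.MonicOfDegree (suc n) μ → μ Pℝ.⟨ β ⟩ ≈ 0# → ¬ (Pℝ.quot β μ Pℝ.⟨ β ⟩ ≈ 0#) →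
      (∀ z → map fromℝ μ ⟨ z ⟩ ≈ᶜ 0ᶜ → ¬ (z ≈ᶜ fromℝ β) → N z ≤ 1#) →
      ∀ s → (∀ k → (μ Pℝ.⟦ s ⟧ˢ) k ≈ 0#) → ∃₂ λ e C → ∀ k → ∣ s k - e * β ^ k ∣ ≤ fromℕ C * fromℕ (suc k) ^ n
    dominant-root {n} {μ} {β} monic root simple others s rec =
      let C , p = recurrence-bounded n qᶜ (quot-monic βᶜ (lift-monic (lift μ) monic)) roots r r-rec
      in re e , C , λ k → ≤-trans (≤-respˡ (∣∣-cong (e-real k)) (x≤x+y (0≤∣x∣ (im (r k))))) (p k)
      where
      βᶜ = fromℝ β
      μᶜ = map fromℝ μ
      qᶜ = quot βᶜ μᶜ
      qβ = Pℝ.quot β μ Pℝ.⟨ β ⟩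
      sᶜ : ℕ → ℂ
      sᶜ k = fromℝ (s k)
      qᶜβ : qᶜ ⟨ βᶜ ⟩ ≈ᶜ fromℝ qβ
      qᶜβ = ℂᶠ.sym (lift-⟨⟩ (lift-quot (lift μ) β) β)
      μᶜβ : μᶜ ⟨ βᶜ ⟩ ≈ᶜ 0ᶜ
      μᶜβ = ℂᶠ.trans (ℂᶠ.sym (lift-⟨⟩ (lift μ) β)) (root , refl)
      roots : ∀ z → qᶜ ⟨ z ⟩ ≈ᶜ 0ᶜ → N z ≤ 1#
      roots z p = others z (quot-root {μᶜ} μᶜβ p) λ q → simple (proj₁ (ℂᶠ.trans (ℂᶠ.sym qᶜβ) (ℂᶠ.trans (⟨⟩-cong qᶜ {βᶜ} {z} (ℂᶠ.sym q)) p)))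
      y : ℕ → ℂ
      y = qᶜ ⟦ sᶜ ⟧ˢ
      y-suc : ∀ k → y (suc k) ≈ᶜ βᶜ *ᶜ y k
      y-suc k = ℂᶠ.trans (solveᶜ 2 (λ a b → a :=ᶜ (a :-ᶜ b) :+ᶜ b) ℂᶠ.refl (y (suc k)) (βᶜ *ᶜ y k))
        (ℂᶠ.trans (ℂᶠ.+-congʳ (ℂᶠ.trans (ℂᶠ.sym (⟦⟧ˢ-shift-minus qᶜ βᶜ sᶜ k)) zero-shift)) (ℂᶠ.+-identityˡ (βᶜ *ᶜ y k)))
        where
        zero-shift : (qᶜ ⟦ shift-minus βᶜ sᶜ ⟧ˢ) k ≈ᶜ 0ᶜ
        zero-shift = ℂᶠ.trans (solveᶜ 2 (λ a b → b :=ᶜ 𝟘ᶜ :*ᶜ a :+ᶜ b) ℂᶠ.refl (sᶜ k) ((qᶜ ⟦ shift-minus βᶜ sᶜ ⟧ˢ) k))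
          (ℂᶠ.trans (ℂᶠ.+-congʳ (ℂᶠ.*-congʳ {sᶜ k} (ℂᶠ.sym μᶜβ))) (ℂᶠ.trans (ℂᶠ.sym (⟦⟧ˢ-quot μᶜ βᶜ sᶜ k))
            (ℂᶠ.trans (ℂᶠ.sym (lift-⟦⟧ˢ (lift μ) s k)) (rec k , refl))))
      y≈ : ∀ k → y k ≈ᶜ y 0 *ᶜ βᶜ ^ᶜ k
      y≈ zero    = ℂᶠ.sym (ℂᶠ.*-identityʳ (y 0))
      y≈ (suc k) = ℂᶠ.trans (y-suc k) (ℂᶠ.trans (ℂᶠ.*-congˡ {βᶜ} (y≈ k))
        (solveᶜ 3 (λ b y p → b :*ᶜ (y :*ᶜ p) :=ᶜ y :*ᶜ (b :*ᶜ p)) ℂᶠ.refl βᶜ (y 0) (βᶜ ^ᶜ k)))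
      e : ℂ
      e = y 0 *ᶜ fromℝ (qβ ⁻¹)
      r : ℕ → ℂ
      r k = 1ᶜ *ᶜ sᶜ k +ᶜ (-ᶜ e) *ᶜ βᶜ ^ᶜ k
      e*q : e *ᶜ qᶜ ⟨ βᶜ ⟩ ≈ᶜ y 0
      e*q = ℂᶠ.trans (ℂᶠ.*-congˡ {e} qᶜβ) (ℂᶠ.trans (ℂᶠ.*-assoc (y 0) (fromℝ (qβ ⁻¹)) (fromℝ qβ))
        (ℂᶠ.trans (ℂᶠ.*-congˡ {y 0} (trans (solve 2 (λ a b → a :* b :- 𝟘 :* 𝟘 := b :* a) refl (qβ ⁻¹) qβ) (*-inverseʳ simple) ,
             solve 2 (λ a b → a :* 𝟘 :+ 𝟘 :* b := 𝟘) refl (qβ ⁻¹) qβ)) (ℂᶠ.*-identityʳ (y 0))))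
      r-rec : ∀ k → (qᶜ ⟦ r ⟧ˢ) k ≈ᶜ 0ᶜ
      r-rec k = ℂᶠ.trans (⟦⟧ˢ-linear qᶜ sᶜ (βᶜ ^ᶜ_) 1ᶜ (-ᶜ e) k)
        (ℂᶠ.trans (ℂᶠ.+-cong (ℂᶠ.trans (ℂᶠ.*-identityˡ (y k)) (y≈ k)) (ℂᶠ.*-congˡ { -ᶜ e} (⟦⟧ˢ-geometric qᶜ βᶜ k)))
          (ℂᶠ.trans (solveᶜ 4 (λ e q p y → y :*ᶜ p :+ᶜ (:-ᶜ e) :*ᶜ (q :*ᶜ p) :=ᶜ (y :-ᶜ e :*ᶜ q) :*ᶜ p) ℂᶠ.refl e (qᶜ ⟨ βᶜ ⟩) (βᶜ ^ᶜ k) (y 0))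
            (ℂᶠ.trans (ℂᶠ.*-congʳ {βᶜ ^ᶜ k} (ℂᶠ.trans (ℂᶠ.+-congˡ {y 0} (ℂᶠ.-‿cong e*q)) (ℂᶠ.-‿inverseʳ (y 0)))) (ℂᶠ.zeroˡ (βᶜ ^ᶜ k)))))
      e-real : ∀ k → re (r k) ≈ s k - re e * β ^ k
      e-real k = trans (+-congˡ (proj₁ (ℂᶠ.*-congˡ { -ᶜ e} (fromℝ-^ β k))))
        (solve 5 (λ s a b p t → (𝟙 :* s :- 𝟘 :* 𝟘) :+ ((:- a) :* p :- (:- b) :* 𝟘) := s :- a :* p) refl (s k) (re e) (im e) (β ^ k) 0#)

  -- Merges finitely many constants into one. It is used with addition for bounds and with a product
  -- for denominators, whence the abstract operation.
  uniform : (P : ℕ → ℕ → Set) (_∙_ : ℕ → ℕ → ℕ) → (∀ i a b → P i a → P i (a ∙ b)) → (∀ i a b → P i b → P i (a ∙ b)) →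
            ∀ n → (∀ i → i ℕ.< n → ∃ (P i)) → ∃ λ c → ∀ i → i ℕ.< n → P i c
  uniform P _∙_ left right zero    p = 0 , λ i ()
  uniform P _∙_ left right (suc n) p =
    let c , q = uniform P _∙_ left right n λ i i<n → p i (ℕ.m≤n⇒m≤1+n i<n)
        c′ , r = p n ℕ.≤-refl
    in c ∙ c′ , λ i i<1+n → step c q c′ r i (ℕ.m≤n⇒m<n∨m≡n (ℕ.≤-pred i<1+n))
    where
    step : ∀ c → (∀ i → i ℕ.< n → P i c) → ∀ c′ → P n c′ → ∀ i → i ℕ.< n ⊎ i ≡ n → P i (c ∙ c′)
    step c q c′ r i (inj₁ i<n)    = left i c c′ (q i i<n)
    step c q c′ r i (inj₂ ≡.refl) = right n c c′ r

  -- Coordinates of the powers of a Pisot or Salem number.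

  module Coordinates where

    open RealField
    open Series
    open Polynomials commutativeRing
    open Integrality
    open Complex using (N; 0ᶜ; ∣z∣ᶜ≤1⇒N≤1)
    open FundamentalTheoremOfAlgebra using () renaming (_⟨_⟩ to _⟨_⟩ᶜ)
    open Recurrences using (dominant-root)

    coefficient : List ℝ → ℕ → ℝ
    coefficient []       i       = 0#
    coefficient (c ∷ cs) zero    = c
    coefficient (c ∷ cs) (suc i) = coefficient cs i

    coefficient-rational : ∀ {cs} → All IsRational cs → ∀ i → IsRational (coefficient cs i)
    coefficient-rational []       i       = IsInteger⇒IsRational IsInteger-0
    coefficient-rational (r ∷ rs) zero    = r
    coefficient-rational (r ∷ rs) (suc i) = coefficient-rational rs i

    ∑-shift-* : ∀ (f : ℕ → ℝ) x n → ∑ (λ i → f i * x ^ suc i) n ≈ x * ∑ (λ i → f i * x ^ i) n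
    ∑-shift-* f x n = trans (∑-cong n λ i _ → solve 3 (λ a x p → a :* (x :* p) := x :* (a :* p)) refl (f i) x (x ^ i)) (∑-*ˡ x _ n)

    monic-⟨⟩ : ∀ {n cs} → MonicOfDegree n cs → ∀ x → cs ⟨ x ⟩ ≈ ∑ (λ i → coefficient cs i * x ^ i) n + x ^ n
    monic-⟨⟩ ([_] {c} p) x = trans (+-congʳ p) (solve 1 (λ x → 𝟙 :+ x :* 𝟘 := 𝟘 :+ 𝟙) refl x)
    monic-⟨⟩ (_∷_ {n} {cs} c m) x = begin
      c + x * cs ⟨ x ⟩                  ≈⟨ +-congˡ (*-congˡ (monic-⟨⟩ m x)) ⟩
      c + x * (∑ f n + x ^ n)           ≈⟨ solve 4 (λ c x s p → c :+ x :* (s :+ p) := (c :* 𝟙 :+ x :* s) :+ x :* p) refl c x (∑ f n) (x ^ n) ⟩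
      (c * 1# + x * ∑ f n) + x ^ suc n  ≈⟨ +-congʳ (+-congˡ (∑-shift-* (coefficient cs) x n)) ⟨
      (c * 1# + ∑ (λ i → coefficient cs i * x ^ suc i) n) + x ^ suc n ≈⟨ +-congʳ (∑-head _ n) ⟨
      ∑ (λ i → coefficient (c ∷ cs) i * x ^ i) (suc n) + x ^ suc n ∎
      where
      open Relation.Binary.Reasoning.Setoid setoid
      f = λ i → coefficient cs i * x ^ i

    applyUpTo-⟨⟩ : ∀ v n x → applyUpTo v n ⟨ x ⟩ ≈ ∑ (λ i → v i * x ^ i) n
    applyUpTo-⟨⟩ v zero    x = refl
    applyUpTo-⟨⟩ v (suc n) x = trans (+-cong (sym (*-identityʳ (v 0)))
        (trans (*-congˡ (applyUpTo-⟨⟩ (λ i → v (suc i)) n x)) (sym (∑-shift-* (λ i → v (suc i)) x n))))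
      (sym (∑-head _ n))

    ⟦⟧ˢ-rational : ∀ {cs s} → All IsRational cs → (∀ k → IsRational (s k)) → ∀ k → IsRational ((cs ⟦ s ⟧ˢ) k)
    ⟦⟧ˢ-rational []       q k = IsInteger⇒IsRational IsInteger-0
    ⟦⟧ˢ-rational (r ∷ rs) q k = IsRational-+ (IsRational-* r (q k)) (⟦⟧ˢ-rational rs q (suc k))

    ⟦⟧ˢ-∑ : ∀ cs (s : ℕ → ℕ → ℝ) (w : ℕ → ℝ) n k →
            ∑ (λ i → (cs ⟦ (λ j → s j i) ⟧ˢ) k * w i) n ≈ (cs ⟦ (λ j → ∑ (λ i → s j i * w i) n) ⟧ˢ) k
    ⟦⟧ˢ-∑ []       s w n k = trans (∑-cong n λ i _ → zeroˡ (w i)) (∑-0 n)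
    ⟦⟧ˢ-∑ (c ∷ cs) s w n k = trans (∑-cong n λ i _ → solve 4 (λ c s p w → (c :* s :+ p) :* w := c :* (s :* w) :+ p :* w) refl c (s k i) _ (w i))
      (trans (∑-+ _ _ n) (+-cong (∑-*ˡ c _ n) (⟦⟧ˢ-∑ cs s w n (suc k))))

    ⟦⟧ˢ-integral : ∀ {n cs s} → MonicOfDegree n cs → All IsInteger cs → ∀ k → (∀ j → j ℕ.< n → IsInteger (s (k ℕ.+ j))) →
                   IsInteger ((cs ⟦ s ⟧ˢ) k) → IsInteger (s (k ℕ.+ n))
    ⟦⟧ˢ-integral {s = s} ([_] {c} p) _ k _ q = ≡.subst (λ j → IsInteger (s j)) (≡.sym (ℕ.+-identityʳ k))
      (IsInteger-resp (trans (+-identityʳ _) (trans (*-congʳ p) (*-identityˡ _))) q)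
    ⟦⟧ˢ-integral {s = s} (_∷_ {n} {cs} c m) (r ∷ rs) k q t = ≡.subst (λ j → IsInteger (s j)) (≡.sym (ℕ.+-suc k n))
      (⟦⟧ˢ-integral m rs (suc k) (λ j j<n → ≡.subst (λ j → IsInteger (s j)) (ℕ.+-suc k j) (q (suc j) (s≤s j<n)))
        (IsInteger-resp (solve 2 (λ a b → (a :+ b) :+ :- a := b) refl (c * s k) _)
          (IsInteger-+ t (IsInteger-neg (IsInteger-* r (≡.subst (λ j → IsInteger (s j)) (ℕ.+-identityʳ k) (q 0 (s≤s z≤n))))))))

    integral-recurrence : ∀ {n cs s} → MonicOfDegree n cs → All IsInteger cs → (∀ k → (cs ⟦ s ⟧ˢ) k ≈ 0#) →
                          (∀ k → k ℕ.< n → IsInteger (s k)) → ∀ k → IsInteger (s k)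
    integral-recurrence {n} {cs} {s} m is rec init = go
      where
      window : ∀ k → ∀ j → j ℕ.< n → IsInteger (s (k ℕ.+ j))
      window zero    j j<n = init j j<n
      window (suc k) j j<n with ℕ.m≤n⇒m<n∨m≡n j<n
      ... | inj₁ 1+j<n = ≡.subst (λ i → IsInteger (s i)) (ℕ.+-suc k j) (window k (suc j) 1+j<n)
      ... | inj₂ ≡.refl = ≡.subst (λ i → IsInteger (s i)) (ℕ.+-suc k j)
          (⟦⟧ˢ-integral m is k (window k) (IsInteger-resp (sym (rec k)) IsInteger-0))
      go : ∀ k → IsInteger (s k)
      go k with ℕ.m≤n⇒m<n∨m≡n (z≤n {n})
      ... | inj₁ 0<n = ≡.subst (λ i → IsInteger (s i)) (ℕ.+-identityʳ k) (window k 0 0<n)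
      ... | inj₂ ≡.refl = ≡.subst (λ i → IsInteger (s i)) (ℕ.+-identityʳ k)
          (⟦⟧ˢ-integral m is k (λ j ()) (IsInteger-resp (sym (rec k)) IsInteger-0))

    All-weighted-rational : ∀ n {cs} → All IsRational cs → All IsRational (weighted n cs)
    All-weighted-rational n []       = []
    All-weighted-rational n (r ∷ rs) = IsRational-* (IsInteger⇒IsRational (+ n , sym (fromℤ≈int (+ n)))) r ∷ All-weighted-rational (suc n) rs

    length-weighted : ∀ n cs → length (weighted n cs) ≡ length cs
    length-weighted n []       = ≡.refl
    length-weighted n (c ∷ cs) = ≡.cong suc (length-weighted (suc n) cs)

    weighted-≉0 : ∀ {n cs} → MonicOfDegree n cs → ∀ m → 1 ℕ.≤ m → ¬ All (_≈ 0#) (weighted m cs)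
    weighted-≉0 [ p ]   m 1≤m (z ∷ []) = <⇒≉ (0<fromℕ 1≤m) (sym (trans (fromℤ≈int (+ m)) (trans (sym (trans (*-congˡ p) (*-identityʳ _))) z)))
    weighted-≉0 (c ∷ q) m 1≤m (_ ∷ zs) = weighted-≉0 q (suc m) (s≤s z≤n) zs

    rationals : ∀ qs → All IsRational (map fromℚ qs)
    rationals []       = []
    rationals (q ∷ qs) = IsRational-fromℚ q ∷ rationals qs

    integers : ∀ is → All IsInteger (map fromℤ is)
    integers []       = []
    integers (i ∷ is) = (i , refl) ∷ integers is

    All-IsRational : ∀ {cs} → All IsInteger cs → All IsRational cs
    All-IsRational []       = []
    All-IsRational (r ∷ rs) = IsInteger⇒IsRational r ∷ All-IsRational rs

    -- ξ k i is the coordinate of β^k at β^i in the basis 1, ..., β^(degree-1) of ℚ(β). The common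
    -- denominator Q takes the place of Gauss's lemma, and `ξ-asymptotic` is all that is kept of the
    -- condition on the conjugates.
    record Coordinatised (β : ℝ) : Set where
      field
        degree-1 Q C : ℕ
      degree : ℕ
      degree = suc degree-1
      field
        ξ            : ℕ → ℕ → ℝ
        ξ-sum        : ∀ k → ∑ (λ i → ξ k i * β ^ i) degree ≈ β ^ k
        1≤Q          : 1 ℕ.≤ Q
        ξ-integral   : ∀ k i → i ℕ.< degree → IsInteger (fromℕ Q * ξ k i)
        ξ-asymptotic : ∀ i → i ℕ.< degree → ∃ λ e → ∣ e ∣ ≤ fromℕ C ×
                       (∀ k → ∣ ξ k i - e * β ^ k ∣ ≤ fromℕ C * fromℕ (suc k) ^ degree-1)
        independent  : ∀ (v : ℕ → ℝ) → (∀ i → IsRational (v i)) → ∑ (λ i → v i * β ^ i) degree ≈ 0# → ∀ i → i ℕ.< degree → v i ≈ 0#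

    private
      module Companion {β p} (mp : MinimalPolynomial β p) (ai : AlgebraicInteger β)
        (small : ∀ z → OtherConjugate β z → ∣ z ∣ᶜ ≤ 1#) {d : ℕ} (monic : MonicOfDegree (suc d) (map fromℚ p))
        (len : length p ≡ suc (suc d)) where

        μ : List ℝ
        μ = map fromℚ p

        root : μ ⟨ β ⟩ ≈ 0#
        root = trans (sym (reflexive (eval≈ fromℚ p β))) (proj₂ (proj₁ mp))

        m : ℕ → ℝ
        m = coefficient μ

        m-rational : ∀ i → IsRational (m i)
        m-rational = coefficient-rational (rationals p)

        independent : ∀ (v : ℕ → ℝ) → (∀ i → IsRational (v i)) → ∑ (λ i → v i * β ^ i) (suc d) ≈ 0# → ∀ i → i ℕ.< suc d → v i ≈ 0#
        independent v r z i i<d = applyUpTo⁻ v (suc d)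
          (linearly-independent mp (applyUpTo v (suc d)) (applyUpTo⁺₂ v (suc d) r)
            (ℕ.≤-reflexive (≡.trans (≡.cong suc (List.length-applyUpTo v (suc d))) (≡.sym len)))
            (trans (applyUpTo-⟨⟩ v (suc d) β) z)) i<d

        ev : (ℕ → ℝ) → ℝ
        ev v = ∑ (λ i → v i * β ^ i) (suc d)

        shift-up : (ℕ → ℝ) → ℕ → ℝ
        shift-up v zero    = 0#
        shift-up v (suc i) = v i

        -- The coordinates of β^k with respect to 1, β, …, β^d.
        ξ : ℕ → ℕ → ℝ
        ξ zero    zero    = 1#
        ξ zero    (suc i) = 0#
        ξ (suc k) i       = shift-up (ξ k) i + - ξ k d * m i

        ξ-rational : ∀ k i → IsRational (ξ k i)
        ξ-rational zero    zero    = IsInteger⇒IsRational IsInteger-1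
        ξ-rational zero    (suc i) = IsInteger⇒IsRational IsInteger-0
        ξ-rational (suc k) i       = IsRational-+ (up i) (IsRational-* (IsRational-neg (ξ-rational k d)) (m-rational i))
          where
          up : ∀ i → IsRational (shift-up (ξ k) i)
          up zero    = IsInteger⇒IsRational IsInteger-0
          up (suc i) = ξ-rational k i

        ξ-sum : ∀ k → ev (ξ k) ≈ β ^ k
        ξ-sum zero = trans (∑-head _ d) (trans (+-congˡ (trans (∑-cong d λ i _ → zeroˡ _) (∑-0 d)))
          (solve 0 (𝟙 :* 𝟙 :+ 𝟘 := 𝟙) refl))
        ξ-sum (suc k) = begin
          ev (ξ (suc k))
            ≈⟨ ∑-cong (suc d) (λ i _ → solve 4 (λ s x m p → (s :+ :- x :* m) :* p := s :* p :+ :- x :* (m :* p)) refl (shift-up (ξ k) i) (ξ k d) (m i) (β ^ i)) ⟩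
          ∑ (λ i → shift-up (ξ k) i * β ^ i + - ξ k d * (m i * β ^ i)) (suc d)
            ≈⟨ trans (∑-+ _ _ (suc d)) (+-cong (∑-head _ d) (∑-*ˡ (- ξ k d) _ (suc d))) ⟩
          (0# * 1# + ∑ (λ i → ξ k i * β ^ suc i) d) + - ξ k d * ev m
            ≈⟨ +-cong (+-congˡ (∑-shift-* (ξ k) β d)) (*-congˡ ev-m) ⟩
          (0# * 1# + β * S) + - ξ k d * - (β * β ^ d)
            ≈⟨ solve 4 (λ b s x p → (𝟘 :* 𝟙 :+ b :* s) :+ :- x :* :- (b :* p) := b :* (s :+ x :* p)) refl β S (ξ k d) (β ^ d) ⟩
          β * ev (ξ k)
            ≈⟨ *-congˡ (ξ-sum k) ⟩
          β ^ suc k ∎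
          where
          open Relation.Binary.Reasoning.Setoid setoid
          S = ∑ (λ i → ξ k i * β ^ i) d
          ev-m : ev m ≈ - (β ^ suc d)
          ev-m = trans (solve 2 (λ a b → a := (a :+ b) :+ :- b) refl (ev m) (β ^ suc d))
            (trans (+-congʳ (trans (sym (monic-⟨⟩ monic β)) root)) (+-identityˡ _))

        -- Applying the polynomial to the sequence β^k gives 0; since the powers of β are linearly
        -- independent over the rationals, this can be read off coordinate by coordinate.
        ξ-recurrence : ∀ {cs} → All IsRational cs → cs ⟨ β ⟩ ≈ 0# → ∀ i → i ℕ.< suc d → ∀ k → (cs ⟦ (λ j → ξ j i) ⟧ˢ) k ≈ 0#
        ξ-recurrence {cs} rs z i i<d k = independent (λ i → (cs ⟦ (λ j → ξ j i) ⟧ˢ) k)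
          (λ i → ⟦⟧ˢ-rational rs (λ j → ξ-rational j i) k)
          (trans (⟦⟧ˢ-∑ cs ξ (β ^_) (suc d) k) (trans (⟦⟧ˢ-cong cs ξ-sum k)
            (trans (⟦⟧ˢ-geometric cs β k) (trans (*-congʳ z) (zeroˡ _))))) i i<d

        -- Otherwise the derivative of μ, a nonzero rational polynomial of smaller degree, would
        -- vanish at β.
        simple : ¬ (quot β μ ⟨ β ⟩ ≈ 0#)
        simple z = contradiction monic (rationals p) (ℕ.≤-reflexive (≡.sym (≡.trans (List.length-map fromℚ p) len))) z
          where
          contradiction : ∀ {cs} → MonicOfDegree (suc d) cs → All IsRational cs → suc (suc d) ℕ.≤ length cs →
                          quot β cs ⟨ β ⟩ ≈ 0# → ⊥
          contradiction (_∷_ {cs = cs} c m) (_ ∷ rs) _ z = weighted-≉0 m 1 (s≤s z≤n)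
            (linearly-independent mp (weighted 1 cs) (All-weighted-rational 1 rs)
              (ℕ.≤-reflexive (≡.trans (≡.cong suc (≡.trans (length-weighted 1 cs) (length-monic m))) (≡.sym len)))
              (trans (sym (quot-self c cs β)) z))
            where
            length-monic : ∀ {n cs} → MonicOfDegree n cs → length cs ≡ suc n
            length-monic [ _ ]   = ≡.refl
            length-monic (_ ∷ m) = ≡.cong suc (length-monic m)

        others : ∀ z → map fromℝ μ ⟨ z ⟩ᶜ ≈ᶜ 0ᶜ → ¬ (z ≈ᶜ fromℝ β) → N z ≤ 1#
        others z q z≉β = ∣z∣ᶜ≤1⇒N≤1 z (small z ((p , mp , ≡.subst (_≈ᶜ 0ᶜ) (≡.sym (evalᶜ p)) q) , z≉β))
          where
          evalᶜ : ∀ qs → eval ℂ-rawRing (λ q → fromℝ (fromℚ q)) {1} qs (z ∷ []) ≡ map fromℝ (map fromℚ qs) ⟨ z ⟩ᶜ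
          evalᶜ []       = ≡.refl
          evalᶜ (q ∷ qs) = ≡.cong (λ w → RawRing._+_ ℂ-rawRing (fromℝ (fromℚ q)) (RawRing._*_ ℂ-rawRing z w)) (evalᶜ qs)

        Asymptotic : ℕ → ℕ → Set
        Asymptotic i C = ∃ λ e → ∣ e ∣ ≤ fromℕ C × (∀ k → ∣ ξ k i - e * β ^ k ∣ ≤ fromℕ C * fromℕ (suc k) ^ d)

        Asymptotic-mono : ∀ i {a b} → a ℕ.≤ b → Asymptotic i a → Asymptotic i b
        Asymptotic-mono i a≤b (e , p , q) = e , ≤-trans p (fromℕ-mono-≤ a≤b) ,
          λ k → ≤-trans (q k) (*-monoʳ-≤ (0≤x^n d (0≤fromℕ (suc k))) (fromℕ-mono-≤ a≤b))

        asymptotic : ∃ λ C → ∀ i → i ℕ.< suc d → Asymptotic i C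
        asymptotic = uniform Asymptotic ℕ._+_ (λ i a b → Asymptotic-mono i (ℕ.m≤m+n a b)) (λ i a b → Asymptotic-mono i (ℕ.m≤n+m b a)) (suc d) each
          where
          each : ∀ i → i ℕ.< suc d → ∃ (Asymptotic i)
          each i i<d =
            let e , C , q = dominant-root monic root simple others (λ j → ξ j i) (ξ-recurrence (rationals p) root i i<d)
                E , e≤E , _ = 0≤x⇒x≤fromℕ ∣ e ∣
            in C ℕ.+ E , e , ≤-trans e≤E (fromℕ-mono-≤ (ℕ.m≤n+m E C)) ,
               λ k → ≤-trans (q k) (*-monoʳ-≤ (0≤x^n d (0≤fromℕ (suc k))) (fromℕ-mono-≤ (ℕ.m≤m+n C E)))

        -- suc (a ⊙ b) is suc a * suc b.
        _⊙_ : ℕ → ℕ → ℕ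
        a ⊙ b = b ℕ.+ a ℕ.* suc b

        scaleʳ : ∀ a b {x} → IsInteger (fromℕ (suc b) * x) → IsInteger (fromℕ (suc (a ⊙ b)) * x)
        scaleʳ a b {x} q = IsInteger-resp (trans (sym (*-assoc (fromℕ (suc a)) (fromℕ (suc b)) x)) (*-congʳ (sym (fromℕ-* (suc a) (suc b)))))
          (IsInteger-* (IsInteger-fromℕ (suc a)) q)

        scaleˡ : ∀ a b {x} → IsInteger (fromℕ (suc a) * x) → IsInteger (fromℕ (suc (a ⊙ b)) * x)
        scaleˡ a b {x} q = ≡.subst (λ c → IsInteger (fromℕ c * x)) (ℕ.*-comm (suc b) (suc a)) (scaleʳ b a q)

        -- The coordinates satisfy the recurrence of the monic integral annihilator of β, so a
        -- denominator for its finitely many initial values works for all k.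
        denominators : ∃ λ Q → ∀ i → i ℕ.< suc d → ∀ k → IsInteger (fromℕ (suc Q) * ξ k i)
        denominators = uniform (λ i Q → ∀ k → IsInteger (fromℕ (suc Q) * ξ k i)) _⊙_
            (λ i a b q k → scaleˡ a b (q k)) (λ i a b q k → scaleʳ a b (q k)) (suc d) row
          where
          row : ∀ i → i ℕ.< suc d → ∃ λ Q → ∀ k → IsInteger (fromℕ (suc Q) * ξ k i)
          row i i<d =
            let is , im , iroot = ai
                n , imonic , _ = Monic⇒MonicOfDegree fromℕ-1 is im
                ints = integers is
                iroot′ = trans (sym (reflexive (eval≈ fromℤ is β))) iroot
                Q , q = uniform (λ k Q → IsInteger (fromℕ (suc Q) * ξ k i)) _⊙_ (λ k a b → scaleˡ a b) (λ k a b → scaleʳ a b)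
                          n λ k _ → ξ-rational k i
            in Q , integral-recurrence {s = λ k → fromℕ (suc Q) * ξ k i} imonic ints
                  (λ k → trans (⟦⟧ˢ-cong (map fromℤ is) (λ j → solve 2 (λ a b → a :* b := a :* b :+ 𝟘 :* 𝟘) refl (fromℕ (suc Q)) (ξ j i)) k)
                    (trans (⟦⟧ˢ-linear (map fromℤ is) (λ j → ξ j i) (λ _ → 0#) (fromℕ (suc Q)) 0# k)
                      (trans (+-congʳ (*-congˡ (ξ-recurrence (All-IsRational ints) iroot′ i i<d k)))
                        (solve 2 (λ a b → a :* 𝟘 :+ 𝟘 :* b := 𝟘) refl (fromℕ (suc Q)) ((map fromℤ is ⟦ (λ _ → 0#) ⟧ˢ) k)))))
                  q

        coordinatised : Coordinatised β
        coordinatised = record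
          { degree-1     = d
          ; Q            = suc (proj₁ denominators)
          ; C            = proj₁ asymptotic
          ; ξ            = ξ
          ; ξ-sum        = ξ-sum
          ; 1≤Q          = s≤s z≤n
          ; ξ-integral   = λ k i i<d → proj₂ denominators i i<d k
          ; ξ-asymptotic = proj₂ asymptotic
          ; independent  = independent
          }

    coordinatise : ∀ {β} → AlgebraicInteger β → (∀ z → OtherConjugate β z → ∣ z ∣ᶜ ≤ 1#) → Coordinatised β
    coordinatise {β} ai small with minimal-polynomial ai
    ... | p , mp with Monic⇒MonicOfDegree {ι = fromℚ} fromℚ-1 p (proj₁ (proj₁ mp))
    ... | zero  , monic , len = ⊥-elim (constant monic (trans (sym (reflexive (eval≈ fromℚ p β))) (proj₂ (proj₁ mp))))
      where
      constant : ∀ {cs} → MonicOfDegree 0 cs → cs ⟨ β ⟩ ≈ 0# → ⊥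
      constant [ c≈1 ] z = 0≉1 (trans (solve 1 (λ b → 𝟙 := 𝟙 :+ b :* 𝟘) refl β) (trans (+-congʳ (sym c≈1)) z))
    ... | suc d , monic , len = Companion.coordinatised mp ai small monic len

    Pisot-or-Salem⇒Coordinatised : ∀ {β} → Pisot β ⊎ Salem β → Coordinatised β
    Pisot-or-Salem⇒Coordinatised (inj₁ (ai , _ , small))     = coordinatise ai λ z p → inj₁ (small z p)
    Pisot-or-Salem⇒Coordinatised (inj₂ (ai , _ , small , _)) = coordinatise ai small

  -- A Liouville inequality by the pigeonhole principle.

  module Liouville where

    open RealField
    open Series
    open Integrality
    open Coordinates
    open SubexponentialFunctions using (^-distrib)

    offset : ∀ U i → ℤ.∣ i ∣ ℕ.≤ U → ∃ λ n → n ℕ.< suc (U ℕ.+ U) × i ℤ.+ + U ≡ + n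
    offset U (+ n)    p = n ℕ.+ U , s≤s (ℕ.+-monoˡ-≤ U p) , ≡.refl
    offset U -[1+ n ] p = U ℕ.∸ suc n , s≤s (ℕ.≤-trans (ℕ.m∸n≤m U (suc n)) (ℕ.m≤m+n U U)) , ℤ.⊖-≥ p

    funToFin-cong : ∀ {m n} {f g : Fin m → Fin n} → (∀ i → f i ≡ g i) → funToFin f ≡ funToFin g
    funToFin-cong {zero}  p = ≡.refl
    funToFin-cong {suc m} p = ≡.cong₂ Fin.combine (p zero) (funToFin-cong λ i → p (suc i))

    ∑-bound : ∀ (f : ℕ → ℝ) c n → (∀ i → i ℕ.< n → ∣ f i ∣ ≤ fromℕ c) → ∣ ∑ f n ∣ ≤ fromℕ (n ℕ.* c)
    ∑-bound f c n p = ≤-trans (≤-trans (∣∑∣≤∑∣∣ f n) (∑-mono n p)) (≤-reflexive (trans (∑-const (fromℕ c) n) (sym (fromℕ-* n c))))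

    ∣*∣≤ : ∀ x y m n → ∣ x ∣ ≤ fromℕ m → ∣ y ∣ ≤ fromℕ n → ∣ x * y ∣ ≤ fromℕ (m ℕ.* n)
    ∣*∣≤ x y m n p q = ≤-respˡ (sym (∣x*y∣≈∣x∣*∣y∣ x y)) (≤-respʳ (sym (fromℕ-* m n)) (*-mono-≤ (0≤∣x∣ x) (0≤∣x∣ y) p q))

    ∣fromℕ∣≤ : ∀ {m n} → m ℕ.≤ n → ∣ fromℕ m ∣ ≤ fromℕ n
    ∣fromℕ∣≤ {m} p = ≤-respˡ (sym (0≤x⇒∣x∣≈x (0≤fromℕ m))) (fromℕ-mono-≤ p)

    module DoubleSum (D R T : ℕ) (b : ℕ → ℤ) (b≤T : ∀ k → k ℕ.< R → ℤ.∣ b k ∣ ℕ.≤ T) where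

      -- The linear functional X^k ↦ g k applied to the product of Σ a_j X^j and Σ b_k X^k. With g =
      -- β^k it gives the value of the product at β, with g = ξ k i the coordinates of that value.
      L : (ℕ → ℕ) → (ℕ → ℝ) → ℝ
      L a g = ∑ (λ j → ∑ (λ k → fromℕ (a j) * (fromℤ (b k) * g (j ℕ.+ k))) R) D

      L-cong : ∀ a (f g : ℕ → ℝ) → (∀ k → f k ≈ g k) → L a f ≈ L a g
      L-cong a f g p = ∑-cong D λ j _ → ∑-cong R λ k _ → *-congˡ (*-congˡ (p (j ℕ.+ k)))

      L-linear : ∀ a x (f g : ℕ → ℝ) → L a (λ k → x * f k + g k) ≈ x * L a f + L a g
      L-linear a x f g = trans
        (∑-cong D λ j _ → trans (∑-cong R λ k _ → solve 5 (λ a b x f g → a :* (b :* (x :* f :+ g)) := x :* (a :* (b :* f)) :+ a :* (b :* g))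
            refl (fromℕ (a j)) (fromℤ (b k)) x (f (j ℕ.+ k)) (g (j ℕ.+ k)))
          (trans (∑-+ _ _ R) (+-congʳ (∑-*ˡ x _ R))))
        (trans (∑-+ _ _ D) (+-congʳ (∑-*ˡ x _ D)))

      L-0 : ∀ a → L a (λ _ → 0#) ≈ 0#
      L-0 a = trans (∑-cong D λ j _ → trans (∑-cong R λ k _ → solve 2 (λ a b → a :* (b :* 𝟘) := 𝟘) refl (fromℕ (a j)) (fromℤ (b k))) (∑-0 R)) (∑-0 D)

      L-* : ∀ a x (f : ℕ → ℝ) → L a (λ k → x * f k) ≈ x * L a f
      L-* a x f = trans (L-cong a (λ k → x * f k) (λ k → x * f k + 0#) λ k → sym (+-identityʳ (x * f k))) (trans (L-linear a x f (λ _ → 0#)) (trans (+-congˡ (L-0 a)) (+-identityʳ _)))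

      L-∑ : ∀ a (g : ℕ → ℕ → ℝ) (w : ℕ → ℝ) n → ∑ (λ i → L a (λ k → g k i) * w i) n ≈ L a (λ k → ∑ (λ i → g k i * w i) n)
      L-∑ a g w zero    = sym (L-0 a)
      L-∑ a g w (suc n) = trans (+-congʳ (L-∑ a g w n)) (trans (+-comm _ _) (trans (+-congʳ (*-comm _ _))
        (trans (sym (L-linear a (w n) (λ k → g k n) (λ k → ∑ (λ i → g k i * w i) n)))
          (L-cong a (λ k → w n * g k n + ∑ (λ i → g k i * w i) n) (λ k → ∑ (λ i → g k i * w i) (suc n)) λ k → trans (+-comm _ _) (+-congˡ (*-comm _ _))))))

      L-integral : ∀ a (g : ℕ → ℝ) → (∀ k → IsInteger (g k)) → IsInteger (L a g)
      L-integral a g p = IsInteger-∑ D λ j _ → IsInteger-∑ R λ k _ →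
        IsInteger-* (IsInteger-fromℕ (a j)) (IsInteger-* (b k , refl) (p (j ℕ.+ k)))

      L-bound : ∀ a A g G → (∀ j → a j ℕ.≤ A) → (∀ k → k ℕ.≤ D ℕ.+ R → ∣ g k ∣ ≤ fromℕ G) →
                ∣ L a g ∣ ≤ fromℕ (D ℕ.* (R ℕ.* (A ℕ.* (T ℕ.* G))))
      L-bound a A g G a≤A p = ∑-bound _ (R ℕ.* (A ℕ.* (T ℕ.* G))) D λ j j<d → ∑-bound _ (A ℕ.* (T ℕ.* G)) R λ k k<R →
        ∣*∣≤ (fromℕ (a j)) (fromℤ (b k) * g (j ℕ.+ k)) A (T ℕ.* G) (∣fromℕ∣≤ (a≤A j))
          (∣*∣≤ (fromℤ (b k)) (g (j ℕ.+ k)) T G (≤-respˡ (sym (∣fromℤ∣ (b k))) (fromℕ-mono-≤ (b≤T k k<R)))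
            (p (j ℕ.+ k) (ℕ.+-mono-≤ (ℕ.<⇒≤ j<d) (ℕ.<⇒≤ k<R))))

    module _ {β : ℝ} (1<β : 1# < β) (coords : Coordinatised β) where
      open Coordinatised coords renaming (degree-1 to d)

      private
        B₀ : ℕ
        B₀ = proj₁ (0≤x⇒x≤fromℕ (β ^ degree))

        β^deg≤B₀ : β ^ degree ≤ fromℕ B₀
        β^deg≤B₀ = proj₁ (proj₂ (0≤x⇒x≤fromℕ (β ^ degree)))

        0≤β : 0# ≤ β
        0≤β = ≤-trans 0≤1 (inj₁ 1<β)

      -- For sums of R terms with coefficients at most T: G bounds the remainders of the asymptotic
      -- expansion, A U₀ the coordinates, and A is chosen so that A^degree > (2 A U₀ + 1)^(degree - 1).
      G U₀ A height : ℕ → ℕ → ℕ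
      G R T = C ℕ.* suc (degree ℕ.+ R) ℕ.^ d
      U₀ R T = Q ℕ.* (C ℕ.+ degree ℕ.* (R ℕ.* (T ℕ.* G R T)))
      A R T = suc (suc (U₀ R T ℕ.+ U₀ R T) ℕ.^ d)
      height R T = 2 ℕ.* (Q ℕ.* (degree ℕ.* (A R T ℕ.* B₀)))

      private
        module Pigeonhole (R T : ℕ) (b : ℕ → ℤ) (b≤T : ∀ k → k ℕ.< R → ℤ.∣ b k ∣ ℕ.≤ T) where

          open DoubleSum degree R T b b≤T

          y : ℝ
          y = ∑ (λ k → fromℤ (b k) * β ^ k) R

          α z : (ℕ → ℕ) → ℝ
          α a = ∑ (λ j → fromℕ (a j) * β ^ j) degree
          z a = L a (β ^_)

          z≈ : ∀ a → z a ≈ α a * y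
          z≈ a = trans (∑-cong degree λ j _ → trans (∑-cong R λ k _ → trans (*-congˡ (*-congˡ (^-homo-* β j k)))
                     (solve 4 (λ a b x y → a :* (b :* (x :* y)) := (a :* x) :* (b :* y)) refl (fromℕ (a j)) (fromℤ (b k)) (β ^ j) (β ^ k)))
                   (∑-*ˡ _ _ R)) (∑-*ʳ y _ degree)

          X : (ℕ → ℕ) → ℕ → ℝ
          X a i = L a (λ k → ξ k i)

          X-sum : ∀ a → ∑ (λ i → X a i * β ^ i) degree ≈ z a
          X-sum a = trans (L-∑ a ξ (β ^_) degree) (L-cong a (λ k → ∑ (λ i → ξ k i * β ^ i) degree) (β ^_) ξ-sum)

          QX-integral : ∀ a i → i ℕ.< degree → IsInteger (fromℕ Q * X a i)
          QX-integral a i i<d = IsInteger-resp (L-* a (fromℕ Q) (λ k → ξ k i)) (L-integral a _ λ k → ξ-integral k i i<d)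

          -- By the asymptotic expansion the coordinate is e · z plus a remainder of polynomial
          -- size. As |z| ≤ 1, the exponential growth of β^k disappears from the bound.
          X-bound : ∀ a A → 1 ℕ.≤ A → (∀ j → a j ℕ.≤ A) → ∣ z a ∣ ≤ 1# → ∀ i → i ℕ.< degree →
                    ∣ fromℕ Q * X a i ∣ ≤ fromℕ (A ℕ.* U₀ R T)
          X-bound a A 1≤A a≤A ∣z∣≤1 i i<d with ξ-asymptotic i i<d
          ... | e , ∣e∣≤C , remainder = ≤-trans
              (∣*∣≤ (fromℕ Q) (X a i) Q (C ℕ.+ degree ℕ.* (R ℕ.* (A ℕ.* (T ℕ.* G R T)))) (∣fromℕ∣≤ {Q} ℕ.≤-refl) (begin
                ∣ X a i ∣
                  ≈⟨ ∣∣-cong (trans (L-cong a (λ k → ξ k i) (λ k → e * β ^ k + (ξ k i - e * β ^ k)) λ k → solve 3 (λ x e p → x := e :* p :+ (x :- e :* p)) refl (ξ k i) e (β ^ k)) (L-linear a e (β ^_) (λ k → ξ k i - e * β ^ k))) ⟩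
                ∣ e * z a + r ∣
                  ≤⟨ ∣x+y∣≤∣x∣+∣y∣ (e * z a) r ⟩
                ∣ e * z a ∣ + ∣ r ∣
                  ≤⟨ +-mono-≤ (≤-respˡ (sym (∣x*y∣≈∣x∣*∣y∣ e (z a))) (≤-respʳ (*-identityʳ (fromℕ C)) (*-mono-≤ (0≤∣x∣ e) (0≤∣x∣ (z a)) ∣e∣≤C ∣z∣≤1)))
                      (L-bound a A (λ k → ξ k i - e * β ^ k) (G R T) a≤A λ k k≤ → ≤-trans (remainder k)
                        (≤-trans (*-monoˡ-≤ (0≤fromℕ C) (^-monoˡ-≤ d (0≤fromℕ (suc k)) (fromℕ-mono-≤ (s≤s k≤))))
                          (≤-reflexive (sym (trans (fromℕ-* C (suc (degree ℕ.+ R) ℕ.^ d)) (*-congˡ (fromℕ-^ (suc (degree ℕ.+ R)) d))))))) ⟩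
                fromℕ C + fromℕ (degree ℕ.* (R ℕ.* (A ℕ.* (T ℕ.* G R T))))
                  ≈⟨ fromℕ-+ C (degree ℕ.* (R ℕ.* (A ℕ.* (T ℕ.* G R T)))) ⟨
                fromℕ (C ℕ.+ degree ℕ.* (R ℕ.* (A ℕ.* (T ℕ.* G R T)))) ∎))
              (fromℕ-mono-≤ (ℕ.≤-trans (ℕ.*-monoʳ-≤ Q (ℕ.+-monoˡ-≤ (degree ℕ.* (R ℕ.* (A ℕ.* (T ℕ.* G R T)))) (ℕ.m≤n*m C A ⦃ ℕ.>-nonZero 1≤A ⦄)))
                (ℕ.≤-reflexive (rearrange Q C A degree R (T ℕ.* G R T)))))
            where
            open ≤-Reasoning
            r = L a (λ k → ξ k i - e * β ^ k)
            rearrange : ∀ Q C A d R T → Q ℕ.* (A ℕ.* C ℕ.+ d ℕ.* (R ℕ.* (A ℕ.* T))) ≡ A ℕ.* (Q ℕ.* (C ℕ.+ d ℕ.* (R ℕ.* T)))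
            rearrange = solve-∀

          α-bound : ∀ a A → (∀ j → a j ℕ.≤ A) → ∣ α a ∣ ≤ fromℕ (degree ℕ.* (A ℕ.* B₀))
          α-bound a A a≤A = ∑-bound _ (A ℕ.* B₀) degree λ j j<d → ∣*∣≤ (fromℕ (a j)) (β ^ j) A B₀ (∣fromℕ∣≤ (a≤A j))
            (≤-respˡ (sym (0≤x⇒∣x∣≈x (0≤x^n j 0≤β))) (≤-trans (^-monoʳ-≤ (inj₁ 1<β) (ℕ.<⇒≤ j<d)) β^deg≤B₀))

          2Q∣z∣<1 : fromℕ (height R T) * ∣ y ∣ < 1# → ∀ a → (∀ j → a j ℕ.≤ A R T) → (1# + 1#) * (fromℕ Q * ∣ z a ∣) < 1#
          2Q∣z∣<1 y-small a a≤A = ≤-<-trans (begin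
            num 2 * (fromℕ Q * ∣ z a ∣)
              ≤⟨ *-monoˡ-≤ (inj₁ 0<2) (*-monoˡ-≤ (0≤fromℕ Q)
                   (≤-respˡ (sym (trans (∣∣-cong (z≈ a)) (∣x*y∣≈∣x∣*∣y∣ (α a) y))) (*-monoʳ-≤ (0≤∣x∣ y) (α-bound a (A R T) a≤A)))) ⟩
            num 2 * (fromℕ Q * (fromℕ (degree ℕ.* (A R T ℕ.* B₀)) * ∣ y ∣))
              ≈⟨ solve 3 (λ q x y → 𝟚 :* (q :* (x :* y)) := (𝟚 :* (q :* x)) :* y) refl (fromℕ Q) (fromℕ (degree ℕ.* (A R T ℕ.* B₀))) (∣ y ∣) ⟩
            num 2 * (fromℕ Q * fromℕ (degree ℕ.* (A R T ℕ.* B₀))) * ∣ y ∣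
              ≈⟨ *-congʳ (sym (trans (fromℕ-* 2 (Q ℕ.* (degree ℕ.* (A R T ℕ.* B₀)))) (*-cong (+-congˡ (+-identityʳ 1#)) (fromℕ-* Q (degree ℕ.* (A R T ℕ.* B₀)))))) ⟩
            fromℕ (height R T) * ∣ y ∣ ∎)
            y-small
            where open ≤-Reasoning

          module Collision (y≉0 : ¬ (y ≈ 0#)) (A′ U : ℕ) (fewer : suc (U ℕ.+ U) ℕ.^ d ℕ.< A′ ℕ.^ degree)
            (QX≤U : ∀ a → (∀ j → a j ℕ.≤ A′) → ∣ z a ∣ ≤ 1# → ∀ i → i ℕ.< degree → ∣ fromℕ Q * X a i ∣ ≤ fromℕ U)
            (2Q∣z∣<1 : ∀ a → (∀ j → a j ℕ.≤ A′) → (1# + 1#) * (fromℕ Q * ∣ z a ∣) < 1#) where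

            ∣z∣≤1 : ∀ a → (∀ j → a j ℕ.≤ A′) → ∣ z a ∣ ≤ 1#
            ∣z∣≤1 a a≤A = ≤-trans (≤-trans (≤-respˡ (*-identityˡ _) (*-monoʳ-≤ (0≤∣x∣ (z a)) (1≤fromℕ 1≤Q)))
                (≤-by (0≤x*y (0≤fromℕ Q) (0≤∣x∣ (z a))) (solve 1 (λ x → 𝟚 :* x :- x := x) refl (fromℕ Q * ∣ z a ∣))))
              (inj₁ (2Q∣z∣<1 a a≤A))

            code : ∀ a → (∀ j → a j ℕ.≤ A′) → ∀ i → i ℕ.< degree → ∃ λ n → n ℕ.< suc (U ℕ.+ U) × fromℕ Q * X a i + fromℕ U ≈ fromℕ n
            code a a≤A i i<d =
              let q , p = QX-integral a i i<d
                  n , n< , e = offset U q (fromℕ-cancel-≤ (≤-respˡ (trans (∣∣-cong p) (∣fromℤ∣ q)) (QX≤U a a≤A (∣z∣≤1 a a≤A) i i<d)))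
              in n , n< , trans (+-congʳ p) (trans (sym (fromℤ-+ q (+ U))) (reflexive (≡.cong fromℤ e)))

            digits : Fin (A′ ℕ.^ degree) → ℕ → ℕ
            digits x j with j ℕ.<? degree
            ... | yes j<d = toℕ (finToFun {A′} {degree} x (fromℕ< j<d))
            ... | no _    = 0

            digits≤ : ∀ x j → digits x j ℕ.≤ A′
            digits≤ x j with j ℕ.<? degree
            ... | yes j<d = ℕ.<⇒≤ (Fin.toℕ<n (finToFun {A′} {degree} x (fromℕ< j<d)))
            ... | no _    = z≤n

            digits-injective : ∀ x x′ → (∀ j → j ℕ.< degree → digits x j ≡ digits x′ j) → x ≡ x′
            digits-injective x x′ p = ≡.trans (≡.sym (Fin.funToFin-finToFin {degree} {A′} x))
              (≡.trans (funToFin-cong λ i → Fin.toℕ-injective (digit i)) (Fin.funToFin-finToFin {degree} {A′} x′))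
              where
              digits-toℕ : ∀ x i → digits x (toℕ i) ≡ toℕ (finToFun {A′} {degree} x i)
              digits-toℕ x i with toℕ i ℕ.<? degree
              ... | yes i<d = ≡.cong (λ i → toℕ (finToFun {A′} {degree} x i)) (Fin.fromℕ<-toℕ i i<d)
              ... | no i≮d  = ⊥-elim (i≮d (Fin.toℕ<n i))
              digit : ∀ i → toℕ (finToFun {A′} {degree} x i) ≡ toℕ (finToFun {A′} {degree} x′ i)
              digit i = ≡.trans (≡.sym (digits-toℕ x i)) (≡.trans (p (toℕ i) (Fin.toℕ<n i)) (digits-toℕ x′ i))

            -- Coordinate 0 is deliberately left out, which makes the codes fewer than the digit
            -- vectors. If the other coordinates agree, z a - z a′ is the difference of the
            -- coordinates 0, an integer divided by Q; being too small, it vanishes, and y ≠ 0 with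
            -- the independence of 1, ..., β^d forces equal digits.
            codes : Fin (A′ ℕ.^ degree) → Fin d → Fin (suc (U ℕ.+ U))
            codes x i = fromℕ< (proj₁ (proj₂ (code (digits x) (digits≤ x) (suc (toℕ i)) (s≤s (Fin.toℕ<n i)))))

            module Agreement (a a′ : ℕ → ℕ) (a≤ : ∀ j → a j ℕ.≤ A′) (a′≤ : ∀ j → a′ j ℕ.≤ A′)
                             (X-equal : ∀ i → i ℕ.< d → X a (suc i) ≈ X a′ (suc i)) where

              tail-sum : (ℕ → ℕ) → ℝ
              tail-sum a = ∑ (λ i → X a (suc i) * β ^ suc i) d

              z-split : ∀ a → z a ≈ X a 0 * 1# + tail-sum a
              z-split a = trans (sym (X-sum a)) (∑-head (λ i → X a i * β ^ i) d)

              tails-equal : tail-sum a ≈ tail-sum a′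
              tails-equal = ∑-cong d λ i i<d → *-congʳ (X-equal i i<d)

              z-difference : z a - z a′ ≈ X a 0 - X a′ 0
              z-difference = trans (+-cong (z-split a) (-‿cong (trans (z-split a′) (+-congˡ (sym tails-equal)))))
                (solve 3 (λ x y s → (x :* 𝟙 :+ s) :- (y :* 𝟙 :+ s) := x :- y) refl (X a 0) (X a′ 0) (tail-sum a))

              Q-difference-integral : IsInteger (fromℕ Q * (z a - z a′))
              Q-difference-integral = IsInteger-resp
                (trans (solve 3 (λ q x y → q :* x :+ :- (q :* y) := q :* (x :- y)) refl (fromℕ Q) (X a 0) (X a′ 0)) (*-congˡ (sym z-difference)))
                (IsInteger-+ (QX-integral a 0 (s≤s z≤n)) (IsInteger-neg (QX-integral a′ 0 (s≤s z≤n))))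

              Q-difference-small : ∣ fromℕ Q * (z a - z a′) ∣ < 1#
              Q-difference-small = *-cancelˡ-< (inj₁ 0<2) (≤-<-trans
                (*-monoˡ-≤ (inj₁ 0<2) (≤-respˡ (sym (trans (∣x*y∣≈∣x∣*∣y∣ (fromℕ Q) (z a - z a′)) (*-congʳ (0≤x⇒∣x∣≈x (0≤fromℕ Q)))))
                  (*-monoˡ-≤ (0≤fromℕ Q) (≤-respʳ (+-congˡ (∣-x∣≈∣x∣ (z a′))) (∣x+y∣≤∣x∣+∣y∣ (z a) (- z a′))))))
                (<-respˡ-≈ (solve 3 (λ q x y → 𝟚 :* (q :* x) :+ 𝟚 :* (q :* y) := 𝟚 :* (q :* (x :+ y))) refl (fromℕ Q) (∣ z a ∣) (∣ z a′ ∣))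
                  (<-respʳ-≈ (sym (*-identityʳ (1# + 1#))) (+-mono-<-≤ (2Q∣z∣<1 a a≤) (inj₁ (2Q∣z∣<1 a′ a′≤))))))

              z-equal : z a - z a′ ≈ 0#
              z-equal = *-cancelˡ (0<x⇒x≉0 (0<fromℕ 1≤Q)) (trans p (trans (reflexive (≡.cong fromℤ
                  (∣fromℤ∣<1⇒≡0 i (<-respˡ-≈ (∣∣-cong p) Q-difference-small)))) (sym (zeroʳ (fromℕ Q)))))
                where
                i = proj₁ Q-difference-integral
                p = proj₂ Q-difference-integral

              α-split : ∑ (λ j → (fromℕ (a j) - fromℕ (a′ j)) * β ^ j) degree ≈ α a + - 1# * α a′
              α-split = trans
                (∑-cong degree λ j _ → solve 3 (λ a b p → (a :- b) :* p := a :* p :+ :- 𝟙 :* (b :* p)) refl (fromℕ (a j)) (fromℕ (a′ j)) (β ^ j))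
                (trans (∑-+ (λ j → fromℕ (a j) * β ^ j) (λ j → - 1# * (fromℕ (a′ j) * β ^ j)) degree) (+-congˡ (∑-*ˡ (- 1#) (λ j → fromℕ (a′ j) * β ^ j) degree)))

              α-equal : ∑ (λ j → (fromℕ (a j) - fromℕ (a′ j)) * β ^ j) degree ≈ 0#
              α-equal = by-contradiction λ ≉0 → *-≉0 ≉0 y≉0 (trans (*-congʳ α-split)
                (trans (solve 3 (λ x w y → (x :+ :- 𝟙 :* w) :* y := x :* y :- w :* y) refl (α a) (α a′) y)
                  (trans (+-cong (sym (z≈ a)) (-‿cong (sym (z≈ a′)))) z-equal)))

              agree : ∀ j → j ℕ.< degree → a j ≡ a′ j
              agree j j<d = ℕ.≤-antisym (fromℕ-cancel-≤ (≤-reflexive aj≈)) (fromℕ-cancel-≤ (≤-reflexive (sym aj≈)))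
                where
                aj≈ : fromℕ (a j) ≈ fromℕ (a′ j)
                aj≈ = x-y≈0⇒x≈y (independent (λ j → fromℕ (a j) - fromℕ (a′ j))
                  (λ j → IsInteger⇒IsRational (IsInteger-+ (IsInteger-fromℕ (a j)) (IsInteger-neg (IsInteger-fromℕ (a′ j))))) α-equal j j<d)

            X-equal : ∀ x x′ → funToFin (codes x) ≡ funToFin (codes x′) → ∀ i → i ℕ.< d → X (digits x) (suc i) ≈ X (digits x′) (suc i)
            X-equal x x′ same i i<d = ≡.subst (λ i → X (digits x) (suc i) ≈ X (digits x′) (suc i)) (Fin.toℕ-fromℕ< i<d)
              (from-codes (X (digits x) (suc (toℕ (fromℕ< i<d)))) (X (digits x′) (suc (toℕ (fromℕ< i<d))))
                (code (digits x) (digits≤ x) (suc (toℕ (fromℕ< i<d))) (s≤s (Fin.toℕ<n (fromℕ< i<d))))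
                (code (digits x′) (digits≤ x′) (suc (toℕ (fromℕ< i<d))) (s≤s (Fin.toℕ<n (fromℕ< i<d))))
                (codes≡ (fromℕ< i<d)))
              where
              codes≡ : ∀ i → codes x i ≡ codes x′ i
              codes≡ i = ≡.trans (≡.sym (Fin.finToFun-funToFin (codes x) i))
                (≡.trans (≡.cong (λ c → finToFun {suc (U ℕ.+ U)} {d} c i) same) (Fin.finToFun-funToFin (codes x′) i))
              from-codes : ∀ v v′ (c : ∃ λ n → n ℕ.< suc (U ℕ.+ U) × fromℕ Q * v + fromℕ U ≈ fromℕ n)
                           (c′ : ∃ λ n → n ℕ.< suc (U ℕ.+ U) × fromℕ Q * v′ + fromℕ U ≈ fromℕ n) →
                           fromℕ< (proj₁ (proj₂ c)) ≡ fromℕ< (proj₁ (proj₂ c′)) → v ≈ v′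
              from-codes v v′ (n , n< , p) (n′ , n′< , p′) e = *-cancelˡ (0<x⇒x≉0 (0<fromℕ 1≤Q))
                (≈-by 1# (trans p (trans (reflexive (≡.cong fromℕ n≡n′)) (sym p′)))
                  (solve 3 (λ x y u → x :- y := 𝟙 :* ((x :+ u) :- (y :+ u))) refl (fromℕ Q * v) (fromℕ Q * v′) (fromℕ U)))
                where
                n≡n′ : n ≡ n′
                n≡n′ = ≡.trans (≡.sym (Fin.toℕ-fromℕ< n<)) (≡.trans (≡.cong toℕ e) (Fin.toℕ-fromℕ< n′<))

            distinct-impossible : ∀ x x′ → x ≢ x′ → funToFin (codes x) ≡ funToFin (codes x′) → ⊥
            distinct-impossible x x′ x≢x′ same = x≢x′ (digits-injective x x′
              (Agreement.agree (digits x) (digits x′) (digits≤ x) (digits≤ x′) (X-equal x x′ same)))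

            impossible : ⊥
            impossible =
              let x , x′ , x<x′ , same = Fin.pigeonhole fewer (λ x → funToFin (codes x))
              in distinct-impossible x x′ (λ x≡x′ → ℕ.<-irrefl (≡.cong toℕ x≡x′) x<x′) same

        -- With V = 2 U₀ + 1 and A = V^d + 1, the left side is at most (A V)^d = A^d V^d, which is
        -- less than A^d · A.
        A-large : ∀ R T → suc (A R T ℕ.* U₀ R T ℕ.+ A R T ℕ.* U₀ R T) ℕ.^ d ℕ.< A R T ℕ.^ degree
        A-large R T = enough (U₀ R T)
          where
          rearrange : ∀ a u → a ℕ.+ (a ℕ.* u ℕ.+ a ℕ.* u) ≡ a ℕ.* (1 ℕ.+ (u ℕ.+ u))
          rearrange = solve-∀
          enough′ : ∀ A V u → V ≡ suc (u ℕ.+ u) → A ≡ suc (V ℕ.^ d) → suc (A ℕ.* u ℕ.+ A ℕ.* u) ℕ.^ d ℕ.< A ℕ.^ suc d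
          enough′ A V u ≡.refl p = ℕ.≤-<-trans
            (ℕ.≤-trans (ℕ.^-monoˡ-≤ d (ℕ.≤-trans (ℕ.+-monoˡ-≤ (A ℕ.* u ℕ.+ A ℕ.* u) 1≤A) (ℕ.≤-reflexive (rearrange A u))))
              (ℕ.≤-reflexive (^-distrib A V d)))
            (≡.subst (A ℕ.^ d ℕ.* V ℕ.^ d ℕ.<_) (≡.trans (≡.sym (ℕ.*-suc (A ℕ.^ d) (V ℕ.^ d))) (≡.trans (ℕ.*-comm (A ℕ.^ d) _) (≡.cong (ℕ._* A ℕ.^ d) (≡.sym p))))
              (ℕ.m<n+m (A ℕ.^ d ℕ.* V ℕ.^ d) (ℕ.m^n>0 A ⦃ ℕ.>-nonZero 1≤A ⦄ d)))
            where
            1≤A : 1 ℕ.≤ A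
            1≤A = ≡.subst (1 ℕ.≤_) (≡.sym p) (s≤s z≤n)
          enough : ∀ u → suc (suc (suc (u ℕ.+ u) ℕ.^ d) ℕ.* u ℕ.+ suc (suc (u ℕ.+ u) ℕ.^ d) ℕ.* u) ℕ.^ d ℕ.< suc (suc (u ℕ.+ u) ℕ.^ d) ℕ.^ suc d
          enough u = enough′ (suc (suc (u ℕ.+ u) ℕ.^ d)) (suc (u ℕ.+ u)) u ≡.refl ≡.refl

        height-large : ∀ R T b b≤T → let module P = Pigeonhole R T b b≤T in
                       ¬ (P.y ≈ 0#) → ¬ (fromℕ (height R T) * ∣ P.y ∣ < 1#)
        height-large R T b b≤T y≉0 y-small = P.Collision.impossible y≉0 (A R T) (A R T ℕ.* U₀ R T) (A-large R T)
          (λ a a≤A → P.X-bound a (A R T) (s≤s z≤n) a≤A) (P.2Q∣z∣<1 y-small)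
          where module P = Pigeonhole R T b b≤T

      -- A nonzero integral combination of powers of β, multiplied by all small integral combinations
      -- of 1, …, β^(degree - 1), would give more points than there is room for if it were too small.
      liouville : ∀ R T (b : ℕ → ℤ) → (∀ k → k ℕ.< R → ℤ.∣ b k ∣ ℕ.≤ T) →
                  let y = ∑ (λ k → fromℤ (b k) * β ^ k) R in
                  ¬ (y ≈ 0#) → 1# ≤ fromℕ (height R T) * ∣ y ∣
      liouville R T b b≤T y≉0 = ≮⇒≥ {fromℕ (height R T) * ∣ ∑ (λ k → fromℤ (b k) * β ^ k) R ∣} {1#} (height-large R T b b≤T y≉0)

  -- Nonzero coefficients in every window that follows a nonzero Y.

  module RecurrenceOfCoefficients where

    open RealField
    open Series
    open Exponential
    open Coordinates using (Coordinatised)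
    open Liouville
    open SubexponentialFunctions

    root-exists : ∀ {x} v → 1# ≤ x → 1 ℕ.≤ v → ∃ λ η → 1# ≤ η × η ^ v ≈ x
    root-exists {x} v 1≤x 1≤v = exp (log x / fromℕ v) ,
      ≤-respˡ exp-0 (exp-mono-≤ (0≤x*y (0≤log 1≤x) (inj₁ (0<x⁻¹ (0<fromℕ 1≤v))))) ,
      trans (exp-^ v _) (trans (exp-cong (*-/-cancel (log x) (0<fromℕ 1≤v))) (log-exp 1≤x))

    module _ {β : ℝ} (1<β : 1# < β) (coords : Coordinatised β) {g : ℕ} (2≤g : 2 ℕ.≤ g)
             (c : ℕ → ℤ) (T : ℕ → ℕ) (c≤T : ∀ R m → m ℕ.≤ R → ℤ.∣ c m ∣ ℕ.≤ T R) (T-subexp : Subexponential g T)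
             (vanishes : HasSum (λ m → fromℤ (c m) * (β ⁻¹) ^ m) 0#) where

      private
        1≤g : 1 ℕ.≤ g
        1≤g = ℕ.≤-trans (s≤s z≤n) 2≤g

        b : ℝ
        b = β ⁻¹

        0<β : 0# < β
        0<β = <-trans 0<1 1<β

        0<b : 0# < b
        0<b = 0<x⁻¹ 0<β

        βb≈1 : β * b ≈ 1#
        βb≈1 = x/x≈1 0<β

        β^n*b^n≈1 : ∀ n → β ^ n * b ^ n ≈ 1#
        β^n*b^n≈1 n = trans (sym (^-distrib-* β b n)) (trans (^-congˡ n βb≈1) (1^n≈1 n))

      -- β^R times the partial sum of the series up to R, hence -β^R times its tail.
      Y : ℕ → ℝ
      Y R = ∑ (λ k → fromℤ (c (R ℕ.∸ k)) * β ^ k) (suc R)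

      Y-suc : ∀ R → Y (suc R) ≈ fromℤ (c (suc R)) + β * Y R
      Y-suc R = trans (∑-head (λ k → fromℤ (c (suc R ℕ.∸ k)) * β ^ k) (suc R)) (+-cong (*-identityʳ _)
        (trans (∑-cong (suc R) λ k _ → solve 3 (λ c b p → c :* (b :* p) := b :* (c :* p)) refl (fromℤ (c (R ℕ.∸ k))) β (β ^ k))
          (∑-*ˡ β (λ k → fromℤ (c (R ℕ.∸ k)) * β ^ k) (suc R))))

      private
        Y≈ : ∀ R → Y R ≈ β ^ R * ∑ (λ m → fromℤ (c m) * b ^ m) (suc R)
        Y≈ zero    = solve 1 (λ c → 𝟘 :+ c :* 𝟙 := 𝟙 :* (𝟘 :+ c :* 𝟙)) refl (fromℤ (c 0))
        Y≈ (suc R) = trans (Y-suc R) (trans (+-cong (trans (sym (*-identityʳ _)) (*-congˡ (sym (β^n*b^n≈1 (suc R))))) (*-congˡ (Y≈ R)))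
          (solve 5 (λ c b r s q → c :* ((b :* r) :* q) :+ b :* (r :* s) := (b :* r) :* (s :+ c :* q)) refl
            (fromℤ (c (suc R))) β (β ^ R) (∑ (λ m → fromℤ (c m) * b ^ m) (suc R)) (b ^ suc R)))

        Y-step : ∀ R → ∣ Y R ∣ ≤ b * (∣ Y (suc R) ∣ + ∣ fromℤ (c (suc R)) ∣)
        Y-step R = begin
          ∣ Y R ∣
            ≈⟨ ∣∣-cong (trans (trans (sym (*-identityˡ (Y R))) (*-congʳ (sym βb≈1)))
                 (trans (solve 4 (λ b β y c → (β :* b) :* y := b :* ((c :+ β :* y) :+ :- c)) refl b β (Y R) (fromℤ (c (suc R)))) (*-congˡ (+-congʳ (sym (Y-suc R)))))) ⟩
          ∣ b * (Y (suc R) - fromℤ (c (suc R))) ∣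
            ≈⟨ trans (∣x*y∣≈∣x∣*∣y∣ b _) (*-congʳ (0≤x⇒∣x∣≈x (inj₁ 0<b))) ⟩
          b * ∣ Y (suc R) - fromℤ (c (suc R)) ∣
            ≤⟨ *-monoˡ-≤ (inj₁ 0<b) (≤-respʳ (+-congˡ (∣-x∣≈∣x∣ (fromℤ (c (suc R))))) (∣x+y∣≤∣x∣+∣y∣ (Y (suc R)) (- fromℤ (c (suc R))))) ⟩
          b * (∣ Y (suc R) ∣ + ∣ fromℤ (c (suc R)) ∣) ∎
          where open ≤-Reasoning

        Y-telescope : ∀ R j → ∣ Y R ∣ ≤ b ^ j * ∣ Y (j ℕ.+ R) ∣ + ∑ (λ i → b ^ suc i * ∣ fromℤ (c (suc i ℕ.+ R)) ∣) j
        Y-telescope R zero = ≤-reflexive (solve 1 (λ y → y := 𝟙 :* y :+ 𝟘) refl (∣ Y R ∣))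
        Y-telescope R (suc j) = ≤-trans (Y-telescope R j) (≤-trans (+-monoˡ-≤ S (*-monoˡ-≤ (0≤x^n j (inj₁ 0<b)) (Y-step (j ℕ.+ R))))
          (≤-reflexive (solve 5 (λ p b y c s → p :* (b :* (y :+ c)) :+ s := (b :* p) :* y :+ (s :+ (b :* p) :* c)) refl (b ^ j) b (∣ Y (suc j ℕ.+ R) ∣) (∣ fromℤ (c (suc j ℕ.+ R)) ∣) S)))
          where S = ∑ (λ i → b ^ suc i * ∣ fromℤ (c (suc i ℕ.+ R)) ∣) j

        scaled-Y⟶0 : ∀ R → (λ j → b ^ j * ∣ Y (j ℕ.+ R) ∣) ⟶ 0#
        scaled-Y⟶0 R = ⟶-cong (λ j → sym (eq j)) (trans (*-congˡ ∣0∣≈0) (zeroʳ _)) (⟶-*ˡ (β ^ R)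
            (⟶-shift {s = λ n → ∣ ∑ (λ m → fromℤ (c m) * b ^ m) n ∣} (λ j → suc (j ℕ.+ R)) (λ j → ℕ.m≤n⇒m≤1+n (ℕ.m≤m+n j R)) abs-limit))
          where
          abs-limit : (λ n → ∣ ∑ (λ m → fromℤ (c m) * b ^ m) n ∣) ⟶ ∣ 0# ∣
          abs-limit ε 0<ε = let N , h = vanishes ε 0<ε in N , λ n N≤n →
            <-respˡ-≈ (trans (∣∣-cong (solve 1 (λ x → x :- 𝟘 := x) refl _)) (sym (trans (∣∣-cong (trans (+-congˡ (-‿cong ∣0∣≈0)) (solve 1 (λ x → x :- 𝟘 := x) refl _))) (0≤x⇒∣x∣≈x (0≤∣x∣ _))))) (h n N≤n)
          eq : ∀ j → b ^ j * ∣ Y (j ℕ.+ R) ∣ ≈ β ^ R * ∣ ∑ (λ m → fromℤ (c m) * b ^ m) (suc (j ℕ.+ R)) ∣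
          eq j = begin
            b ^ j * ∣ Y (j ℕ.+ R) ∣
              ≈⟨ *-congˡ (trans (∣∣-cong (Y≈ (j ℕ.+ R))) (trans (∣x*y∣≈∣x∣*∣y∣ (β ^ (j ℕ.+ R)) P) (*-congʳ (trans (0≤x⇒∣x∣≈x (0≤x^n (j ℕ.+ R) (inj₁ 0<β))) (^-homo-* β j R))))) ⟩
            b ^ j * (β ^ j * β ^ R * ∣ P ∣)
              ≈⟨ solve 4 (λ p q r s → p :* (q :* r :* s) := (q :* p) :* (r :* s)) refl (b ^ j) (β ^ j) (β ^ R) (∣ P ∣) ⟩
            (β ^ j * b ^ j) * (β ^ R * ∣ P ∣)
              ≈⟨ trans (*-congʳ (β^n*b^n≈1 j)) (*-identityˡ _) ⟩
            β ^ R * ∣ P ∣ ∎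
            where
            open Relation.Binary.Reasoning.Setoid setoid
            P = ∑ (λ m → fromℤ (c m) * b ^ m) (suc (j ℕ.+ R))

        -- In `Y-telescope` the first term is β^R times the absolute value of a partial sum of the
        -- vanishing series, so it tends to 0 and only the later coefficients remain.
        Y-≤ : ∀ R W → (∀ j → ∑ (λ i → b ^ suc i * ∣ fromℤ (c (suc i ℕ.+ R)) ∣) j ≤ W) → ∣ Y R ∣ ≤ W
        Y-≤ R W p = ≤-by (x≤y⇒0≤y-x (⟶-≥ 0 (scaled-Y⟶0 R) λ j _ → ≤-by (0≤x+y (x≤y⇒0≤y-x (Y-telescope R j)) (x≤y⇒0≤y-x (p j)))
            (solve 4 (λ y w a s → a :- (y :- w) := ((a :+ s) :- y) :+ (w :- s)) refl (∣ Y R ∣) W _ _)))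
          (solve 2 (λ y w → w :- y := 𝟘 :- (y :- w)) refl (∣ Y R ∣) W)

        -- An intermediate growth rate: above 1, so that it eventually exceeds the coefficients, and
        -- below β, so that σ b < 1 makes the tails geometric.
        σ : ℝ
        σ = proj₁ (between 1<β)

        1<σ : 1# < σ
        1<σ = proj₁ (proj₂ (between 1<β))

        σ<β : σ < β
        σ<β = proj₂ (proj₂ (between 1<β))

        σb<1 : σ * b < 1#
        σb<1 = <-respˡ-≈ (*-comm b σ) (<-respʳ-≈ (trans (*-comm b β) βb≈1) (*-monoˡ-< 0<b σ<β))

        0≤σb : 0# ≤ σ * b
        0≤σb = 0≤x*y (≤-trans 0≤1 (inj₁ 1<σ)) (inj₁ 0<b)

        K : ℝ
        K = (1# - σ * b) ⁻¹

        E₁ : ℕ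
        E₁ = base T-subexp

      module Root (v : ℕ) (1≤v : 1 ℕ.≤ v) (E₁≤σ^v : fromℕ E₁ ≤ σ ^ v) where

        private
          root : ∃ λ η → 1# ≤ η × η ^ v ≈ fromℕ E₁
          root = root-exists v (1≤fromℕ (1≤base T-subexp)) 1≤v

        -- A root of the fixed base E₁ whose order v is at our disposal: |c n| ≤ η^n as soon as n ≥
        -- v^g, and η is close to 1 when v is large.
        η : ℝ
        η = proj₁ root

        1≤η : 1# ≤ η
        1≤η = proj₁ (proj₂ root)

        0≤η : 0# ≤ η
        0≤η = ≤-trans 0≤1 1≤η

        η^v≈E₁ : η ^ v ≈ fromℕ E₁
        η^v≈E₁ = proj₂ (proj₂ root)

        ^v-cancel : ∀ {x y} → 0# ≤ y → x ^ v ≤ y ^ v → x ≤ y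
        ^v-cancel {x} {y} p = go v 1≤v
          where
          go : ∀ v → 1 ℕ.≤ v → x ^ v ≤ y ^ v → x ≤ y
          go (suc v) _ = ^-cancelˡ-≤ v p

        η≤σ : η ≤ σ
        η≤σ = ^v-cancel (≤-trans 0≤1 (inj₁ 1<σ)) (≤-respˡ (sym η^v≈E₁) E₁≤σ^v)

        ^-swap : ∀ x m n → (x ^ m) ^ n ≈ (x ^ n) ^ m
        ^-swap x m n = trans (^-assocʳ x m n) (trans (reflexive (≡.cong (x ^_) (ℕ.*-comm m n))) (sym (^-assocʳ x n m)))

        coefficient-≤ : ∀ n → v ℕ.^ g ℕ.≤ n → ∣ fromℤ (c n) ∣ ≤ η ^ n
        coefficient-≤ n v^g≤n = ^v-cancel (0≤x^n n 0≤η) (begin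
          ∣ fromℤ (c n) ∣ ^ v       ≈⟨ ^-congˡ v (∣fromℤ∣ (c n)) ⟩
          fromℕ ℤ.∣ c n ∣ ^ v       ≤⟨ ^-monoˡ-≤ v (0≤fromℕ ℤ.∣ c n ∣) (fromℕ-mono-≤ (ℕ.m≤n⇒m≤1+n (c≤T n n ℕ.≤-refl))) ⟩
          fromℕ (suc (T n)) ^ v     ≈⟨ fromℕ-^ (suc (T n)) v ⟨
          fromℕ (suc (T n) ℕ.^ v)   ≤⟨ fromℕ-mono-≤ (bound T-subexp n v 1≤v v^g≤n) ⟩
          fromℕ (E₁ ℕ.^ n)          ≈⟨ fromℕ-^ E₁ n ⟩
          fromℕ E₁ ^ n              ≈⟨ ^-congˡ n η^v≈E₁ ⟨
          (η ^ v) ^ n               ≈⟨ ^-swap η v n ⟩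
          (η ^ n) ^ v               ∎)
          where open ≤-Reasoning

        Y-bound : ∀ R → v ℕ.^ g ℕ.≤ R → ∣ Y R ∣ ≤ η ^ R * K
        Y-bound R v^g≤R = Y-≤ R (η ^ R * K) λ j → begin
          ∑ (λ i → b ^ suc i * ∣ fromℤ (c (suc i ℕ.+ R)) ∣) j
            ≤⟨ ∑-mono j (λ i _ → term i) ⟩
          ∑ (λ i → η ^ R * (σ * b) ^ i) j
            ≈⟨ ∑-*ˡ (η ^ R) ((σ * b) ^_) j ⟩
          η ^ R * ∑ ((σ * b) ^_) j
            ≤⟨ *-monoˡ-≤ (0≤x^n R 0≤η) (∑-geometric-≤ j 0≤σb σb<1) ⟩
          η ^ R * K ∎
          where
          open ≤-Reasoning
          term : ∀ i → b ^ suc i * ∣ fromℤ (c (suc i ℕ.+ R)) ∣ ≤ η ^ R * (σ * b) ^ i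
          term i = begin
            b ^ suc i * ∣ fromℤ (c (suc i ℕ.+ R)) ∣
              ≤⟨ *-monoˡ-≤ (0≤x^n (suc i) (inj₁ 0<b)) (coefficient-≤ (suc i ℕ.+ R) (ℕ.≤-trans v^g≤R (ℕ.m≤n+m R (suc i)))) ⟩
            b ^ suc i * η ^ (suc i ℕ.+ R)
              ≈⟨ *-congˡ (^-homo-* η (suc i) R) ⟩
            b ^ suc i * (η ^ suc i * η ^ R)
              ≤⟨ *-monoˡ-≤ (0≤x^n (suc i) (inj₁ 0<b)) (*-monoʳ-≤ (0≤x^n R 0≤η) (^-monoˡ-≤ (suc i) 0≤η η≤σ)) ⟩
            b ^ suc i * (σ ^ suc i * η ^ R)
              ≈⟨ trans (solve 3 (λ a b c → a :* (b :* c) := c :* (b :* a)) refl (b ^ suc i) (σ ^ suc i) (η ^ R)) (*-congˡ (sym (^-distrib-* σ b (suc i)))) ⟩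
            η ^ R * (σ * b) ^ suc i
              ≤⟨ *-monoˡ-≤ (0≤x^n R 0≤η) (≤-respʳ (*-identityˡ _) (*-monoʳ-≤ (0≤x^n i 0≤σb) (inj₁ σb<1))) ⟩
            η ^ R * (σ * b) ^ i ∎

      Y-zeros : ∀ R h → (∀ m → R ℕ.< m → m ℕ.≤ h ℕ.+ R → c m ≡ + 0) → Y (h ℕ.+ R) ≈ β ^ h * Y R
      Y-zeros R zero    p = sym (*-identityˡ _)
      Y-zeros R (suc h) p = trans (Y-suc (h ℕ.+ R)) (trans
        (+-cong (reflexive (≡.cong fromℤ (p (suc h ℕ.+ R) (s≤s (ℕ.m≤n+m R h)) ℕ.≤-refl)))
          (*-congˡ (Y-zeros R h λ m q r → p m q (ℕ.m≤n⇒m≤1+n r))))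
        (solve 3 (λ b p y → 𝟘 :+ b :* (p :* y) := (b :* p) :* y) refl β (β ^ h) (Y R)))

      private
        H : ℕ → ℕ
        H R = height 1<β coords (suc R) (T R)

        -- The height is a polynomial in R and `T R` with exponents fixed by the degree of β.
        H-subexp : Subexponential g H
        H-subexp = const 2 *′ (const Q *′ (const degree *′ (A-subexp *′ const B₀)))
          where
          open Coordinatised coords renaming (degree-1 to d)
          const = Subexponential-const 1≤g
          infixr 7 _*′_
          _*′_ = Subexponential-* {g}
          B₀ : ℕ
          B₀ = proj₁ (0≤x⇒x≤fromℕ (β ^ degree))
          suc-id : Subexponential g (λ R → suc R)
          suc-id = Subexponential-+ (const 1) (Subexponential-id 2≤g)
          U-subexp : Subexponential g (λ R → U₀ 1<β coords (suc R) (T R))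
          U-subexp = const Q *′ Subexponential-+ (const C) (const degree *′ (suc-id *′ (T-subexp *′ (const C *′
            Subexponential-^ 1≤g (Subexponential-+ (const 1) (Subexponential-+ (const degree) suc-id)) d))))
          A-subexp : Subexponential g (λ R → A 1<β coords (suc R) (T R))
          A-subexp = Subexponential-+ (const 1) (Subexponential-^ 1≤g (Subexponential-+ (const 1) (Subexponential-+ U-subexp U-subexp)) d)

        E₂ K₀ E₄ : ℕ
        E₂ = base H-subexp
        K₀ = proj₁ (0≤x⇒x≤fromℕ K)
        E₄ = E₁ ℕ.* E₂ ℕ.* K₀

        K≤K₀ : K ≤ fromℕ K₀
        K≤K₀ = proj₁ (proj₂ (0≤x⇒x≤fromℕ K))

        1≤K₀ : 1 ℕ.≤ K₀
        1≤K₀ = proj₂ (proj₂ (0≤x⇒x≤fromℕ K))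

      -- With v close to R^(1/g), the window length h is of order R^(1 - 1/g); this power saving is
      -- what the gap argument consumes.
      Recurs : ℕ → ℕ → Set
      Recurs C v₀ = ∀ R v h → v₀ ℕ.≤ v → v ℕ.^ g ℕ.≤ R → C ℕ.* R ℕ.< h ℕ.* v → ¬ (Y R ≈ 0#) →
                    ∃ λ m → R ℕ.< m × m ℕ.≤ h ℕ.+ R × c m ≢ + 0

      private
        module Window (C v₀ : ℕ) (E₄²≤β^C : fromℕ (E₄ ℕ.* E₄) ≤ β ^ C) (1≤v₀ : 1 ℕ.≤ v₀)
                      (E₁≤σ^v₀ : fromℕ E₁ ≤ σ ^ v₀) (E₁²≤β^v₀ : fromℕ (E₁ ℕ.* E₁) ≤ β ^ v₀)
                      (R v h : ℕ) (v₀≤v : v₀ ℕ.≤ v) (v^g≤R : v ℕ.^ g ℕ.≤ R) (Y≉0 : ¬ (Y R ≈ 0#))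
                      (zeros : ∀ m → R ℕ.< m → m ℕ.≤ h ℕ.+ R → c m ≡ + 0) where

          1≤v : 1 ℕ.≤ v
          1≤v = ℕ.≤-trans 1≤v₀ v₀≤v

          open Root v 1≤v (≤-trans E₁≤σ^v₀ (^-monoʳ-≤ (inj₁ 1<σ) v₀≤v))
          open ≤-Reasoning

          E₁ʳ E₂ʳ K₀ʳ : ℝ
          E₁ʳ = fromℕ E₁
          E₂ʳ = fromℕ E₂
          K₀ʳ = fromℕ K₀

          β^h≤ : β ^ h ≤ fromℕ (H R) * (η ^ (h ℕ.+ R) * K₀ʳ)
          β^h≤ = begin
            β ^ h                              ≈⟨ *-identityʳ (β ^ h) ⟨
            β ^ h * 1#                         ≤⟨ *-monoˡ-≤ (0≤x^n h (inj₁ 0<β)) (liouville 1<β coords (suc R) (T R) (λ k → c (R ℕ.∸ k))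
                                                    (λ k _ → c≤T R (R ℕ.∸ k) (ℕ.m∸n≤m R k)) Y≉0) ⟩
            β ^ h * (fromℕ (H R) * ∣ Y R ∣)    ≈⟨ solve 3 (λ a b c → a :* (b :* c) := b :* (a :* c)) refl (β ^ h) (fromℕ (H R)) (∣ Y R ∣) ⟩
            fromℕ (H R) * (β ^ h * ∣ Y R ∣)    ≈⟨ *-congˡ (trans (*-congʳ (sym (0≤x⇒∣x∣≈x (0≤x^n h (inj₁ 0<β))))) (trans (sym (∣x*y∣≈∣x∣*∣y∣ (β ^ h) (Y R))) (∣∣-cong (sym (Y-zeros R h zeros))))) ⟩
            fromℕ (H R) * ∣ Y (h ℕ.+ R) ∣      ≤⟨ *-monoˡ-≤ (0≤fromℕ (H R)) (≤-trans (Y-bound (h ℕ.+ R) (ℕ.≤-trans v^g≤R (ℕ.m≤n+m R h)))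
                                                    (*-monoˡ-≤ (0≤x^n (h ℕ.+ R) 0≤η) K≤K₀)) ⟩
            fromℕ (H R) * (η ^ (h ℕ.+ R) * K₀ʳ) ∎

          H^v≤ : fromℕ (H R) ^ v ≤ E₂ʳ ^ R
          H^v≤ = ≤-respˡ (fromℕ-^ (H R) v) (≤-respʳ (fromℕ-^ E₂ R) (fromℕ-mono-≤
            (ℕ.≤-trans (ℕ.^-monoˡ-≤ v (ℕ.n≤1+n (H R))) (bound H-subexp R v 1≤v v^g≤R))))

          -- The v-th power turns every factor of `β^h≤` into a power of a fixed base: η^v = E₁, H^v
          -- ≤ E₂^R, and K₀^v ≤ K₀^R because v ≤ R.
          β^hv≤ : (β ^ h) ^ v ≤ fromℕ E₄ ^ R * E₁ʳ ^ h
          β^hv≤ = begin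
            (β ^ h) ^ v
              ≤⟨ ^-monoˡ-≤ v (0≤x^n h (inj₁ 0<β)) β^h≤ ⟩
            (fromℕ (H R) * (η ^ (h ℕ.+ R) * K₀ʳ)) ^ v
              ≈⟨ trans (^-distrib-* (fromℕ (H R)) _ v) (*-congˡ (trans (^-distrib-* (η ^ (h ℕ.+ R)) K₀ʳ v) (*-congʳ (trans (^-swap η (h ℕ.+ R) v) (trans (^-congˡ (h ℕ.+ R) η^v≈E₁) (^-homo-* E₁ʳ h R)))))) ⟩
            fromℕ (H R) ^ v * ((E₁ʳ ^ h * E₁ʳ ^ R) * K₀ʳ ^ v)
              ≤⟨ *-mono-≤ (0≤x^n v (0≤fromℕ (H R))) (0≤x*y (0≤x*y (0≤x^n h (0≤fromℕ E₁)) (0≤x^n R (0≤fromℕ E₁))) (0≤x^n v (0≤fromℕ K₀)))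
                   H^v≤ (*-monoˡ-≤ (0≤x*y (0≤x^n h (0≤fromℕ E₁)) (0≤x^n R (0≤fromℕ E₁))) (^-monoʳ-≤ (1≤fromℕ 1≤K₀) (v≤R 1≤g 1≤v v^g≤R))) ⟩
            E₂ʳ ^ R * ((E₁ʳ ^ h * E₁ʳ ^ R) * K₀ʳ ^ R)
              ≈⟨ solve 4 (λ e h r k → e :* ((h :* r) :* k) := ((r :* e) :* k) :* h) refl (E₂ʳ ^ R) (E₁ʳ ^ h) (E₁ʳ ^ R) (K₀ʳ ^ R) ⟩
            ((E₁ʳ ^ R * E₂ʳ ^ R) * K₀ʳ ^ R) * E₁ʳ ^ h
              ≈⟨ *-congʳ (sym (trans (^-congˡ R (trans (fromℕ-* (E₁ ℕ.* E₂) K₀) (*-congʳ (fromℕ-* E₁ E₂)))) (trans (^-distrib-* (E₁ʳ * E₂ʳ) K₀ʳ R) (*-congʳ (^-distrib-* E₁ʳ E₂ʳ R))))) ⟩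
            fromℕ E₄ ^ R * E₁ʳ ^ h ∎

          B : ℝ
          B = (β ^ h) ^ v

          0<B : 0# < B
          0<B = 0<x^n v (0<x^n h 0<β)

          E₁^2h≤B : E₁ʳ ^ h * E₁ʳ ^ h ≤ B
          E₁^2h≤B = begin
            E₁ʳ ^ h * E₁ʳ ^ h   ≈⟨ ^-distrib-* E₁ʳ E₁ʳ h ⟨
            (E₁ʳ * E₁ʳ) ^ h     ≤⟨ ^-monoˡ-≤ h (0≤x² E₁ʳ) (≤-respˡ (fromℕ-* E₁ E₁) (≤-trans E₁²≤β^v₀ (^-monoʳ-≤ (inj₁ 1<β) v₀≤v))) ⟩
            (β ^ v) ^ h         ≈⟨ ^-swap β v h ⟩
            B                   ∎

          E₄^2R≤ : fromℕ E₄ ^ R * fromℕ E₄ ^ R ≤ β ^ (C ℕ.* R)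
          E₄^2R≤ = begin
            fromℕ E₄ ^ R * fromℕ E₄ ^ R   ≈⟨ ^-distrib-* (fromℕ E₄) (fromℕ E₄) R ⟨
            (fromℕ E₄ * fromℕ E₄) ^ R     ≤⟨ ^-monoˡ-≤ R (0≤x² (fromℕ E₄)) (≤-respˡ (fromℕ-* E₄ E₄) E₄²≤β^C) ⟩
            (β ^ C) ^ R                   ≈⟨ ^-assocʳ β C R ⟩
            β ^ (C ℕ.* R)                 ∎

          -- Squaring `β^hv≤` produces E₁^(2h), which is at most B because β^v ≥ E₁²; one factor B
          -- then cancels, and C was chosen so that β^C ≥ E₄².
          B≤ : B ≤ β ^ (C ℕ.* R)
          B≤ = *-cancelˡ-≤ 0<B (begin
            B * B
              ≤⟨ *-mono-≤ (inj₁ 0<B) (inj₁ 0<B) β^hv≤ β^hv≤ ⟩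
            (fromℕ E₄ ^ R * E₁ʳ ^ h) * (fromℕ E₄ ^ R * E₁ʳ ^ h)
              ≈⟨ solve 2 (λ a b → (a :* b) :* (a :* b) := (b :* b) :* (a :* a)) refl (fromℕ E₄ ^ R) (E₁ʳ ^ h) ⟩
            (E₁ʳ ^ h * E₁ʳ ^ h) * (fromℕ E₄ ^ R * fromℕ E₄ ^ R)
              ≤⟨ *-mono-≤ (0≤x² (E₁ʳ ^ h)) (0≤x² (fromℕ E₄ ^ R)) E₁^2h≤B E₄^2R≤ ⟩
            B * β ^ (C ℕ.* R) ∎)

          hv≤CR : h ℕ.* v ℕ.≤ C ℕ.* R
          hv≤CR = ℕ.≮⇒≥ λ CR<hv → <⇒≱ (<-≤-trans (<-respˡ-≈ (*-identityˡ _) (<-respˡ-≈ (*-comm _ _) (<-respʳ-≈ (*-comm _ _) (*-monoˡ-< (0<x^n (C ℕ.* R) 0<β) 1<β))))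
              (≤-respʳ (sym (^-assocʳ β h v)) (^-monoʳ-≤ {β} {suc (C ℕ.* R)} (inj₁ 1<β) CR<hv))) B≤

      coefficients-recur : ∃₂ Recurs
      coefficients-recur =
        let C , pC = ^-unbounded 1<β (fromℕ (E₄ ℕ.* E₄))
            v₁ , p₁ = ^-unbounded 1<σ (fromℕ E₁)
            v₂ , p₂ = ^-unbounded 1<β (fromℕ (E₁ ℕ.* E₁))
            v₀ = suc (v₁ ℕ.+ v₂)
            v₁≤v₀ = ℕ.m≤n⇒m≤1+n (ℕ.m≤m+n v₁ v₂)
            v₂≤v₀ = ℕ.m≤n⇒m≤1+n (ℕ.m≤n+m v₂ v₁)
        in C , v₀ , λ R v h v₀≤v v^g≤R CR<hv Y≉0 → by-contradiction λ none →
             ℕ.<⇒≱ CR<hv (Window.hv≤CR C v₀ (inj₁ pC) (s≤s z≤n)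
               (≤-trans (inj₁ p₁) (^-monoʳ-≤ (inj₁ 1<σ) v₁≤v₀)) (≤-trans (inj₁ p₂) (^-monoʳ-≤ (inj₁ 1<β) v₂≤v₀))
               R v h v₀≤v v^g≤R Y≉0 (λ m p q → by-contradiction λ r → none (m , p , q , r)))

  -- Coefficients of products, sumsets, free blocks and gaps.

  module Combinatorics where

    open import Data.Nat.Base using (_+_; _*_; _∸_; _^_; _≤_; _<_)

    sumℕ : (ℕ → ℕ) → ℕ → ℕ
    sumℕ f zero    = 0
    sumℕ f (suc n) = sumℕ f n + f n

    sumℕ-mono : ∀ {f g} n → (∀ i → i < n → f i ≤ g i) → sumℕ f n ≤ sumℕ g n
    sumℕ-mono zero    p = z≤n
    sumℕ-mono (suc n) p = ℕ.+-mono-≤ (sumℕ-mono n λ i q → p i (ℕ.m≤n⇒m≤1+n q)) (p n ℕ.≤-refl)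

    sumℕ-const : ∀ c n → sumℕ (λ _ → c) n ≡ n * c
    sumℕ-const c zero    = ≡.refl
    sumℕ-const c (suc n) = ≡.trans (≡.cong (_+ c) (sumℕ-const c n)) (ℕ.+-comm (n * c) c)

    *-sumℕ : ∀ c f n → c * sumℕ f n ≡ sumℕ (λ i → c * f i) n
    *-sumℕ c f zero    = ℕ.*-zeroʳ c
    *-sumℕ c f (suc n) = ≡.trans (ℕ.*-distribˡ-+ c (sumℕ f n) (f n)) (≡.cong (_+ c * f n) (*-sumℕ c f n))

    sumℕ-≥ : ∀ f n i → i < n → f i ≤ sumℕ f n
    sumℕ-≥ f (suc n) i i<1+n with ℕ.m≤n⇒m<n∨m≡n (ℕ.≤-pred i<1+n)
    ... | inj₁ i<n    = ℕ.≤-trans (sumℕ-≥ f n i i<n) (ℕ.m≤m+n _ _)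
    ... | inj₂ ≡.refl = ℕ.m≤n+m _ _

    sumℕ-positive : ∀ f n → 0 < sumℕ f n → ∃ λ i → i < n × 0 < f i
    sumℕ-positive f (suc n) p with f n in eq
    ... | suc k = n , ℕ.≤-refl , ≡.subst (0 <_) (≡.sym eq) (s≤s z≤n)
    ... | zero  = let i , i<n , q = sumℕ-positive f n (≡.subst (0 <_) (ℕ.+-identityʳ (sumℕ f n)) p) in i , ℕ.m≤n⇒m≤1+n i<n , q

    *-positive : ∀ {a b} → 0 < a → 0 < b → 0 < a * b
    *-positive p q = ℕ.*-mono-≤ p q

    positive-* : ∀ a b → 0 < a * b → 0 < a × 0 < b
    positive-* (suc a) zero    p = ⊥-elim (ℕ.n≮0 (≡.subst (0 <_) (ℕ.*-zeroʳ a) p))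
    positive-* (suc a) (suc b) p = s≤s z≤n , s≤s z≤n

    -- The coefficients of the product of the power series with the given coefficients.
    ρ : List (ℕ → ℕ) → ℕ → ℕ
    ρ []      zero    = 1
    ρ []      (suc m) = 0
    ρ (f ∷ w) m       = sumℕ (λ a → f a * ρ w (m ∸ a)) (suc m)

    ρ-positive⁻ : ∀ f w m → 0 < ρ (f ∷ w) m → ∃₂ λ a b → m ≡ a + b × 0 < f a × 0 < ρ w b
    ρ-positive⁻ f w m p =
      let a , a<1+m , q = sumℕ-positive (λ a → f a * ρ w (m ∸ a)) (suc m) p
          q₁ , q₂ = positive-* (f a) (ρ w (m ∸ a)) q
      in a , m ∸ a , ≡.sym (ℕ.m+[n∸m]≡n (ℕ.≤-pred a<1+m)) , q₁ , q₂

    ρ-positive⁺ : ∀ f w a b → 0 < f a → 0 < ρ w b → 0 < ρ (f ∷ w) (a + b)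
    ρ-positive⁺ f w a b p q = ℕ.≤-trans
      (*-positive p (≡.subst (λ k → 0 < ρ w k) (≡.sym (ℕ.m+n∸m≡n a b)) q))
      (sumℕ-≥ (λ i → f i * ρ w (a + b ∸ i)) (suc (a + b)) a (s≤s (ℕ.m≤m+n a b)))

    -- Termwise comparison of the two convolutions: by `large`, in every contributing decomposition
    -- of m the exchanged factor has an argument of at least B, where g dominates f by the factor W.
    ρ-exchange : ∀ {f g W B} → (∀ a → B ≤ a → W * f a ≤ g a) → ∀ pre suf m →
      (∀ x a b → m ≡ x + (a + b) → 0 < ρ pre x → 0 < f a → 0 < ρ suf b → B ≤ a) →
      W * ρ (pre ++ f ∷ suf) m ≤ ρ (pre ++ g ∷ suf) m
    ρ-exchange {f} {g} {W} {B} W*f≤g [] suf m large =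
      ℕ.≤-trans (ℕ.≤-reflexive (*-sumℕ W _ (suc m))) (sumℕ-mono (suc m) λ a a<1+m → term a (ℕ.≤-pred a<1+m))
      where
      term : ∀ a → a ≤ m → W * (f a * ρ suf (m ∸ a)) ≤ g a * ρ suf (m ∸ a)
      term a a≤m with ℕ.m≤n⇒m<n∨m≡n (z≤n {f a}) | ℕ.m≤n⇒m<n∨m≡n (z≤n {ρ suf (m ∸ a)})
      ... | inj₂ fa≡0 | _ = ≡.subst (λ k → W * (k * ρ suf (m ∸ a)) ≤ g a * ρ suf (m ∸ a)) fa≡0 (≡.subst (_≤ g a * ρ suf (m ∸ a)) (≡.sym (ℕ.*-zeroʳ W)) z≤n)
      ... | inj₁ _ | inj₂ r≡0 = ≡.subst (λ k → W * (f a * k) ≤ g a * k) r≡0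
            (≡.subst (_≤ g a * 0) (≡.sym (≡.trans (≡.cong (W *_) (ℕ.*-zeroʳ (f a))) (ℕ.*-zeroʳ W))) z≤n)
      ... | inj₁ p | inj₁ q = ≡.subst (_≤ g a * ρ suf (m ∸ a)) (ℕ.*-assoc W (f a) (ρ suf (m ∸ a)))
            (ℕ.*-monoˡ-≤ (ρ suf (m ∸ a)) (W*f≤g a (large 0 a (m ∸ a) (≡.sym (ℕ.m+[n∸m]≡n a≤m)) (s≤s z≤n) p q)))
    ρ-exchange {f} {g} {W} W*f≤g (h ∷ pre) suf m large =
      ℕ.≤-trans (ℕ.≤-reflexive (*-sumℕ W _ (suc m))) (sumℕ-mono (suc m) λ y y<1+m → term y (ℕ.≤-pred y<1+m))
      where
      term : ∀ y → y ≤ m → W * (h y * ρ (pre ++ f ∷ suf) (m ∸ y)) ≤ h y * ρ (pre ++ g ∷ suf) (m ∸ y)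
      term y y≤m with ℕ.m≤n⇒m<n∨m≡n (z≤n {h y})
      ... | inj₂ hy≡0 = ≡.subst (λ k → W * (k * ρ (pre ++ f ∷ suf) (m ∸ y)) ≤ k * ρ (pre ++ g ∷ suf) (m ∸ y)) hy≡0 (≡.subst (_≤ 0) (≡.sym (ℕ.*-zeroʳ W)) z≤n)
      ... | inj₁ 0<hy = ℕ.≤-trans (ℕ.≤-reflexive (swap W (h y) (ρ (pre ++ f ∷ suf) (m ∸ y))))
            (ℕ.*-monoʳ-≤ (h y) (ρ-exchange {W = W} W*f≤g pre suf (m ∸ y) λ x a b e p q r →
              large (y + x) a b (≡.trans (≡.sym (ℕ.m+[n∸m]≡n y≤m)) (≡.trans (≡.cong (ℕ._+_ y) e) (≡.sym (ℕ.+-assoc y x (a + b)))))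
                (ρ-positive⁺ h pre y x 0<hy p) q r))
        where
        swap : ∀ a b c → a * (b * c) ≡ b * (a * c)
        swap = solve-∀

    ⊛-+ : ∀ {S : Pred ℕ 0ℓ} i j {x y} → x ∈ i ⊛ S → y ∈ j ⊛ S → (x + y) ∈ (i + j) ⊛ S
    ⊛-+ zero    j ≡.refl q = q
    ⊛-+ {S} (suc i) j {y = y} (a , b , a∈S , b∈ , ≡.refl) q = a , b + y , a∈S , ⊛-+ {S} i j b∈ q , ℕ.+-assoc a b y

    ⊛-* : ∀ {S : Pred ℕ 0ℓ} {s} n → s ∈ S → n * s ∈ n ⊛ S
    ⊛-* zero    _ = ≡.refl
    ⊛-* {s = s} (suc n) p = s , n * s , p , ⊛-* n p , ≡.refl

    Supported : (ℕ → ℕ) → Pred ℕ 0ℓ → Set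
    Supported t S = ∀ a → 0 < t a → a ∈ S

    PositiveOn : (ℕ → ℕ) → Pred ℕ 0ℓ → Set
    PositiveOn t S = ∀ a → a ∈ S → 0 < t a

    ρ-replicate-++⁻ : ∀ {t S} → Supported t S → ∀ n w m → 0 < ρ (replicate n t ++ w) m →
                      ∃₂ λ x b → m ≡ x + b × x ∈ n ⊛ S × 0 < ρ w b
    ρ-replicate-++⁻ supp zero w m p = 0 , m , ≡.refl , ≡.refl , p
    ρ-replicate-++⁻ {t} supp (suc n) w m p =
      let a , b , e , q , r = ρ-positive⁻ t (replicate n t ++ w) m p
          x , b′ , e′ , x∈ , r′ = ρ-replicate-++⁻ supp n w b r
      in a + x , b′ , ≡.trans e (≡.trans (≡.cong (ℕ._+_ a) e′) (≡.sym (ℕ.+-assoc a x b′))) , (a , x , supp a q , x∈ , ≡.refl) , r′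

    ρ-replicate-++⁺ : ∀ {t S} → PositiveOn t S → ∀ n w x b → x ∈ n ⊛ S → 0 < ρ w b → 0 < ρ (replicate n t ++ w) (x + b)
    ρ-replicate-++⁺ pos zero w x b ≡.refl q = q
    ρ-replicate-++⁺ {t} pos (suc n) w x b (a , y , a∈S , y∈ , ≡.refl) q =
      ≡.subst (λ k → 0 < ρ (t ∷ replicate n t ++ w) k) (≡.sym (ℕ.+-assoc a y b))
        (ρ-positive⁺ t (replicate n t ++ w) a (y + b) (pos a a∈S) (ρ-replicate-++⁺ pos n w y b y∈ q))

    ρ-[] : ∀ b → 0 < ρ [] b → b ≡ 0
    ρ-[] zero _ = ≡.refl

    Covers : List ℕ → Pred ℕ 0ℓ → ℕ → Set
    Covers xs P N = ∀ m → m < N → P m → m ∈ˡ xs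

    sums : ℕ → List ℕ → List ℕ
    sums zero    xs = 0 ∷ []
    sums (suc n) xs = cartesianProductWith _+_ xs (sums n xs)

    length-cartesianProductWith : ∀ (f : ℕ → ℕ → ℕ) xs ys → length (cartesianProductWith f xs ys) ≡ length xs * length ys
    length-cartesianProductWith f []       ys = ≡.refl
    length-cartesianProductWith f (x ∷ xs) ys = ≡.trans (List.length-++ (map (f x) ys))
      (≡.cong₂ _+_ (List.length-map (f x) ys) (length-cartesianProductWith f xs ys))

    length-sums : ∀ n xs → length (sums n xs) ≡ length xs ^ n
    length-sums zero    xs = ≡.refl
    length-sums (suc n) xs = ≡.trans (length-cartesianProductWith _+_ xs (sums n xs)) (≡.cong (length xs *_) (length-sums n xs))

    ∈-sum : ∀ xs ys {a b} → a ∈ˡ xs → b ∈ˡ ys → (a + b) ∈ˡ cartesianProductWith _+_ xs ys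
    ∈-sum xs ys = ∈-cartesianProductWith⁺ _+_ {xs} {ys}

    sums-suc : ∀ n xs {m} → m ∈ˡ sums n (0 ∷ xs) → m ∈ˡ sums (suc n) (0 ∷ xs)
    sums-suc n xs p = ∈-sum (0 ∷ xs) (sums n (0 ∷ xs)) (here ≡.refl) p

    -- Adjoining 0 to the list makes sums of exactly n entries include those of fewer.
    sums-covers : ∀ {S xs N} → Covers xs S N → ∀ n k → k ≤ n → Covers (sums n (0 ∷ xs)) (k ⊛ S) N
    sums-covers cov zero    zero    _ m m<N ≡.refl = here ≡.refl
    sums-covers {xs = xs} cov (suc n) zero _ m m<N p = sums-suc n xs (sums-covers cov n zero z≤n m m<N p)
    sums-covers {xs = xs} cov (suc n) (suc k) (s≤s k≤n) m m<N (a , b , a∈S , b∈ , ≡.refl) =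
      ∈-sum (0 ∷ xs) (sums n (0 ∷ xs)) (there (cov a (ℕ.≤-<-trans (ℕ.m≤m+n a b) m<N) a∈S))
        (sums-covers cov n k k≤n b (ℕ.≤-<-trans (ℕ.m≤n+m b a) m<N) b∈)

    unique-length : ∀ {xs ys : List ℕ} → Unique xs → (∀ m → m ∈ˡ xs → m ∈ˡ ys) → length xs ≤ length ys
    unique-length [] p = z≤n
    unique-length {x ∷ xs} {ys} (x∉ ∷ u) p with ∈-∃++ (p x (here ≡.refl))
    ... | as , bs , ≡.refl = ≡.subst (suc (length xs) ≤_)
        (≡.sym (≡.trans (List.length-++ as) (≡.trans (ℕ.+-suc (length as) (length bs)) (≡.cong suc (≡.sym (List.length-++ as))))))
        (s≤s (unique-length u λ m q → remove m q (∈-++⁻ as (p m (there q)))))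
      where
      remove : ∀ m → m ∈ˡ xs → m ∈ˡ as ⊎ m ∈ˡ (x ∷ bs) → m ∈ˡ (as ++ bs)
      remove m q (inj₁ r)              = ∈-++⁺ˡ r
      remove m q (inj₂ (here ≡.refl))  = ⊥-elim (All.lookup x∉ q ≡.refl)
      remove m q (inj₂ (there r))      = ∈-++⁺ʳ as r

    -- There are n + 1 blocks against at most n points. Either no point lies in or beyond the last
    -- block, which is then free, or discarding such points leaves fewer of them and n blocks.
    free-block : ∀ n L p (zs : List ℕ) → length zs ≤ n →
                 ∃ λ i → i ≤ n × (∀ m → p + i * L ≤ m → m < p + suc i * L → ¬ m ∈ˡ zs)
    free-block zero    L p [] _ = 0 , z≤n , λ m _ _ ()
    free-block (suc n) L p zs len with em {∃ λ z → z ∈ˡ zs × p + suc n * L ≤ z}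
    ... | no none = suc n , ℕ.≤-refl , λ m q _ r → none (m , r , q)
    ... | yes (z , z∈ , q) =
      let i , i≤n , free = free-block n L p (filter (ℕ._<? p + suc n * L) zs)
            (ℕ.≤-pred (ℕ.≤-trans (List.filter-notAll (ℕ._<? p + suc n * L) zs (lose z∈ (ℕ.≤⇒≯ q))) len))
      in i , ℕ.m≤n⇒m≤1+n i≤n , λ m r s m∈ → free m r s (∈-filter⁺ (ℕ._<? p + suc n * L) m∈
           (ℕ.<-≤-trans s (ℕ.+-monoʳ-≤ p (ℕ.*-monoˡ-≤ L (s≤s i≤n)))))

    -- Walk along P from x, in steps shorter than ℓ, until a gap of length ℓ appears.
    next-gap : ∀ {P : Pred ℕ 0ℓ} {N} ℓ n (zs : List ℕ) x → length zs ≤ n → (∀ m → x < m → m < N → P m → m ∈ˡ zs) →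
               P x → x + suc n * ℓ ≤ N → ∃ λ u → x ≤ u × u + ℓ ≤ N × P u × (∀ m → u < m → m < u + ℓ → ¬ P m)
    next-gap {P} {N} ℓ n zs x len cov px room with em {∃ λ m → x < m × m < x + ℓ × P m}
    ... | no none = x , ℕ.≤-refl , ℕ.≤-trans (ℕ.+-monoʳ-≤ x (ℕ.m≤m+n ℓ (n * ℓ))) room , px ,
          λ m p q r → none (m , p , q , r)
    next-gap ℓ zero [] x len cov px room | yes (m , p , q , r)
      with cov m p (ℕ.<-≤-trans q (ℕ.≤-trans (ℕ.+-monoʳ-≤ x (ℕ.m≤m+n ℓ 0)) room)) r
    ... | ()
    next-gap {P} {N} ℓ (suc n) zs x len cov px room | yes (m , x<m , m<x+ℓ , pm) =
      let m∈ = cov m x<m (ℕ.<-≤-trans m<x+ℓ (ℕ.≤-trans (ℕ.+-monoʳ-≤ x (ℕ.m≤m+n ℓ (suc n * ℓ))) room)) pm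
          u , m≤u , rest = next-gap {P} {N} ℓ n (filter (m ℕ.<?_) zs) m
            (ℕ.≤-pred (ℕ.≤-trans (List.filter-notAll (m ℕ.<?_) zs (lose m∈ (ℕ.<-irrefl ≡.refl))) len))
            (λ y m<y y<N py → ∈-filter⁺ (m ℕ.<?_) (cov y (ℕ.<-trans x<m m<y) y<N py) m<y)
            pm (ℕ.≤-trans (ℕ.≤-trans (ℕ.+-monoˡ-≤ (suc n * ℓ) (ℕ.<⇒≤ m<x+ℓ)) (ℕ.≤-reflexive (ℕ.+-assoc x ℓ (suc n * ℓ)))) room)
      in u , ℕ.≤-trans (ℕ.<⇒≤ x<m) m≤u , rest

    -- D + 1 and k₀ + 1 are the numbers of summands from S₁ and S₂ in the leading monomial.
    module Configuration (S₁ S₂ : Pred ℕ 0ℓ) (D k₀ K B : ℕ) where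

      Sum : ℕ → ℕ → ℕ → Set
      Sum n k m = ∃₂ λ x y → m ≡ x + y × x ∈ n ⊛ S₁ × y ∈ k ⊛ S₂

      -- The three kinds of m at which a monomial can have a positive coefficient, by comparison
      -- with the leading one. The shift a < B in `Low` stands for a summand from S₁ too small for
      -- (5) to be effective; a = 0 gives the sums of lower degree. `Mid` admits k = 0, so it
      -- contains (D + 1)S₁.
      Low Mid High : ℕ → Set
      Low m  = ∃ λ a → ∃ λ b → m ≡ a + b × a < B × (∃₂ λ n k → n ≤ D × k ≤ K × Sum n k b)
      Mid m  = ∃ λ k → k ≤ k₀ × Sum (suc D) k m
      High m = Sum (suc D) (suc k₀) m

      module _ {xs ys : List ℕ} {N : ℕ} (cov₁ : Covers xs S₁ N) (cov₂ : Covers ys S₂ N) where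

        sumList : ℕ → List ℕ
        sumList n = cartesianProductWith _+_ (sums n (0 ∷ xs)) (sums K (0 ∷ ys))

        length-sumList : ∀ n → length (sumList n) ≡ suc (length xs) ^ n * suc (length ys) ^ K
        length-sumList n = ≡.trans (length-cartesianProductWith _+_ (sums n (0 ∷ xs)) (sums K (0 ∷ ys)))
          (≡.cong₂ _*_ (length-sums n (0 ∷ xs)) (length-sums K (0 ∷ ys)))

        sumList-covers : ∀ N′ n k m → n ≤ N′ → k ≤ K → m < N → Sum n k m → m ∈ˡ sumList N′
        sumList-covers N′ n k m n≤ k≤ m<N (x , y , ≡.refl , x∈ , y∈) = ∈-sum (sums N′ (0 ∷ xs)) (sums K (0 ∷ ys))
          (sums-covers cov₁ N′ n n≤ x (ℕ.≤-<-trans (ℕ.m≤m+n x y) m<N) x∈) (sums-covers cov₂ K k k≤ y (ℕ.≤-<-trans (ℕ.m≤n+m y x) m<N) y∈)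

        lowList : List ℕ
        lowList = cartesianProductWith _+_ (upTo B) (sumList D)

        length-lowList : length lowList ≡ B * (suc (length xs) ^ D * suc (length ys) ^ K)
        length-lowList = ≡.trans (length-cartesianProductWith _+_ (upTo B) (sumList D)) (≡.cong₂ _*_ (List.length-upTo B) (length-sumList D))

        lowList-covers : Covers lowList Low N
        lowList-covers m m<N (a , b , ≡.refl , a<B , n , k , n≤D , k≤K , s) =
          ∈-sum (upTo B) (sumList D) (∈-upTo⁺ a<B) (sumList-covers D n k b n≤D k≤K (ℕ.≤-<-trans (ℕ.m≤n+m b a) m<N) s)

  -- From a polynomial relation to a list of monomials with integer coefficients.

  module Monomials where

    open RealField
    open Integrality

    private
      variable
        A B : Set

    lsum : (A → ℝ) → List A → ℝ
    lsum f []       = 0#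
    lsum f (x ∷ xs) = f x + lsum f xs

    lsum-cong : ∀ {f g : A → ℝ} xs → (∀ x → f x ≈ g x) → lsum f xs ≈ lsum g xs
    lsum-cong []       p = refl
    lsum-cong (x ∷ xs) p = +-cong (p x) (lsum-cong xs p)

    lsum-++ : ∀ (f : A → ℝ) xs ys → lsum f (xs ++ ys) ≈ lsum f xs + lsum f ys
    lsum-++ f []       ys = sym (+-identityˡ _)
    lsum-++ f (x ∷ xs) ys = trans (+-congˡ (lsum-++ f xs ys)) (sym (+-assoc _ _ _))

    lsum-map : ∀ (f : B → ℝ) (g : A → B) xs → lsum f (map g xs) ≈ lsum (λ x → f (g x)) xs
    lsum-map f g []       = refl
    lsum-map f g (x ∷ xs) = +-congˡ (lsum-map f g xs)

    lsum-*ˡ : ∀ c (f : A → ℝ) xs → lsum (λ x → c * f x) xs ≈ c * lsum f xs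
    lsum-*ˡ c f []       = sym (zeroʳ c)
    lsum-*ˡ c f (x ∷ xs) = trans (+-congˡ (lsum-*ˡ c f xs)) (sym (distribˡ c _ _))

    -- One layer of the passage from nested coefficient lists to lists of monomials: the exponents of the
    -- monomials in the coefficient of X^i are tagged with i.
    module Flatten {Poly′ Key : Set} (monomials : Poly′ → List (Key × ℚ)) where

      tag : ℕ → Key × ℚ → (ℕ × Key) × ℚ
      tag n (k , q) = (n , k) , q

      flatten : ℕ → List Poly′ → List ((ℕ × Key) × ℚ)
      flatten n []       = []
      flatten n (c ∷ cs) = map (tag n) (monomials c) ++ flatten (suc n) cs

      keys-≥ : ∀ n cs → All (λ m → n ℕ.≤ proj₁ (proj₁ m)) (flatten n cs)
      keys-≥ n []       = []
      keys-≥ n (c ∷ cs) = All.++⁺ (All.map⁺ (All.universal (λ _ → ℕ.≤-refl) (monomials c)))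
        (All.map (ℕ.≤-trans (ℕ.n≤1+n n)) (keys-≥ (suc n) cs))

      distinct : (∀ c → AllPairs (λ x y → proj₁ x ≢ proj₁ y) (monomials c)) →
                 ∀ n cs → AllPairs (λ x y → proj₁ x ≢ proj₁ y) (flatten n cs)
      distinct p n []       = []
      distinct p n (c ∷ cs) = AllPairs.++⁺ (AllPairs.map⁺ (AllPairs.map (λ x≢y e → x≢y (≡.cong proj₂ e)) (p c))) (distinct p (suc n) cs)
        (All.map⁺ (All.universal (λ _ → All.map (λ n< e → ℕ.<-irrefl (≡.cong proj₁ e) n<) (keys-≥ (suc n) cs)) (monomials c)))

      evaluates : ∀ {value : Key → ℝ} {ev : Poly′ → ℝ} → (∀ c → lsum (λ (k , q) → fromℚ q * value k) (monomials c) ≈ ev c) →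
        ∀ x n cs → lsum (λ ((i , k) , q) → fromℚ q * (x ^ i * value k)) (flatten n cs) ≈ x ^ n * foldr (λ c acc → ev c + x * acc) 0# cs
      evaluates p x n [] = sym (zeroʳ _)
      evaluates {value} {ev} p x n (c ∷ cs) = trans (lsum-++ _ (map (tag n) (monomials c)) (flatten (suc n) cs)) (trans
        (+-cong (trans (lsum-map _ (tag n) (monomials c)) (trans
            (lsum-cong (monomials c) λ (k , q) → solve 3 (λ q x v → q :* (x :* v) := x :* (q :* v)) refl (fromℚ q) (x ^ n) (value k))
            (trans (lsum-*ˡ (x ^ n) _ (monomials c)) (*-congˡ (p c)))))
          (evaluates p x (suc n) cs))
        (solve 4 (λ p e x a → p :* e :+ (x :* p) :* a := p :* (e :+ x :* a)) refl (x ^ n) (ev c) x (foldr (λ c acc → ev c + x * acc) 0# cs)))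

      nonzero : ∀ {NonZero′ : Poly′ → Set} → (∀ c → NonZero′ c → Any (λ m → proj₂ m ≢ ℚ.0ℚ) (monomials c)) →
                ∀ n cs → Any NonZero′ cs → Any (λ m → proj₂ m ≢ ℚ.0ℚ) (flatten n cs)
      nonzero p n (c ∷ cs) (here q)  = Any.++⁺ˡ (Any.map⁺ (p c q))
      nonzero p n (c ∷ cs) (there q) = Any.++⁺ʳ (map (tag n) (monomials c)) (nonzero p (suc n) cs q)

    Exponents : ℕ → Set
    Exponents zero    = ⊤
    Exponents (suc n) = ℕ × Exponents n

    monomials : ∀ n → Poly ℚ n → List (Exponents n × ℚ)
    monomials zero    q  = (tt , q) ∷ []
    monomials (suc n) cs = Flatten.flatten (monomials n) 0 cs

    monomial-value : ∀ {n} → Vec ℝ n → Exponents n → ℝ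
    monomial-value []       tt      = 1#
    monomial-value (x ∷ xs) (i , k) = x ^ i * monomial-value xs k

    monomials-distinct : ∀ n P → AllPairs (λ x y → proj₁ x ≢ proj₁ y) (monomials n P)
    monomials-distinct zero    q  = [] ∷ []
    monomials-distinct (suc n) cs = Flatten.distinct (monomials n) (monomials-distinct n) 0 cs

    monomials-evaluate : ∀ {n} (xs : Vec ℝ n) P →
      lsum (λ (k , q) → fromℚ q * monomial-value xs k) (monomials n P) ≈ eval ℝ-rawRing fromℚ P xs
    monomials-evaluate []       q  = trans (+-identityʳ _) (*-identityʳ _)
    monomials-evaluate (x ∷ xs) cs = trans (Flatten.evaluates (monomials _) (monomials-evaluate xs) x 0 cs) (*-identityˡ _)

    monomials-nonzero : ∀ n P → NonZeroPoly n P → Any (λ m → proj₂ m ≢ ℚ.0ℚ) (monomials n P)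
    monomials-nonzero zero    q  p = here p
    monomials-nonzero (suc n) cs p = Flatten.nonzero (monomials n) (monomials-nonzero n) 0 cs p

    record IntegralRelation (n : ℕ) (xs : Vec ℝ n) : Set where
      field
        terms    : List (Exponents n × ℤ)
        distinct : AllPairs (λ x y → proj₁ x ≢ proj₁ y) terms
        nonzero  : All (λ m → proj₂ m ≢ + 0) terms
        nonempty : ∃ λ m → m ∈ˡ terms
        relation : lsum (λ (k , A) → fromℤ A * monomial-value xs k) terms ≈ 0#

    private
      module Clear {K : Set} (value : K → ℝ) where

        Scaled : ℕ → List (K × ℚ) → List (K × ℤ) → Set
        Scaled d = Pointwise λ (k , q) (k′ , A) → k ≡ k′ × fromℤ A ≈ fromℕ d * fromℚ q

        rescale : ∀ e d {ms ns} → Scaled d ms ns → Scaled (suc e ℕ.* d) ms (map (λ (k , A) → k , + suc e ℤ.* A) ns)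
        rescale e d []              = []
        rescale e d (_∷_ {y = _ , A} (p , q) ps) = (p , trans (fromℤ-* (+ suc e) A) (trans (*-congˡ q) (trans (sym (*-assoc _ _ _)) (*-congʳ (sym (fromℕ-* (suc e) d)))))) ∷ rescale e d ps

        -- The product of the denominators met so far serves as the common one, so the integers
        -- already found have to be rescaled at each step.
        clear : ∀ ms → ∃₂ λ d ns → 1 ℕ.≤ d × Scaled d ms ns
        clear [] = 1 , [] , s≤s z≤n , []
        clear ((k , q) ∷ ms) =
          let d , ns , 1≤d , ps = clear ms
              e = ℚ.denominator-1 q
          in suc e ℕ.* d , (k , + d ℤ.* ↥ q) ∷ map (λ (k , A) → k , + suc e ℤ.* A) ns , ℕ.*-mono-≤ {1} {suc e} (s≤s z≤n) 1≤d ,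
             (≡.refl , trans (fromℤ-* (+ d) (↥ q)) (trans (*-congˡ (sym (*-/-cancel (fromℤ (↥ q)) (0<fromℕ-suc e))))
               (trans (solve 3 (λ d e q → d :* (e :* q) := (e :* d) :* q) refl (fromℕ d) (fromℕ (suc e)) (fromℚ q)) (*-congʳ (sym (fromℕ-* (suc e) d)))))) ∷ rescale e d ps

        scaled-lsum : ∀ d {ms ns} → Scaled d ms ns → lsum (λ (k , A) → fromℤ A * value k) ns ≈ fromℕ d * lsum (λ (k , q) → fromℚ q * value k) ms
        scaled-lsum d [] = sym (zeroʳ _)
        scaled-lsum d {ms = (k , q) ∷ _} ((≡.refl , p) ∷ ps) = trans (+-cong (trans (*-congʳ p) (*-assoc _ _ _)) (scaled-lsum d ps)) (sym (distribˡ _ _ _))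

        scaled-distinct : ∀ d {ms ns} → Scaled d ms ns → AllPairs (λ x y → proj₁ x ≢ proj₁ y) ms → AllPairs (λ x y → proj₁ x ≢ proj₁ y) ns
        scaled-distinct d []       []       = []
        scaled-distinct d ((≡.refl , _) ∷ ps) (u ∷ us) = go ps u ∷ scaled-distinct d ps us
          where
          go : ∀ {k ms ns} → Scaled d ms ns → All (λ y → k ≢ proj₁ y) ms → All (λ y → k ≢ proj₁ y) ns
          go []                  []       = []
          go ((≡.refl , _) ∷ ps) (v ∷ vs) = v ∷ go ps vs

        scaled-nonzero : ∀ d {ms ns} → 1 ℕ.≤ d → Scaled d ms ns → All (λ m → proj₂ m ≢ ℚ.0ℚ) ms → All (λ m → proj₂ m ≢ + 0) ns
        scaled-nonzero d 1≤d []             []       = []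
        scaled-nonzero d 1≤d ((_ , p) ∷ ps) (u ∷ us) =
          (λ A≡0 → *-≉0 (0<x⇒x≉0 (0<fromℕ 1≤d)) (fromℚ-≉0 u) (trans (sym p) (reflexive (≡.cong fromℤ A≡0)))) ∷ scaled-nonzero d 1≤d ps us

    integral-relation : ∀ n xs P → NonZeroPoly n P → eval ℝ-rawRing fromℚ P xs ≈ 0# → IntegralRelation n xs
    integral-relation n xs P P≢0 root =
      let d , ns , 1≤d , ps = clear ms′
      in record
        { terms    = ns
        ; distinct = scaled-distinct d ps (AllPairs.filter⁺ nonzero? (monomials-distinct n P))
        ; nonzero  = scaled-nonzero d 1≤d ps (All.all-filter nonzero? ms)
        ; nonempty = inhabited d ps (proj₂ (filtered (monomials-nonzero n P P≢0)))
        ; relation = trans (scaled-lsum d ps) (trans (*-congˡ (trans (drop-zeros ms) (trans (monomials-evaluate xs P) root))) (zeroʳ _))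
        }
      where
      open Clear (monomial-value xs)
      ms = monomials n P
      nonzero? : (m : Exponents n × ℚ) → Dec (proj₂ m ≢ ℚ.0ℚ)
      nonzero? m = ¬? (proj₂ m ℚ.≟ ℚ.0ℚ)
      ms′ = filter nonzero? ms
      filtered : Any (λ m → proj₂ m ≢ ℚ.0ℚ) ms → ∃ λ m → m ∈ˡ ms′
      filtered p = let m , m∈ , q = find p in m , ∈-filter⁺ nonzero? m∈ q
      inhabited : ∀ d {ms ns m} → Scaled d ms ns → m ∈ˡ ms → ∃ λ m → m ∈ˡ ns
      inhabited d (_ ∷ _) _ = _ , here ≡.refl
      drop-zeros : ∀ ms → lsum (λ (k , q) → fromℚ q * monomial-value xs k) (filter nonzero? ms) ≈ lsum (λ (k , q) → fromℚ q * monomial-value xs k) ms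
      drop-zeros []       = refl
      drop-zeros (m ∷ ms) with proj₂ m ℚ.≟ ℚ.0ℚ
      ... | no _    = +-congˡ (drop-zeros ms)
      ... | yes q≡0 = trans (drop-zeros ms) (trans (sym (+-identityˡ _)) (+-congʳ (sym (trans (*-congʳ (trans (reflexive (≡.cong fromℚ q≡0)) fromℚ-0)) (zeroˡ _)))))
        where
        fromℚ-0 : fromℚ ℚ.0ℚ ≈ 0#
        fromℚ-0 = zeroˡ _

  -- Size, support and sign of the coefficients of the relation.

  module Coefficients (t₁ t₂ t₃ : ℕ → ℕ) where

    open import Data.Nat.Base using (_+_; _*_; _∸_; _^_; _≤_; _<_)
    open Combinatorics
    open SubexponentialFunctions

    Key : Set
    Key = ℕ × ℕ × ℕ × ⊤

    -- The monomial X₁ X₃ · X₁^i X₂^j X₃^k; the extra factor makes the exponents of X₁ and X₃ positive.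
    word : Key → List (ℕ → ℕ)
    word (i , j , k , _) = replicate (suc i) t₁ ++ replicate j t₂ ++ replicate (suc k) t₃ ++ []

    coeff : List (Key × ℤ) → ℕ → ℤ
    coeff []             m = + 0
    coeff ((k , A) ∷ ns) m = A ℤ.* + ρ (word k) m ℤ.+ coeff ns m

    coeff-++ : ∀ as bs m → coeff (as ++ bs) m ≡ coeff as m ℤ.+ coeff bs m
    coeff-++ []             bs m = ≡.sym (ℤ.+-identityˡ _)
    coeff-++ ((k , A) ∷ as) bs m = ≡.trans (≡.cong (ℤ._+_ (A ℤ.* + ρ (word k) m)) (coeff-++ as bs m)) (≡.sym (ℤ.+-assoc (A ℤ.* + ρ (word k) m) (coeff as m) (coeff bs m)))

    maxUpTo : (ℕ → ℕ) → ℕ → ℕ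
    maxUpTo t zero    = t 0
    maxUpTo t (suc R) = maxUpTo t R ℕ.⊔ t (suc R)

    ≤-maxUpTo : ∀ t R n → n ≤ R → t n ≤ maxUpTo t R
    ≤-maxUpTo t zero    zero z≤n = ℕ.≤-refl
    ≤-maxUpTo t (suc R) n n≤1+R with ℕ.m≤n⇒m<n∨m≡n n≤1+R
    ... | inj₁ n<1+R  = ℕ.≤-trans (≤-maxUpTo t R n (ℕ.≤-pred n<1+R)) (ℕ.m≤m⊔n _ _)
    ... | inj₂ ≡.refl = ℕ.m≤n⊔m (maxUpTo t R) _

    maxUpTo-attained : ∀ t R → ∃ λ n → n ≤ R × maxUpTo t R ≡ t n
    maxUpTo-attained t zero = 0 , z≤n , ≡.refl
    maxUpTo-attained t (suc R) with ℕ.⊔-sel (maxUpTo t R) (t (suc R)) | maxUpTo-attained t R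
    ... | inj₁ e | n , n≤R , e′ = n , ℕ.m≤n⇒m≤1+n n≤R , ≡.trans e e′
    ... | inj₂ e | _            = suc R , ℕ.≤-refl , e

    wordBound : List (ℕ → ℕ) → ℕ → ℕ
    wordBound []      R = 1
    wordBound (f ∷ w) R = suc R * (maxUpTo f R * wordBound w R)

    ρ≤wordBound : ∀ w R m → m ≤ R → ρ w m ≤ wordBound w R
    ρ≤wordBound []      R zero    _   = ℕ.≤-refl
    ρ≤wordBound []      R (suc m) _   = z≤n
    ρ≤wordBound (f ∷ w) R m       m≤R = ℕ.≤-trans
      (sumℕ-mono (suc m) λ a a<1+m → ℕ.*-mono-≤ (≤-maxUpTo f R a (ℕ.≤-trans (ℕ.≤-pred a<1+m) m≤R)) (ρ≤wordBound w R (m ∸ a) (ℕ.≤-trans (ℕ.m∸n≤m m a) m≤R)))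
      (ℕ.≤-trans (ℕ.≤-reflexive (sumℕ-const (maxUpTo f R * wordBound w R) (suc m))) (ℕ.*-monoˡ-≤ (maxUpTo f R * wordBound w R) (s≤s m≤R)))

    coeffBound : List (Key × ℤ) → ℕ → ℕ
    coeffBound []             R = 0
    coeffBound ((k , A) ∷ ns) R = ℤ.∣ A ∣ * wordBound (word k) R + coeffBound ns R

    ∣coeff∣≤ : ∀ ns R m → m ≤ R → ℤ.∣ coeff ns m ∣ ≤ coeffBound ns R
    ∣coeff∣≤ []             R m m≤R = z≤n
    ∣coeff∣≤ ((k , A) ∷ ns) R m m≤R = ℕ.≤-trans (ℤ.∣i+j∣≤∣i∣+∣j∣ (A ℤ.* + ρ (word k) m) (coeff ns m)) (ℕ.+-mono-≤
      (ℕ.≤-trans (ℕ.≤-reflexive (ℤ.∣i*j∣≡∣i∣*∣j∣ A (+ ρ (word k) m))) (ℕ.*-monoʳ-≤ ℤ.∣ A ∣ (ρ≤wordBound (word k) R m m≤R)))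
      (∣coeff∣≤ ns R m m≤R))

    module _ {g : ℕ} (2≤g : 2 ≤ g) (s₁ : Subexponential g (maxUpTo t₁)) (s₂ : Subexponential g (maxUpTo t₂))
             (s₃ : Subexponential g (maxUpTo t₃)) where

      private
        1≤g : 1 ≤ g
        1≤g = ℕ.≤-trans (s≤s z≤n) 2≤g

      wordBound-subexp : ∀ {t} → Subexponential g (maxUpTo t) → ∀ n w → Subexponential g (wordBound w) → Subexponential g (wordBound (replicate n t ++ w))
      wordBound-subexp s zero    w q = q
      wordBound-subexp s (suc n) w q = Subexponential-* (Subexponential-+ (Subexponential-const 1≤g 1) (Subexponential-id 2≤g))
        (Subexponential-* s (wordBound-subexp s n w q))

      coeffBound-subexp : ∀ ns → Subexponential g (coeffBound ns)
      coeffBound-subexp []                           = Subexponential-const 1≤g 0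
      coeffBound-subexp (((i , j , k , _) , A) ∷ ns) = Subexponential-+ (Subexponential-* (Subexponential-const 1≤g ℤ.∣ A ∣)
        (wordBound-subexp s₁ (suc i) _ (wordBound-subexp s₂ j _ (wordBound-subexp s₃ (suc k) [] (Subexponential-const 1≤g 1)))))
        (coeffBound-subexp ns)

    absSum : List (Key × ℤ) → ℕ
    absSum []             = 0
    absSum ((k , A) ∷ ns) = ℤ.∣ A ∣ + absSum ns

    absSum-++ : ∀ as bs → absSum (as ++ bs) ≡ absSum as + absSum bs
    absSum-++ []             bs = ≡.refl
    absSum-++ ((k , A) ∷ as) bs = ≡.trans (≡.cong (ℕ._+_ ℤ.∣ A ∣) (absSum-++ as bs)) (≡.sym (ℕ.+-assoc ℤ.∣ A ∣ (absSum as) (absSum bs)))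

    W*∣coeff∣≤ : ∀ W r m ns → All (λ x → W * ρ (word (proj₁ x)) m ≤ r) ns → W * ℤ.∣ coeff ns m ∣ ≤ absSum ns * r
    W*∣coeff∣≤ W r m []             []       = ℕ.≤-reflexive (ℕ.*-zeroʳ W)
    W*∣coeff∣≤ W r m ((k , A) ∷ ns) (p ∷ ps) = begin
      W * ℤ.∣ A ℤ.* + ρ (word k) m ℤ.+ coeff ns m ∣
        ≤⟨ ℕ.*-monoʳ-≤ W (ℤ.∣i+j∣≤∣i∣+∣j∣ (A ℤ.* + ρ (word k) m) (coeff ns m)) ⟩
      W * (ℤ.∣ A ℤ.* + ρ (word k) m ∣ + ℤ.∣ coeff ns m ∣)
        ≡⟨ ≡.cong (λ x → W * (x + ℤ.∣ coeff ns m ∣)) (ℤ.∣i*j∣≡∣i∣*∣j∣ A (+ ρ (word k) m)) ⟩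
      W * (ℤ.∣ A ∣ * ρ (word k) m + ℤ.∣ coeff ns m ∣)
        ≡⟨ expand W ℤ.∣ A ∣ (ρ (word k) m) ℤ.∣ coeff ns m ∣ ⟩
      ℤ.∣ A ∣ * (W * ρ (word k) m) + W * ℤ.∣ coeff ns m ∣
        ≤⟨ ℕ.+-mono-≤ (ℕ.*-monoʳ-≤ ℤ.∣ A ∣ p) (W*∣coeff∣≤ W r m ns ps) ⟩
      ℤ.∣ A ∣ * r + absSum ns * r
        ≡⟨ ≡.sym (ℕ.*-distribʳ-+ r ℤ.∣ A ∣ (absSum ns)) ⟩
      (ℤ.∣ A ∣ + absSum ns) * r ∎
      where
      open ℕ.≤-Reasoning
      expand : ∀ w a p c → w * (a * p + c) ≡ a * (w * p) + w * c
      expand = solve-∀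

    dominated-sum : ∀ x n → ℤ.∣ x ∣ ≤ n → ∃ λ k → x ℤ.+ + n ≡ + k × (ℤ.∣ x ∣ < n → 0 < k)
    dominated-sum (+ a)    n p = a + n , ≡.refl , λ q → ℕ.≤-trans (ℕ.≤-trans (s≤s z≤n) q) (ℕ.m≤n+m n a)
    dominated-sum -[1+ a ] n p = n ∸ suc a , ℤ.⊖-≥ p , ℕ.m<n⇒0<n∸m

    module Support {S₁ S₂ : Pred ℕ 0ℓ} (supp₁ : Supported t₁ S₁) (supp₂ : Supported t₂ S₁) (supp₃ : Supported t₃ S₂)
                   (pos₁ : PositiveOn t₁ S₁) (pos₂ : PositiveOn t₂ S₁) (pos₃ : PositiveOn t₃ S₂) where

      tail-support : ∀ j k b → 0 < ρ (replicate j t₂ ++ replicate (suc k) t₃ ++ []) b → ∃₂ λ x y → b ≡ x + y × x ∈ j ⊛ S₁ × y ∈ suc k ⊛ S₂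
      tail-support j k b p =
        let x , b′ , e , x∈ , q = ρ-replicate-++⁻ {t₂} {S₁} supp₂ j _ b p
            y , z , e′ , y∈ , r = ρ-replicate-++⁻ {t₃} {S₂} supp₃ (suc k) [] b′ q
        in x , y , ≡.trans e (≡.cong (ℕ._+_ x) (≡.trans e′ (≡.trans (≡.cong (ℕ._+_ y) (ρ-[] z r)) (ℕ.+-identityʳ y)))) , x∈ , y∈

      word-support : ∀ i j k u m → 0 < ρ (word (i , j , k , u)) m → ∃₂ λ x y → m ≡ x + y × x ∈ (suc i + j) ⊛ S₁ × y ∈ suc k ⊛ S₂
      word-support i j k u m p =
        let x , b , e , x∈ , q = ρ-replicate-++⁻ {t₁} {S₁} supp₁ (suc i) _ m p
            x′ , y , e′ , x′∈ , y∈ = tail-support j k b q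
        in x + x′ , y , ≡.trans e (≡.trans (≡.cong (ℕ._+_ x) e′) (≡.sym (ℕ.+-assoc x x′ y))) , ⊛-+ {S₁} (suc i) j x∈ x′∈ , y∈

      ⊛-split : ∀ {S : Pred ℕ 0ℓ} i j {z} → z ∈ (i + j) ⊛ S → ∃₂ λ x y → z ≡ x + y × x ∈ i ⊛ S × y ∈ j ⊛ S
      ⊛-split zero    j {z} p = 0 , z , ≡.refl , ≡.refl , p
      ⊛-split {S} (suc i) j (a , b , a∈ , b∈ , ≡.refl) =
        let x , y , e , x∈ , y∈ = ⊛-split {S} i j b∈
        in a + x , y , ≡.trans (≡.cong (ℕ._+_ a) e) (≡.sym (ℕ.+-assoc a x y)) , (a , x , a∈ , x∈ , ≡.refl) , y∈

      word-positive : ∀ i j k u x y → x ∈ (suc i + j) ⊛ S₁ → y ∈ suc k ⊛ S₂ → 0 < ρ (word (i , j , k , u)) (x + y)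
      word-positive i j k u x y x∈ y∈ =
        let a , b , e , a∈ , b∈ = ⊛-split {S₁} (suc i) j x∈
        in ≡.subst (λ m → 0 < ρ (word (i , j , k , u)) m) (≡.trans (≡.sym (ℕ.+-assoc a b y)) (≡.cong (_+ y) (≡.sym e)))
             (ρ-replicate-++⁺ {t₁} {S₁} pos₁ (suc i) _ a (b + y) a∈ (ρ-replicate-++⁺ {t₂} {S₁} pos₂ j _ b y b∈
               (≡.subst (λ m → 0 < ρ (replicate (suc k) t₃ ++ []) m) (ℕ.+-identityʳ y)
                 (ρ-replicate-++⁺ {t₃} {S₂} pos₃ (suc k) [] y 0 y∈ (s≤s z≤n)))))

      replicate-∷ : ∀ n (x : ℕ → ℕ) ys → replicate n x ++ x ∷ ys ≡ x ∷ replicate n x ++ ys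
      replicate-∷ zero    x ys = ≡.refl
      replicate-∷ (suc n) x ys = ≡.cong (x ∷_) (replicate-∷ n x ys)

      -- (i₀ , j₀ , k₀) is the leading monomial: of maximal degree i + j, then of maximal k, then of maximal i.
      module Leading (ns : List (Key × ℤ)) (distinct : AllPairs (λ x y → proj₁ x ≢ proj₁ y) ns) (i₀ j₀ k₀ a₀ K B : ℕ) (1≤B : 1 ≤ B)
        (lead∈ : ((i₀ , j₀ , k₀ , tt) , + suc a₀) ∈ˡ ns)
        (degree-max : ∀ i j k u A → ((i , j , k , u) , A) ∈ˡ ns → i + j ≤ i₀ + j₀)
        (k-max : ∀ i j k u A → ((i , j , k , u) , A) ∈ˡ ns → i + j ≡ i₀ + j₀ → k ≤ k₀)
        (i-max : ∀ i j k u A → ((i , j , k , u) , A) ∈ˡ ns → i + j ≡ i₀ + j₀ → k ≡ k₀ → i ≤ i₀)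
        (k-bound : ∀ i j k u A → ((i , j , k , u) , A) ∈ˡ ns → suc k ≤ K)
        (dominates : ∀ a → B ≤ a → suc (absSum ns) * t₂ a ≤ t₁ a) where

        D W : ℕ
        D = i₀ + j₀
        W = suc (absSum ns)

        open Configuration S₁ S₂ D k₀ K B

        -- If the exchanged factor had an argument a < B, the other factors would make m - a a sum
        -- of D elements of S₁ and k₀ + 1 of S₂, and m would be `Low`.
        exchange : ∀ i j m → suc i + j ≡ D → ¬ Low m → W * ρ (word (i , suc j , k₀ , tt)) m ≤ ρ (word (suc i , j , k₀ , tt)) m
        exchange i j m e ¬low = ≡.subst (λ w → W * ρ (word (i , suc j , k₀ , tt)) m ≤ ρ w m) (replicate-∷ (suc i) t₁ suf)
          (ρ-exchange {t₂} {t₁} {W} {B} dominates (replicate (suc i) t₁) suf m λ x a b m≡ p q r → ℕ.≮⇒≥ λ a<B →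
            let x₁ , z , x≡ , x₁∈ , z0 = ρ-replicate-++⁻ {t₁} {S₁} supp₁ (suc i) [] x (≡.subst (λ w → 0 < ρ w x) (≡.sym (List.++-identityʳ (replicate (suc i) t₁))) p)
                x∈ = ≡.subst (_∈ suc i ⊛ S₁) (≡.sym (≡.trans x≡ (≡.trans (≡.cong (ℕ._+_ x₁) (ρ-[] z z0)) (ℕ.+-identityʳ x₁)))) x₁∈
                x′ , y , b≡ , x′∈ , y∈ = tail-support j k₀ b r
            in ¬low (a , x + b , ≡.trans m≡ (swap x a b) , a<B , suc i + j , suc k₀ , ℕ.≤-reflexive e , k-bound i₀ j₀ k₀ tt _ lead∈ ,
                     x + x′ , y , ≡.trans (≡.cong (ℕ._+_ x) b≡) (≡.sym (ℕ.+-assoc x x′ y)) , ⊛-+ {S₁} (suc i) j x∈ x′∈ , y∈))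
          where
          suf = replicate j t₂ ++ replicate (suc k₀) t₃ ++ []
          swap : ∀ x a b → x + (a + b) ≡ a + (x + b)
          swap = solve-∀

        -- One exchange already yields the factor W; the remaining ones only have to lose nothing,
        -- for which W ≥ 1 is enough.
        exchange-many : ∀ n i j m → suc n + i + j ≡ D → ¬ Low m →
                        W * ρ (word (i , suc n + j , k₀ , tt)) m ≤ ρ (word (suc n + i , j , k₀ , tt)) m
        exchange-many zero    i j m e ¬low = exchange i j m e ¬low
        exchange-many (suc n) i j m e ¬low = ℕ.≤-trans (exchange i (suc n + j) m (≡.trans (shuffle n i j) e) ¬low)
          (ℕ.≤-trans (ℕ.m≤n*m (ρ (word (suc i , suc n + j , k₀ , tt)) m) W)
            (≡.subst (λ l → W * ρ (word (suc i , suc n + j , k₀ , tt)) m ≤ ρ (word (l , j , k₀ , tt)) m) (ℕ.+-suc (suc n) i)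
              (exchange-many n (suc i) j m (≡.trans (≡.cong (_+ j) (ℕ.+-suc (suc n) i)) e) ¬low)))
          where
          shuffle : ∀ n i j → 1 + i + (1 + n + j) ≡ 1 + (1 + n) + i + j
          shuffle = solve-∀

        lead : Key
        lead = i₀ , j₀ , k₀ , tt

        zero-or-positive : ∀ n → n ≡ 0 ⊎ 0 < n
        zero-or-positive zero    = inj₁ ≡.refl
        zero-or-positive (suc n) = inj₂ (s≤s z≤n)

        W*0≤ : ∀ {n r} → n ≡ 0 → W * n ≤ r
        W*0≤ {r = r} ≡.refl = ≡.subst (_≤ r) (≡.sym (ℕ.*-zeroʳ W)) z≤n

        -- A positive coefficient off `Low` and `Mid` forces the maximal degree and the maximal k. A
        -- different monomial then has i < i₀, hence more factors t₂ than the leading one, and these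
        -- are exchanged for t₁.
        non-leading : ∀ i j k u A → ((i , j , k , u) , A) ∈ˡ ns → (i , j , k , u) ≢ lead → ∀ m → ¬ Low m → ¬ Mid m →
                      W * ρ (word (i , j , k , u)) m ≤ ρ (word lead) m
        non-leading i j k u A ∈ns ≢lead m ¬low ¬mid with zero-or-positive (ρ (word (i , j , k , u)) m)
        ... | inj₁ z = W*0≤ z
        ... | inj₂ p with word-support i j k u m p | ℕ.m≤n⇒m<n∨m≡n (degree-max i j k u A ∈ns)
        ... | s | inj₁ d< = ⊥-elim (¬low (0 , m , ≡.refl , 1≤B , suc i + j , suc k , d< , k-bound i j k u A ∈ns , s))
        ... | s | inj₂ d≡ with ℕ.m≤n⇒m<n∨m≡n (k-max i j k u A ∈ns d≡)
        ... | inj₁ k< = ⊥-elim (¬mid (suc k , k< , ≡.subst (λ d → Sum (suc d) (suc k) m) d≡ s))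
        ... | inj₂ ≡.refl with ℕ.m≤n⇒m<n∨m≡n (i-max i j k u A ∈ns d≡ ≡.refl)
        ... | inj₂ ≡.refl = ⊥-elim (≢lead (≡.cong (λ j → i₀ , j , k₀ , tt) (ℕ.+-cancelˡ-≡ i₀ j j₀ d≡)))
        ... | inj₁ i<i₀ = ≡.subst₂ (λ j i′ → W * ρ (word (i , j , k₀ , tt)) m ≤ ρ (word (i′ , j₀ , k₀ , tt)) m) j≡ i₀≡
                (exchange-many n i j₀ m (≡.cong (_+ j₀) i₀≡) ¬low)
          where
          n = i₀ ∸ suc i
          i₀≡ : suc n + i ≡ i₀
          i₀≡ = ≡.trans (≡.sym (ℕ.+-suc n i)) (ℕ.m∸n+n≡m i<i₀)
          j≡ : suc n + j₀ ≡ j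
          j≡ = ℕ.+-cancelˡ-≡ i _ _ (≡.trans (shuffle i n j₀) (≡.trans (≡.cong (_+ j₀) i₀≡) (≡.sym d≡)))
            where
            shuffle : ∀ i n j → i + (1 + n + j) ≡ 1 + n + i + j
            shuffle = solve-∀

        -- W exceeds the sum of all |A| by 1, so W |X| ≤ (W - 1) r for the total X of the other
        -- terms. Hence |X| < r when r > 0, while the leading term is at least r.
        coeff-sign : ∀ m → ¬ Low m → ¬ Mid m → ∃ λ k → coeff ns m ≡ + k × (0 < ρ (word lead) m → 0 < k)
        coeff-sign m ¬low ¬mid with ∈-∃++ lead∈
        ... | as , bs , ns≡ =
          let k , e , pos = dominated-sum X (suc a₀ * r) (ℕ.≤-trans ∣X∣≤r (ℕ.m≤n*m r (suc a₀)))
          in k , ≡.trans coeff≡ e , λ 0<r → pos (ℕ.<-≤-trans (∣X∣<r 0<r) (ℕ.m≤n*m r (suc a₀)))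
          where
          r = ρ (word lead) m
          X = coeff as m ℤ.+ coeff bs m

          coeff≡ : coeff ns m ≡ X ℤ.+ + (suc a₀ * r)
          coeff≡ = ≡.trans (≡.cong (λ l → coeff l m) ns≡) (≡.trans (coeff-++ as ((lead , + suc a₀) ∷ bs) m)
            (≡.trans (≡.cong (λ x → coeff as m ℤ.+ (x ℤ.+ coeff bs m)) (≡.sym (ℤ.pos-* (suc a₀) r)))
              (≡.trans (≡.cong (ℤ._+_ (coeff as m)) (ℤ.+-comm (+ (suc a₀ * r)) (coeff bs m))) (≡.sym (ℤ.+-assoc (coeff as m) (coeff bs m) (+ (suc a₀ * r)))))))

          pairs : AllPairs (λ x y → proj₁ x ≢ proj₁ y) (as ++ (lead , + suc a₀) ∷ bs)
          pairs = ≡.subst (AllPairs (λ x y → proj₁ x ≢ proj₁ y)) ns≡ distinct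

          others : ∀ x → x ∈ˡ as ⊎ x ∈ˡ bs → proj₁ x ≢ lead
          others x (inj₁ p) = before as pairs p
            where
            before : ∀ as {bs x} → AllPairs (λ x y → proj₁ x ≢ proj₁ y) (as ++ (lead , + suc a₀) ∷ bs) → x ∈ˡ as → proj₁ x ≢ lead
            before (_ ∷ as) (q ∷ _)  (here ≡.refl) = All.lookup q (∈-++⁺ʳ as (here ≡.refl))
            before (_ ∷ as) (_ ∷ qs) (there p)     = before as qs p
          others x (inj₂ p) = after as pairs p
            where
            after : ∀ as {bs x} → AllPairs (λ x y → proj₁ x ≢ proj₁ y) (as ++ (lead , + suc a₀) ∷ bs) → x ∈ˡ bs → proj₁ x ≢ lead
            after []       (q ∷ _)  p e = All.lookup q p (≡.sym e)
            after (_ ∷ as) (_ ∷ qs) p   = after as qs p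

          bounded : ∀ x → x ∈ˡ as ⊎ x ∈ˡ bs → W * ρ (word (proj₁ x)) m ≤ r
          bounded x@((i , j , k , u) , A) p = non-leading i j k u A
            (≡.subst (x ∈ˡ_) (≡.sym ns≡) (place p)) (others x p) m ¬low ¬mid
            where
            place : x ∈ˡ as ⊎ x ∈ˡ bs → x ∈ˡ (as ++ (lead , + suc a₀) ∷ bs)
            place (inj₁ p) = ∈-++⁺ˡ p
            place (inj₂ p) = ∈-++⁺ʳ as (there p)

          W∣X∣≤ : W * ℤ.∣ X ∣ ≤ absSum ns * r
          W∣X∣≤ = begin
            W * ℤ.∣ X ∣
              ≤⟨ ℕ.*-monoʳ-≤ W (ℤ.∣i+j∣≤∣i∣+∣j∣ (coeff as m) (coeff bs m)) ⟩
            W * (ℤ.∣ coeff as m ∣ + ℤ.∣ coeff bs m ∣)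
              ≡⟨ ℕ.*-distribˡ-+ W ℤ.∣ coeff as m ∣ ℤ.∣ coeff bs m ∣ ⟩
            W * ℤ.∣ coeff as m ∣ + W * ℤ.∣ coeff bs m ∣
              ≤⟨ ℕ.+-mono-≤ (W*∣coeff∣≤ W r m as (All.tabulate λ {x} p → bounded x (inj₁ p))) (W*∣coeff∣≤ W r m bs (All.tabulate λ {x} p → bounded x (inj₂ p))) ⟩
            absSum as * r + absSum bs * r
              ≡⟨ ≡.sym (ℕ.*-distribʳ-+ r (absSum as) (absSum bs)) ⟩
            (absSum as + absSum bs) * r
              ≤⟨ ℕ.*-monoˡ-≤ r (ℕ.≤-trans (ℕ.+-monoʳ-≤ (absSum as) (ℕ.m≤n+m (absSum bs) (suc a₀)))
                   (ℕ.≤-reflexive (≡.sym (≡.trans (≡.cong absSum ns≡) (absSum-++ as ((lead , + suc a₀) ∷ bs)))))) ⟩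
            absSum ns * r ∎
            where open ℕ.≤-Reasoning

          ∣X∣≤r : ℤ.∣ X ∣ ≤ r
          ∣X∣≤r = ℕ.*-cancelˡ-≤ W (ℕ.≤-trans W∣X∣≤ (ℕ.*-monoˡ-≤ r (ℕ.n≤1+n (absSum ns))))

          ∣X∣<r : 0 < r → ℤ.∣ X ∣ < r
          ∣X∣<r 0<r = ℕ.*-cancelˡ-< W ℤ.∣ X ∣ r (ℕ.≤-<-trans W∣X∣≤ (ℕ.m<n+m (absSum ns * r) 0<r))

        coeff-nonneg : ∀ m → ¬ Low m → ¬ Mid m → + 0 ℤ.≤ coeff ns m
        coeff-nonneg m ¬low ¬mid = let k , e , _ = coeff-sign m ¬low ¬mid in ≡.subst (+ 0 ℤ.≤_) (≡.sym e) (ℤ.+≤+ z≤n)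

        coeff-positive : ∀ m → ¬ Low m → ¬ Mid m → High m → + 0 ℤ.< coeff ns m
        coeff-positive m ¬low ¬mid (x , y , ≡.refl , x∈ , y∈) = let k , e , pos = coeff-sign m ¬low ¬mid in
          ≡.subst (+ 0 ℤ.<_) (≡.sym e) (ℤ.+<+ (pos (word-positive i₀ j₀ k₀ tt x y x∈ y∈)))

        coeff-support : ∀ m → coeff ns m ≢ + 0 → ∃₂ λ n k → n ≤ suc D × k ≤ K × Sum n k m
        coeff-support m c≢0 = go ns (λ x p → p) c≢0
          where
          go : ∀ l → (∀ x → x ∈ˡ l → x ∈ˡ ns) → coeff l m ≢ + 0 → ∃₂ λ n k → n ≤ suc D × k ≤ K × Sum n k m
          go [] _ q = ⊥-elim (q ≡.refl)
          go (((i , j , k , u) , A) ∷ l) sub q with zero-or-positive (ρ (word (i , j , k , u)) m)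
          ... | inj₂ p = suc i + j , suc k , s≤s (degree-max i j k u A (sub _ (here ≡.refl))) , k-bound i j k u A (sub _ (here ≡.refl)) , word-support i j k u m p
          ... | inj₁ z = go l (λ x p → sub x (there p)) λ e → q (≡.trans
                (≡.cong₂ ℤ._+_ (≡.trans (≡.cong (λ r → A ℤ.* + r) z) (ℤ.*-zeroʳ A)) e) ≡.refl)

  -- Values of the power series and of their products.

  module GeneratingSeries where

    open RealField
    open Series
    open Growth
    open Monomials
    open Combinatorics
    open SubexponentialFunctions

    fromℕ-sumℕ : ∀ f n → fromℕ (sumℕ f n) ≈ ∑ (λ i → fromℕ (f i)) n
    fromℕ-sumℕ f zero    = refl
    fromℕ-sumℕ f (suc n) = trans (fromℕ-+ (sumℕ f n) (f n)) (+-congʳ (fromℕ-sumℕ f n))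

    module _ (b : ℝ) where

      series : (ℕ → ℕ) → ℕ → ℝ
      series t m = fromℕ (t m) * b ^ m

      SumsTo : (ℕ → ℕ) → ℝ → Set
      SumsTo t V = AbsSummable (series t) × HasSum (series t) V

      series-ρ : ∀ f w m → (series f ✶ series (ρ w)) m ≈ series (ρ (f ∷ w)) m
      series-ρ f w m = trans
        (∑-cong (suc m) λ { a (s≤s a≤m) → trans (solve 4 (λ x p y q → (x :* p) :* (y :* q) := (x :* y) :* (p :* q)) refl (fromℕ (f a)) (b ^ a) (fromℕ (ρ w (m ℕ.∸ a))) (b ^ (m ℕ.∸ a)))
          (*-cong (sym (fromℕ-* (f a) (ρ w (m ℕ.∸ a)))) (trans (sym (^-homo-* b a (m ℕ.∸ a))) (reflexive (≡.cong (b ^_) (ℕ.m+[n∸m]≡n a≤m))))) })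
        (trans (∑-*ʳ (b ^ m) (λ a → fromℕ (f a ℕ.* ρ w (m ℕ.∸ a))) (suc m)) (*-congʳ (sym (fromℕ-sumℕ (λ a → f a ℕ.* ρ w (m ℕ.∸ a)) (suc m)))))

      AbsSummable-cong : ∀ {f g} → (∀ n → f n ≈ g n) → AbsSummable f → AbsSummable g
      AbsSummable-cong p (B , q) = B , λ n → ≤-respˡ (∑-cong n λ i _ → ∣∣-cong (p i)) (q n)

      ρ-[]-sums : SumsTo (ρ []) 1#
      ρ-[]-sums = (1# , λ n → ≤-trans (∑-monoʳ {n = suc n} (λ i → 0≤∣x∣ (series (ρ []) i)) (ℕ.n≤1+n n)) (≤-reflexive (total n))) ,
        λ ε 0<ε → 1 , λ { (suc n) _ → <-respˡ-≈ (sym (≈0⇒∣x∣≈0 (x≈y⇒x-y≈0 (partial n)))) 0<ε }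
        where
        one : fromℕ 1 * 1# ≈ 1#
        one = trans (*-identityʳ _) fromℕ-1
        partial : ∀ n → ∑ (series (ρ [])) (suc n) ≈ 1#
        partial n = trans (∑-head (series (ρ [])) n) (trans (+-cong one (trans (∑-cong n λ i _ → zeroˡ _) (∑-0 n))) (+-identityʳ 1#))
        total : ∀ n → ∑ (λ i → ∣ series (ρ []) i ∣) (suc n) ≈ 1#
        total n = trans (∑-head _ n) (trans (+-cong (trans (∣∣-cong one) (0≤x⇒∣x∣≈x 0≤1)) (trans (∑-cong n λ i _ → ≈0⇒∣x∣≈0 (zeroˡ _)) (∑-0 n))) (+-identityʳ 1#))

      HasSum-resp : ∀ f {l m} → l ≈ m → HasSum f l → HasSum f m
      HasSum-resp f p = HasSum-cong {f} {f} (λ _ → refl) p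

      ρ-∷-sums : ∀ f w {F V} → SumsTo f F → SumsTo (ρ w) V → SumsTo (ρ (f ∷ w)) (F * V)
      ρ-∷-sums f w (s , h) (s′ , h′) = AbsSummable-cong {series f ✶ series (ρ w)} {series (ρ (f ∷ w))} (series-ρ f w) (AbsSummable-✶ s s′) ,
        HasSum-cong {series f ✶ series (ρ w)} {series (ρ (f ∷ w))} (series-ρ f w) refl (HasSum-✶ s s′ h h′)

      ρ-replicate-sums : ∀ f w {F V} → SumsTo f F → ∀ n → SumsTo (ρ w) V → SumsTo (ρ (replicate n f ++ w)) (F ^ n * V)
      ρ-replicate-sums f w p zero (s , h) = s , HasSum-resp (series (ρ w)) (sym (*-identityˡ _)) h
      ρ-replicate-sums f w p (suc n) q =
        let s , h = ρ-∷-sums f (replicate n f ++ w) p (ρ-replicate-sums f w p n q)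
        in s , HasSum-resp (series (ρ (f ∷ replicate n f ++ w))) (sym (*-assoc _ _ _)) h

      module _ {t₁ t₂ t₃ : ℕ → ℕ} {F₁ F₂ F₃ : ℝ} (p₁ : SumsTo t₁ F₁) (p₂ : SumsTo t₂ F₂) (p₃ : SumsTo t₃ F₃) where
        open Coefficients t₁ t₂ t₃

        private
          value : Key → ℝ
          value = monomial-value (F₁ ∷ F₂ ∷ F₃ ∷ [])

        word-sums : ∀ k → HasSum (series (ρ (word k))) (F₁ * F₃ * value k)
        word-sums (i , j , k , tt) = HasSum-resp (series (ρ (word (i , j , k , tt))))
          (solve 5 (λ x z p q r → (x :* p) :* (q :* ((z :* r) :* 𝟙)) := (x :* z) :* (p :* (q :* (r :* 𝟙)))) refl F₁ F₃ (F₁ ^ i) (F₂ ^ j) (F₃ ^ k))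
          (proj₂ (ρ-replicate-sums t₁ (replicate j t₂ ++ replicate (suc k) t₃ ++ []) p₁ (suc i)
            (ρ-replicate-sums t₂ (replicate (suc k) t₃ ++ []) p₂ j (ρ-replicate-sums t₃ [] p₃ (suc k) ρ-[]-sums))))

        coeff-sums : ∀ ns → HasSum (λ m → fromℤ (coeff ns m) * b ^ m) (F₁ * F₃ * lsum (λ (k , A) → fromℤ A * value k) ns)
        coeff-sums [] = HasSum-cong {λ _ → 0#} {λ m → fromℤ (+ 0) * b ^ m} (λ _ → sym (zeroˡ _)) (sym (zeroʳ _)) HasSum-0
        coeff-sums ((k , A) ∷ ns) = HasSum-cong {λ m → fromℤ A * series (ρ (word k)) m + fromℤ (coeff ns m) * b ^ m} {λ m → fromℤ (coeff ((k , A) ∷ ns) m) * b ^ m}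
          (λ m → trans (solve 4 (λ a r c p → a :* (r :* p) :+ c :* p := (a :* r :+ c) :* p) refl (fromℤ A) (fromℕ (ρ (word k) m)) (fromℤ (coeff ns m)) (b ^ m))
            (*-congʳ (sym (trans (fromℤ-+ (A ℤ.* + ρ (word k) m) (coeff ns m)) (+-congʳ (fromℤ-* A (+ ρ (word k) m)))))))
          (solve 4 (λ a f v l → a :* (f :* v) :+ f :* l := f :* (a :* v :+ l)) refl (fromℤ A) (F₁ * F₃) (value k) (lsum (λ (k , A) → fromℤ A * value k) ns))
          (HasSum-+ (HasSum-*ˡ (fromℤ A) (word-sums k)) (coeff-sums ns))

    module _ {β : ℝ} (1<β : 1# < β) {g E : ℕ} {t : ℕ → ℕ} (t≤ : SubexponentialBound g E t) where

      private
        σ : ℝ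
        σ = proj₁ (between 1<β)
        1<σ = proj₁ (proj₂ (between 1<β))
        σ<β = proj₂ (proj₂ (between 1<β))
        0<β = <-trans 0<1 1<β
        b = β ⁻¹
        0<b = 0<x⁻¹ 0<β
        0≤σ = ≤-trans 0≤1 (inj₁ 1<σ)
        0≤σb = 0≤x*y 0≤σ (inj₁ 0<b)
        σb<1 : σ * b < 1#
        σb<1 = <-respˡ-≈ (*-comm b σ) (<-respʳ-≈ (trans (*-comm b β) (x/x≈1 0<β)) (*-monoˡ-< 0<b σ<β))

        v m₀ : ℕ
        v = suc (proj₁ (^-unbounded 1<σ (fromℕ E)))
        m₀ = v ℕ.^ g

        E≤σ^v : fromℕ E ≤ σ ^ v
        E≤σ^v = ≤-trans (inj₁ (proj₂ (^-unbounded 1<σ (fromℕ E)))) (^-monoʳ-≤ {σ} {proj₁ (^-unbounded 1<σ (fromℕ E))} {v} (inj₁ 1<σ) (ℕ.n≤1+n _))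

        B : ℕ
        B = proj₁ (nat-bound t m₀)

        -- v is chosen with σ^v ≥ E, so taking v-th roots of t(m)^v ≤ E^m gives the bound; it is
        -- available once m ≥ v^g.
        t≤σ^ : ∀ m → m₀ ℕ.≤ m → fromℕ (t m) ≤ σ ^ m
        t≤σ^ m m₀≤m = ^-cancelˡ-≤ (ℕ.pred v) (0≤x^n m 0≤σ) (begin
          fromℕ (t m) ^ v            ≈⟨ fromℕ-^ (t m) v ⟨
          fromℕ (t m ℕ.^ v)          ≤⟨ fromℕ-mono-≤ (ℕ.≤-trans (ℕ.^-monoˡ-≤ v (ℕ.m≤n⊔m 1 (t m))) (t≤ m v m ℕ.≤-refl (s≤s z≤n) m₀≤m)) ⟩
          fromℕ (E ℕ.^ m)            ≈⟨ fromℕ-^ E m ⟩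
          fromℕ E ^ m                ≤⟨ ^-monoˡ-≤ m (0≤fromℕ E) E≤σ^v ⟩
          (σ ^ v) ^ m                ≈⟨ trans (^-assocʳ σ v m) (trans (reflexive (≡.cong (σ ^_) (ℕ.*-comm v m))) (sym (^-assocʳ σ m v))) ⟩
          (σ ^ m) ^ v                ∎)
          where open ≤-Reasoning

        t≤Bσ^ : ∀ m → fromℕ (t m) ≤ fromℕ (suc B) * σ ^ m
        t≤Bσ^ m with m₀ ℕ.≤? m
        ... | yes p = ≤-trans (t≤σ^ m p) (≤-respˡ (*-identityˡ _) (*-monoʳ-≤ (0≤x^n m 0≤σ) (1≤fromℕ {suc B} (s≤s z≤n))))
        ... | no p  = ≤-trans (fromℕ-mono-≤ (ℕ.≤-trans (proj₂ (nat-bound t m₀) m (ℕ.≰⇒> p)) (ℕ.n≤1+n B)))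
                        (≤-respˡ (*-identityʳ _) (*-monoˡ-≤ (0≤fromℕ (suc B)) (1≤x^n m (inj₁ 1<σ))))

      series-summable : AbsSummable (series (β ⁻¹) t)
      series-summable = fromℕ (suc B) * (1# - σ * b) ⁻¹ , λ n → ≤-trans
        (∑-mono n λ i _ → ≤-respˡ (sym (0≤x⇒∣x∣≈x (0≤x*y (0≤fromℕ (t i)) (0≤x^n i (inj₁ 0<b)))))
          (≤-trans (*-monoʳ-≤ (0≤x^n i (inj₁ 0<b)) (t≤Bσ^ i)) (≤-reflexive (trans (*-assoc _ _ _) (*-congˡ (sym (^-distrib-* σ b i)))))))
        (≤-respˡ (sym (∑-*ˡ (fromℕ (suc B)) ((σ * b) ^_) n)) (*-monoˡ-≤ (0≤fromℕ (suc B)) (∑-geometric-≤ n 0≤σb σb<1)))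

      series-sums : SumsTo (β ⁻¹) t (⟦ t ⟧ (β ⁻¹))
      series-sums = series-summable , let l , h = AbsSummable⇒HasSum series-summable in HasSum-resp (β ⁻¹) (series (β ⁻¹) t) (sym (∑∞-unique h)) h

    maxUpTo-subexp : ∀ {g E t₁ t₂ t₃} (t : ℕ → ℕ) → 1 ℕ.≤ E → SubexponentialBound g E t → 1 ℕ.≤ g → Subexponential g (Coefficients.maxUpTo t₁ t₂ t₃ t)
    maxUpTo-subexp {g} {E} {t₁} {t₂} {t₃} t 1≤E p 1≤g = subexponential (2 ℕ.* E) (ℕ.*-mono-≤ {1} {2} (s≤s z≤n) 1≤E) λ R v 1≤v v^g≤R →
      let n , n≤R , e = maxUpTo-attained t R in ℕ.≤-trans
        (ℕ.^-monoˡ-≤ v (ℕ.≤-trans (ℕ.≤-reflexive (≡.cong suc e)) (suc≤2⊔ (t n))))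
        (ℕ.≤-trans (ℕ.≤-reflexive (^-distrib 2 (1 ℕ.⊔ t n) v))
          (ℕ.≤-trans (ℕ.*-mono-≤ (ℕ.^-monoʳ-≤ 2 (v≤R 1≤g 1≤v v^g≤R)) (p R v n n≤R 1≤v v^g≤R)) (ℕ.≤-reflexive (≡.sym (^-distrib 2 E R)))))
      where
      open Coefficients t₁ t₂ t₃
      suc≤2⊔ : ∀ x → suc x ℕ.≤ 2 ℕ.* (1 ℕ.⊔ x)
      suc≤2⊔ x = ℕ.≤-trans (ℕ.+-mono-≤ (ℕ.m≤m⊔n 1 x) (ℕ.m≤n⊔m 1 x)) (ℕ.≤-reflexive (≡.cong ((1 ℕ.⊔ x) ℕ.+_) (≡.sym (ℕ.+-identityʳ _))))

  -- Counting functions and the hypotheses in terms of natural numbers.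

  module Counting where

    open RealField
    open Growth
    open Combinatorics

    module _ (S : Pred ℕ 0ℓ) where

      count : ℕ → ℕ
      count N = Λ S (fromℕ N)

      private
        enumerate : ∀ N → ∃ (HasCard ([0, fromℕ N ⟩∩ S))
        enumerate N = length xs , xs , Unique.filter⁺ ∈S? (Unique.upTo⁺ N) ,
            (λ n → mk⇔ (λ p → let q , r = ∈-filter⁻ ∈S? p in fromℕ-mono-< {n} {N} (∈-upTo⁻ q) , r)
                       (λ (q , r) → ∈-filter⁺ ∈S? (∈-upTo⁺ (fromℕ-cancel-< {n} {N} q)) r)) , ≡.refl
          where
          ∈S? : ∀ n → Dec (n ∈ S)
          ∈S? n = em
          xs : List ℕ
          xs = filter ∈S? (upTo N)

      elements : ∀ N → ∃ λ xs → Unique xs × (∀ m → m ∈ˡ xs → m ℕ.< N × m ∈ S) × Covers xs S N × length xs ≡ count N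
      elements N =
        let xs , u , eq , len = the-satisfies 0 (HasCard ([0, fromℕ N ⟩∩ S)) (enumerate N)
        in xs , u , (λ m p → let q , r = Equivalence.to (eq m) p in fromℕ-cancel-< q , r) ,
           (λ m m<N p → Equivalence.from (eq m) (fromℕ-mono-< m<N , p)) , len

      count-mono : ∀ {M N} → M ℕ.≤ N → count M ℕ.≤ count N
      count-mono {M} {N} M≤N =
        let xs , u , sound , _ , len = elements M
            ys , _ , _ , cov , len′ = elements N
        in ≡.subst₂ ℕ._≤_ len len′ (unique-length u λ m p → let m<M , m∈S = sound m p in cov m (ℕ.<-≤-trans m<M M≤N) m∈S)

      count-unbounded : Infinite S → ∀ k → ∃ λ N → ∀ N′ → N ℕ.≤ N′ → k ℕ.≤ count N′
      count-unbounded inf zero = 0 , λ _ _ → z≤n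
      count-unbounded inf (suc k) =
        let N , p = count-unbounded inf k
            s , N≤s , s∈S = inf N
        in suc s , λ N′ s<N′ → ℕ.≤-trans (s≤s (p N ℕ.≤-refl)) (ℕ.≤-trans (step N s N≤s s∈S) (count-mono s<N′))
        where
        step : ∀ N s → N ℕ.≤ s → s ∈ S → suc (count N) ℕ.≤ count (suc s)
        step N s N≤s s∈S =
          let xs , u , sound , _ , len = elements N
              ys , _ , _ , cov , len′ = elements (suc s)
          in ≡.subst₂ ℕ._≤_ (≡.cong suc len) len′ (unique-length
               (All.tabulate (λ {m} p s≡m → ℕ.<-irrefl (≡.sym s≡m) (ℕ.<-≤-trans (proj₁ (sound m p)) N≤s)) ∷ u)
               λ { m (here ≡.refl) → cov s ℕ.≤-refl s∈S
                 ; m (there p)     → let m<N , m∈S = sound m p in cov m (ℕ.m≤n⇒m≤1+n (ℕ.<-≤-trans m<N N≤s)) m∈S })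

    module _ {S₁ S₂ : Pred ℕ 0ℓ} (small₁ : ∀ ε → 0# < ε → (λ R → fromℕ (Λ S₁ R)) =o (λ R → R ^ʳ ε))
             (small₂ : ∀ ε → 0# < ε → (λ R → fromℕ (Λ S₂ R)) =o (λ R → R ^ʳ ε)) where

      private
        square-cancel : ∀ {a b} → a ℕ.* a ℕ.≤ b ℕ.* b → a ℕ.≤ b
        square-cancel p = ℕ.≮⇒≥ λ b<a → ℕ.<⇒≱ (ℕ.*-mono-< b<a b<a) p

        suc≤2* : ∀ n → suc n ℕ.≤ 2 ℕ.* (1 ℕ.⊔ n)
        suc≤2* n = ℕ.≤-trans (ℕ.+-mono-≤ (ℕ.m≤m⊔n 1 n) (ℕ.m≤n⊔m 1 n)) (ℕ.≤-reflexive (≡.cong ((1 ℕ.⊔ n) ℕ.+_) (≡.sym (ℕ.+-identityʳ _))))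

        1⊔-^ : ∀ x s {N} → 1 ℕ.≤ N → x ℕ.^ s ℕ.≤ N → (1 ℕ.⊔ x) ℕ.^ s ℕ.≤ N
        1⊔-^ zero    s 1≤N p = ℕ.≤-trans (ℕ.≤-reflexive (ℕ.^-zeroˡ s)) 1≤N
        1⊔-^ (suc x) s 1≤N p = p

      open SubexponentialFunctions using (^-distrib)

      -- Using (2) with the exponent 4 e bounds the square of the power of the counts by N; the
      -- constant is absorbed by the remaining factor √N.
      counts-small : ∀ c e → ∃ λ N₀ → ∀ N → N₀ ℕ.≤ N → c ℕ.* (suc (count S₁ N) ℕ.* suc (count S₂ N)) ℕ.^ e ℕ.≤ N
      counts-small c e =
        let N₁ , p₁ = =o-^ʳ⇒^≤ {Λ S₁} small₁ (e ℕ.+ e ℕ.+ (e ℕ.+ e))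
            N₂ , p₂ = =o-^ʳ⇒^≤ {Λ S₂} small₂ (e ℕ.+ e ℕ.+ (e ℕ.+ e))
            N₀ = suc (N₁ ℕ.+ N₂ ℕ.+ K ℕ.* K)
        in N₀ , λ N N₀≤N → bound N (ℕ.≤-trans (s≤s z≤n) N₀≤N)
             (p₁ N (ℕ.≤-trans (ℕ.m≤n⇒m≤1+n (ℕ.≤-trans (ℕ.m≤m+n N₁ N₂) (ℕ.m≤m+n _ _))) N₀≤N))
             (p₂ N (ℕ.≤-trans (ℕ.m≤n⇒m≤1+n (ℕ.≤-trans (ℕ.m≤n+m N₂ N₁) (ℕ.m≤m+n _ _))) N₀≤N))
             (ℕ.≤-trans (ℕ.m≤n⇒m≤1+n (ℕ.m≤n+m (K ℕ.* K) (N₁ ℕ.+ N₂))) N₀≤N)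
        where
        K : ℕ
        K = c ℕ.* 4 ℕ.^ e
        bound : ∀ N → 1 ℕ.≤ N → count S₁ N ℕ.^ (e ℕ.+ e ℕ.+ (e ℕ.+ e)) ℕ.≤ N → count S₂ N ℕ.^ (e ℕ.+ e ℕ.+ (e ℕ.+ e)) ℕ.≤ N → K ℕ.* K ℕ.≤ N →
                c ℕ.* (suc (count S₁ N) ℕ.* suc (count S₂ N)) ℕ.^ e ℕ.≤ N
        bound N 1≤N q₁ q₂ K²≤N = ℕ.≤-trans
            (ℕ.*-monoʳ-≤ c (ℕ.≤-trans (ℕ.^-monoˡ-≤ e (ℕ.≤-trans (ℕ.*-mono-≤ (suc≤2* (count S₁ N)) (suc≤2* (count S₂ N))) (ℕ.≤-reflexive (four x₁ x₂))))
              (ℕ.≤-reflexive (^-distrib 4 (x₁ ℕ.* x₂) e))))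
            (ℕ.≤-trans (ℕ.≤-reflexive (≡.sym (ℕ.*-assoc c (4 ℕ.^ e) ((x₁ ℕ.* x₂) ℕ.^ e))))
              (square-cancel (ℕ.≤-trans (ℕ.≤-reflexive (swap K z))
                (ℕ.*-mono-≤ K²≤N (square-cancel (ℕ.≤-trans (ℕ.≤-reflexive z⁴) (ℕ.*-mono-≤ (1⊔-^ (count S₁ N) (e ℕ.+ e ℕ.+ (e ℕ.+ e)) 1≤N q₁) (1⊔-^ (count S₂ N) (e ℕ.+ e ℕ.+ (e ℕ.+ e)) 1≤N q₂))))))))
          where
          x₁ = 1 ℕ.⊔ count S₁ N
          x₂ = 1 ℕ.⊔ count S₂ N
          z = (x₁ ℕ.* x₂) ℕ.^ e
          four : ∀ a b → 2 ℕ.* a ℕ.* (2 ℕ.* b) ≡ 4 ℕ.* (a ℕ.* b)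
          four = solve-∀
          swap : ∀ k z → k ℕ.* z ℕ.* (k ℕ.* z) ≡ k ℕ.* k ℕ.* (z ℕ.* z)
          swap = solve-∀
          z⁴ : z ℕ.* z ℕ.* (z ℕ.* z) ≡ x₁ ℕ.^ (e ℕ.+ e ℕ.+ (e ℕ.+ e)) ℕ.* x₂ ℕ.^ (e ℕ.+ e ℕ.+ (e ℕ.+ e))
          z⁴ = ≡.trans (≡.cong₂ ℕ._*_ z² z²) (≡.trans (≡.sym (ℕ.^-distribˡ-+-* (x₁ ℕ.* x₂) (e ℕ.+ e) (e ℕ.+ e))) (^-distrib x₁ x₂ (e ℕ.+ e ℕ.+ (e ℕ.+ e))))
            where z² = ≡.sym (ℕ.^-distribˡ-+-* (x₁ ℕ.* x₂) e e)

    2^n>n : ∀ n → n ℕ.< 2 ℕ.^ n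
    2^n>n zero    = s≤s z≤n
    2^n>n (suc n) = ℕ.≤-trans (ℕ.+-mono-≤ (ℕ.m^n>0 2 n) (2^n>n n)) (ℕ.≤-reflexive (≡.cong (2 ℕ.^ n ℕ.+_) (≡.sym (ℕ.+-identityʳ (2 ℕ.^ n)))))

    -- Quadrupling at every doubling would make M grow quadratically.
    slow-doubling : ∀ (M : ℕ → ℕ) N₀ → (∀ N → 1 ℕ.≤ M N) → (∀ N → N₀ ℕ.≤ N → M N ℕ.≤ N) → ∀ N₁ → ∃ λ N → N₁ ℕ.≤ N × M (2 ℕ.* N) ℕ.≤ 4 ℕ.* M N
    slow-doubling M N₀ 1≤M M≤ N₁ = by-contradiction λ none →
      let P = suc (N₀ ℕ.+ N₁)
          fast : ∀ N → P ℕ.≤ N → 4 ℕ.* M N ℕ.< M (2 ℕ.* N)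
          fast N P≤N = ℕ.≰⇒> λ q → none (N , ℕ.≤-trans (ℕ.m≤n⇒m≤1+n (ℕ.m≤n+m N₁ N₀)) P≤N , q)
          large : ∀ j → P ℕ.≤ 2 ℕ.^ j ℕ.* P × 4 ℕ.^ j ℕ.≤ M (2 ℕ.^ j ℕ.* P)
          large = λ { zero → ℕ.≤-reflexive (≡.sym (ℕ.*-identityˡ P)) , 1≤M _
                    ; (suc j) → grow P fast j }
      in ℕ.<⇒≱ (ℕ.*-monoʳ-< (2 ℕ.^ P) ⦃ ℕ.>-nonZero (ℕ.m^n>0 2 P) ⦄ (2^n>n P))
           (ℕ.≤-trans (ℕ.≤-reflexive (≡.sym (^-distrib 2 2 P))) (ℕ.≤-trans (proj₂ (large P))
             (M≤ _ (ℕ.≤-trans (ℕ.m≤n⇒m≤1+n (ℕ.m≤m+n N₀ N₁)) (proj₁ (large P))))))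
      where
      open SubexponentialFunctions using (^-distrib)
      grow : ∀ P → (∀ N → P ℕ.≤ N → 4 ℕ.* M N ℕ.< M (2 ℕ.* N)) → ∀ j → P ℕ.≤ 2 ℕ.^ suc j ℕ.* P × 4 ℕ.^ suc j ℕ.≤ M (2 ℕ.^ suc j ℕ.* P)
      grow P fast j =
        let P≤ , q = ih j
        in ℕ.m≤n*m P (2 ℕ.^ suc j) ⦃ ℕ.>-nonZero (ℕ.m^n>0 2 (suc j)) ⦄ ,
           ℕ.≤-trans (ℕ.*-monoʳ-≤ 4 q) (ℕ.<⇒≤ (≡.subst (λ n → 4 ℕ.* M (2 ℕ.^ j ℕ.* P) ℕ.< M n) (≡.sym (ℕ.*-assoc 2 (2 ℕ.^ j) P)) (fast (2 ℕ.^ j ℕ.* P) P≤)))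
        where
        ih : ∀ j → P ℕ.≤ 2 ℕ.^ j ℕ.* P × 4 ℕ.^ j ℕ.≤ M (2 ℕ.^ j ℕ.* P)
        ih zero    = ℕ.≤-reflexive (≡.sym (ℕ.*-identityˡ P)) , 1≤M _
        ih (suc j) = grow P fast j

    module _ (S₁ S₂ : Pred ℕ 0ℓ) where

      -- Condition (3) at an integer, multiplied out. The element x is the value of θ, whose
      -- defining property has to be secured first.
      gaps-small : ∀ a₁ a₂ → (∃ λ C₂ → 0# < C₂ × (∀ R → C₂ ≤ R →
          θ-Defined (suc a₁ ⊛ S₁) R × (Λ S₁ R ℕ.^ a₁ ℕ.* Λ S₂ R ℕ.^ a₂ ≢ 0) ×
          (R - fromℕ (θ (suc a₁ ⊛ S₁) R) < R / (fromℕ (Λ S₁ R) ^ a₁ * fromℕ (Λ S₂ R) ^ a₂)))) →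
        ∃ λ N₀ → ∀ N → N₀ ℕ.≤ N → ∃ λ x → x ∈ (suc a₁ ⊛ S₁) × x ℕ.< N ×
          (N ℕ.∸ x) ℕ.* (count S₁ N ℕ.^ a₁ ℕ.* count S₂ N ℕ.^ a₂) ℕ.< N
      gaps-small a₁ a₂ (C₂ , _ , p) =
        let N₀ , C₂<N₀ = archimedean C₂
        in N₀ , λ N N₀≤N → at N (p (fromℕ N) (≤-trans (inj₁ C₂<N₀) (fromℕ-mono-≤ N₀≤N)))
        where
        A : Pred ℕ 0ℓ
        A = suc a₁ ⊛ S₁
        at : ∀ N → θ-Defined A (fromℕ N) × (count S₁ N ℕ.^ a₁ ℕ.* count S₂ N ℕ.^ a₂ ≢ 0) ×
             (fromℕ N - fromℕ (θ A (fromℕ N)) < fromℕ N / (fromℕ (count S₁ N) ^ a₁ * fromℕ (count S₂ N) ^ a₂)) →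
             ∃ λ x → x ∈ A × x ℕ.< N × (N ℕ.∸ x) ℕ.* (count S₁ N ℕ.^ a₁ ℕ.* count S₂ N ℕ.^ a₂) ℕ.< N
        at N ((m , (m∈A , _) , m<N) , pr≢0 , q) = x , x∈A , x<N , fromℕ-cancel-< (begin-strict
            fromℕ ((N ℕ.∸ x) ℕ.* pr)              ≈⟨ fromℕ-* (N ℕ.∸ x) pr ⟩
            fromℕ (N ℕ.∸ x) * fromℕ pr            ≈⟨ *-comm _ _ ⟩
            fromℕ pr * fromℕ (N ℕ.∸ x)            ≈⟨ *-congˡ N-x ⟩
            fromℕ pr * (fromℕ N - fromℕ x)        <⟨ *-monoˡ-< 0<pr q ⟩
            fromℕ pr * (fromℕ N / Q)              ≈⟨ *-congʳ pr≈ ⟩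
            Q * (fromℕ N / Q)                     ≈⟨ *-/-cancel (fromℕ N) (<-respʳ-≈ pr≈ 0<pr) ⟩
            fromℕ N                               ∎)
          where
          open ≤-Reasoning
          x = θ A (fromℕ N)
          pr = count S₁ N ℕ.^ a₁ ℕ.* count S₂ N ℕ.^ a₂
          Q = fromℕ (count S₁ N) ^ a₁ * fromℕ (count S₂ N) ^ a₂
          0<pr : 0# < fromℕ pr
          0<pr = 0<fromℕ (ℕ.n≢0⇒n>0 pr≢0)
          pr≈ : fromℕ pr ≈ Q
          pr≈ = trans (fromℕ-* (count S₁ N ℕ.^ a₁) (count S₂ N ℕ.^ a₂)) (*-cong (fromℕ-^ (count S₁ N) a₁) (fromℕ-^ (count S₂ N) a₂))
          -- The default value of `θ` is excluded by showing that a maximum exists: climb from m,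
          -- where k bounds the distance left to N.
          greatest : ∀ k → (∃ λ m → m ∈ ([0, fromℕ N ⟩∩ A) × N ℕ.≤ m ℕ.+ k) → ∃ (IsMax ([0, fromℕ N ⟩∩ A))
          greatest zero (m , (m< , _) , N≤) = ⊥-elim (ℕ.<⇒≱ (fromℕ-cancel-< m<) (ℕ.≤-trans N≤ (ℕ.≤-reflexive (ℕ.+-identityʳ m))))
          greatest (suc k) (m , m∈ , N≤) with em {∃ λ m′ → m′ ∈ ([0, fromℕ N ⟩∩ A) × m ℕ.< m′}
          ... | yes (m′ , m′∈ , m<m′) = greatest k (m′ , m′∈ , ℕ.≤-trans N≤ (ℕ.≤-trans (ℕ.≤-reflexive (ℕ.+-suc m k)) (ℕ.+-monoˡ-≤ k m<m′)))
          ... | no none = m , m∈ , λ n n∈ → ℕ.≮⇒≥ λ m<n → none (n , n∈ , m<n)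
          x-max : IsMax ([0, fromℕ N ⟩∩ A) x
          x-max = the-satisfies 0 (IsMax ([0, fromℕ N ⟩∩ A)) (greatest N (m , (m<N , m∈A) , ℕ.m≤n+m N m))
          x∈A = proj₂ (proj₁ x-max)
          x<N = fromℕ-cancel-< (proj₁ (proj₁ x-max))
          N-x : fromℕ (N ℕ.∸ x) ≈ fromℕ N - fromℕ x
          N-x = trans (solve 2 (λ a b → a := (a :+ b) :- b) refl (fromℕ (N ℕ.∸ x)) (fromℕ x))
            (+-congʳ (trans (sym (fromℕ-+ (N ℕ.∸ x) x)) (reflexive (≡.cong fromℕ (ℕ.m∸n+n≡m (ℕ.<⇒≤ x<N))))))

    relatively-dense : ∀ {S : Pred ℕ 0ℓ} →
      (∃ λ C₁ → 1# < C₁ × Eventually (λ R → ∃ λ n → R ≤ fromℕ n × fromℕ n < C₁ * R × n ∈ S)) →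
      ∃₂ λ C r₀ → ∀ r → r₀ ℕ.≤ r → ∃ λ s → s ∈ S × r ℕ.≤ s × s ℕ.< C ℕ.* r
    relatively-dense (C₁ , _ , R₀ , p) =
      let C , C₁≤C , _ = 0≤x⇒x≤fromℕ C₁
          r₀ , R₀<r₀ = archimedean R₀
      in C , r₀ , λ r r₀≤r →
        let n , r≤n , n< , n∈S = p (fromℕ r) (≤-trans (inj₁ R₀<r₀) (fromℕ-mono-≤ r₀≤r))
        in n , n∈S , fromℕ-cancel-≤ r≤n , fromℕ-cancel-< (<-≤-trans n< (≤-respʳ (sym (fromℕ-* C r)) (*-monoʳ-≤ (0≤fromℕ r) C₁≤C)))

    ratio-unbounded : ∀ {S : Pred ℕ 0ℓ} {t₁ t₂ : ℕ → ℕ} → (∀ m → m ∈ S → 0 ℕ.< t₂ m) → (∀ m → m ∉ S → t₂ m ≡ 0) →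
      TendsTo∞Along S (λ n → fromℕ (t₁ n) / fromℕ (t₂ n)) → ∀ W → ∃ λ B → 1 ℕ.≤ B × (∀ a → B ℕ.≤ a → W ℕ.* t₂ a ℕ.≤ t₁ a)
    ratio-unbounded {S} {t₁} {t₂} pos vanish p W =
      let B , q = p (fromℕ W) in suc B , s≤s z≤n , λ a B<a → bound a (q a (ℕ.<⇒≤ B<a)) em
      where
      bound : ∀ a → (a ∈ S → fromℕ W < fromℕ (t₁ a) / fromℕ (t₂ a)) → Dec (a ∈ S) → W ℕ.* t₂ a ℕ.≤ t₁ a
      bound a q (no a∉S)  = ≡.subst (λ k → W ℕ.* k ℕ.≤ t₁ a) (≡.sym (vanish a a∉S)) (ℕ.≤-trans (ℕ.≤-reflexive (ℕ.*-zeroʳ W)) z≤n)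
      bound a q (yes a∈S) = fromℕ-cancel-≤ (≤-respˡ (trans (*-comm _ _) (sym (fromℕ-* W (t₂ a))))
        (≤-respʳ (*-/-cancel (fromℕ (t₁ a)) 0<t₂) (*-monoˡ-≤ (inj₁ 0<t₂) (inj₁ (q a∈S)))))
        where 0<t₂ = 0<fromℕ (pos a a∈S)

  -- Choice of the scale and the contradiction in a long gap.

  module GapArgument where

    open RealField
    open Counting
    open Combinatorics
    open GapArithmetic

    module _ {S₁ S₂ : Pred ℕ 0ℓ} (inf₁ : Infinite S₁) (inf₂ : Infinite S₂)
      (small : ∀ c e → ∃ λ N₀ → ∀ N → N₀ ℕ.≤ N → c ℕ.* (suc (count S₁ N) ℕ.* suc (count S₂ N)) ℕ.^ e ℕ.≤ N)
      (gaps : ∀ a₁ a₂ → ∃ λ N₀ → ∀ N → N₀ ℕ.≤ N → ∃ λ x → x ∈ (suc a₁ ⊛ S₁) × x ℕ.< N ×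
         (N ℕ.∸ x) ℕ.* (count S₁ N ℕ.^ a₁ ℕ.* count S₂ N ℕ.^ a₂) ℕ.< N)
      {C₁ r₀ : ℕ} (dense : ∀ r → r₀ ℕ.≤ r → ∃ λ s → s ∈ S₂ × r ℕ.≤ s × s ℕ.< C₁ ℕ.* r)
      {D k₀ K B : ℕ} (1≤B : 1 ℕ.≤ B) (k₀≤K : k₀ ℕ.≤ K) where

      open Configuration S₁ S₂ D k₀ K B

      module _ (c : ℕ → ℤ)
        (nonneg : ∀ m → ¬ Low m → ¬ Mid m → + 0 ℤ.≤ c m)
        (positive : ∀ m → ¬ Low m → ¬ Mid m → High m → + 0 ℤ.< c m)
        (support : ∀ m → c m ≢ + 0 → ∃₂ λ n k → n ℕ.≤ suc D × k ℕ.≤ K × Sum n k m)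
        {β : ℝ} (0<β : 0# < β) (Y : ℕ → ℝ) (Y-suc : ∀ R → Y (suc R) ≈ fromℤ (c (suc R)) + β * Y R)
        {g C v₀ : ℕ} (recurs : ∀ R v h → v₀ ℕ.≤ v → v ℕ.^ g ℕ.≤ R → C ℕ.* R ℕ.< h ℕ.* v → ¬ (Y R ≈ 0#) →
           ∃ λ m → R ℕ.< m × m ℕ.≤ h ℕ.+ R × c m ≢ + 0) where

        private
          fromℤ-nonneg : ∀ {i} → + 0 ℤ.≤ i → 0# ≤ fromℤ i
          fromℤ-nonneg (ℤ.+≤+ {n = n} _) = 0≤fromℕ n

          fromℤ-positive : ∀ {i} → + 0 ℤ.< i → 0# < fromℤ i
          fromℤ-positive (ℤ.+<+ p) = 0<fromℕ p

          -- `M N` bounds the number of `Low` numbers below N, `X N` that of the indices below N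
          -- with nonzero coefficient; `q N` exceeds both at 2 N.
          M X q : ℕ → ℕ
          M N = B ℕ.* (suc (count S₁ N) ℕ.^ D ℕ.* suc (count S₂ N) ℕ.^ K)
          X N = suc (count S₁ N) ℕ.^ suc D ℕ.* suc (count S₂ N) ℕ.^ K
          q N = suc (B ℕ.* (suc (count S₁ (2 ℕ.* N)) ℕ.* suc (count S₂ (2 ℕ.* N))) ℕ.^ (suc D ℕ.+ K))

          1≤M : ∀ N → 1 ℕ.≤ M N
          1≤M N = ℕ.*-mono-≤ 1≤B (ℕ.*-mono-≤ (ℕ.m^n>0 (suc (count S₁ N)) D) (ℕ.m^n>0 (suc (count S₂ N)) K))

          M<q : ∀ N → suc (M (2 ℕ.* N)) ℕ.≤ q N
          M<q N = s≤s (ℕ.*-monoʳ-≤ B (ℕ.≤-trans (^*^≤ (count S₁ (2 ℕ.* N)) (count S₂ (2 ℕ.* N)) D K)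
            (ℕ.^-monoʳ-≤ (suc (count S₁ (2 ℕ.* N)) ℕ.* suc (count S₂ (2 ℕ.* N))) (ℕ.n≤1+n (D ℕ.+ K)))))

          X<q : ∀ N → suc (X (2 ℕ.* N)) ℕ.≤ q N
          X<q N = s≤s (ℕ.≤-trans (^*^≤ (count S₁ (2 ℕ.* N)) (count S₂ (2 ℕ.* N)) (suc D) K) (ℕ.m≤n*m _ B ⦃ ℕ.>-nonZero 1≤B ⦄))

          q-small : ∀ a e → ∃ λ N₀ → ∀ N → N₀ ℕ.≤ N → a ℕ.* q N ℕ.^ e ℕ.≤ N
          q-small a e =
            let N₀ , p = small (2 ℕ.* (a ℕ.* suc B ℕ.^ e)) ((suc D ℕ.+ K) ℕ.* e)
            in N₀ , λ N N₀≤N → bound N (p (2 ℕ.* N) (ℕ.≤-trans N₀≤N (ℕ.m≤m+n N _)))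
            where
            bound : ∀ N → let Λ̂ = suc (count S₁ (2 ℕ.* N)) ℕ.* suc (count S₂ (2 ℕ.* N)) in
                    2 ℕ.* (a ℕ.* suc B ℕ.^ e) ℕ.* Λ̂ ℕ.^ ((suc D ℕ.+ K) ℕ.* e) ℕ.≤ 2 ℕ.* N → a ℕ.* q N ℕ.^ e ℕ.≤ N
            bound N = go (suc (count S₁ (2 ℕ.* N)) ℕ.* suc (count S₂ (2 ℕ.* N))) (s≤s z≤n)
              where
              assoc : ∀ a b c → 2 ℕ.* (a ℕ.* b) ℕ.* c ≡ 2 ℕ.* (a ℕ.* (b ℕ.* c))
              assoc = solve-∀
              go : ∀ L → 1 ℕ.≤ L → 2 ℕ.* (a ℕ.* suc B ℕ.^ e) ℕ.* L ℕ.^ ((suc D ℕ.+ K) ℕ.* e) ℕ.≤ 2 ℕ.* N →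
                   a ℕ.* suc (B ℕ.* L ℕ.^ (suc D ℕ.+ K)) ℕ.^ e ℕ.≤ N
              go L 1≤L r = ℕ.*-cancelˡ-≤ 2 (ℕ.≤-trans (ℕ.*-monoʳ-≤ 2 (ℕ.*-monoʳ-≤ a (ℕ.≤-trans
                  (ℕ.^-monoˡ-≤ e (ℕ.+-monoˡ-≤ (B ℕ.* L ℕ.^ (suc D ℕ.+ K)) (ℕ.m^n>0 L ⦃ ℕ.>-nonZero 1≤L ⦄ (suc D ℕ.+ K))))
                  (ℕ.≤-reflexive (≡.trans (SubexponentialFunctions.^-distrib (suc B) (L ℕ.^ (suc D ℕ.+ K)) e) (≡.cong (suc B ℕ.^ e ℕ.*_) (ℕ.^-*-assoc L (suc D ℕ.+ K) e)))))))
                (ℕ.≤-trans (ℕ.≤-reflexive (≡.sym (assoc a (suc B ℕ.^ e) (L ℕ.^ ((suc D ℕ.+ K) ℕ.* e))))) r))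

          -- At most κ copies of an element below C₁ r are added to u, so a gap of length (κ C₁ + 1)
          -- r leaves a stretch r beyond m. The factor 2 in c₀ pays for walking in only half of a
          -- block.
          κ c₀ : ℕ
          κ = suc k₀
          c₀ = 2 ℕ.* suc (κ ℕ.* C₁)

          -- A stretch without zeros of Y needs a nonzero coefficient in every window of length H.
          module Run (N H v : ℕ) (v₀≤v : v₀ ℕ.≤ v) (v^g≤N : v ℕ.^ g ℕ.≤ N) (large : C ℕ.* (2 ℕ.* N) ℕ.< H ℕ.* v)
                     (zs : List ℕ) (cov : ∀ m → m ℕ.< 2 ℕ.* N → c m ≢ + 0 → m ∈ˡ zs) where

            1≤H : 1 ℕ.≤ H
            1≤H = go H large
              where
              go : ∀ H → C ℕ.* (2 ℕ.* N) ℕ.< H ℕ.* v → 1 ℕ.≤ H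
              go (suc H) _ = s≤s z≤n

            run-impossible : ∀ x len → N ℕ.≤ x → x ℕ.+ len ℕ.< 2 ℕ.* N → suc (length zs) ℕ.* H ℕ.≤ len →
                             ¬ (∀ R → x ℕ.≤ R → R ℕ.< x ℕ.+ len → ¬ (Y R ≈ 0#))
            run-impossible x len N≤x x+len< fits nz = contradiction (free-block (length zs) H (suc x) zs ℕ.≤-refl)
              where
              contradiction : (∃ λ i → i ℕ.≤ length zs × (∀ m → suc x ℕ.+ i ℕ.* H ℕ.≤ m → m ℕ.< suc x ℕ.+ suc i ℕ.* H → ¬ m ∈ˡ zs)) → ⊥
              contradiction (i , i≤ , free) =
                let R = x ℕ.+ i ℕ.* H
                    R+H≤ : H ℕ.+ R ℕ.≤ x ℕ.+ len
                    R+H≤ = ℕ.≤-trans (ℕ.≤-reflexive (e H x (i ℕ.* H))) (ℕ.+-monoʳ-≤ x (ℕ.≤-trans (ℕ.*-monoˡ-≤ H (s≤s i≤)) fits))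
                    R< : R ℕ.< x ℕ.+ len
                    R< = ℕ.<-≤-trans (ℕ.m<n+m R 1≤H) R+H≤
                    N≤R = ℕ.≤-trans N≤x (ℕ.m≤m+n x (i ℕ.* H))
                    m , R<m , m≤ , cm≢0 = recurs R v H v₀≤v (ℕ.≤-trans v^g≤N N≤R)
                      (ℕ.≤-<-trans (ℕ.*-monoʳ-≤ C (ℕ.<⇒≤ (ℕ.<-trans R< x+len<))) large) (nz R (ℕ.m≤m+n x (i ℕ.* H)) R<)
                in free m R<m (s≤s (ℕ.≤-trans m≤ (ℕ.≤-reflexive (e H x (i ℕ.* H))))) (cov m (ℕ.≤-<-trans (ℕ.≤-trans m≤ R+H≤) x+len<) cm≢0)
                where
                e : ∀ h x y → h ℕ.+ (x ℕ.+ y) ≡ x ℕ.+ (h ℕ.+ y)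
                e = solve-∀

          -- In a gap (u, u + ℓ) the coefficients are nonnegative and one of them, at m, is positive, so that
          -- Y is negative up to m or positive from m on.
          module Sign (u m ℓ : ℕ) (u<m : u ℕ.< m) (c≥0 : ∀ i → u ℕ.< i → i ℕ.< u ℕ.+ ℓ → + 0 ℤ.≤ c i) (m<u+ℓ : m ℕ.< u ℕ.+ ℓ) (cm>0 : + 0 ℤ.< c m) where

            step : ∀ R → u ℕ.≤ R → suc R ℕ.< u ℕ.+ ℓ → 0# ≤ Y R → 0# ≤ Y (suc R)
            step R u≤R R< p = ≤-respʳ (sym (Y-suc R)) (0≤x+y (fromℤ-nonneg (c≥0 (suc R) (s≤s u≤R) R<)) (0≤x*y (inj₁ 0<β) p))

            step-positive : ∀ R → u ℕ.≤ R → suc R ℕ.< u ℕ.+ ℓ → 0# < Y R → 0# < Y (suc R)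
            step-positive R u≤R R< p = <-respʳ-≈ (trans (+-comm _ _) (sym (Y-suc R))) (0<x+y′ (*-pos 0<β p) (fromℤ-nonneg (c≥0 (suc R) (s≤s u≤R) R<)))

            climb : ∀ R → u ℕ.≤ R → 0# ≤ Y R → ∀ n → n ℕ.+ R ℕ.< u ℕ.+ ℓ → 0# ≤ Y (n ℕ.+ R)
            climb R u≤R p zero    _ = p
            climb R u≤R p (suc n) q = step (n ℕ.+ R) (ℕ.≤-trans u≤R (ℕ.m≤n+m R n)) q (climb R u≤R p n (ℕ.≤-trans (ℕ.n≤1+n _) q))

            positive-at : ∀ R → u ℕ.≤ R → R ℕ.< m → 0# ≤ Y R → 0# < Y m
            positive-at R u≤R R<m p = at (ℕ.m≤n⇒∃[o]m+o≡n R<m)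
              where
              at : (∃ λ n → suc R ℕ.+ n ≡ m) → 0# < Y m
              at (n , e) = ≡.subst (λ k → 0# < Y k) e′ (<-respʳ-≈ (sym (Y-suc (n ℕ.+ R)))
                  (0<x+y′ (fromℤ-positive (≡.subst (λ k → + 0 ℤ.< c k) (≡.sym e′) cm>0)) (0≤x*y (inj₁ 0<β)
                    (climb R u≤R p n (ℕ.<-trans (ℕ.≤-reflexive e′) m<u+ℓ)))))
                where
                e′ : suc (n ℕ.+ R) ≡ m
                e′ = ≡.trans (≡.cong suc (ℕ.+-comm n R)) e

            stay-positive : 0# < Y m → ∀ n → n ℕ.+ m ℕ.< u ℕ.+ ℓ → 0# < Y (n ℕ.+ m)
            stay-positive p zero    _ = p
            stay-positive p (suc n) q = step-positive (n ℕ.+ m) (ℕ.≤-trans (ℕ.<⇒≤ u<m) (ℕ.m≤n+m m n)) q (stay-positive p n (ℕ.≤-trans (ℕ.n≤1+n _) q))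

            dichotomy : (∀ R → u ℕ.≤ R → R ℕ.< m → ¬ (Y R ≈ 0#)) ⊎ (∀ R → m ℕ.≤ R → R ℕ.< u ℕ.+ ℓ → ¬ (Y R ≈ 0#))
            dichotomy with em {∃ λ R → u ℕ.≤ R × R ℕ.< m × 0# ≤ Y R}
            ... | no none = inj₁ λ R u≤R R<m z → none (R , u≤R , R<m , ≤-reflexive (sym z))
            ... | yes (R₀ , u≤R₀ , R₀<m , p) = inj₂ λ R m≤R R< → 0<x⇒x≉0 (at R R< (ℕ.m≤n⇒∃[o]m+o≡n m≤R))
              where
              at : ∀ R → R ℕ.< u ℕ.+ ℓ → (∃ λ n → m ℕ.+ n ≡ R) → 0# < Y R
              at R R< (n , e) = ≡.subst (λ k → 0# < Y k) e′ (stay-positive (positive-at R₀ u≤R₀ R₀<m p) n (≡.subst (ℕ._< u ℕ.+ ℓ) (≡.sym e′) R<))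
                where
                e′ : n ℕ.+ m ≡ R
                e′ = ≡.trans (ℕ.+-comm n m) e

          module AtScale (N : ℕ) (doubling : M (2 ℕ.* N) ℕ.≤ 4 ℕ.* M N)
            (N-large₁ : 2 ℕ.* c₀ ℕ.* q N ℕ.^ 3 ℕ.≤ N) (N-large₂ : c₀ ℕ.* suc r₀ ℕ.* q N ℕ.^ 2 ℕ.≤ N)
            (v^g≤N : (suc (2 ℕ.* C) ℕ.* (2 ℕ.* (c₀ ℕ.* q N ℕ.^ 3)) ℕ.* suc v₀) ℕ.^ g ℕ.≤ N)
            (1≤λ₁ : 1 ℕ.≤ count S₁ N) (λ₂-large : 40 ℕ.* (B ℕ.* (2 ℕ.^ D ℕ.* 2 ℕ.^ K)) ℕ.≤ count S₂ N)
            (gap : ∀ R → N ℕ.≤ R → ∃ λ x → x ∈ (suc D ⊛ S₁) × x ℕ.< R ×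
                   (R ℕ.∸ x) ℕ.* (count S₁ R ℕ.^ D ℕ.* count S₂ R ℕ.^ suc K) ℕ.< R) where

            T Q n₁ v : ℕ
            T = 2 ℕ.* N
            Q = q N
            n₁ = M T
            v = suc (2 ℕ.* C) ℕ.* (2 ℕ.* (c₀ ℕ.* Q ℕ.^ 3)) ℕ.* suc v₀

            E₁ = elements S₁ T
            E₂ = elements S₂ T
            xs = proj₁ E₁
            ys = proj₁ E₂
            cov₁ : Covers xs S₁ T
            cov₁ = proj₁ (proj₂ (proj₂ (proj₂ E₁)))
            cov₂ : Covers ys S₂ T
            cov₂ = proj₁ (proj₂ (proj₂ (proj₂ E₂)))
            len₁ : length xs ≡ count S₁ T
            len₁ = proj₂ (proj₂ (proj₂ (proj₂ E₁)))
            len₂ : length ys ≡ count S₂ T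
            len₂ = proj₂ (proj₂ (proj₂ (proj₂ E₂)))

            zs ls : List ℕ
            zs = sumList cov₁ cov₂ (suc D)
            ls = lowList cov₁ cov₂

            length-ls : length ls ≡ n₁
            length-ls = ≡.trans (length-lowList cov₁ cov₂) (≡.cong₂ (λ a b → B ℕ.* (suc a ℕ.^ D ℕ.* suc b ℕ.^ K)) len₁ len₂)

            length-zs<Q : suc (length zs) ℕ.≤ Q
            length-zs<Q = ℕ.≤-trans (ℕ.≤-reflexive (≡.cong suc (≡.trans (length-sumList cov₁ cov₂ (suc D))
              (≡.cong₂ (λ a b → suc a ℕ.^ suc D ℕ.* suc b ℕ.^ K) len₁ len₂)))) (X<q N)

            1≤c₀ : 1 ℕ.≤ c₀
            1≤c₀ = s≤s z≤n

            -- r is as large as 2 Q² ℓ ≤ N permits: one factor Q is for the number of blocks, the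
            -- other for the number of steps of length ℓ in the walk.
            F-ρ = floor (c₀ ℕ.* Q ℕ.^ 2) N (ℕ.*-mono-≤ 1≤c₀ (ℕ.m^n>0 Q 2))
            r : ℕ
            r = proj₁ F-ρ
            c₀Q²r≤N : c₀ ℕ.* Q ℕ.^ 2 ℕ.* r ℕ.≤ N
            c₀Q²r≤N = proj₁ (proj₂ F-ρ)
            N<c₀Q²r : N ℕ.< c₀ ℕ.* Q ℕ.^ 2 ℕ.* suc r
            N<c₀Q²r = proj₂ (proj₂ F-ρ)

            r₀<r : suc r₀ ℕ.≤ r
            r₀<r = floor-≤ {c₀ ℕ.* Q ℕ.^ 2} (ℕ.≤-trans (ℕ.≤-reflexive (e c₀ (suc r₀) (Q ℕ.^ 2))) N-large₂) N<c₀Q²r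
              where
              e : ∀ a b c → a ℕ.* c ℕ.* b ≡ a ℕ.* b ℕ.* c
              e = solve-∀

            -- A stretch of length r contains Q windows of length H, and the list `zs` has fewer
            -- than Q entries.
            F-H = floor Q r (s≤s z≤n)
            H : ℕ
            H = proj₁ F-H

            window : C ℕ.* T ℕ.< H ℕ.* v
            window = window-large {c₀} {Q} {r} {H} {N} C v₀ (s≤s z≤n) 1≤c₀ (ℕ.≤-trans (ℕ.≤-reflexive (≡.sym (ℕ.*-assoc 2 c₀ (Q ℕ.^ 3)))) N-large₁) N<c₀Q²r (proj₂ (proj₂ F-H))

            run-fits : suc (length zs) ℕ.* H ℕ.≤ r
            run-fits = ℕ.≤-trans (ℕ.*-monoˡ-≤ H length-zs<Q) (proj₁ (proj₂ F-H))

            v₀≤v : v₀ ℕ.≤ v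
            v₀≤v = ℕ.≤-trans (ℕ.n≤1+n v₀) (ℕ.m≤n*m (suc v₀) (suc (2 ℕ.* C) ℕ.* (2 ℕ.* (c₀ ℕ.* Q ℕ.^ 3))) ⦃ ℕ.>-nonZero
              (ℕ.*-mono-≤ {1} {suc (2 ℕ.* C)} (s≤s z≤n) (ℕ.*-mono-≤ {1} {2} (s≤s z≤n) (ℕ.*-mono-≤ 1≤c₀ (ℕ.m^n>0 Q 3)))) ⦄)

            zs-covers : ∀ m → m ℕ.< T → c m ≢ + 0 → m ∈ˡ zs
            zs-covers m m<T cm≢0 =
              let n , k , n≤ , k≤ , s = support m cm≢0 in sumList-covers cov₁ cov₂ (suc D) n k m n≤ k≤ m<T s

            open Run N H v v₀≤v v^g≤N window zs zs-covers

            ℓ : ℕ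
            ℓ = suc (κ ℕ.* C₁) ℕ.* r

            -- The interval from N to 2N is cut into n₁ + 1 blocks, one more than the length of the
            -- list of low numbers.
            F-L = floor (suc n₁) N (s≤s z≤n)
            L : ℕ
            L = proj₁ F-L
            F-h = floor 2 L (s≤s z≤n)
            h : ℕ
            h = proj₁ F-h

            gaps-fit : suc (length zs) ℕ.* ℓ ℕ.≤ h
            gaps-fit = floor-≤ {2} (floor-≤ {suc n₁} (ℕ.≤-trans (ℕ.*-mono-≤ (M<q N) (ℕ.*-monoʳ-≤ 2 (ℕ.*-monoˡ-≤ ℓ length-zs<Q)))
              (ℕ.≤-trans (ℕ.≤-reflexive (e Q (suc (κ ℕ.* C₁)) r)) c₀Q²r≤N)) (proj₂ (proj₂ F-L))) (proj₂ (proj₂ F-h))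
              where
              e : ∀ q k r → q ℕ.* (2 ℕ.* (q ℕ.* (k ℕ.* r))) ≡ 2 ℕ.* k ℕ.* (q ℕ.* (q ℕ.* 1)) ℕ.* r
              e = solve-∀

            M≤ : M N ℕ.≤ B ℕ.* (2 ℕ.^ D ℕ.* 2 ℕ.^ K) ℕ.* (count S₁ N ℕ.^ D ℕ.* count S₂ N ℕ.^ K)
            M≤ = ℕ.≤-trans (ℕ.*-monoʳ-≤ B (ℕ.*-mono-≤ (suc^≤ D 1≤λ₁) (suc^≤ K 1≤λ₂)))
              (ℕ.≤-reflexive (e B (2 ℕ.^ D) (count S₁ N ℕ.^ D) (2 ℕ.^ K) (count S₂ N ℕ.^ K)))
              where
              1≤λ₂ : 1 ℕ.≤ count S₂ N
              1≤λ₂ = ℕ.≤-trans (ℕ.*-mono-≤ {1} {40} (s≤s z≤n) (ℕ.*-mono-≤ 1≤B (ℕ.*-mono-≤ (ℕ.m^n>0 2 D) (ℕ.m^n>0 2 K)))) λ₂-large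
              e : ∀ B a x b y → B ℕ.* (a ℕ.* x ℕ.* (b ℕ.* y)) ≡ B ℕ.* (a ℕ.* b) ℕ.* (x ℕ.* y)
              e = solve-∀

            contradiction : ⊥
            contradiction = inBlock (free-block n₁ L N ls (ℕ.≤-reflexive length-ls))
              where
              inBlock : (∃ λ i → i ℕ.≤ n₁ × (∀ m → N ℕ.+ i ℕ.* L ℕ.≤ m → m ℕ.< N ℕ.+ suc i ℕ.* L → ¬ m ∈ˡ ls)) → ⊥
              inBlock (i , i≤n₁ , free) = from-element (gap R (ℕ.≤-trans N≤p (ℕ.m≤m+n p h)))
                where
                -- The free block starts at p, and (3) is applied at its midpoint R: x falls into
                -- the first half, and the second half is room for the walk.
                p R : ℕ
                p = N ℕ.+ i ℕ.* L
                R = p ℕ.+ h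
                N≤p : N ℕ.≤ p
                N≤p = ℕ.m≤m+n N (i ℕ.* L)
                h≤L : h ℕ.+ h ℕ.≤ L
                h≤L = ℕ.≤-trans (ℕ.≤-reflexive (≡.cong (h ℕ.+_) (≡.sym (ℕ.+-identityʳ h)))) (proj₁ (proj₂ F-h))
                p+L≡ : p ℕ.+ L ≡ N ℕ.+ suc i ℕ.* L
                p+L≡ = ≡.trans (ℕ.+-assoc N (i ℕ.* L) L) (≡.cong (N ℕ.+_) (ℕ.+-comm (i ℕ.* L) L))
                p+L≤T : p ℕ.+ L ℕ.≤ T
                p+L≤T = ℕ.≤-trans (ℕ.≤-reflexive p+L≡) (ℕ.+-monoʳ-≤ N (ℕ.≤-trans (ℕ.≤-trans (ℕ.*-monoˡ-≤ L (s≤s i≤n₁)) (proj₁ (proj₂ F-L))) (ℕ.≤-reflexive (≡.sym (ℕ.+-identityʳ N)))))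
                R≤T : R ℕ.≤ T
                R≤T = ℕ.≤-trans (ℕ.+-monoʳ-≤ p (ℕ.≤-trans (ℕ.m≤m+n h h) h≤L)) p+L≤T
                ¬low : ∀ m → p ℕ.≤ m → m ℕ.< p ℕ.+ L → ¬ Low m
                ¬low m p≤m m< low = free m p≤m (ℕ.<-≤-trans m< (ℕ.≤-reflexive p+L≡)) (lowList-covers cov₁ cov₂ m (ℕ.<-≤-trans m< p+L≤T) low)

                from-element : (∃ λ x → x ∈ (suc D ⊛ S₁) × x ℕ.< R × (R ℕ.∸ x) ℕ.* (count S₁ R ℕ.^ D ℕ.* count S₂ R ℕ.^ suc K) ℕ.< R) → ⊥
                from-element (x , x∈ , x<R , close) = from-gap (next-gap {Mid} {p ℕ.+ L} ℓ (length zs) zs x ℕ.≤-refl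
                    (λ { m x<m m< (k , k≤k₀ , s) → sumList-covers cov₁ cov₂ (suc D) (suc D) k m ℕ.≤-refl (ℕ.≤-trans k≤k₀ k₀≤K) (ℕ.<-≤-trans m< p+L≤T) s })
                    -- The walk may start at x, which is a `Mid` number with no summand from S₂.
                    (0 , z≤n , x , 0 , ≡.sym (ℕ.+-identityʳ x) , x∈ , ≡.refl) room)
                  where
                  δ : ℕ
                  δ = R ℕ.∸ x
                  N≤R : N ℕ.≤ R
                  N≤R = ℕ.≤-trans N≤p (ℕ.m≤m+n p h)
                  -- Condition (3) with exponents D and K + 1 makes δ small against N / M(N): the
                  -- product of counts matches M(N) up to a constant, and the additional factor
                  -- `count S₂ N` beats that constant. By `doubling`, N / M(N) is comparable to the
                  -- block length.
                  δ≤h : δ ℕ.≤ h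
                  δ≤h = half-block {δ} {M N} {n₁} {L} {h} {N} (1≤M N)
                    (twenty {δ} {M N} {count S₁ N ℕ.^ D ℕ.* count S₂ N ℕ.^ K} {B ℕ.* (2 ℕ.^ D ℕ.* 2 ℕ.^ K)} {count S₂ N} {N} {R}
                      (ℕ.*-mono-≤ 1≤B (ℕ.*-mono-≤ (ℕ.m^n>0 2 D) (ℕ.m^n>0 2 K)))
                      (ℕ.≤-<-trans (ℕ.*-monoʳ-≤ δ (ℕ.≤-trans (ℕ.≤-reflexive (e (count S₁ N ℕ.^ D) (count S₂ N ℕ.^ K) (count S₂ N)))
                        (ℕ.*-mono-≤ (ℕ.^-monoˡ-≤ D (count-mono S₁ N≤R)) (ℕ.^-monoˡ-≤ (suc K) (count-mono S₂ N≤R))))) close)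
                      R≤T M≤ λ₂-large)
                    (proj₂ (proj₂ F-L)) doubling (proj₂ (proj₂ F-h))
                    where
                    e : ∀ a b c → a ℕ.* b ℕ.* c ≡ a ℕ.* (c ℕ.* b)
                    e = solve-∀
                  p≤x : p ℕ.≤ x
                  p≤x = ℕ.+-cancelʳ-≤ h p x (ℕ.≤-trans (ℕ.≤-reflexive (≡.sym (ℕ.m+[n∸m]≡n (ℕ.<⇒≤ x<R)))) (ℕ.+-monoʳ-≤ x δ≤h))
                  room : x ℕ.+ suc (length zs) ℕ.* ℓ ℕ.≤ p ℕ.+ L
                  room = ℕ.≤-trans (ℕ.+-mono-≤ (ℕ.<⇒≤ x<R) gaps-fit) (ℕ.≤-trans (ℕ.≤-reflexive (ℕ.+-assoc p h h)) (ℕ.+-monoʳ-≤ p h≤L))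

                  from-gap : (∃ λ u → x ℕ.≤ u × u ℕ.+ ℓ ℕ.≤ p ℕ.+ L × Mid u × (∀ m → u ℕ.< m → m ℕ.< u ℕ.+ ℓ → ¬ Mid m)) → ⊥
                  from-gap (u , x≤u , u+ℓ≤ , (k , k≤k₀ , a , b , u≡ , a∈ , b∈) , ¬mid) = from-dense (dense r (ℕ.≤-trans (ℕ.n≤1+n r₀) r₀<r))
                    where
                    from-dense : (∃ λ s → s ∈ S₂ × r ℕ.≤ s × s ℕ.< C₁ ℕ.* r) → ⊥
                    from-dense (s , s∈ , r≤s , s<) = finish (Sign.dichotomy u m ℓ u<m c≥0 m<u+ℓ
                        (positive m (¬low m (ℕ.≤-trans p≤u (ℕ.<⇒≤ u<m)) (ℕ.<-≤-trans m<u+ℓ u+ℓ≤)) (¬mid m u<m m<u+ℓ) high))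
                      where
                      n m : ℕ
                      -- k + n = k₀ + 1, so m has exactly the leading number of summands from S₂; n
                      -- ≥ 1 puts m at least r beyond u.
                      n = suc (k₀ ℕ.∸ k)
                      m = u ℕ.+ n ℕ.* s
                      n≤κ : n ℕ.≤ κ
                      n≤κ = s≤s (ℕ.m∸n≤m k₀ k)
                      p≤u = ℕ.≤-trans p≤x x≤u
                      N≤u = ℕ.≤-trans N≤p p≤u
                      u+r≤m : u ℕ.+ r ℕ.≤ m
                      u+r≤m = ℕ.+-monoʳ-≤ u (ℕ.≤-trans r≤s (ℕ.m≤m+n s _))
                      1≤r : 1 ℕ.≤ r
                      1≤r = ℕ.≤-trans (s≤s z≤n) r₀<r
                      u<m : u ℕ.< m
                      u<m = ℕ.<-≤-trans (ℕ.m<m+n u 1≤r) u+r≤m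
                      m+r<u+ℓ : m ℕ.+ r ℕ.< u ℕ.+ ℓ
                      m+r<u+ℓ = ℕ.≤-<-trans (ℕ.≤-reflexive (ℕ.+-assoc u (n ℕ.* s) r)) (ℕ.+-monoʳ-< u
                        (ℕ.<-≤-trans (ℕ.+-monoˡ-< r (ℕ.≤-<-trans (ℕ.*-monoˡ-≤ s n≤κ) (ℕ.<-≤-trans (ℕ.*-monoʳ-< κ s<) (ℕ.≤-reflexive (≡.sym (ℕ.*-assoc κ C₁ r))))))
                          (ℕ.≤-reflexive (ℕ.+-comm (κ ℕ.* C₁ ℕ.* r) r))))
                      m<u+ℓ : m ℕ.< u ℕ.+ ℓ
                      m<u+ℓ = ℕ.≤-<-trans (ℕ.m≤m+n m r) m+r<u+ℓ
                      high : High m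
                      high = a , b ℕ.+ n ℕ.* s , ≡.trans (≡.cong (ℕ._+ n ℕ.* s) u≡) (ℕ.+-assoc a b (n ℕ.* s)) , a∈ ,
                        ≡.subst (λ j → b ℕ.+ n ℕ.* s ∈ j ⊛ S₂) (≡.trans (ℕ.+-suc k (k₀ ℕ.∸ k)) (≡.cong suc (ℕ.m+[n∸m]≡n k≤k₀)))
                          (⊛-+ {S₂} k n b∈ (⊛-* {S₂} n s∈))
                      c≥0 : ∀ i → u ℕ.< i → i ℕ.< u ℕ.+ ℓ → + 0 ℤ.≤ c i
                      c≥0 i u<i i< = nonneg i (¬low i (ℕ.≤-trans p≤u (ℕ.<⇒≤ u<i)) (ℕ.<-≤-trans i< u+ℓ≤)) (¬mid i u<i i<)
                      u+ℓ≤T : u ℕ.+ ℓ ℕ.≤ T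
                      u+ℓ≤T = ℕ.≤-trans u+ℓ≤ p+L≤T
                      finish : (∀ R → u ℕ.≤ R → R ℕ.< m → ¬ (Y R ≈ 0#)) ⊎ (∀ R → m ℕ.≤ R → R ℕ.< u ℕ.+ ℓ → ¬ (Y R ≈ 0#)) → ⊥
                      finish (inj₁ nz) = run-impossible u r N≤u (ℕ.<-≤-trans (ℕ.≤-<-trans u+r≤m m<u+ℓ) u+ℓ≤T) run-fits
                        λ R u≤R R< → nz R u≤R (ℕ.<-≤-trans R< u+r≤m)
                      finish (inj₂ nz) = run-impossible m r (ℕ.≤-trans N≤u (ℕ.<⇒≤ u<m)) (ℕ.<-≤-trans m+r<u+ℓ u+ℓ≤T) run-fits
                        λ R m≤R R< → nz R m≤R (ℕ.<-trans R< m+r<u+ℓ)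

        gap-contradiction : ⊥
        gap-contradiction =
          let NM , M≤ = small B (D ℕ.+ K)
              N₁ , p₁ = q-small (2 ℕ.* c₀) 3
              N₂ , p₂ = q-small (c₀ ℕ.* suc r₀) 2
              N₃ , p₃ = q-small (k ℕ.^ g) (3 ℕ.* g)
              N₄ , p₄ = count-unbounded S₁ inf₁ 1
              N₅ , p₅ = count-unbounded S₂ inf₂ (40 ℕ.* (B ℕ.* (2 ℕ.^ D ℕ.* 2 ℕ.^ K)))
              N₆ , p₆ = gaps D (suc K)
              -- The doubling bound holds only for suitable N, so N is chosen after all thresholds
              -- and beyond their sum.
              N , large , doubling = slow-doubling M NM 1≤M (λ N NM≤N → ℕ.≤-trans (ℕ.*-monoʳ-≤ B (^*^≤ (count S₁ N) (count S₂ N) D K)) (M≤ N NM≤N))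
                                       (N₁ ℕ.+ (N₂ ℕ.+ (N₃ ℕ.+ (N₄ ℕ.+ (N₅ ℕ.+ N₆)))))
              large₁ = split N₁ large
              large₂ = split N₂ (proj₂ large₁)
              large₃ = split N₃ (proj₂ large₂)
              large₄ = split N₄ (proj₂ large₃)
              large₅ = split N₅ (proj₂ large₄)
          in AtScale.contradiction N doubling (p₁ N (proj₁ large₁)) (p₂ N (proj₁ large₂)) (power (q N) (p₃ N (proj₁ large₃)))
               (p₄ N (proj₁ large₄)) (p₅ N (proj₁ large₅)) (λ R N≤R → p₆ R (ℕ.≤-trans (proj₂ large₅) N≤R))
          where
          k : ℕ
          k = suc (2 ℕ.* C) ℕ.* (2 ℕ.* c₀) ℕ.* suc v₀
          split : ∀ a {b N} → a ℕ.+ b ℕ.≤ N → a ℕ.≤ N × b ℕ.≤ N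
          split a p = ℕ.m+n≤o⇒m≤o a p , ℕ.m+n≤o⇒n≤o a p
          power : ∀ Q {N} → k ℕ.^ g ℕ.* Q ℕ.^ (3 ℕ.* g) ℕ.≤ N → (suc (2 ℕ.* C) ℕ.* (2 ℕ.* (c₀ ℕ.* Q ℕ.^ 3)) ℕ.* suc v₀) ℕ.^ g ℕ.≤ N
          power Q = ℕ.≤-trans (ℕ.≤-reflexive (≡.trans (≡.cong (ℕ._^ g) (e (suc (2 ℕ.* C)) c₀ (Q ℕ.^ 3) (suc v₀)))
            (≡.trans (SubexponentialFunctions.^-distrib k (Q ℕ.^ 3) g) (≡.cong (k ℕ.^ g ℕ.*_) (ℕ.^-*-assoc Q 3 g)))))
            where
            e : ∀ a c x v → a ℕ.* (2 ℕ.* (c ℕ.* x)) ℕ.* v ≡ a ℕ.* (2 ℕ.* c) ℕ.* v ℕ.* x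
            e = solve-∀

  -- The leading monomial of a relation.

  module LeadingTerms where

    Term : Set
    Term = (ℕ × ℕ × ℕ × ⊤) × ℤ

    private
      degree k-exponent i-exponent : Term → ℕ
      degree     ((i , j , k , _) , _) = i ℕ.+ j
      k-exponent ((i , j , k , _) , _) = k
      i-exponent ((i , j , k , _) , _) = i

    maximal : ∀ {A : Set} (f : A → ℕ) {P : A → Set} xs {x} → x ∈ˡ xs → P x →
              ∃ λ y → y ∈ˡ xs × P y × (∀ z → z ∈ˡ xs → P z → f z ℕ.≤ f y)
    maximal {A} f {P} xs {x} x∈ px = pick (search xs)
      where
      Best : List A → Set
      Best xs = ∃ λ y → y ∈ˡ xs × P y × (∀ z → z ∈ˡ xs → P z → f z ℕ.≤ f y)
      search : ∀ xs → Best xs ⊎ (∀ z → z ∈ˡ xs → ¬ P z)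
      search [] = inj₂ λ _ ()
      search (x ∷ xs) with search xs | em {P x}
      ... | inj₂ none | no ¬px = inj₂ λ { z (here ≡.refl) → ¬px ; z (there p) → none z p }
      ... | inj₂ none | yes px = inj₁ (x , here ≡.refl , px , λ { z (here ≡.refl) _ → ℕ.≤-refl ; z (there p) pz → ⊥-elim (none z p pz) })
      ... | inj₁ (y , y∈ , py , max) | no ¬px = inj₁ (y , there y∈ , py , λ { z (here ≡.refl) pz → ⊥-elim (¬px pz) ; z (there p) pz → max z p pz })
      ... | inj₁ (y , y∈ , py , max) | yes px with f x ℕ.≤? f y
      ... | yes fx≤fy = inj₁ (y , there y∈ , py , λ { z (here ≡.refl) _ → fx≤fy ; z (there p) pz → max z p pz })
      ... | no fx≰fy  = inj₁ (x , here ≡.refl , px , λ { z (here ≡.refl) _ → ℕ.≤-refl ; z (there p) pz → ℕ.≤-trans (max z p pz) (ℕ.<⇒≤ (ℕ.≰⇒> fx≰fy)) })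
      pick : Best xs ⊎ (∀ z → z ∈ˡ xs → ¬ P z) → Best xs
      pick (inj₁ best) = best
      pick (inj₂ none) = ⊥-elim (none x x∈ px)

    record IsLeading (ns : List Term) (i₀ j₀ k₀ : ℕ) (A₀ : ℤ) : Set where
      field
        lead∈      : ((i₀ , j₀ , k₀ , tt) , A₀) ∈ˡ ns
        degree-max : ∀ i j k u A → ((i , j , k , u) , A) ∈ˡ ns → i ℕ.+ j ℕ.≤ i₀ ℕ.+ j₀
        k-max      : ∀ i j k u A → ((i , j , k , u) , A) ∈ˡ ns → i ℕ.+ j ≡ i₀ ℕ.+ j₀ → k ℕ.≤ k₀
        i-max      : ∀ i j k u A → ((i , j , k , u) , A) ∈ˡ ns → i ℕ.+ j ≡ i₀ ℕ.+ j₀ → k ≡ k₀ → i ℕ.≤ i₀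

    leading : ∀ ns {x} → x ∈ˡ ns → ∃ λ i₀ → ∃ λ j₀ → ∃ λ k₀ → ∃ λ A₀ → IsLeading ns i₀ j₀ k₀ A₀
    leading ns x∈ =
      let x , x∈ , _  , degree-max = maximal degree {λ _ → ⊤} ns x∈ tt
          y , y∈ , dy , k-max      = maximal k-exponent {λ z → degree z ≡ degree x} ns x∈ ≡.refl
          z , z∈ , (dz , kz) , i-max = maximal i-exponent {λ z → degree z ≡ degree x × k-exponent z ≡ k-exponent y} ns y∈ (dy , ≡.refl)
      in _ , _ , _ , _ , record
        { lead∈      = z∈
        ; degree-max = λ i j k u A p → ℕ.≤-trans (degree-max _ p tt) (ℕ.≤-reflexive (≡.sym dz))
        ; k-max      = λ i j k u A p d≡ → ℕ.≤-trans (k-max _ p (≡.trans d≡ dz)) (ℕ.≤-reflexive (≡.sym kz))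
        ; i-max      = λ i j k u A p d≡ k≡ → i-max _ p (≡.trans d≡ dz , ≡.trans k≡ kz)
        }

    k-bounded : ∀ (ns : List Term) {x} → x ∈ˡ ns → ∃ λ K → ∀ i j k u A → ((i , j , k , u) , A) ∈ˡ ns → suc k ℕ.≤ K
    k-bounded ns x∈ = let y , _ , _ , max = maximal k-exponent {λ _ → ⊤} ns x∈ tt in suc (k-exponent y) , λ i j k u A p → s≤s (max _ p tt)

    -- Makes a negative leading coefficient positive: changing all signs preserves the relation and
    -- the leading exponents.
    negate : List Term → List Term
    negate = map (λ (k , A) → k , ℤ.- A)

    negate-∈⁻ : ∀ ns {k A} → (k , A) ∈ˡ negate ns → ∃ λ A′ → (k , A′) ∈ˡ ns
    negate-∈⁻ ((k , A) ∷ ns) (here ≡.refl) = A , here ≡.refl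
    negate-∈⁻ (_ ∷ ns)       (there p)     = let A , q = negate-∈⁻ ns p in A , there q

    negate-leading : ∀ ns {i₀ j₀ k₀ A₀} → IsLeading ns i₀ j₀ k₀ A₀ → IsLeading (negate ns) i₀ j₀ k₀ (ℤ.- A₀)
    negate-leading ns l = record
      { lead∈      = ∈-map⁺ (λ (k , A) → k , ℤ.- A) lead∈
      ; degree-max = λ i j k u A p → let A′ , q = negate-∈⁻ ns p in degree-max i j k u A′ q
      ; k-max      = λ i j k u A p → let A′ , q = negate-∈⁻ ns p in k-max i j k u A′ q
      ; i-max      = λ i j k u A p → let A′ , q = negate-∈⁻ ns p in i-max i j k u A′ q
      }
      where open IsLeading l

  -- The gap argument applied to an integral relation.

  module NoRelation where

    open RealField
    open Series using (HasSum)
    open Growth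
    open Coordinates using (Coordinatised)
    open Monomials
    open LeadingTerms
    open Combinatorics
    open GeneratingSeries
    open Counting
    open SubexponentialFunctions

    negate-relation : ∀ ns (value : ℕ × ℕ × ℕ × ⊤ → ℝ) → lsum (λ (k , A) → fromℤ A * value k) ns ≈ 0# → lsum (λ (k , A) → fromℤ A * value k) (negate ns) ≈ 0#
    negate-relation ns value p = trans (lsum-map _ _ ns) (trans (lsum-cong ns λ (k , A) → trans (*-congʳ (fromℤ-neg A)) (solve 2 (λ a v → (:- a) :* v := (:- 𝟙) :* (a :* v)) refl (fromℤ A) (value k)))
      (trans (lsum-*ˡ (- 1#) _ ns) (trans (*-congˡ p) (zeroʳ _))))

    module _ {S₁ S₂ : Pred ℕ 0ℓ} (inf₁ : Infinite S₁) (inf₂ : Infinite S₂) (t₁ t₂ t₃ : ℕ → ℕ)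
      (pos₁₂ : ∀ m → m ∈ S₁ → 0 ℕ.< t₁ m × 0 ℕ.< t₂ m) (vanish₁₂ : ∀ m → m ∉ S₁ → t₁ m ≡ 0 × t₂ m ≡ 0)
      (pos₃ : ∀ m → m ∈ S₂ → 0 ℕ.< t₃ m) (vanish₃ : ∀ m → m ∉ S₂ → t₃ m ≡ 0)
      {C₁ r₀ : ℕ} (dense : ∀ r → r₀ ℕ.≤ r → ∃ λ s → s ∈ S₂ × r ℕ.≤ s × s ℕ.< C₁ ℕ.* r)
      (small : ∀ c e → ∃ λ N₀ → ∀ N → N₀ ℕ.≤ N → c ℕ.* (suc (count S₁ N) ℕ.* suc (count S₂ N)) ℕ.^ e ℕ.≤ N)
      (gaps : ∀ a₁ a₂ → ∃ λ N₀ → ∀ N → N₀ ℕ.≤ N → ∃ λ x → x ∈ (suc a₁ ⊛ S₁) × x ℕ.< N ×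
         (N ℕ.∸ x) ℕ.* (count S₁ N ℕ.^ a₁ ℕ.* count S₂ N ℕ.^ a₂) ℕ.< N)
      {g E₁ E₂ E₃ : ℕ} (2≤g : 2 ℕ.≤ g) (t₁≤ : SubexponentialBound g E₁ t₁) (t₂≤ : SubexponentialBound g E₂ t₂) (t₃≤ : SubexponentialBound g E₃ t₃)
      (ratio : ∀ W → ∃ λ B → 1 ℕ.≤ B × (∀ a → B ℕ.≤ a → W ℕ.* t₂ a ℕ.≤ t₁ a))
      {β : ℝ} (1<β : 1# < β) (coords : Coordinatised β) where

      open Coefficients t₁ t₂ t₃

      values : Vec ℝ 3
      values = ⟦ t₁ ⟧ (β ⁻¹) ∷ ⟦ t₂ ⟧ (β ⁻¹) ∷ ⟦ t₃ ⟧ (β ⁻¹) ∷ []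

      private
        supported : ∀ {t S} → (∀ m → m ∉ S → t m ≡ 0) → Supported t S
        supported vanish a 0<ta = by-contradiction λ a∉S → ℕ.<⇒≢ 0<ta (≡.sym (vanish a a∉S))

        1≤E : ∀ {t E} → SubexponentialBound g E t → 1 ℕ.≤ E
        1≤E {t} {E} p = ℕ.≤-trans (ℕ.≤-trans (ℕ.m≤m⊔n 1 (t 0)) (ℕ.≤-reflexive (≡.sym (ℕ.^-identityʳ (1 ℕ.⊔ t 0)))))
          (ℕ.≤-trans (p 1 1 0 z≤n ℕ.≤-refl (ℕ.≤-reflexive (ℕ.^-zeroˡ g))) (ℕ.≤-reflexive (ℕ.^-identityʳ E)))

        maxUpTo-bounded : ∀ t {E} → SubexponentialBound g E t → Subexponential g (maxUpTo t)
        maxUpTo-bounded t {E} p = maxUpTo-subexp {g} {E} {t₁} {t₂} {t₃} t (1≤E {t} {E} p) p (ℕ.≤-trans (s≤s z≤n) 2≤g)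

        no-leading : ∀ ns → AllPairs (λ x y → proj₁ x ≢ proj₁ y) ns →
                     lsum (λ (k , A) → fromℤ A * monomial-value values k) ns ≈ 0# →
                     ∀ {i₀ j₀ k₀ a₀} → IsLeading ns i₀ j₀ k₀ (+ suc a₀) → ⊥
        no-leading ns distinct relation {i₀} {j₀} {k₀} {a₀} l =
          let K , k-bound       = k-bounded ns lead∈
              B , 1≤B , dominates = ratio (suc (absSum ns))
          in conclusion K k-bound B 1≤B dominates
          where
          open IsLeading l

          vanishes : HasSum (λ m → fromℤ (coeff ns m) * (β ⁻¹) ^ m) 0#
          vanishes = HasSum-resp (β ⁻¹) (λ m → fromℤ (coeff ns m) * (β ⁻¹) ^ m) (trans (*-congˡ relation) (zeroʳ _))
            (coeff-sums (β ⁻¹) {t₁} {t₂} {t₃} (series-sums {β} 1<β {g} {E₁} {t₁} t₁≤) (series-sums {β} 1<β {g} {E₂} {t₂} t₂≤) (series-sums {β} 1<β {g} {E₃} {t₃} t₃≤) ns)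

          bounded : Subexponential g (coeffBound ns)
          bounded = coeffBound-subexp 2≤g (maxUpTo-bounded t₁ t₁≤) (maxUpTo-bounded t₂ t₂≤) (maxUpTo-bounded t₃ t₃≤) ns

          open RecurrenceOfCoefficients using (Y; Y-suc; Recurs; coefficients-recur)

          recurrence : ∃₂ (Recurs {β} 1<β coords {g} 2≤g (coeff ns) (coeffBound ns) (∣coeff∣≤ ns) bounded vanishes)
          recurrence = coefficients-recur 1<β coords 2≤g (coeff ns) (coeffBound ns) (∣coeff∣≤ ns) bounded vanishes

          conclusion : ∀ K → (∀ i j k u A → ((i , j , k , u) , A) ∈ˡ ns → suc k ℕ.≤ K) → ∀ B → 1 ℕ.≤ B →
                       (∀ a → B ℕ.≤ a → suc (absSum ns) ℕ.* t₂ a ℕ.≤ t₁ a) → ⊥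
          conclusion K k-bound B 1≤B dominates = GapArgument.gap-contradiction {S₁} {S₂} inf₁ inf₂ small gaps {C₁} {r₀} dense
            {i₀ ℕ.+ j₀} {k₀} {K} {B} 1≤B (ℕ.<⇒≤ (k-bound i₀ j₀ k₀ tt (+ suc a₀) lead∈)) (coeff ns)
            L.coeff-nonneg L.coeff-positive L.coeff-support (<-trans 0<1 1<β)
            (Y 1<β coords 2≤g (coeff ns) (coeffBound ns) (∣coeff∣≤ ns) bounded vanishes)
            (Y-suc 1<β coords 2≤g (coeff ns) (coeffBound ns) (∣coeff∣≤ ns) bounded vanishes)
            {g} {proj₁ recurrence} {proj₁ (proj₂ recurrence)} (proj₂ (proj₂ recurrence))
            where
            module L = Support.Leading {S₁} {S₂} (supported λ m p → proj₁ (vanish₁₂ m p)) (supported λ m p → proj₂ (vanish₁₂ m p)) (supported vanish₃)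
              (λ m p → proj₁ (pos₁₂ m p)) (λ m p → proj₂ (pos₁₂ m p)) pos₃
              ns distinct i₀ j₀ k₀ a₀ K B 1≤B lead∈ degree-max k-max i-max k-bound dominates

      no-relation : ¬ IntegralRelation 3 values
      no-relation R = let i₀ , j₀ , k₀ , A₀ , l = leading terms (proj₂ nonempty) in by-sign A₀ l
        where
        open IntegralRelation R
        by-sign : ∀ A₀ {i₀ j₀ k₀} → IsLeading terms i₀ j₀ k₀ A₀ → ⊥
        by-sign (+ zero)  l = All.lookup nonzero (IsLeading.lead∈ l) ≡.refl
        by-sign (+ suc a) l = no-leading terms distinct relation l
        by-sign -[1+ a ]  l = no-leading (negate terms) (AllPairs.map⁺ distinct) (negate-relation terms (monomial-value values) relation) (negate-leading terms l)

theorem2 :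
  (em : ExcludedMiddle 0ℓ) (ℛ : CompleteOrderedField) →
  let open Analysis em ℛ in
  (S₁ S₂ : Pred ℕ 0ℓ) → Infinite S₁ → Infinite S₂ →
  (t₁ t₂ t₃ : ℕ → ℕ) →
  (∀ m → m ∈ S₁ → 0 ℕ.< t₁ m × 0 ℕ.< t₂ m) →
  (∀ m → m ∉ S₁ → t₁ m ≡ 0 × t₂ m ≡ 0) →
  (∀ m → m ∈ S₂ → 0 ℕ.< t₃ m) →
  (∀ m → m ∉ S₂ → t₃ m ≡ 0) →
  -- (1)
  (∃ λ C₁ → 1# < C₁ ×
    Eventually (λ R → ∃ λ n → R ≤ fromℕ n × fromℕ n < C₁ * R × n ∈ S₂)) →
  -- (2)
  (∀ ε → 0# < ε →
    ((λ R → fromℕ (Λ S₁ R)) =o (λ R → R ^ʳ ε)) ×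
    ((λ R → fromℕ (Λ S₂ R)) =o (λ R → R ^ʳ ε))) →
  -- (3)
  (∀ (a₁ a₂ : ℕ) → ∃ λ C₂ → 0# < C₂ ×
    (∀ R → C₂ ≤ R →
      θ-Defined (suc a₁ ⊛ S₁) R ×
      (Λ S₁ R ℕ.^ a₁ ℕ.* Λ S₂ R ℕ.^ a₂ ≢ 0) ×
      (R - fromℕ (θ (suc a₁ ⊛ S₁) R)
        < R / (fromℕ (Λ S₁ R) ^ a₁ * fromℕ (Λ S₂ R) ^ a₂)))) →
  -- (4)
  (∃ λ C₃ → 0# < C₃ × C₃ < 1# ×
    ((λ n → log⁺ (fromℕ (t₁ n))) =oℕ (λ n → fromℕ n ^ʳ (1# - C₃))) ×
    ((λ n → log⁺ (fromℕ (t₂ n))) =oℕ (λ n → fromℕ n ^ʳ (1# - C₃))) ×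
    ((λ n → log⁺ (fromℕ (t₃ n))) =oℕ (λ n → fromℕ n ^ʳ (1# - C₃)))) →
  -- (5)
  TendsTo∞Along S₁ (λ n → fromℕ (t₁ n) / fromℕ (t₂ n)) →
  ∀ β → Pisot β ⊎ Salem β →
  AlgebraicallyIndependent
    (⟦ t₁ ⟧ (β ⁻¹) ∷ ⟦ t₂ ⟧ (β ⁻¹) ∷ ⟦ t₃ ⟧ (β ⁻¹) ∷ [])
theorem2 em ℛ S₁ S₂ inf₁ inf₂ t₁ t₂ t₃ pos₁₂ vanish₁₂ pos₃ vanish₃ dense small gaps (C₃ , 0<C₃ , C₃<1 , o₁ , o₂ , o₃) ratio β β∈ P P≢0 root =
  Independence.NoRelation.no-relation em ℛ {S₁} {S₂} inf₁ inf₂ t₁ t₂ t₃ pos₁₂ vanish₁₂ pos₃ vanish₃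
    {proj₁ dense′} {proj₁ (proj₂ dense′)} (proj₂ (proj₂ dense′))
    (counts-small {S₁} {S₂} (λ ε 0<ε → proj₁ (small ε 0<ε)) (λ ε 0<ε → proj₂ (small ε 0<ε)))
    (λ a₁ a₂ → gaps-small S₁ S₂ a₁ a₂ (gaps a₁ a₂))
    {g} {proj₁ (bound {t₁} o₁)} {proj₁ (bound {t₂} o₂)} {proj₁ (bound {t₃} o₃)} (s≤s (s≤s z≤n)) (proj₂ (bound {t₁} o₁)) (proj₂ (bound {t₂} o₂)) (proj₂ (bound {t₃} o₃))
    (ratio-unbounded {S₁} {t₁} {t₂} (λ m m∈S₁ → proj₂ (pos₁₂ m m∈S₁)) (λ m m∉S₁ → proj₂ (vanish₁₂ m m∉S₁)) ratio)
    {β} (1<β β∈) (Independence.Coordinates.Pisot-or-Salem⇒Coordinatised em ℛ β∈)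
    (Independence.Monomials.integral-relation em ℛ 3 _ P P≢0 root)
  where
  open Independence.RealField em ℛ
  open Independence.Counting em ℛ
  open Independence.Growth em ℛ

  dense′ = relatively-dense {S₂} dense

  g : ℕ
  -- Larger than 1/C₃, so that v^g ≤ R implies v ≤ R^C₃; the added 2 secures g ≥ 2, under which R
  -- itself counts as subexponential.
  g = suc (suc (proj₁ (archimedean (C₃ ⁻¹))))

  1≤gC₃ : 1# ≤ fromℕ g * C₃
  1≤gC₃ = ≤-respˡ (trans (*-comm (C₃ ⁻¹) C₃) (x/x≈1 0<C₃)) (*-monoʳ-≤ (inj₁ 0<C₃)
    (≤-trans (inj₁ (proj₂ (archimedean (C₃ ⁻¹)))) (fromℕ-mono-≤ (ℕ.m≤n+m (proj₁ (archimedean (C₃ ⁻¹))) 2))))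

  bound : ∀ {t} → (λ n → log⁺ (fromℕ (t n))) =oℕ (λ n → fromℕ n ^ʳ (1# - C₃)) → ∃ λ E → SubexponentialBound g E t
  bound {t} o = log⁺-=o⇒^≤ {t} {C₃} C₃<1 o g 1≤gC₃

  1<β : Pisot β ⊎ Salem β → 1# < β
  1<β (inj₁ (_ , p , _)) = p
  1<β (inj₂ (_ , p , _)) = p
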